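{- Let $0\le k\le n$ and $f\in\widetilde S_n$. Then $G_{f,k}\ne0$ if and only if $f\in T\operatorname{Bound}(k,n)$.
   Context: $\widetilde S_n$: bijections $f:\mathbb{Z}\to\mathbb{Z}$ with $f(i+n)=f(i)+n$; $\tau(i)=i+1$, $T=\{\tau^j\}$; $s_i$ swaps $i+pn$ and $i+1+pn$ for all $p$; $\widetilde S^0_n=\langle s_0,\dots,s_{n-1}\rangle$; $f=\tau^{\operatorname{av}(f)}g$ uniquely with $g\in\widetilde S^0_n$. $\ell(f)=\#\{(i,j):1\le i\le n,\ i<j,\ f(i)>f(j)\}$. $\operatorname{Bound}(k,n)$: $f$ with $i\le f(i)\le i+n$ for all $i$ and exactly $k$ of $f(1),\dots,f(n)$ exceeding $n$; $T\operatorname{Bound}(k,n)=\{\tau^jg\}$. Affine Stanley symmetric function: $\widetilde F_f=\sum x_1^{\ell(f_1)}x_2^{\ell(f_2)}\cdots$ over factorizations $\tau^{ -\operatorname{av}(f)}f=f_1f_2\cdots$ with $\sum\ell(f_i)=\ell(f)$ and each $f_i$ cyclically decreasing, i.e. equal to $s_{i_1}\cdots s_{i_m}$ for distinct $i_1,\dots,i_m\in\mathbb{Z}/n\mathbb{Z}$ such that whenever $j,j+1$ both occur, $j+1$ occurs first. $G_{f,k}$ is the image of $\widetilde F_f(x_1,\dots,x_k)$ in $\Lambda^{n-k}(k)=\mathbb{Z}[x_1,\dots,x_k]^{S_k}/\langle h_d(x_1,\dots,x_k): d>n-k\rangle$. -}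

module Defs where

open import Data.Nat as ℕ using (ℕ; zero; suc; NonZero; _≤?_; _∸_)
open import Data.Nat.DivMod using (_%_)
open import Data.Integer as ℤ using (ℤ; +_; _%ℕ_; 0ℤ; 1ℤ)
open import Data.Fin as Fin using (Fin; toℕ)
open import Data.Fin.Permutation using (Permutation′; _⟨$⟩ʳ_)
open import Data.List as List using (List; []; _∷_; length; lookup; map; concatMap; upTo; filter; foldr)
open import Data.List.Relation.Unary.All using (All)
open import Data.List.Relation.Unary.Any using (Any)
open import Data.List.Relation.Unary.AllPairs using (AllPairs)
open import Data.List.Relation.Unary.Unique.Propositional using (Unique)
open import Data.List.Membership.Propositional using (_∈_)
open import Data.Vec as Vec using (Vec; []; _∷_; tabulate; zipWith)
open import Data.Vec.Properties using (≡-dec)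
open import Data.Product using (Σ; Σ-syntax; ∃; _×_; _,_)
open import Function using (_∘_; id; _⇔_)
open import Relation.Nullary using (¬_; yes; no)
open import Relation.Binary.PropositionalEquality using (_≡_)

IsAffPerm : (n : ℕ) → (ℤ → ℤ) → Set
IsAffPerm n f =
  (∀ x y → f x ≡ f y → x ≡ y) ×
  (∀ y → ∃ λ x → f x ≡ y) ×
  (∀ i → f (i ℤ.+ + n) ≡ f i ℤ.+ + n)

-- the generator s_i (i ∈ ℤ/nℤ, represented by Fin n): swaps i+pn and i+1+pn.
-- Convention: for n = 1 (where the informal description degenerates) s_0 = id.
s : (n : ℕ) .{{_ : NonZero n}} → Fin n → ℤ → ℤ
s n i j with 2 ≤? n
... | no _ = j
... | yes _ with j %ℕ n ℕ.≟ toℕ i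
...   | yes _ = j ℤ.+ 1ℤ
...   | no _ with j %ℕ n ℕ.≟ (suc (toℕ i)) % n
...     | yes _ = j ℤ.- 1ℤ
...     | no _ = j

sWord : (n : ℕ) .{{_ : NonZero n}} → List (Fin n) → ℤ → ℤ
sWord n [] = id
sWord n (j ∷ w) = s n j ∘ sWord n w

-- g ∈ S̃⁰_n = ⟨s_0,…,s_{n-1}⟩ (the s_i are involutions, so words suffice)
InS0 : (n : ℕ) .{{_ : NonZero n}} → (ℤ → ℤ) → Set
InS0 n g = Σ (List (Fin n)) λ w → ∀ i → g i ≡ sWord n w i

τ^ : ℤ → ℤ → ℤ
τ^ a i = i ℤ.+ a

IsAv : (n : ℕ) .{{_ : NonZero n}} → (ℤ → ℤ) → ℤ → Set
IsAv n f a = Σ (ℤ → ℤ) λ g → InS0 n g × (∀ i → f i ≡ τ^ a (g i))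

HasLength : (n : ℕ) → (ℤ → ℤ) → ℕ → Set
HasLength n f m = Σ (List (ℤ × ℤ)) λ L →
  Unique L ×
  (∀ i j → ((i , j) ∈ L) ⇔ ((1ℤ ℤ.≤ i × i ℤ.≤ + n) × i ℤ.< j × f j ℤ.< f i)) ×
  length L ≡ m

CycDec : (n : ℕ) .{{_ : NonZero n}} → (ℤ → ℤ) → Set
CycDec n g = Σ (List (Fin n)) λ w →
  Unique w ×
  (∀ (p q : Fin (length w)) → toℕ (lookup w q) ≡ (suc (toℕ (lookup w p))) % n → q Fin.< p) ×
  (∀ i → g i ≡ sWord n w i)

oneToN : ℕ → List ℤ
oneToN n = map (λ m → + suc m) (upTo n)

InBound : (k n : ℕ) → (ℤ → ℤ) → Set
InBound k n f =
  IsAffPerm n f ×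
  (∀ i → i ℤ.≤ f i × f i ℤ.≤ i ℤ.+ + n) ×
  length (filter (λ i → + n ℤ.<? f i) (oneToN n)) ≡ k

InTBound : (k n : ℕ) → (ℤ → ℤ) → Set
InTBound k n f = Σ ℤ λ j → Σ (ℤ → ℤ) λ g → InBound k n g × (∀ i → f i ≡ τ^ j (g i))

-- Polynomials in x_1,…,x_k over ℤ, as finite lists of terms (coefficient, exponent vector)

Poly : ℕ → Set
Poly k = List (ℤ × Vec ℕ k)

coeff : ∀ {k} → Poly k → Vec ℕ k → ℤ
coeff [] a = 0ℤ
coeff ((c , b) ∷ P) a with ≡-dec ℕ._≟_ b a
... | yes _ = c ℤ.+ coeff P a
... | no _ = coeff P a

_≈P_ : ∀ {k} → Poly k → Poly k → Set
P ≈P Q = ∀ a → coeff P a ≡ coeff Q a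

_*P_ : ∀ {k} → Poly k → Poly k → Poly k
P *P Q = concatMap (λ { (c , a) → map (λ { (d , b) → (c ℤ.* d , zipWith ℕ._+_ a b) }) Q }) P

sumP : ∀ {k} → List (Poly k) → Poly k
sumP = foldr List._++_ []

Symmetric : ∀ {k} → Poly k → Set
Symmetric {k} P = ∀ (σ : Permutation′ k) (a : Vec ℕ k) →
  coeff P a ≡ coeff P (tabulate (λ i → Vec.lookup a (σ ⟨$⟩ʳ i)))

comps : (k d : ℕ) → List (Vec ℕ k)
comps zero zero = [] ∷ []
comps zero (suc d) = []
comps (suc k) d = concatMap (λ i → map (i ∷_) (comps k (d ∸ i))) (upTo (suc d))

h : (k d : ℕ) → Poly k
h k d = map (λ a → (1ℤ , a)) (comps k d)

-- F lies in the ideal ⟨h_d(x_1..x_k) : d > n-k⟩ of ℤ[x_1..x_k]^{S_k};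
-- G ≠ 0 in Λ^{n-k}(k) iff the symmetric polynomial is NOT in this ideal
InIdeal : (n k : ℕ) → Poly k → Set
InIdeal n k F = Σ (List (Poly k × ℕ)) λ L →
  All (λ { (c , d) → Symmetric c × (n ∸ k) ℕ.< d }) L ×
  F ≈P sumP (map (λ { (c , d) → c *P h k d }) L)

HasCard : {X : Set} → (X → X → Set) → (X → Set) → ℕ → Set
HasCard {X} _≈_ S c = Σ (List X) λ L →
  All S L × (∀ x → S x → Any (x ≈_) L) × AllPairs (λ x y → ¬ (x ≈ y)) L × length L ≡ c

compose : ∀ {k} → Vec (ℤ → ℤ) k → ℤ → ℤ
compose [] = id
compose (g ∷ u) = g ∘ compose u

_≈T_ : ∀ {k} → Vec (ℤ → ℤ) k → Vec (ℤ → ℤ) k → Set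
_≈T_ {k} u v = ∀ (r : Fin k) i → Vec.lookup u r i ≡ Vec.lookup v r i

-- factorizations τ^{-a} f = f_1 f_2 ⋯ f_k (a = av f) into cyclically decreasing
-- factors with ℓ(f_r) = e_r and Σ ℓ(f_r) = ℓ(f)
Factorization : (n k : ℕ) .{{_ : NonZero n}} → (ℤ → ℤ) → ℤ → Vec ℕ k → Vec (ℤ → ℤ) k → Set
Factorization n k f a e u =
  (∀ (r : Fin k) → CycDec n (Vec.lookup u r) × HasLength n (Vec.lookup u r) (Vec.lookup e r)) ×
  HasLength n f (Vec.sum e) ×
  (∀ i → compose u i ≡ f i ℤ.- a)

IsStanleyPoly : (n k : ℕ) .{{_ : NonZero n}} → (ℤ → ℤ) → ℤ → Poly k → Set
IsStanleyPoly n k f a P = ∀ (e : Vec ℕ k) → Σ ℕ λ c →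
  HasCard _≈T_ (Factorization n k f a e) c × coeff P e ≡ + c

{-# OPTIONS --safe #-}
module Submission where
-- Put g = f − av(f) + k, so that f is in T·Bound(k,n) iff i ≤ g(i) ≤ i + n for all i. In k variables
-- the affine Stanley polynomial F is obtained by letting a carrier sweep k times through a window of g.
-- The ideal is detected by the Vandermonde determinant a: a symmetric F lies in it iff every
-- coefficient of aF at exponents below n vanishes. If some g(i) < i then F = 0; if some g(i) > i + n, the
-- sweeps can be inverted modulo xⁿ, and downward induction on the number of variables kills aF.
-- If g is bounded, the Chevalley rule Σ (g(b) − g(a)) F(g t_ab) = n (x₁ + ⋯ + x_k) F(g), the sum being over
-- covers, leads upwards through bounded permutations to one with g(i) ∈ {i, i + n}; there every factor has
-- at least n − k letters, exactly n − k is attained, and so the coefficient of the full rectangle in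
-- (x₁ + ⋯ + x_k)^M F is positive.
open import Data.Nat as M using (ℕ; zero; suc; NonZero; _∸_)
open import Data.Integer as I using (ℤ; +_; -[1+_]; 0ℤ; 1ℤ)
open import Data.Product using (_,_; Σ; proj₁; proj₂)
open import Data.Sum using (_⊎_; inj₁; inj₂)
open import Data.Empty using (⊥; ⊥-elim)
open import Data.Bool as Bool using (Bool; true; false; _∧_)
open import Relation.Nullary using (¬_; yes; no; Dec; does)
open import Relation.Nullary.Decidable using (dec-true; dec-false)
open import Relation.Binary.PropositionalEquality as E using (_≡_; _≢_; cong; cong₂)
open import Relation.Binary.Definitions using (tri<; tri≈; tri>)
open import Algebra.Bundles using (CommutativeRing)
open import Level using (0ℓ)
open import Data.List as List using (List; []; _∷_; _++_; length)
open import Data.Vec as Vec using (Vec; []; _∷_)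
open import Data.Integer.DivMod using (_/ℕ_; _%ℕ_; a≡a%ℕn+[a/ℕn]*n; n%ℕd<d)
import Data.Nat.Properties as N
import Data.Integer.Properties as Z
import Data.Vec.Properties as VP
import Data.List.Properties as LP
import Data.List.Relation.Unary.All as LAll
import Data.List.Relation.Unary.All.Properties as AP
import Data.List.Relation.Unary.Unique.Propositional.Properties as UP
import Data.List.Relation.Unary.Any.Properties as YP
import Data.List.Relation.Unary.AllPairs.Properties as PP
import Data.Fin.Properties as FN

-- The Vandermonde multiple aF carries signs, so its non-vanishing cannot be read off from the
-- positive coefficients of F. One number is used instead: the coefficient of a (x_1 + ... + x_k)^M
-- F at (n-k, ..., n-1). Up to the sign `sg k` it reads the full rectangle, the top degree, and it
-- depends only on aF modulo n-th powers of the variables. On it the Chevalley rule is a positive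
-- recursion: the weights g(b) - g(a) are positive, unbounded covers contribute 0, and unless g is
-- at the top some cover is bounded. The exponent M must complete the length of g to k(n-k), so
-- lengths have to rise by exactly one along these covers; this comes from applying the same
-- commutator of the Chevalley operator with a letter to the counting of reduced words. Sweeps are
-- defined over an arbitrary commutative ring, because they are needed over polynomials, modulo n-th
-- powers and at x = 0. Permutations of the integers are plain functions, so sums over carriers,
-- covers and inversions are cut off; `lo`, `m`, `N` only have to be wide enough, and `Adm D`
-- records how far points are moved.

module L where
 open import Data.Integer.Solver using (module +-*-Solver)
 open +-*-Solver public
 I O : ∀ {n} -> Polynomial n
 I = con 1ℤ
 O = con 0ℤ

-- Integer inequalities, Boolean tests and finite sums over a commutative ring

module dK where
 open import Algebra.Bundles using (RawRing)
 open import Data.Integer using (_⊖_)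
 open import Data.Maybe using (Maybe; just; nothing)
 open import Data.Sign as Sign using (Sign)
 open import Data.Product using () renaming (_×_ to _⊗_)
 module ad where
  open import Data.Integer hiding (suc)
  open import Data.Integer.Properties using (+-mono-≤; ≤-trans; ≤-reflexive; +-comm; i<j⇒suc[i]≤j; suc[i]≤j⇒i<j; i≤j⇒0≤j-i; 0≤i-j⇒j≤i)
  infixr 5 _&_
  _&_ : ∀ {a b c d} -> a ≤ b -> c ≤ d -> a + c ≤ b + d
  _&_ = +-mono-≤
  st : ∀ {a b} -> a < b -> a + 1ℤ ≤ b
  st {a} p = ≤-trans (≤-reflexive (+-comm a 1ℤ)) (i<j⇒suc[i]≤j p)
  -- A linear inequality follows from the sum of its hypotheses once the slack is exhibited.
  lin : ∀ k {x y a b} -> a ≤ b -> y - x ≡ (b - a) + + k -> x ≤ y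
  lin k {x} {y} {a} {b} p e = 0≤i-j⇒j≤i (≤-trans (+-mono-≤ (i≤j⇒0≤j-i p) (+≤+ {0} {k} M.z≤n)) (≤-reflexive (E.sym e)))
  aB : ∀ k {x y a b} -> a ≤ b -> y - x ≡ (b - a) + + suc k -> x < y
  aB k {x} {y} {a} {b} p e = suc[i]≤j⇒i<j (lin k p (E.trans (solve 2 (\ x y -> y :- (con 1ℤ :+ x) := (y :- x) :- con 1ℤ) E.refl x y) (E.trans (E.cong (_- 1ℤ) e) (E.trans (E.cong (\ z -> (b - a) + z - 1ℤ) (E.sym (+-comm (+ k) 1ℤ))) (solve 3 (\ b a k -> (b :- a) :+ (k :+ con 1ℤ) :- con 1ℤ := (b :- a) :+ k) E.refl b a (+ k)))))) where open L hiding (I; O)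
 aS : ∀ n a b -> a I.+ n ≡ b I.+ n -> a ≡ b
 aS = ∙-cancelʳ where open import Algebra.Properties.Group (CommutativeRing.+-group Z.+-*-commutativeRing) using (∙-cancelʳ)
 abstract
  -- Abstract, so that goals keep mentioning `lt` and `eq` themselves; only the lemmas of this block
  -- open the decision procedures.
  lt : ℤ -> ℤ -> Bool
  lt a b = does (a I.<? b)
  eq : ℤ -> ℤ -> Bool
  eq a b = does (a I.≟ b)
  bg : ∀ {a b} -> a I.< b -> lt a b ≡ true
  bg {a} {b} p = dec-true (a I.<? b) p
  bk : ∀ {a b} -> ¬ a I.< b -> lt a b ≡ false
  bk {a} {b} p = dec-false (a I.<? b) p
  cw : ∀ {a b} -> a ≡ b -> eq a b ≡ true
  cw {a} {b} p = dec-true (a I.≟ b) p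
  b7 : ∀ {a b} -> a ≢ b -> eq a b ≡ false
  b7 {a} {b} p = dec-false (a I.≟ b) p
  aO : ∀ {a b} -> lt a b ≡ true -> a I.< b
  aO {a} {b} e with a I.<? b | e
  ... | yes p | _ = p
  ... | no _ | ()
  c3 : ∀ {a b} -> eq a b ≡ true -> a ≡ b
  c3 {a} {b} e with a I.≟ b | e
  ... | yes p | _ = p
  ... | no _ | ()
  ky : ∀ {a b} -> lt a b ≡ false -> ¬ a I.< b
  ky {a} {b} e with a I.<? b | e
  ... | yes _ | ()
  ... | no p | _ = p
  kC : ∀ {a b} -> eq a b ≡ false -> a ≢ b
  kC {a} {b} e with a I.≟ b | e
  ... | yes _ | ()
  ... | no p | _ = p
 module o4 (R : CommutativeRing 0ℓ 0ℓ) where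
  open CommutativeRing R hiding (zero) renaming (Carrier to C) public
  open import Algebra.Properties.Semiring.Mult semiring using (_×_; ×1-homo-*)
  open import Algebra.Properties.Monoid.Mult +-monoid using (×-homo-+)
  open import Algebra.Properties.Ring ring public using (-0#≈0#; -‿distribˡ-*; -‿distribʳ-*; -‿involutive)
  open import Algebra.Properties.AbelianGroup +-abelianGroup using (⁻¹-∙-comm)
  open import Relation.Binary.Reasoning.Setoid setoid public
  open import Algebra.Solver.Ring.AlmostCommutativeRing using (AlmostCommutativeRing; fromCommutativeRing; _-Raw-AlmostCommutative⟶_)
  nat : ℕ -> C
  nat m = m × 1#
  -- The canonical ring map from the integers; it lets one solver with integer constants serve every
  -- ring used below, quotients included.
  ι : ℤ -> C
  ι (+ m) = nat m
  ι -[1+ m ] = - nat (suc m)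
  private
   kF : ∀ a b -> (1# + a) + - (1# + b) ≈ a + - b
   kF a b = begin (1# + a) + - (1# + b)   ≈⟨ +-cong (+-comm 1# a) (sym (⁻¹-∙-comm 1# b)) ⟩ (a + 1#) + (- 1# + - b) ≈⟨ +-assoc a 1# _ ⟩ a + (1# + (- 1# + - b)) ≈⟨ +-congˡ (sym (+-assoc 1# (- 1#) (- b))) ⟩ a + ((1# + - 1#) + - b) ≈⟨ +-congˡ (+-congʳ (-‿inverseʳ 1#)) ⟩ a + (0# + - b)          ≈⟨ +-congˡ (+-identityˡ _) ⟩ a + - b ∎
   iU : ∀ m n -> ι (m ⊖ n) ≈ nat m + - nat n
   iU m zero = trans (sym (+-identityʳ (nat m))) (+-congˡ (sym -0#≈0#))
   iU zero (suc n) = sym (+-identityˡ _)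
   iU (suc m) (suc n) = begin ι (suc m ⊖ suc n) ≡⟨ E.cong ι (Z.[1+m]⊖[1+n]≡m⊖n m n) ⟩ ι (m ⊖ n) ≈⟨ iU m n ⟩ nat m + - nat n ≈⟨ sym (kF (nat m) (nat n)) ⟩ nat (suc m) + - nat (suc n) ∎
  e8 : ∀ a -> ι (I.- a) ≈ - ι a
  e8 (+ zero) = sym -0#≈0#
  e8 (+ suc m) = refl
  e8 -[1+ m ] = sym (-‿involutive _)
  kd : ∀ a b -> ι (a I.+ b) ≈ ι a + ι b
  kd (+ m) (+ n) = ×-homo-+ 1# m n
  kd (+ m) -[1+ n ] = iU m (suc n)
  kd -[1+ m ] (+ n) = trans (iU n (suc m)) (+-comm _ _)
  kd -[1+ m ] -[1+ n ] = begin - nat (suc (suc (m M.+ n))) ≡⟨ E.cong (\ z -> - nat z) (E.sym (N.+-suc (suc m) n)) ⟩ - nat (suc m M.+ suc n) ≈⟨ -‿cong (×-homo-+ 1# (suc m) (suc n)) ⟩ - (nat (suc m) + nat (suc n)) ≈⟨ sym (⁻¹-∙-comm _ _) ⟩ - nat (suc m) + - nat (suc n) ∎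
  private
   pI : ∀ m b -> ι (+ m I.* b) ≈ nat m * ι b
   pI zero b = trans (reflexive (E.cong ι (Z.*-zeroˡ b))) (sym (zeroˡ _))
   pI (suc m) b = begin ι (+ suc m I.* b) ≡⟨ E.cong ι (Z.suc-* (+ m) b) ⟩ ι (b I.+ + m I.* b) ≈⟨ kd b _ ⟩ ι b + ι (+ m I.* b) ≈⟨ +-cong (sym (*-identityˡ _)) (pI m b) ⟩ 1# * ι b + nat m * ι b ≈⟨ sym (distribʳ _ _ _) ⟩ nat (suc m) * ι b ∎
  ι-* : ∀ a b -> ι (a I.* b) ≈ ι a * ι b
  ι-* (+ m) b = pI m b
  ι-* -[1+ m ] b = begin ι (-[1+ m ] I.* b) ≡⟨ E.cong ι (E.sym (Z.neg-distribˡ-* (+ suc m) b)) ⟩ ι (I.- (+ suc m I.* b)) ≈⟨ e8 (+ suc m I.* b) ⟩ - ι (+ suc m I.* b) ≈⟨ -‿cong (pI (suc m) b) ⟩ - (nat (suc m) * ι b) ≈⟨ -‿distribˡ-* _ _ ⟩ - nat (suc m) * ι b ∎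
  ι-1 : ι 1ℤ ≈ 1#
  ι-1 = +-identityʳ 1#
  ACR : AlmostCommutativeRing 0ℓ 0ℓ
  ACR = fromCommutativeRing R
  jk : CommutativeRing.rawRing Z.+-*-commutativeRing -Raw-AlmostCommutative⟶ ACR
  jk = record { ⟦_⟧ = ι ; +-homo = kd ; *-homo = ι-* ; -‿homo = e8 ; 0-homo = refl ; 1-homo = ι-1 }
  ι≟ : ∀ a b -> Maybe (ι a ≈ ι b)
  ι≟ a b with a I.≟ b
  ... | yes e = just (reflexive (E.cong ι e))
  ... | no _ = nothing
 module bO (R : CommutativeRing 0ℓ 0ℓ) where
  open o4 R
  open import Algebra.Solver.Ring (CommutativeRing.rawRing Z.+-*-commutativeRing) ACR jk ι≟ public using (Polynomial; solve; _:+_; _:*_; _:-_; :-_; _:=_; con)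
 module aE (R : CommutativeRing 0ℓ 0ℓ) where
  open o4 R public
  private
   kH : ℕ -> Set
   kH = bO.Polynomial R
  infix 9 :-_
  infixl 8 _:*_
  infixl 7 _:+_ _:-_
  infix 4 _:=_
  -- Plain aliases: re-exporting the solver would copy it for every ring.
  _:+_ _:*_ _:-_ : ∀ {n} -> kH n -> kH n -> kH n
  _:+_ = bO._:+_ R
  _:*_ = bO._:*_ R
  _:-_ = bO._:-_ R
  :-_ : ∀ {n} -> kH n -> kH n
  :- p = bO.:-_ {R} p
  con : ∀ {n} -> ℤ -> kH n
  con c = bO.con {R} c
  _:=_ : ∀ {n} -> kH n -> kH n -> kH n ⊗ kH n
  _:=_ = bO._:=_ R
  solve = bO.solve R
  ind : Bool -> C
  ind true = 1#
  ind false = 0#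
  ind-true : ∀ {b} a -> b ≡ true -> ind b * a ≈ a
  ind-true a E.refl = *-identityˡ a
  ind-false : ∀ {b} a -> b ≡ false -> ind b * a ≈ 0#
  ind-false a E.refl = zeroˡ a
  aZ : ∀ b {a a'} -> (b ≡ true -> a ≈ a') -> ind b * a ≈ ind b * a'
  aZ true e = *-congˡ (e E.refl)
  aZ false e = trans (zeroˡ _) (sym (zeroˡ _))
  aU : ∀ b {a} -> (b ≡ true -> a ≈ 0#) -> ind b * a ≈ 0#
  aU b e = trans (aZ b e) (zeroʳ _)
  sumR : ℤ -> ℕ -> (ℤ -> C) -> C
  sumR lo zero f = 0#
  sumR lo (suc m) f = f lo + sumR (lo I.+ 1ℤ) m f
  sumR-cong : ∀ lo m {f g : ℤ -> C} -> (∀ i -> f i ≈ g i) -> sumR lo m f ≈ sumR lo m g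
  sumR-cong lo zero e = refl
  sumR-cong lo (suc m) e = +-cong (e lo) (sumR-cong _ m e)
  dh : ∀ a b c d -> (a + b) + (c + d) ≈ (a + c) + (b + d)
  dh a b c d = solve 4 (\ a b c d -> (a :+ b) :+ (c :+ d) := (a :+ c) :+ (b :+ d)) refl a b c d
  bI : ∀ lo m (f g : ℤ -> C) -> sumR lo m (\ i -> f i + g i) ≈ sumR lo m f + sumR lo m g
  bI lo zero f g = sym (+-identityˡ 0#)
  bI lo (suc m) f g = trans (+-congˡ (bI _ m f g)) (dh _ _ _ _)
  bJ : ∀ lo m a (f : ℤ -> C) -> sumR lo m (\ i -> a * f i) ≈ a * sumR lo m f
  bJ lo zero a f = sym (zeroʳ a)
  bJ lo (suc m) a f = trans (+-congˡ (bJ _ m a f)) (sym (distribˡ a _ _))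
  ff : ∀ lo m {f : ℤ -> C} -> (∀ i -> f i ≈ 0#) -> sumR lo m f ≈ 0#
  ff lo zero e = refl
  ff lo (suc m) e = trans (+-cong (e lo) (ff _ m e)) (+-identityˡ 0#)
  gH : ∀ lo m lo' m' (f : ℤ -> ℤ -> C) -> sumR lo m (\ i -> sumR lo' m' (f i)) ≈ sumR lo' m' (\ j -> sumR lo m (\ i -> f i j))
  gH lo zero lo' m' f = sym (ff lo' m' (\ _ -> refl))
  gH lo (suc m) lo' m' f = trans (+-congˡ (gH _ m lo' m' f)) (sym (bI lo' m' (f lo) _))
  aV : ∀ lo m {f g : ℤ -> C} -> (∀ i -> lo I.≤ i -> i I.< lo I.+ + m -> f i ≈ g i) -> sumR lo m f ≈ sumR lo m g
  aV lo zero e = refl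
  aV lo (suc m) e = +-cong (e lo Z.≤-refl (aB m (Z.≤-refl {lo}) (L.solve 2 (\ l m -> (l L.:+ m) L.:- l L.:= (l L.:- l) L.:+ m) E.refl lo (+ suc m)))) (aV _ m (\ i p q -> e i (lin 1 p (L.solve 2 (\ l i -> i L.:- l L.:= i L.:- (l L.:+ L.I) L.:+ L.I) E.refl lo i)) (E.subst (i I.<_) (Z.+-assoc lo 1ℤ (+ m)) q))) where
   open ad
  bj : ∀ lo m z (f : ℤ -> C) -> lo I.≤ z -> z I.< lo I.+ + m -> sumR lo m (\ i -> ind (eq z i) * f i) ≈ f z
  bj lo zero z f p q = ⊥-elim (Z.<⇒≱ q (Z.≤-trans (Z.≤-reflexive (Z.+-identityʳ lo)) p))
  bj lo (suc m) z f p q with z I.≟ lo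
  ... | yes E.refl = trans (+-cong (ind-true (f z) (cw E.refl)) (trans (aV _ m (\ i r _ -> ind-false (f i) (b7 (\ e -> Z.<⇒≱ (aB 0 (Z.≤-reflexive (E.sym e)) (L.solve 2 (\ l i -> (l L.:+ L.I) L.:- i L.:= (l L.:- i) L.:+ L.I) E.refl lo i)) r)))) (ff (lo I.+ 1ℤ) m (\ _ -> refl)))) (+-identityʳ _) where
   open ad
  ... | no ne = trans (trans (+-congʳ (ind-false (f lo) (b7 ne))) (+-identityˡ _)) (bj _ m z f (lin 0 (st (Z.≤∧≢⇒< p (\ e -> ne (E.sym e)))) (L.solve 2 (\ l z -> z L.:- (l L.:+ L.I) L.:= z L.:- (l L.:+ L.I) L.:+ L.O) E.refl lo z)) (E.subst (z I.<_) (E.sym (Z.+-assoc lo 1ℤ (+ m))) q)) where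
   open ad
  pow : C -> ℕ -> C
  pow x zero = 1#
  pow x (suc m) = x * pow x m
 module h2 = aE Z.+-*-commutativeRing

-- Carrier sweeps: commutation and inversion

module lq where
 open dK
 open import Data.List.Relation.Unary.All using (All; []; _∷_)
 open import Data.Product using (_×_)
 -- The possible paths of `Hs` without their weights: `b2` is an exchange, `f8` a jump. Vanishing
 -- and support arguments look only at these.
 data bu : List ℤ -> ℤ -> List ℤ -> ℤ -> Set where
  eD : ∀ {c} -> bu [] c [] c
  b2 : ∀ {u us c o c'} -> bu us c o c' -> bu (u ∷ us) c (c' ∷ o) u
  f8 : ∀ {u us c o c'} -> bu us c o c' -> u I.< c' -> bu (u ∷ us) c (u ∷ o) c'
 data e3 : List ℤ -> ℤ -> List ℤ -> ℤ -> Set where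
  eD : ∀ {r} -> e3 [] r [] r
  b2 : ∀ {u us r o l} -> e3 us u o l -> e3 (u ∷ us) r (r ∷ o) l
  f8 : ∀ {u us r o l} -> e3 us r o l -> r I.< u -> e3 (u ∷ us) r (u ∷ o) l
 module cA (R : CommutativeRing 0ℓ 0ℓ) where
  open aE R
  -- A carrier c travels along the window (whose last entry comes first in the list) and at each
  -- entry either is exchanged with it or, at the price of x, jumps over a smaller one.
  Hs : C -> List ℤ -> ℤ -> (List ℤ -> ℤ -> C) -> C
  Hs x [] c Ψ = Ψ [] c
  Hs x (u ∷ us) c Ψ = Hs x us c (\ o c' -> Ψ (c' ∷ o) u + ind (lt u c') * (x * Ψ (u ∷ o) c'))
  -- The sweep in the opposite direction, which meets the last entry first; with parameter -x it
  -- undoes `Hs x`, see `nF`.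
  Es : C -> List ℤ -> ℤ -> (List ℤ -> ℤ -> C) -> C
  Es y [] r Ψ = Ψ [] r
  Es y (u ∷ us) r Ψ = Es y us u (\ o l -> Ψ (r ∷ o) l) + ind (lt r u) * (y * Es y us r (\ o l -> Ψ (u ∷ o) l))
  g4 : ∀ x us c {Ψ Ψ'} -> (∀ o c' -> bu us c o c' -> Ψ o c' ≈ Ψ' o c') -> Hs x us c Ψ ≈ Hs x us c Ψ'
  g4 x [] c e = e [] c eD
  g4 x (u ∷ us) c e = g4 x us c (\ o c' p -> +-cong (e _ _ (b2 p)) (aZ (lt u c') (\ b -> *-congˡ (e _ _ (f8 p (aO b))))))
  fI : ∀ y us r {Ψ Ψ'} -> (∀ o l -> e3 us r o l -> Ψ o l ≈ Ψ' o l) -> Es y us r Ψ ≈ Es y us r Ψ'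
  fI y [] r e = e [] r eD
  fI y (u ∷ us) r e = +-cong (fI y us u (\ o l p -> e _ _ (b2 p))) (aZ (lt r u) (\ b -> *-congˡ (fI y us r (\ o l p -> e _ _ (f8 p (aO b))))))
  Hs-cong' : ∀ x us c {Ψ Ψ'} -> (∀ o c' -> Ψ o c' ≈ Ψ' o c') -> Hs x us c Ψ ≈ Hs x us c Ψ'
  Hs-cong' x us c e = g4 x us c (\ o c' _ -> e o c')
  d3 : ∀ x us c {Ψ Ψ'} -> (∀ o c' -> Ψ o c' ≈ Ψ' o c') -> Es x us c Ψ ≈ Es x us c Ψ'
  d3 x us c e = fI x us c (\ o c' _ -> e o c')
  nA : ∀ x us c Ψ Ψ' -> Hs x us c (\ o c' -> Ψ o c' + Ψ' o c') ≈ Hs x us c Ψ + Hs x us c Ψ'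
  nA x [] c Ψ Ψ' = refl
  nA x (u ∷ us) c Ψ Ψ' = trans (Hs-cong' x us c (\ o c' -> solve 6 (\ a a' i x b b' -> (a :+ a') :+ i :* (x :* (b :+ b')) := (a :+ i :* (x :* b)) :+ (a' :+ i :* (x :* b'))) refl (Ψ (c' ∷ o) u) (Ψ' (c' ∷ o) u) (ind (lt u c')) x (Ψ (u ∷ o) c') (Ψ' (u ∷ o) c'))) (nA x us c _ _)
  hS : ∀ x us c a Ψ -> Hs x us c (\ o c' -> a * Ψ o c') ≈ a * Hs x us c Ψ
  hS x [] c a Ψ = refl
  hS x (u ∷ us) c a Ψ = trans (Hs-cong' x us c (\ o c' -> solve 5 (\ a p i x q -> a :* p :+ i :* (x :* (a :* q)) := a :* (p :+ i :* (x :* q))) refl a (Ψ (c' ∷ o) u) (ind (lt u c')) x (Ψ (u ∷ o) c'))) (hS x us c a _)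
  pm : ∀ x us c Ψ Ψ' -> Es x us c (\ o c' -> Ψ o c' + Ψ' o c') ≈ Es x us c Ψ + Es x us c Ψ'
  pm x [] c Ψ Ψ' = refl
  pm x (u ∷ us) c Ψ Ψ' = trans (+-cong (pm x us u _ _) (*-congˡ (*-congˡ (pm x us c _ _)))) (solve 6 (\ a a' i x b b' -> (a :+ a') :+ i :* (x :* (b :+ b')) := (a :+ i :* (x :* b)) :+ (a' :+ i :* (x :* b'))) refl _ _ (ind (lt c u)) x _ _)
  og : ∀ x us c a Ψ -> Es x us c (\ o c' -> a * Ψ o c') ≈ a * Es x us c Ψ
  og x [] c a Ψ = refl
  og x (u ∷ us) c a Ψ = trans (+-cong (og x us u a _) (*-congˡ (*-congˡ (og x us c a _)))) (solve 5 (\ a p i x q -> a :* p :+ i :* (x :* (a :* q)) := a :* (p :+ i :* (x :* q))) refl a _ (ind (lt c u)) x _)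
  Hs-0 : ∀ x us c {Ψ} -> (∀ o c' -> bu us c o c' -> Ψ o c' ≈ 0#) -> Hs x us c Ψ ≈ 0#
  Hs-0 x us c {Ψ} e = trans (g4 x us c (\ o c' p -> trans (e o c' p) (sym (zeroˡ 0#)))) (trans (hS x us c 0# (\ _ _ -> 0#)) (zeroˡ _))
  Es-0 : ∀ x us c {Ψ} -> (∀ o c' -> e3 us c o c' -> Ψ o c' ≈ 0#) -> Es x us c Ψ ≈ 0#
  Es-0 x us c {Ψ} e = trans (fI x us c (\ o c' p -> trans (e o c' p) (sym (zeroˡ 0#)))) (trans (og x us c 0# (\ _ _ -> 0#)) (zeroˡ _))
  kK : ∀ x us c lo m (Ψ : ℤ -> List ℤ -> ℤ -> C) -> Hs x us c (\ o c' -> sumR lo m (\ i -> Ψ i o c')) ≈ sumR lo m (\ i -> Hs x us c (Ψ i))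
  kK x us c lo zero Ψ = Hs-0 x us c (\ _ _ _ -> refl)
  kK x us c lo (suc m) Ψ = trans (nA x us c (Ψ lo) _) (+-congˡ (kK x us c _ m Ψ))
  kM : ∀ x us c lo m (Ψ : ℤ -> List ℤ -> ℤ -> C) -> Es x us c (\ o c' -> sumR lo m (\ i -> Ψ i o c')) ≈ sumR lo m (\ i -> Es x us c (Ψ i))
  kM x us c lo zero Ψ = Es-0 x us c (\ _ _ _ -> refl)
  kM x us c lo (suc m) Ψ = trans (pm x us c (Ψ lo) _) (+-congˡ (kM x us c _ m Ψ))
  hQ : Set
  hQ = List ℤ -> ℤ -> ℤ -> C
  K : C -> C -> List ℤ -> ℤ -> ℤ -> hQ -> C
  K x y us c d Ψ = Hs x us c (\ o c' -> Hs y o d (\ o' d' -> Ψ o' c' d'))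
  private
   -- What two successive carriers do at one further entry u, as an operator on continuations.
   Lx : C -> C -> ℤ -> hQ -> hQ
   Lx x y u Ψ o c d = (Ψ (d ∷ o) u c + ind (lt c d) * (y * Ψ (c ∷ o) u d)) + ind (lt u c) * (x * (Ψ (d ∷ o) c u + ind (lt u d) * (y * Ψ (u ∷ o) c d)))
   -- The R-matrix: two carriers in increasing order may also change roles, at the price t.
   Rm : C -> hQ -> hQ
   Rm t Ψ o c d = Ψ o c d + ind (lt c d) * (t * Ψ o d c)
   l2 : ∀ c d -> ind (lt c d) * ind (lt d c) ≈ 0#
   l2 c d = aU (lt c d) (\ p -> reflexive (E.cong ind (bk (Z.<-asym (aO p)))))
   mm : ∀ x y us c d {Ψ Ψ'} -> (∀ o c' d' -> Ψ o c' d' ≈ Ψ' o c' d') -> K x y us c d Ψ ≈ K x y us c d Ψ'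
   mm x y us c d e = Hs-cong' x us c (\ o c' -> Hs-cong' y o d (\ o' d' -> e o' c' d'))
   ml : ∀ x y u us c d Ψ -> K x y (u ∷ us) c d Ψ ≈ K x y us c d (Lx x y u Ψ)
   ml x y u us c d Ψ = Hs-cong' x us c (\ o c' -> begin Hs y o d (\ o' d' -> Ψ (d' ∷ o') u c' + ind (lt c' d') * (y * Ψ (c' ∷ o') u d')) + ind (lt u c') * (x * Hs y o d (\ o' d' -> Ψ (d' ∷ o') c' u + ind (lt u d') * (y * Ψ (u ∷ o') c' d'))) ≈⟨ +-congˡ (*-congˡ (sym (hS y o d x _))) ⟩ _ ≈⟨ +-congˡ (sym (hS y o d (ind (lt u c')) _)) ⟩ _ ≈⟨ sym (nA y o d _ _) ⟩ _ ∎)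
   -- The Yang-Baxter relation at one entry. It is a polynomial identity in the six values of Ψ, up
   -- to terms that contain [c<d][d<c] or [u<c][c<u].
   m9 : ∀ x y u Ψ o c d -> Lx x y u (Rm (y - x) Ψ) o c d ≈ Rm (y - x) (Lx y x u Ψ) o c d
   m9 x y u Ψ o c d = begin Lx x y u (Rm (y - x) Ψ) o c d ≈⟨ solve 14 (\ x y p q r r' s s' a₁ a₂ a₃ a₄ a₅ a₆ -> (((a₁ :+ r :* ((y :- x) :* a₂)) :+ p :* (y :* (a₃ :+ s :* ((y :- x) :* a₄)))) :+ r :* (x :* ((a₂ :+ r' :* ((y :- x) :* a₁)) :+ s :* (y :* (a₅ :+ p :* ((y :- x) :* a₆)))))) := ((((a₁ :+ p :* (x :* a₃)) :+ r :* (y :* (a₂ :+ s :* (x :* a₅)))) :+ p :* ((y :- x) :* ((a₃ :+ q :* (x :* a₁)) :+ s :* (y :* (a₄ :+ r :* (x :* a₆)))))) :+ (r :* r') :* (x :* ((y :- x) :* a₁))) :- (p :* q) :* ((y :- x) :* (x :* a₁))) refl x y (ind (lt c d)) (ind (lt d c)) (ind (lt u c)) (ind (lt c u)) (ind (lt u d)) (ind (lt d u)) (Ψ (d ∷ o) u c) (Ψ (d ∷ o) c u) (Ψ (c ∷ o) u d) (Ψ (c ∷ o) d u) (Ψ (u ∷ o) c d) (Ψ (u ∷ o) d c) ⟩ _ ≈⟨ +-cong (+-congˡ (*-congʳ (l2 u c))) (-‿cong (*-congʳ (l2 c d))) ⟩ _ ≈⟨ solve 3 (\ a b c -> (a :+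 con 0ℤ :* b) :- con 0ℤ :* c := a) refl _ _ _ ⟩ Rm (y - x) (Lx y x u Ψ) o c d ∎
   -- The R-matrix is moved through the window one entry at a time by `m9`.
   dV : ∀ x y us c d Ψ -> K x y us c d (Rm (y - x) Ψ) ≈ K y x us c d Ψ + ind (lt c d) * ((y - x) * K y x us d c Ψ)
   dV x y [] c d Ψ = refl
   dV x y (u ∷ us) c d Ψ = begin K x y (u ∷ us) c d (Rm (y - x) Ψ) ≈⟨ ml x y u us c d (Rm (y - x) Ψ) ⟩ K x y us c d (Lx x y u (Rm (y - x) Ψ)) ≈⟨ mm x y us c d (m9 x y u Ψ) ⟩ K x y us c d (Rm (y - x) (Lx y x u Ψ)) ≈⟨ dV x y us c d (Lx y x u Ψ) ⟩ K y x us c d (Lx y x u Ψ) + ind (lt c d) * ((y - x) * K y x us d c (Lx y x u Ψ)) ≈⟨ +-cong (sym (ml y x u us c d Ψ)) (*-congˡ (*-congˡ (sym (ml y x u us d c Ψ)))) ⟩ _ ∎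
  module Trace (n : ℕ) (lo : ℤ) (m : ℕ) where
   Σc : (ℤ -> C) -> C
   Σc = sumR lo m
   HH : C -> (List ℤ -> C) -> List ℤ -> C
   HH x φ v = Σc (\ c -> Hs x v c (\ o c' -> ind (eq c' (c I.+ + n)) * φ o))
   EE : C -> (List ℤ -> C) -> List ℤ -> C
   EE y φ v = Σc (\ c -> Es y v (c I.+ + n) (\ o l -> ind (eq l c) * φ o))
   mr : ∀ x {φ φ'} -> (∀ v -> φ v ≈ φ' v) -> ∀ v -> HH x φ v ≈ HH x φ' v
   mr x e v = sumR-cong lo m (\ c -> Hs-cong' x v c (\ o c' -> *-congˡ (e o)))
   HH-* : ∀ x a φ v -> HH x (\ w -> a * φ w) v ≈ a * HH x φ v
   HH-* x a φ v = trans (sumR-cong lo m (\ c -> trans (Hs-cong' x v c (\ o c' -> solve 3 (\ i a p -> i :* (a :* p) := a :* (i :* p)) refl (ind (eq c' (c I.+ + n))) a (φ o))) (hS x v c a _))) (bJ lo m a _)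
   private
    cl : (List ℤ -> C) -> ℤ -> ℤ -> hQ
    cl φ c d o c' d' = ind (eq c' (c I.+ + n)) * (ind (eq d' (d I.+ + n)) * φ o)
    n5 : ∀ x y φ v -> HH x (HH y φ) v ≈ Σc (\ c -> Σc (\ d -> K x y v c d (cl φ c d)))
    n5 x y φ v = sumR-cong lo m (\ c -> begin Hs x v c (\ o c' -> ind (eq c' (c I.+ + n)) * HH y φ o) ≈⟨ Hs-cong' x v c (\ o c' -> trans (sym (bJ lo m (ind (eq c' (c I.+ + n))) _)) (sumR-cong lo m (\ d -> sym (hS y o d _ _)))) ⟩ Hs x v c (\ o c' -> Σc (\ d -> Hs y o d (\ o' d' -> cl φ c d o' c' d'))) ≈⟨ kK x v c lo m _ ⟩ Σc (\ d -> K x y v c d (cl φ c d)) ∎)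
    mT : ∀ c d e e' -> e ≡ c I.+ + n -> e' ≡ d I.+ + n -> lt e e' ≡ lt c d
    mT c d e e' E.refl E.refl with lt c d in q
    ... | true = bg (Z.+-monoˡ-< (+ n) (aO q))
    ... | false = bk (\ r -> ky q (Z.≰⇒> (\ s -> Z.<⇒≱ r (Z.+-monoˡ-≤ (+ n) s))))
    R-cl : ∀ t φ c d o c' d' -> Rm t (cl φ c d) o c' d' ≈ cl φ c d o c' d' + ind (lt d c) * (t * cl φ d c o c' d')
    R-cl t φ c d o c' d' = +-congˡ (begin ind (lt c' d') * (t * (ind (eq d' (c I.+ + n)) * (ind (eq c' (d I.+ + n)) * φ o))) ≈⟨ solve 5 (\ i t a b p -> i :* (t :* (a :* (b :* p))) := a :* (b :* (i :* (t :* p)))) refl (ind (lt c' d')) t (ind (eq d' (c I.+ + n))) (ind (eq c' (d I.+ + n))) (φ o) ⟩ _ ≈⟨ aZ (eq d' (c I.+ + n)) (\ p -> aZ (eq c' (d I.+ + n)) (\ q -> *-congʳ (reflexive (E.cong ind (mT d c c' d' (c3 q) (c3 p)))))) ⟩ _ ≈⟨ solve 5 (\ i t a b p -> a :* (b :* (i :* (t :* p))) := i :* (t :* (b :* (a :* p)))) refl (ind (lt d c)) t (ind (eq d' (c I.+ + n))) (ind (eq c' (d I.+ + n))) (φ o) ⟩ _ ∎)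
    K-+* : ∀ x y us c d a b Ψ Ψ' -> K x y us c d (\ o c' d' -> Ψ o c' d' + a * (b * Ψ' o c' d')) ≈ K x y us c d Ψ + a * (b * K x y us c d Ψ')
    K-+* x y us c d a b Ψ Ψ' = begin K x y us c d (\ o c' d' -> Ψ o c' d' + a * (b * Ψ' o c' d')) ≈⟨ Hs-cong' x us c (\ o c' -> trans (nA y o d (\ o' d' -> Ψ o' c' d') (\ o' d' -> a * (b * Ψ' o' c' d'))) (+-congˡ (trans (hS y o d a (\ o' d' -> b * Ψ' o' c' d')) (*-congˡ (hS y o d b (\ o' d' -> Ψ' o' c' d')))))) ⟩ _ ≈⟨ nA x us c _ _ ⟩ _ ≈⟨ +-congˡ (trans (hS x us c a _) (*-congˡ (hS x us c b _))) ⟩ _ ∎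
   -- Commuting transfer matrices. `dV` is summed over both carriers; since the R-matrix is the
   -- identity plus a correction, the two correction sums P and Q have to be compared separately.
   ms : ∀ x y φ v -> HH x (HH y φ) v ≈ HH y (HH x φ) v
   ms x y φ v = begin HH x (HH y φ) v ≈⟨ n5 x y φ v ⟩ A ≈⟨ solve 2 (\ a b -> a := (a :+ b) :- b) refl A P ⟩ (A + P) - P ≈⟨ +-congʳ (trans (sym (mc A₁ jG)) (trans (sumR-cong lo m \ c -> sumR-cong lo m \ d -> jF c d) (mc B₁ pl))) ⟩ (B + Q) - P ≈⟨ +-congˡ (-‿cong P≈Q) ⟩ (B + Q) - Q ≈⟨ solve 2 (\ a b -> (a :+ b) :- b := a) refl B Q ⟩ B ≈⟨ sym (n5 y x φ v) ⟩ HH y (HH x φ) v ∎ where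
    t : C
    t = y - x
    A₁ B₁ jG pl : ℤ -> ℤ -> C
    A₁ c d = K x y v c d (cl φ c d)
    B₁ c d = K y x v c d (cl φ c d)
    jG c d = ind (lt d c) * (t * K x y v c d (cl φ d c))
    pl c d = ind (lt c d) * (t * K y x v d c (cl φ c d))
    A B P Q : C
    A = Σc (\ c -> Σc (A₁ c))
    B = Σc (\ c -> Σc (B₁ c))
    P = Σc (\ c -> Σc (jG c))
    Q = Σc (\ c -> Σc (pl c))
    mc : ∀ (X Y : ℤ -> ℤ -> C) -> Σc (\ c -> Σc (\ d -> X c d + Y c d)) ≈ Σc (\ c -> Σc (X c)) + Σc (\ c -> Σc (Y c))
    mc X Y = trans (sumR-cong lo m (\ c -> bI lo m (X c) (Y c))) (bI lo m _ _)
    jF : ∀ c d -> A₁ c d + jG c d ≈ B₁ c d + pl c d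
    jF c d = trans (sym (trans (mm x y v c d (R-cl t φ c d)) (K-+* x y v c d _ _ _ _))) (dV x y v c d (cl φ c d))
    -- For d < c the correction terms of `dV` contain [c<d] and disappear, so the two orders of
    -- sweeping agree on these carriers.
    jE : ∀ c d -> jG c d ≈ pl d c
    jE c d = aZ (lt d c) (\ p -> *-congˡ (begin K x y v c d (cl φ d c) ≈⟨ solve 2 (\ a b -> a := a :+ con 0ℤ :* b) refl _ (t * K x y v c d (cl φ c d)) ⟩ _ ≈⟨ +-congˡ (*-congʳ (asym p)) ⟩ _ ≈⟨ sym (K-+* x y v c d (ind (lt c d)) t _ _) ⟩ _ ≈⟨ mm x y v c d (\ o c' d' -> sym (R-cl t φ d c o c' d')) ⟩ _ ≈⟨ dV x y v c d (cl φ d c) ⟩ _ ≈⟨ +-congˡ (*-congʳ (sym (asym p))) ⟩ _ ≈⟨ solve 2 (\ a b -> a :+ con 0ℤ :* b := a) refl (K y x v c d (cl φ d c)) _ ⟩ K y x v c d (cl φ d c) ∎)) where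
     asym : lt d c ≡ true -> 0# ≈ ind (lt c d)
     asym p = reflexive (E.cong ind (E.sym (bk (Z.<-asym (aO p)))))
    P≈Q : P ≈ Q
    P≈Q = trans (sumR-cong lo m \ c -> sumR-cong lo m \ d -> jE c d) (gH lo m lo m (\ c d -> pl d c))
   private
    -- The inverse sweep delivers l, the next sweep starts from c, and θ c = 0 keeps the two apart.
    -- Such terms have to be shown divisible by a high power of x.
    module Off (x : C) (θ : ℤ -> C) (c : ℤ) (θc : θ c ≈ 0#) where
     G : List ℤ -> ℤ -> (List ℤ -> ℤ -> C) -> C
     G vs r Ψ = Es (- x) vs r (\ o l -> θ l * Hs x o c Ψ)
     sp : ℤ -> (List ℤ -> ℤ -> C) -> List ℤ -> ℤ -> C
     sp r Ψ o c' = Ψ (c' ∷ o) r + ind (lt r c') * (x * Ψ (r ∷ o) c')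
     hU : ∀ vs r {Ψ Ψ'} -> (∀ o c' -> Ψ o c' ≈ Ψ' o c') -> G vs r Ψ ≈ G vs r Ψ'
     hU vs r e = d3 (- x) vs r (\ o l -> *-congˡ (Hs-cong' x o c e))
     G-+ : ∀ vs r Ψ Ψ' -> G vs r (\ o c' -> Ψ o c' + Ψ' o c') ≈ G vs r Ψ + G vs r Ψ'
     G-+ vs r Ψ Ψ' = trans (d3 (- x) vs r (\ o l -> trans (*-congˡ (nA x o c Ψ Ψ')) (distribˡ _ _ _))) (pm (- x) vs r _ _)
     G-* : ∀ vs r a Ψ -> G vs r (\ o c' -> a * Ψ o c') ≈ a * G vs r Ψ
     G-* vs r a Ψ = trans (d3 (- x) vs r (\ o l -> trans (*-congˡ (hS x o c a Ψ)) (solve 3 (\ t a h -> t :* (a :* h) := a :* (t :* h)) refl (θ l) a _))) (og (- x) vs r a _)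
     δ : ℤ -> (List ℤ -> C) -> List ℤ -> ℤ -> C
     δ r X o c' = ind (eq c' r) * X o
     ik : List ℤ -> (List ℤ -> C) -> C
     ik [] X = 0#
     ik (u ∷ us) X = G us u (\ o c' -> X (c' ∷ o))
     jP : ∀ us r X -> G us r (δ r X) ≈ ik us X
     jP [] r X with eq c r in q
     ... | true = trans (*-congʳ (trans (reflexive (E.cong θ (E.sym (c3 q)))) θc)) (zeroˡ _)
     ... | false = trans (*-congˡ (zeroˡ _)) (zeroʳ _)
     jP (u ∷ us) r X = trans (+-cong (hU us u ek) (aU (lt r u) (\ p -> trans (*-congˡ (trans (hU us r (kq p)) zeroG)) (zeroʳ _)))) (+-identityʳ _) where
      ek : ∀ o c' -> sp r (δ r X) o c' ≈ X (c' ∷ o)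
      ek o c' = trans (+-cong (ind-true _ (cw E.refl)) (aU (lt r c') (\ p -> trans (*-congˡ (ind-false _ (b7 (\ e -> Z.<-irrefl (E.sym e) (aO p))))) (zeroʳ _)))) (+-identityʳ _)
      kq : lt r u ≡ true -> ∀ o c' -> sp u (δ r X) o c' ≈ 0# * 0#
      kq p o c' = trans (+-cong (ind-false _ (b7 (\ e -> Z.<-irrefl (E.sym e) (aO p)))) (aU (lt u c') (\ q -> trans (*-congˡ (ind-false _ (b7 (\ e -> Z.<-asym (aO p) (E.subst (u I.<_) e (aO q)))))) (zeroʳ _)))) (trans (+-identityʳ 0#) (sym (zeroʳ 0#)))
      zeroG : G us r (\ _ _ -> 0# * 0#) ≈ 0#
      zeroG = trans (G-* us r 0# (\ _ _ -> 0#)) (zeroˡ _)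
     -- A jump at the first entry met is excluded by the final carrier, and after an exchange r no
     -- longer enters the value.
     bF : ∀ us r r' X -> G us r (δ r X) ≈ G us r' (δ r' X)
     bF us r r' X = trans (jP us r X) (sym (jP us r' X))
     off : ℤ -> (List ℤ -> ℤ -> C) -> List ℤ -> ℤ -> C
     off r Ψ o c' = (1# - ind (eq c' r)) * Ψ o c'
     pK : ∀ r Ψ o -> off r Ψ o r ≈ 0#
     pK r Ψ o = trans (*-congʳ (trans (+-congˡ (-‿cong (reflexive (E.cong ind (cw E.refl))))) (-‿inverseʳ 1#))) (zeroˡ _)
     a8 : ∀ us r Ψ -> G us r Ψ ≈ G us r (off r Ψ) + G us r (δ r (\ o -> Ψ o r))
     a8 us r Ψ = trans (hU us r (\ o c' -> trans (solve 2 (\ e a -> a := (con 1ℤ :- e) :* a :+ e :* a) refl (ind (eq c' r)) (Ψ o c')) (+-cong (*-congʳ (+-congʳ ι-1)) (aZ (eq c' r) (\ p -> reflexive (E.cong (Ψ o) (c3 p))))))) (G-+ us r _ _)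
     -- Every entry contributes a factor x. Both branches are split by `a8` into a part to which the
     -- induction applies and a `δ` part; the two `δ` parts are equal by `bF` and enter with the
     -- opposite weights x and -x.
     eX : ∀ vs r Ψ -> (∀ o -> Ψ o r ≈ 0#) -> Σ C (\ z -> G vs r Ψ ≈ pow x (length vs) * z)
     eX [] r Ψ e = _ , sym (*-identityˡ _)
     eX (u ∷ us) r Ψ e = z₁ - i * z₂ , (begin G us u (sp r Ψ) + i * (- x * G us r (sp u Ψ)) ≈⟨ +-cong (trans (hU us u lead) (G-* us u x χ)) (aZ (lt r u) (\ p -> *-congˡ (trans (a8 us r (sp u Ψ)) (+-congˡ (hU us r (\ o c' -> *-congˡ (tail p o))))))) ⟩ x * G us u χ + i * (- x * (G us r (off r (sp u Ψ)) + G us r (δ r X))) ≈⟨ +-cong (*-congˡ (trans (a8 us u χ) (+-cong hI (trans (hU us u (\ o c' -> solve 3 (\ a b c -> a :* (b :* c) := b :* (a :* c)) refl (ind (eq c' u)) i _)) (G-* us u i (δ u X)))))) (*-congˡ (*-congˡ (+-cong e₂ (bF us r u X)))) ⟩ x * (p * z₁ + i * G us u (δ u X)) + i * (- x * (p * z₂ + G us u (δ u X))) ≈⟨ solve 6 (\ x p z₁ i z₂ d -> x :* (p :* z₁ :+ i :* d) :+ i :* ((:- x) :* (p :* z₂ :+ d)) := (x :* p) :* (z₁ :- i :* z₂)) refl x p z₁ i z₂ (G us u (δ u X)) ⟩ (x * p) * (z₁ - i * z₂) ∎) where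
      i p : C
      i = ind (lt r u)
      p = pow x (length us)
      X : List ℤ -> C
      X o = Ψ (r ∷ o) u
      χ : List ℤ -> ℤ -> C
      χ o c' = ind (lt r c') * Ψ (r ∷ o) c'
      lead : ∀ o c' -> sp r Ψ o c' ≈ x * χ o c'
      lead o c' = trans (+-congʳ (e _)) (solve 3 (\ a b c -> con 0ℤ :+ a :* (b :* c) := b :* (a :* c)) refl (ind (lt r c')) x _)
      tail : lt r u ≡ true -> ∀ o -> sp u Ψ o r ≈ X o
      tail q o = trans (+-congˡ (ind-false _ (bk (Z.<-asym (aO q))))) (+-identityʳ _)
      r₁ = eX us u (off u χ) (pK u χ)
      r₂ = eX us r (off r (sp u Ψ)) (pK r (sp u Ψ))
      z₁ = proj₁ r₁
      z₂ = proj₁ r₂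
      hI : G us u (off u χ) ≈ p * z₁
      hI = proj₂ r₁
      e₂ : G us r (off r (sp u Ψ)) ≈ p * z₂
      e₂ = proj₂ r₂
   -- At each entry the jump of `Es` with weight -x cancels the jump of `Hs` with weight x; the term
   -- with both jumps would need r < u and u < r.
   nF : ∀ x vs r Ψ -> Es (- x) vs r (\ o l -> Hs x o l Ψ) ≈ Ψ vs r
   nF x [] r Ψ = refl
   nF x (u ∷ us) r Ψ = begin Es (- x) us u (\ o l -> Hs x o l (sp r)) + ind (lt r u) * (- x * Es (- x) us r (\ o l -> Hs x o l (sp u))) ≈⟨ +-cong (nF x us u (sp r)) (aZ (lt r u) (\ p -> *-congˡ (trans (nF x us r (sp u)) (trans (+-congˡ (ind-false _ (bk (Z.<-asym (aO p))))) (+-identityʳ _))))) ⟩ (Ψ (u ∷ us) r + ind (lt r u) * (x * Ψ (r ∷ us) u)) + ind (lt r u) * (- x * Ψ (r ∷ us) u) ≈⟨ solve 4 (\ a i x b -> (a :+ i :* (x :* b)) :+ i :* ((:- x) :* b) := a) refl _ (ind (lt r u)) x _ ⟩ Ψ (u ∷ us) r ∎ where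
    sp : ℤ -> List ℤ -> ℤ -> C
    sp r o c' = Ψ (c' ∷ o) r + ind (lt r c') * (x * Ψ (r ∷ o) c')
   bW : ℤ -> Set
   bW z = lo I.≤ z × z I.< lo I.+ + m
   cU : ∀ {Q : ℤ -> Set} {vs r o l} -> Q r -> All Q vs -> e3 vs r o l -> All Q o × Q l
   cU q [] eD = [] , q
   cU q (qu ∷ qs) (b2 p) = let a , b = cU qu qs p in q ∷ a , b
   cU q (qu ∷ qs) (f8 p _) = let a , b = cU q qs p in qu ∷ a , b
   -- The double sum over the two carriers is reduced to its diagonal: off the diagonal `Off` gives
   -- the factor x^n. On the diagonal the last entry must be exchanged in both sweeps (`mQ`), and
   -- `nF` handles the rest.
   EE-HH : ∀ x φ u us -> All bW (u ∷ us) -> pow x (suc (length us)) ≈ 0# -> EE (- x) (HH x φ) (u ∷ us) ≈ φ (u ∷ us)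
   EE-HH x φ u us (qu ∷ qs) nil = begin EE (- x) (HH x φ) (u ∷ us) ≈⟨ sumR-cong lo m (\ c -> trans (d3 (- x) v (c I.+ + n) (\ o l -> sym (bJ lo m (ind (eq l c)) (\ d -> Hs x o d (bl d))))) (kM (- x) v (c I.+ + n) lo m (\ d o l -> ind (eq l c) * Hs x o d (bl d)))) ⟩ Σc (\ c -> Σc (\ d -> f c d)) ≈⟨ aV lo m (\ c p q -> trans (sumR-cong lo m (nk c)) (bj lo m c (f c) p q)) ⟩ Σc (\ c -> f c c) ≈⟨ sumR-cong lo m mQ ⟩ Σc (\ c -> Es (- x) us u (\ o l -> ind (eq l c) * Hs x o l φ')) ≈⟨ sym (kM (- x) us u lo m _) ⟩ Es (- x) us u (\ o l -> Σc (\ c -> ind (eq l c) * Hs x o l φ')) ≈⟨ fI (- x) us u (\ o l p -> let q = proj₂ (cU qu qs p) in bj lo m l (\ _ -> Hs x o l φ') (proj₁ q) (proj₂ q)) ⟩ Es (- x) us u (\ o l -> Hs x o l φ') ≈⟨ nF x us u φ' ⟩ φ (u ∷ us) ∎ where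
    v = u ∷ us
    φ' : List ℤ -> ℤ -> C
    φ' o c' = φ (c' ∷ o)
    bl : ℤ -> List ℤ -> ℤ -> C
    bl d o c' = ind (eq c' (d I.+ + n)) * φ o
    f : ℤ -> ℤ -> C
    f c d = Es (- x) v (c I.+ + n) (\ o l -> ind (eq l c) * Hs x o d (bl d))
    nk : ∀ c d -> f c d ≈ ind (eq c d) * f c d
    nk c d with eq c d in q
    ... | true = sym (*-identityˡ _)
    ... | false = trans (proj₂ z) (trans (*-congʳ nil) (trans (zeroˡ _) (sym (zeroˡ _)))) where
     ne = kC q
     open Off x (\ l -> ind (eq l c)) d (reflexive (E.cong ind (b7 (\ e -> ne (E.sym e)))))
     z = eX v (c I.+ + n) (bl d) (\ o -> ind-false _ (b7 (\ e -> ne (aS (+ n) c d e))))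
    mQ : ∀ c -> f c c ≈ Es (- x) us u (\ o l -> ind (eq l c) * Hs x o l φ')
    mQ c = trans (+-cong (d3 (- x) us u (\ o l -> aZ (eq l c) (\ p -> trans (Hs-cong' x o c ek) (reflexive (E.cong (\ z -> Hs x o z φ') (E.sym (c3 p))))))) (aU (lt r u) (\ p -> trans (*-congˡ (Es-0 (- x) us r (\ o l _ -> trans (*-congˡ (Hs-0 x o c (\ o' c' _ -> kq p o' c'))) (zeroʳ _)))) (zeroʳ _)))) (+-identityʳ _) where
     r = c I.+ + n
     ek : ∀ o c' -> bl c (c' ∷ o) r + ind (lt r c') * (x * bl c (r ∷ o) c') ≈ φ' o c'
     ek o c' = trans (+-cong (ind-true _ (cw E.refl)) (aU (lt r c') (\ p -> trans (*-congˡ (ind-false _ (b7 (\ e -> Z.<-irrefl (E.sym e) (aO p))))) (zeroʳ _)))) (+-identityʳ _)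
     kq : lt r u ≡ true -> ∀ o c' -> bl c (c' ∷ o) u + ind (lt u c') * (x * bl c (u ∷ o) c') ≈ 0#
     kq p o c' = trans (+-cong (ind-false _ (b7 (\ e -> Z.<-irrefl (E.sym e) (aO p)))) (aU (lt u c') (\ q -> trans (*-congˡ (ind-false _ (b7 (\ e -> Z.<-asym (aO p) (E.subst (u I.<_) e (aO q)))))) (zeroʳ _)))) (+-identityʳ 0#)

-- How a sweep changes the lower and upper bounds of a window

module o3 where
 open dK
 open lq
 open ad
 open import Data.Integer using (_≤_; _<_)
 open import Data.List.Relation.Unary.All using (All; []; _∷_)
 open import Data.Product using (_×_)
 open import Data.Unit using (⊤; tt)
 open L hiding (I; O)
 -- The entry at the head of a list of length m is the one in slot m of the window.
 a5 : ℤ -> List ℤ -> Set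
 a5 M [] = ⊤
 a5 M (u ∷ us) = u ≤ + suc (length us) I.+ M × a5 M us
 bE : List ℤ -> Set
 bE [] = ⊤
 bE (u ∷ us) = + suc (length us) ≤ u × bE us
 aW : ∀ {vs r o l} -> e3 vs r o l -> length o ≡ length vs
 aW eD = E.refl
 aW (b2 p) = E.cong suc (aW p)
 aW (f8 p _) = E.cong suc (aW p)
 aH : ∀ {vs r o l} -> bu vs r o l -> length o ≡ length vs
 aH eD = E.refl
 aH (b2 p) = E.cong suc (aH p)
 aH (f8 p _) = E.cong suc (aH p)
 private
  gM : ∀ a M {u} -> u ≤ + a I.+ M -> u ≤ + suc a I.+ M
  gM a M {u} p = lin 1 p (solve 3 (\ a M u -> ((con 1ℤ :+ a) :+ M) :- u := ((a :+ M) :- u) :+ con 1ℤ) E.refl (+ a) M u)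
  c2 : ∀ n r -> r ≡ r I.+ + suc n -> ⊥
  c2 n r e with aS r 0ℤ (+ suc n) (E.trans (Z.+-identityˡ r) (E.trans e (Z.+-comm r (+ suc n))))
  ... | ()
 -- Stated from output to input because the contrapositive is used: a violated bound stays violated
 -- in every window that the sweep can produce.
 co : ∀ {M vs r o l} -> e3 vs r o l -> a5 M o -> l ≤ M -> a5 M vs × r ≤ + length vs I.+ M
 co {M} eD b p = tt , Z.≤-trans p (Z.≤-reflexive (E.sym (Z.+-identityˡ M)))
 co {M} {u ∷ us} (b2 q) (b , bs) p with aW q
 ... | e = let c , d = co q bs p in (gM (length us) M d , c) , E.subst (\ z -> _ ≤ + suc z I.+ M) e b
 co {M} {u ∷ us} (f8 q _) (b , bs) p with aW q
 ... | e = let c , d = co q bs p in (E.subst (\ z -> _ ≤ + suc z I.+ M) e b , c) , gM (length us) M d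
 -- Unless r jumps over everything, it is put down in some slot and obeys the bound of that slot.
 dm : ∀ {M vs r o l} -> e3 vs r o l -> a5 M o -> l ≡ r ⊎ r ≤ + length vs I.+ M
 dm eD b = inj₁ E.refl
 dm {M} (b2 q) (b , _) = inj₂ (E.subst (\ z -> _ ≤ + suc z I.+ M) (aW q) b)
 dm {M} {u ∷ us} (f8 q _) (_ , bs) with dm q bs
 ... | inj₁ e = inj₁ e
 ... | inj₂ p = inj₂ (gM (length us) M p)
 cT : ∀ {Q : ℤ -> Set} {vs r o l} -> All Q vs -> e3 vs r o l -> l ≡ r ⊎ Q l
 cT [] eD = inj₁ E.refl
 cT (q ∷ qs) (b2 p) with cT qs p
 ... | inj₁ E.refl = inj₂ q
 ... | inj₂ r = inj₂ r
 cT (q ∷ qs) (f8 p _) = cT qs p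
 cn : ∀ {us c o c'} -> bu us c o c' -> bE o -> + suc (length us) ≤ c' -> bE us × 1ℤ ≤ c
 cn eD a p = tt , p
 cn {u ∷ us} (b2 q) (a , as) p with aH q
 ... | e = let b , d = cn q as (E.subst (\ z -> + suc z ≤ _) e a) in (Z.≤-trans (I.+≤+ (N.n≤1+n _)) p , b) , d
 cn {u ∷ us} (f8 q _) (a , as) p with aH q
 ... | e = let b , d = cn q as (Z.≤-trans (I.+≤+ (N.n≤1+n _)) p) in (E.subst (\ z -> + suc z ≤ _) e a , b) , d
 bP : ∀ {us c o c'} -> bu us c o c' -> bE o -> c' ≡ c ⊎ 1ℤ ≤ c
 bP eD a = inj₁ E.refl
 bP (b2 q) (a , as) with bP q as
 ... | inj₁ E.refl = inj₂ (Z.≤-trans (I.+≤+ (M.s≤s M.z≤n)) a)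
 ... | inj₂ p = inj₂ p
 bP (f8 q _) (_ , as) = bP q as
 -- The paths of `Hs` at x = 0: only exchanges, so the window is shifted by one slot.
 data jw : List ℤ -> ℤ -> List ℤ -> ℤ -> Set where
  eD : ∀ {c} -> jw [] c [] c
  b2 : ∀ {u us c o c'} -> jw us c o c' -> jw (u ∷ us) c (c' ∷ o) u
 bX : ∀ {vs r o l} -> jw vs r o l -> length o ≡ length vs
 bX eD = E.refl
 bX (b2 p) = E.cong suc (bX p)
 -- Every entry sits one slot further to the right afterwards, hence the bound M + 1 before.
 ew : ∀ {M us c o c'} -> jw us c o c' -> a5 M o -> c' ≤ + suc (length us) I.+ M -> a5 (1ℤ I.+ M) us × c ≤ 1ℤ I.+ M
 ew eD b p = tt , p
 ew {M} {u ∷ us} (b2 q) (b , bs) p = let c , d = ew q bs (E.subst (\ z -> _ ≤ + suc z I.+ M) (bX q) b) in (Z.≤-trans p (Z.≤-reflexive (solve 2 (\ a M -> (con 1ℤ :+ a) :+ M := a :+ (con 1ℤ :+ M)) E.refl (+ suc (length us)) M)) , c) , d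
 module ln (R : CommutativeRing 0ℓ 0ℓ) (n : ℕ) (lo : ℤ) (m : ℕ) where
  open aE R hiding (solve; _:+_; _:-_; con; _:=_)
  open cA R
  open Trace (suc n) lo m
  pd : ∀ {Q Q' : ℤ -> Set} {M y φ v} -> (∀ {z} -> Q z -> Q' z) -> (∀ {z} -> Q z -> Q' (z I.+ + suc n)) -> length v ≡ suc n -> All Q v -> ¬ a5 M v -> (∀ o -> length o ≡ suc n -> All Q' o -> ¬ a5 M o -> φ o ≈ 0#) -> EE y φ v ≈ 0#
  pd {Q} {Q'} {M} {y} {φ} {v} i₁ i₂ len q nb e = ff lo m (\ c -> Es-0 y v (c I.+ + suc n) (\ o l p -> aU (eq l c) (\ b -> eS c o l p (c3 b)))) where
   open import Data.List.Relation.Unary.All as All using ()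
   eS : ∀ c o l -> e3 v (c I.+ + suc n) o l -> l ≡ c -> φ o ≈ 0#
   eS c o .c p E.refl = e o (E.trans (aW p) len) (proj₁ (cU (i₂ qc) (All.map i₁ q) p)) bad where
    qc : Q c
    qc with cT q p
    ... | inj₁ eq' = ⊥-elim (c2 n c eq')
    ... | inj₂ r = r
    -- `dm` with l = c and r = c + n: the two differ, so c + n was put down, and its bound n + M
    -- gives c ≤ M.
    bad : ¬ a5 M o
    bad b with dm p b
    ... | inj₁ eq' = c2 n c eq'
    ... | inj₂ r = nb (proj₁ (co p b (lin 0 (E.subst (\ z -> c I.+ + suc n ≤ + z I.+ M) len r) (solve 3 (\ M c n -> M :- c := ((n :+ M) :- (c :+ n)) :+ con 0ℤ) E.refl M c (+ suc n)))))
  pa : ∀ {x φ v} -> length v ≡ suc n -> ¬ bE v -> (∀ o -> length o ≡ suc n -> ¬ bE o -> φ o ≈ 0#) -> HH x φ v ≈ 0#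
  pa {x} {φ} {v} len na e = ff lo m (\ c -> Hs-0 x v c (\ o c' p -> aU (eq c' (c I.+ + suc n)) (\ b -> eS c o c' p (c3 b)))) where
   eS : ∀ c o c' -> bu v c o c' -> c' ≡ c I.+ + suc n -> φ o ≈ 0#
   eS c o c' p r = e o (E.trans (aH p) len) bad where
    bad : ¬ bE o
    bad a with bP p a
    ... | inj₁ q = c2 n c (E.trans (E.sym q) r)
    ... | inj₂ q = na (proj₁ (cn p a (E.subst (\ z -> + suc z ≤ c') (E.sym len) (E.subst (+ suc (suc n) ≤_) (E.sym r) (Z.+-monoˡ-≤ (+ suc n) q)))))
  o6 : ∀ {x} -> x ≈ 0# -> ∀ us c {Ψ} -> (∀ o c' -> jw us c o c' -> Ψ o c' ≈ 0#) -> Hs x us c Ψ ≈ 0#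
  o6 z [] c e = e [] c eD
  o6 z (u ∷ us) c e = o6 z us c (\ o c' p -> trans (+-cong (e _ _ (b2 p)) (trans (*-congˡ (trans (*-congʳ z) (zeroˡ _))) (zeroʳ _))) (+-identityˡ 0#))
  kL : ∀ {M x φ v} -> x ≈ 0# -> length v ≡ suc n -> ¬ a5 (1ℤ I.+ M) v -> (∀ o -> length o ≡ suc n -> ¬ a5 M o -> φ o ≈ 0#) -> HH x φ v ≈ 0#
  kL {M} {x} {φ} {v} z len nb e = ff lo m (\ c -> o6 z v c (\ o c' p -> aU (eq c' (c I.+ + suc n)) (\ b -> eS c o c' p (c3 b)))) where
   eS : ∀ c o c' -> jw v c o c' -> c' ≡ c I.+ + suc n -> φ o ≈ 0#
   eS c o c' p r = e o (E.trans (bX p) len) (bad p len nb) where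
    bad : ∀ {v} -> jw v c o c' -> length v ≡ suc n -> ¬ a5 (1ℤ I.+ M) v -> ¬ a5 M o
    bad (b2 {u} {us} p) l nb (b , bs) = let a , d = ew p bs (E.subst (\ z -> _ ≤ + suc z I.+ M) (bX p) b) in nb (E.subst (\ z -> u ≤ + z I.+ (1ℤ I.+ M)) (E.sym l) (lin 0 (d & Z.≤-reflexive r) (solve 4 (\ n M u c -> n :+ (con 1ℤ :+ M) :- u := ((con 1ℤ :+ M) :+ (c :+ n)) :- (c :+ u) :+ con 0ℤ) E.refl (+ suc n) M u c)) , a)

-- The polynomial ring, ideals of powers of the variables, quotient rings

module iM where
 open import Defs using (Poly; coeff; _≈P_; _*P_)
 open dK
 open import Data.Integer using (_+_; _*_; -_)
 open import Data.List using (map; concatMap)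
 open import Data.Vec using (replicate; zipWith)
 open import Data.Vec.Relation.Unary.All as All using (All; []; _∷_)
 open import Data.Product using (_×_)
 open E using (sym; trans; refl)
 open L hiding (I; O)
 infixl 6 _⊞_
 _⊞_ : ∀ {k} -> Vec ℕ k -> Vec ℕ k -> Vec ℕ k
 _⊞_ = zipWith M._+_
 bo : ∀ {k} -> Vec ℕ k
 bo = replicate _ 0
 hZ : ∀ {k} (a b : Vec ℕ k) -> a ⊞ b ≡ b ⊞ a
 hZ = VP.zipWith-comm N.+-comm
 k0 : ∀ {k} (a b c : Vec ℕ k) -> a ⊞ b ⊞ c ≡ a ⊞ (b ⊞ c)
 k0 = VP.zipWith-assoc N.+-assoc
 aG : ∀ {k} (a : Vec ℕ k) -> bo ⊞ a ≡ a
 aG = VP.zipWith-identityˡ N.+-identityˡ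
 val : ∀ {k} -> Poly k -> (Vec ℕ k -> ℤ) -> ℤ
 val [] φ = 0ℤ
 val ((c , b) ∷ P) φ = c * φ b + val P φ
 infix 4 _≋_
 -- Equality as functionals on exponents rather than coefficientwise: `val` of a product is an
 -- iterated `val`, so the ring laws become interchanges of sums. Coefficients are the functionals
 -- `δ[ a ]`.
 record _≋_ {k} (P Q : Poly k) : Set where
  constructor mk≋
  field at : ∀ φ -> val P φ ≡ val Q φ
 open _≋_ public
 ao : ∀ {k} (P : Poly k) {φ ψ} -> (∀ b -> φ b ≡ ψ b) -> val P φ ≡ val P ψ
 ao [] e = refl
 ao ((c , b) ∷ P) e = cong₂ _+_ (cong (c *_) (e b)) (ao P e)
 aK : ∀ {k} (P Q : Poly k) φ -> val (P ++ Q) φ ≡ val P φ + val Q φ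
 aK [] Q φ = sym (Z.+-identityˡ _)
 aK ((c , b) ∷ P) Q φ = trans (cong (I._+_ ((c * φ b))) (aK P Q φ)) (sym (Z.+-assoc (c * φ b) _ _))
 jm : ∀ {k} (P : Poly k) φ ψ -> val P (\ b -> φ b + ψ b) ≡ val P φ + val P ψ
 jm [] φ ψ = refl
 jm ((c , b) ∷ P) φ ψ = trans (cong (I._+_ ((c * (φ b + ψ b)))) (jm P φ ψ)) (solve 5 (\ c a b x y -> c :* (a :+ b) :+ (x :+ y) := (c :* a :+ x) :+ (c :* b :+ y)) refl c (φ b) (ψ b) (val P φ) (val P ψ))
 jn : ∀ {k} (P : Poly k) z φ -> val P (\ b -> z * φ b) ≡ z * val P φ
 jn [] z φ = sym (Z.*-zeroʳ z)
 jn ((c , b) ∷ P) z φ = trans (cong (I._+_ ((c * (z * φ b)))) (jn P z φ)) (solve 4 (\ c z a x -> c :* (z :* a) :+ z :* x := z :* (c :* a :+ x)) refl c z (φ b) (val P φ))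
 hl : ∀ {k} (P : Poly k) {φ} -> (∀ b -> φ b ≡ 0ℤ) -> val P φ ≡ 0ℤ
 hl P e = trans (ao P (\ b -> trans (e b) (sym (Z.*-zeroˡ 0ℤ)))) (trans (jn P 0ℤ (\ _ -> 0ℤ)) (Z.*-zeroˡ (val P (\ _ -> 0ℤ))))
 h8 : ∀ {k l} (P : Poly k) (Q : Poly l) (φ : Vec ℕ k -> Vec ℕ l -> ℤ) -> val P (\ a -> val Q (φ a)) ≡ val Q (\ b -> val P (\ a -> φ a b))
 h8 [] Q φ = sym (hl Q (\ _ -> refl))
 h8 ((c , a) ∷ P) Q φ = trans (cong₂ _+_ (sym (jn Q c (φ a))) (h8 P Q φ)) (sym (jm Q (\ b -> c * φ a b) _))
 private
  gE : ∀ {k} c a (Q : Poly k) φ -> val (map (\ { (d , b) -> (c * d , zipWith M._+_ a b) }) Q) φ ≡ c * val Q (\ b -> φ (a ⊞ b))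
  gE c a [] φ = sym (Z.*-zeroʳ c)
  gE c a ((d , b) ∷ Q) φ = trans (cong (I._+_ ((c * d * φ (a ⊞ b)))) (gE c a Q φ)) (solve 4 (\ c d x y -> c :* d :* x :+ c :* y := c :* (d :* x :+ y)) refl c d (φ (a ⊞ b)) (val Q (\ b -> φ (a ⊞ b))))
 ap : ∀ {k} (P Q : Poly k) φ -> val (P *P Q) φ ≡ val P (\ a -> val Q (\ b -> φ (a ⊞ b)))
 ap [] Q φ = refl
 ap ((c , a) ∷ P) Q φ = trans (aK (map _ Q) (P *P Q) φ) (cong₂ _+_ (gE c a Q φ) (ap P Q φ))
 dd : ∀ {k} -> Poly k -> Poly k
 dd = map (\ t -> - proj₁ t , proj₂ t)
 bR : ∀ {k} (P : Poly k) φ -> val (dd P) φ ≡ - val P φ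
 bR [] φ = refl
 bR ((c , b) ∷ P) φ = trans (cong (I._+_ ((- c * φ b))) (bR P φ)) (solve 3 (\ c a x -> (:- c) :* a :+ (:- x) := :- (c :* a :+ x)) refl c (φ b) (val P φ))
 du : ∀ {k} -> Poly k
 du = (1ℤ , bo) ∷ []
 ed : ∀ {k} (φ : Vec ℕ k -> ℤ) -> val du φ ≡ φ bo
 ed φ = trans (Z.+-identityʳ _) (Z.*-identityˡ _)
 ai : ℕ -> CommutativeRing 0ℓ 0ℓ
 ai k = record { Carrier = Poly k ; _≈_ = _≋_ ; _+_ = _++_ ; _*_ = _*P_ ; -_ = dd ; 0# = [] ; 1# = du ; isCommutativeRing = record { isRing = record { +-isAbelianGroup = record { isGroup = record { isMonoid = record { isSemigroup = record { isMagma = record { isEquivalence = record { refl = mk≋ (\ φ -> refl) ; sym = \ p -> mk≋ (\ φ -> sym (at p φ)) ; trans = \ p q -> mk≋ (\ φ -> trans (at p φ) (at q φ)) } ; ∙-cong = \ {P} {P'} {Q} {Q'} p q -> mk≋ (\ φ -> trans (aK P Q φ) (trans (cong₂ _+_ (at p φ) (at q φ)) (sym (aK P' Q' φ)))) } ; assoc = \ P Q S -> mk≋ (\ φ -> trans (aK (P ++ Q) S φ) (trans (cong (_+ val S φ) (aK P Q φ)) (trans (Z.+-assoc (val P φ) _ _) (sym (trans (aK P (Q ++ S) φ) (cong (I._+_ (val P φ)) (aK Q S φ))))))) } ; identity = (\ P -> mk≋ (\ φ -> refl)) , (\ P -> mk≋ (\ φ -> trans (aK P [] φ) (Z.+-identityʳ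 _))) } ; inverse = (\ P -> mk≋ (\ φ -> trans (aK (dd P) P φ) (trans (cong (_+ val P φ) (bR P φ)) (Z.+-inverseˡ (val P φ))))) , (\ P -> mk≋ (\ φ -> trans (aK P (dd P) φ) (trans (cong (I._+_ (val P φ)) (bR P φ)) (Z.+-inverseʳ (val P φ))))) ; ⁻¹-cong = \ {P} {Q} p -> mk≋ (\ φ -> trans (bR P φ) (trans (cong -_ (at p φ)) (sym (bR Q φ)))) } ; comm = \ P Q -> mk≋ (\ φ -> trans (aK P Q φ) (trans (Z.+-comm (val P φ) _) (sym (aK Q P φ)))) } ; *-cong = \ {P} {P'} {Q} {Q'} p q -> mk≋ (\ φ -> trans (ap P Q φ) (trans (at p _) (trans (ao P' (\ a -> at q _)) (sym (ap P' Q' φ))))) ; *-assoc = \ P Q S -> mk≋ (\ φ -> trans (ap (P *P Q) S φ) (trans (ap P Q _) (trans (ao P (\ a -> trans (ao Q (\ b -> ao S (\ c -> cong φ (k0 a b c)))) (sym (ap Q S _)))) (sym (ap P (Q *P S) φ))))) ; *-identity = (\ P -> mk≋ (\ φ -> trans (ap du P φ) (trans (ed (\ a -> val P (\ b -> φ (a ⊞ b)))) (ao P (\ b -> cong φ (aG b)))))) , (\ P -> mk≋ (\ φ -> trans (ap P du φ) (ao P (\ a -> trans (ed (\ b -> φ (a ⊞ b))) (cong φ (trans (hZ a bo) (aG a))))))) ; distrib = (\ P Q S -> mk≋ (\ φ -> trans (ap P (Q ++ S) φ) (trans (trans (ao P (\ a -> aK Q S _)) (jm P _ _)) (sym (trans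 (aK (P *P Q) (P *P S) φ) (cong₂ _+_ (ap P Q φ) (ap P S φ))))))) , (\ P Q S -> mk≋ (\ φ -> trans (ap (Q ++ S) P φ) (trans (aK Q S _) (sym (trans (aK (Q *P P) (S *P P) φ) (cong₂ _+_ (ap Q P φ) (ap S P φ))))))) } ; *-comm = \ P Q -> mk≋ (\ φ -> trans (ap P Q φ) (trans (h8 P Q _) (trans (ao Q (\ b -> ao P (\ a -> cong φ (hZ a b)))) (sym (ap Q P φ))))) } }
 _≟V_ : ∀ {k} (a b : Vec ℕ k) -> Dec (a ≡ b)
 _≟V_ = VP.≡-dec M._≟_
 abstract
  δ[_] : ∀ {k} -> Vec ℕ k -> Vec ℕ k -> ℤ
  δ[ a ] b with b ≟V a
  ... | yes _ = 1ℤ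
  ... | no _ = 0ℤ
  iV : ∀ {k} (a b : Vec ℕ k) -> b ≡ a -> δ[ a ] b ≡ 1ℤ
  iV a b e with b ≟V a
  ... | yes _ = refl
  ... | no n = ⊥-elim (n e)
  d8 : ∀ {k} (a b : Vec ℕ k) -> b ≢ a -> δ[ a ] b ≡ 0ℤ
  d8 a b n with b ≟V a
  ... | yes e = ⊥-elim (n e)
  ... | no _ = refl
  hx : ∀ {k l} (a b : Vec ℕ k) (c d : Vec ℕ l) -> (b ≡ a -> d ≡ c) -> (d ≡ c -> b ≡ a) -> δ[ a ] b ≡ δ[ c ] d
  hx a b c d f g with b ≟V a
  ... | yes e = sym (iV c d (f e))
  ... | no n = sym (d8 c d (\ e -> n (g e)))
  aj : ∀ {k} (P : Poly k) a -> coeff P a ≡ val P δ[ a ]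
  aj [] a = refl
  aj ((c , b) ∷ P) a with b ≟V a
  ... | yes _ = cong₂ _+_ (sym (Z.*-identityʳ c)) (aj P a)
  ... | no _ = trans (sym (Z.+-identityˡ _)) (cong₂ _+_ (sym (Z.*-zeroʳ c)) (aj P a))
 ac : ∀ {k} {P Q : Poly k} -> P ≋ Q -> P ≈P Q
 ac {P = P} {Q} e a = trans (aj P a) (trans (at e δ[ a ]) (sym (aj Q a)))
 dB : ∀ {k} (a b c : Vec ℕ k) -> a ⊞ b ≡ a ⊞ c -> b ≡ c
 dB [] [] [] e = refl
 dB (a ∷ as) (b ∷ bs) (c ∷ cs) e = cong₂ _∷_ (N.+-cancelˡ-≡ a b c (VP.∷-injectiveˡ e)) (dB as bs cs (VP.∷-injectiveʳ e))
 ig : ∀ {k} (a e : Vec ℕ k) -> (Σ (Vec ℕ k) \ e' -> a ⊞ e' ≡ e) ⊎ (∀ b -> a ⊞ b ≢ e)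
 ig [] [] = inj₁ ([] , refl)
 ig (a ∷ as) (e ∷ es) with a M.≤? e | ig as es
 ... | no p | _ = inj₂ (\ { (b ∷ bs) q -> p (E.subst (a M.≤_) (VP.∷-injectiveˡ q) (N.m≤m+n a b)) })
 ... | yes p | inj₂ n = inj₂ (\ { (b ∷ bs) q -> n bs (VP.∷-injectiveʳ q) })
 ... | yes p | inj₁ (e' , q) = inj₁ (e M.∸ a ∷ e' , cong₂ _∷_ (N.m+[n∸m]≡n p) q)
 en : ∀ {k} (a e : Vec ℕ k) -> (Σ (Vec ℕ k) \ e' -> a ⊞ e' ≡ e × (∀ P -> val P (\ b -> δ[ e ] (a ⊞ b)) ≡ coeff P e')) ⊎ (∀ P -> val P (\ b -> δ[ e ] (a ⊞ b)) ≡ 0ℤ)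
 en a e with ig a e
 ... | inj₁ (e' , q) = inj₁ (e' , q , \ P -> trans (ao P (\ b -> hx e (a ⊞ b) e' b (\ r -> dB a b e' (trans r (sym q))) (\ r -> trans (cong (a ⊞_) r) q))) (sym (aj P e')))
 ... | inj₂ n = inj₂ (\ P -> hl P (\ b -> d8 e (a ⊞ b) (n b)))
 jj : ∀ {k} (A : Poly k) {P Q} -> P ≈P Q -> (A *P P) ≈P (A *P Q)
 jj A {P} {Q} e a = trans (aj (A *P P) a) (trans (ap A P _) (trans (ao A bp) (sym (trans (aj (A *P Q) a) (ap A Q _))))) where
  bp : ∀ b -> val P (\ c -> δ[ a ] (b ⊞ c)) ≡ val Q (\ c -> δ[ a ] (b ⊞ c))
  bp b with en b a
  ... | inj₁ (e' , _ , f) = trans (f P) (trans (e e') (sym (f Q)))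
  ... | inj₂ f = trans (f P) (sym (f Q))
 a0 : ∀ {k} (P Q : Poly k) a -> coeff (P ++ Q) a ≡ coeff P a + coeff Q a
 a0 P Q a = trans (aj (P ++ Q) a) (trans (aK P Q _) (cong₂ _+_ (sym (aj P a)) (sym (aj Q a))))
 eZ : ∀ {k} (P : Poly k) a -> coeff (dd P) a ≡ - coeff P a
 eZ P a = trans (aj (dd P) a) (trans (bR P _) (cong -_ (sym (aj P a))))
 -- Membership in the ideal generated by the N-th powers of the variables.
 record Low {k} (N : ℕ) (P : Poly k) : Set where
  constructor mkLow
  field low : ∀ e -> All (M._< N) e -> coeff P e ≡ 0ℤ
 open Low public
 module _ {k : ℕ} (N : ℕ) where
  qk : ∀ {P Q : Poly k} -> Low N P -> Low N Q -> Low N (P ++ Q)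
  qk {P} {Q} p q = mkLow (\ e b -> trans (a0 P Q e) (cong₂ _+_ (low p e b) (low q e b)))
  dJ : ∀ {P Q : Poly k} -> P ≋ Q -> Low N P -> Low N Q
  dJ e p = mkLow (\ a b -> trans (sym (ac e a)) (low p a b))
  nt : ∀ (A : Poly k) {P} -> Low N P -> Low N (A *P P)
  nt A {P} p = mkLow (\ e b -> trans (aj (A *P P) e) (trans (ap A P _) (hl A (\ a -> bp e b a)))) where
   oi : ∀ {k} (a e : Vec ℕ k) -> All (M._< N) (a ⊞ e) -> All (M._< N) e
   oi [] [] [] = []
   oi (a ∷ as) (e ∷ es) (p ∷ ps) = N.≤-<-trans (N.m≤n+m e a) p ∷ oi as es ps
   bp : ∀ e -> All (M._< N) e -> ∀ a -> val P (\ c -> δ[ e ] (a ⊞ c)) ≡ 0ℤ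
   bp e b a with en a e
   ... | inj₁ (e' , q , f) = trans (f P) (low p e' (oi a e' (E.subst (All (M._< N)) (sym q) b)))
   ... | inj₂ f = f P
 -- The quotient keeps the carrier and only coarsens equality, so a lemma proved for all commutative
 -- rings can be applied to the same polynomials modulo `I`.
 module qe (R : CommutativeRing 0ℓ 0ℓ) (I : CommutativeRing.Carrier R -> Set) (I-0 : I (CommutativeRing.0# R)) (I-+ : ∀ {a b} -> I a -> I b -> I (CommutativeRing._+_ R a b)) (I-* : ∀ a {b} -> I b -> I (CommutativeRing._*_ R a b)) (I-≈ : ∀ {a b} -> CommutativeRing._≈_ R a b -> I a -> I b) where
  open aE R renaming (_+_ to _∔_; _*_ to _∙_; -_ to ⊝_; solve to solveR; _:+_ to _⊕_; _:*_ to _⊗_; _:-_ to _⊖_; _:=_ to _⊜_; con to κ; :-_ to ⊟_; refl to ≈-refl; sym to ≈-sym; trans to ≈-trans)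
  private
   dZ : ∀ {a b} -> a ≈ b -> I (a - b)
   dZ {a} {b} e = I-≈ (≈-trans (≈-sym (-‿inverseʳ b)) (+-congʳ (≈-sym e))) I-0
   jV : ∀ {a b c : C} -> I b -> I c -> a ≈ (b ∔ c) -> I a
   jV p q e = I-≈ (≈-sym e) (I-+ p q)
  quotient : CommutativeRing 0ℓ 0ℓ
  quotient = record { Carrier = C ; _≈_ = \ a b -> I (a - b) ; _+_ = _∔_ ; _*_ = _∙_ ; -_ = ⊝_ ; 0# = 0# ; 1# = 1# ; isCommutativeRing = record { isRing = record { +-isAbelianGroup = record { isGroup = record { isMonoid = record { isSemigroup = record { isMagma = record { isEquivalence = record { refl = dZ ≈-refl ; sym = \ {a} {b} p -> I-≈ (solveR 2 (\ a b -> (κ (- 1ℤ)) ⊗ (a ⊖ b) ⊜ b ⊖ a) ≈-refl a b) (I-* (ι (- 1ℤ)) p) ; trans = \ {a} {b} {c} p q -> jV p q (solveR 3 (\ a b c -> a ⊖ c ⊜ (a ⊖ b) ⊕ (b ⊖ c)) ≈-refl a b c) } ; ∙-cong = \ {a} {b} {c} {d} p q -> jV p q (solveR 4 (\ a b c d -> (a ⊕ c) ⊖ (b ⊕ d) ⊜ (a ⊖ b) ⊕ (c ⊖ d)) ≈-refl a b c d) } ; assoc = \ a b c -> dZ (+-assoc a b c) } ; identity = (\ a -> dZ (+-identityˡ a)) , (\ a -> dZ (+-identityʳ a)) } ; inverse = (\ a -> dZ (-‿inverseˡ a)) , (\ a -> dZ (-‿inverseʳ a)) ; ⁻¹-cong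 = \ {a} {b} p -> I-≈ (solveR 2 (\ a b -> (κ (- 1ℤ)) ⊗ (a ⊖ b) ⊜ (⊟ a) ⊖ (⊟ b)) ≈-refl a b) (I-* (ι (- 1ℤ)) p) } ; comm = \ a b -> dZ (+-comm a b) } ; *-cong = \ {a} {b} {c} {d} p q -> jV (I-* c p) (I-* b q) (solveR 4 (\ a b c d -> (a ⊗ c) ⊖ (b ⊗ d) ⊜ (c ⊗ (a ⊖ b)) ⊕ (b ⊗ (c ⊖ d))) ≈-refl a b c d) ; *-assoc = \ a b c -> dZ (*-assoc a b c) ; *-identity = (\ a -> dZ (*-identityˡ a)) , (\ a -> dZ (*-identityʳ a)) ; distrib = (\ a b c -> dZ (distribˡ a b c)) , (\ a b c -> dZ (distribʳ a b c)) } ; *-comm = \ a b -> dZ (*-comm a b) } }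
  ht : ∀ {a b} -> a ≈ b -> I (a - b)
  ht = dZ
  e0 : ∀ {a} -> I a -> I (a - 0#)
  e0 {a} p = I-≈ (solveR 1 (\ a -> a ⊜ a ⊖ κ 0ℤ) ≈-refl a) p
  h1 : ∀ {a} -> I (a - 0#) -> I a
  h1 {a} p = I-≈ (solveR 1 (\ a -> a ⊖ κ 0ℤ ⊜ a) ≈-refl a) p

-- Exchanging, adding and removing variables

module kZ where
 open import Defs using (Poly; coeff; _≈P_; _*P_)
 open dK
 open lq
 open iM
 open import Data.List using (map)
 open import Data.Vec using (replicate)
 open import Data.Vec.Relation.Unary.All as All using (All; []; _∷_)
 open import Data.Vec.Relation.Unary.Any as Any using (Any; here; there)
 open import Data.Vec.Relation.Binary.Pointwise.Inductive as PW using (Pointwise; []; _∷_)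
 open import Data.Product using (_×_)
 aD : ∀ {A : Set} {k} -> ℕ -> Vec A k -> Vec A k
 aD zero (a ∷ b ∷ v) = b ∷ a ∷ v
 aD (suc i) (a ∷ v) = a ∷ aD i v
 aD zero [] = []
 aD zero (a ∷ []) = a ∷ []
 aD (suc i) [] = []
 module dQ (R : CommutativeRing 0ℓ 0ℓ) where
  open aE R
  prodDiff : ∀ {k} -> C -> Vec C k -> C
  prodDiff x [] = 1#
  prodDiff x (y ∷ ys) = (x - y) * prodDiff x ys
  vand : ∀ {k} -> Vec C k -> C
  vand [] = 1#
  vand (x ∷ xs) = prodDiff x xs * vand xs
  c0 : ∀ {k} {x y} {xs ys : Vec C k} -> x ≈ y -> Pointwise _≈_ xs ys -> prodDiff x xs ≈ prodDiff y ys
  c0 e [] = refl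
  c0 e (p ∷ ps) = *-cong (+-cong e (-‿cong p)) (c0 e ps)
  iZ : ∀ {k} {xs ys : Vec C k} -> Pointwise _≈_ xs ys -> vand xs ≈ vand ys
  iZ [] = refl
  iZ (p ∷ ps) = *-cong (c0 p ps) (iZ ps)
  bb : ∀ {k} i x (ys : Vec C k) -> prodDiff x (aD i ys) ≈ prodDiff x ys
  bb zero x [] = refl
  bb zero x (_ ∷ []) = refl
  bb zero x (y ∷ z ∷ ys) = solve 3 (\ a b c -> a :* (b :* c) := b :* (a :* c)) refl (x - z) (x - y) (prodDiff x ys)
  bb (suc i) x [] = refl
  bb (suc i) x (y ∷ ys) = *-congˡ (bb i x ys)
  eK : ∀ {k} i (xs : Vec C k) -> suc i M.< k -> vand (aD i xs) ≈ - vand xs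
  eK zero (x ∷ y ∷ zs) _ = solve 5 (\ x y p q v -> ((y :- x) :* q) :* (p :* v) := :- (((x :- y) :* p) :* (q :* v))) refl x y (prodDiff x zs) (prodDiff y zs) (vand zs)
  eK zero (x ∷ []) (M.s≤s ())
  eK (suc i) (x ∷ xs) (M.s≤s p) = trans (*-cong (bb i x xs) (eK i xs p)) (solve 2 (\ a b -> a :* (:- b) := :- (a :* b)) refl (prodDiff x xs) (vand xs))
 module fH (R : CommutativeRing 0ℓ 0ℓ) (n : ℕ) (lo : ℤ) (m : ℕ) where
  open aE R
  open cA R
  open Trace n lo m
  Fop : ∀ {k} -> Vec C k -> (List ℤ -> C) -> List ℤ -> C
  Fop [] φ = φ
  Fop (x ∷ xs) φ = Fop xs (HH x φ)
  Fop-cong : ∀ {k} (xs : Vec C k) {φ φ'} -> (∀ v -> φ v ≈ φ' v) -> ∀ v -> Fop xs φ v ≈ Fop xs φ' v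
  Fop-cong [] e = e
  Fop-cong (x ∷ xs) e = Fop-cong xs (mr x e)
  -- By `ms` the order of the sweeps is immaterial; moving the first variable outermost gives a
  -- recursion on the number of variables.
  Fop-out : ∀ {k} x (xs : Vec C k) φ v -> Fop xs (HH x φ) v ≈ HH x (Fop xs φ) v
  Fop-out x [] φ v = refl
  Fop-out x (y ∷ xs) φ v = trans (Fop-cong xs (ms y x φ) v) (Fop-out x xs (HH y φ) v)
  Fop-swap : ∀ {k} i (xs : Vec C k) φ v -> Fop (aD i xs) φ v ≈ Fop xs φ v
  Fop-swap zero [] φ v = refl
  Fop-swap zero (x ∷ []) φ v = refl
  Fop-swap zero (x ∷ y ∷ xs) φ v = Fop-cong xs (ms x y φ) v
  Fop-swap (suc i) [] φ v = refl
  Fop-swap (suc i) (x ∷ xs) φ v = Fop-swap i xs (HH x φ) v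
 -- Ring homomorphisms commute with sweeps and Vandermonde products. The instances are a new
 -- variable, an exchange of two variables, x_1 = 0 and the passage to a quotient.
 module Hom (R S : CommutativeRing 0ℓ 0ℓ) (θ : CommutativeRing.Carrier R -> CommutativeRing.Carrier S) (θ-cong : ∀ {a b} -> CommutativeRing._≈_ R a b -> CommutativeRing._≈_ S (θ a) (θ b)) (θ-+ : ∀ a b -> CommutativeRing._≈_ S (θ (CommutativeRing._+_ R a b)) (CommutativeRing._+_ S (θ a) (θ b))) (θ-* : ∀ a b -> CommutativeRing._≈_ S (θ (CommutativeRing._*_ R a b)) (CommutativeRing._*_ S (θ a) (θ b))) (θ-0 : CommutativeRing._≈_ S (θ (CommutativeRing.0# R)) (CommutativeRing.0# S)) (θ-1 : CommutativeRing._≈_ S (θ (CommutativeRing.1# R)) (CommutativeRing.1# S)) where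
  private
   module R = aE R
   module S = aE S
   module SR = cA R
   module SS = cA S
   module AR = dQ R
   module AS = dQ S
  open S using (_≈_; trans; sym; reflexive; +-cong; *-cong; +-congˡ; *-congˡ; +-congʳ; -‿cong)
  fQ : ∀ b -> θ (R.ind b) ≈ S.ind b
  fQ true = θ-1
  fQ false = θ-0
  pq : ∀ a -> θ (R.- a) ≈ S.- (θ a)
  pq a = begin θ (R.- a) ≈⟨ S.solve 2 (\ p q -> p S.:= (q S.:+ p) S.:- q) S.refl (θ (R.- a)) (θ a) ⟩ (θ a S.+ θ (R.- a)) S.- θ a ≈⟨ +-congʳ (trans (sym (θ-+ a (R.- a))) (trans (θ-cong (R.-‿inverseʳ a)) θ-0)) ⟩ S.0# S.- θ a ≈⟨ S.+-identityˡ _ ⟩ S.- (θ a) ∎ where open S using (begin_; step-≈-⟩; _∎)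
  oj : ∀ x us c Ψ -> θ (SR.Hs x us c Ψ) ≈ SS.Hs (θ x) us c (\ o c' -> θ (Ψ o c'))
  oj x [] c Ψ = S.refl
  oj x (u ∷ us) c Ψ = trans (oj x us c _) (SS.Hs-cong' (θ x) us c (\ o c' -> trans (θ-+ _ _) (+-congˡ (trans (θ-* _ _) (*-cong (fQ (lt u c')) (θ-* _ _))))))
  lB : ∀ lo m f -> θ (R.sumR lo m f) ≈ S.sumR lo m (\ i -> θ (f i))
  lB lo zero f = θ-0
  lB lo (suc m) f = trans (θ-+ _ _) (+-congˡ (lB _ m f))
  c6 : ∀ {k} x (ys : Vec R.C k) -> θ (AR.prodDiff x ys) ≈ AS.prodDiff (θ x) (Vec.map θ ys)
  c6 x [] = θ-1
  c6 x (y ∷ ys) = trans (θ-* _ _) (*-cong (trans (θ-+ _ _) (+-congˡ (pq y))) (c6 x ys))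
  hv : ∀ x m -> θ (R.pow x m) ≈ S.pow (θ x) m
  hv x zero = θ-1
  hv x (suc m) = trans (θ-* _ _) (*-congˡ (hv x m))
  e9 : ∀ {k} (xs : Vec R.C k) -> θ (AR.vand xs) ≈ AS.vand (Vec.map θ xs)
  e9 [] = θ-1
  e9 (x ∷ xs) = trans (θ-* _ _) (*-cong (c6 x xs) (e9 xs))
  module _ (n : ℕ) (lo : ℤ) (m : ℕ) where
   private
    module TR = SR.Trace n lo m
    module TS = SS.Trace n lo m
    module FR = fH R n lo m
    module FS = fH S n lo m
   pr : ∀ x φ v -> θ (TR.HH x φ v) ≈ TS.HH (θ x) (\ w -> θ (φ w)) v
   pr x φ v = trans (lB lo m _) (S.sumR-cong lo m (\ c -> trans (oj x v c _) (SS.Hs-cong' (θ x) v c (\ o c' -> trans (θ-* _ _) (S.*-congʳ (fQ (eq c' (c I.+ + n))))))))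
   hw : ∀ {k} (xs : Vec R.C k) φ v -> θ (FR.Fop xs φ v) ≈ FS.Fop (Vec.map θ xs) (\ w -> θ (φ w)) v
   hw [] φ v = S.refl
   hw (x ∷ xs) φ v = trans (hw xs (TR.HH x φ) v) (FS.Fop-cong (Vec.map θ xs) (pr x φ) v)
 module P {k : ℕ} = aE (ai k)
 fp : ∀ {k l} -> (Vec ℕ k -> Vec ℕ l) -> Poly k -> Poly l
 fp f = map (\ t -> proj₁ t , f (proj₂ t))
 aL : ∀ {k l} (f : Vec ℕ k -> Vec ℕ l) P φ -> val (fp f P) φ ≡ val P (\ b -> φ (f b))
 aL f [] φ = E.refl
 aL f ((c , b) ∷ P) φ = cong (I._+_ (c I.* φ (f b))) (aL f P φ)
 k8 : ∀ {k l} (f : Vec ℕ k -> Vec ℕ l) {P Q} -> P ≋ Q -> fp f P ≋ fp f Q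
 k8 f {P} {Q} e = mk≋ (\ φ -> E.trans (aL f P φ) (E.trans (at e _) (E.sym (aL f Q φ))))
 l0 : ∀ {k l} (f : Vec ℕ k -> Vec ℕ l) P Q -> fp f (P ++ Q) ≋ fp f P ++ fp f Q
 l0 f P Q = CommutativeRing.reflexive (ai _) (LP.map-++ _ P Q)
 fo : ∀ {k l} (f : Vec ℕ k -> Vec ℕ l) -> (∀ a b -> f (a ⊞ b) ≡ f a ⊞ f b) -> ∀ P Q -> fp f (P *P Q) ≋ fp f P *P fp f Q
 fo f h P Q = mk≋ (\ φ -> E.trans (aL f (P *P Q) φ) (E.trans (ap P Q _) (E.sym (E.trans (ap (fp f P) (fp f Q) φ) (E.trans (aL f P _) (ao P (\ a -> E.trans (aL f Q _) (ao Q (\ b -> cong φ (E.sym (h a b)))))))))))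
 lZ : ∀ {k l} (f : Vec ℕ k -> Vec ℕ l) -> f bo ≡ bo -> fp f du ≋ du
 lZ f e = CommutativeRing.reflexive (ai _) (cong (\ z -> (1ℤ , z) ∷ []) e)
 module qj {k l} (f : Vec ℕ k -> Vec ℕ l) (f-⊞ : ∀ a b -> f (a ⊞ b) ≡ f a ⊞ f b) (f-𝟎 : f bo ≡ bo) = Hom (ai k) (ai l) (fp f) (k8 f) (l0 f) (fo f f-⊞) (CommutativeRing.refl (ai l)) (lZ f f-𝟎)
 am : ∀ {k} -> Poly k -> Poly (suc k)
 am = fp (0 ∷_)
 module qm {k : ℕ} = qj {k} {suc k} (0 ∷_) (\ a b -> E.refl) E.refl
 bH : ∀ {k} i (a b : Vec ℕ k) -> aD i (a ⊞ b) ≡ aD i a ⊞ aD i b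
 bH zero [] [] = E.refl
 bH zero (a ∷ []) (b ∷ []) = E.refl
 bH zero (a ∷ a' ∷ as) (b ∷ b' ∷ bs) = E.refl
 bH (suc i) [] [] = E.refl
 bH (suc i) (a ∷ as) (b ∷ bs) = cong (_ ∷_) (bH i as bs)
 bw : ∀ {k} i -> aD i (bo {k}) ≡ bo
 bw {zero} zero = E.refl
 bw {suc zero} zero = E.refl
 bw {suc (suc k)} zero = E.refl
 bw {zero} (suc i) = E.refl
 bw {suc k} (suc i) = cong (0 ∷_) (bw i)
 cj : ∀ {A : Set} {k} i (a : Vec A k) -> aD i (aD i a) ≡ a
 cj zero [] = E.refl
 cj zero (a ∷ []) = E.refl
 cj zero (a ∷ b ∷ v) = E.refl
 cj (suc i) [] = E.refl
 cj (suc i) (a ∷ v) = cong (a ∷_) (cj i v)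
 bZ : ∀ {k} -> ℕ -> Poly k -> Poly k
 bZ i = fp (aD i)
 module mi {k : ℕ} (i : ℕ) = qj {k} {k} (aD i) (bH i) (bw i)
 hL : ∀ {k} i (P : Poly k) e -> coeff (bZ i P) e ≡ coeff P (aD i e)
 hL i P e = E.trans (aj (bZ i P) e) (E.trans (aL (aD i) P _) (E.trans (ao P (\ b -> hx e (aD i b) (aD i e) b (\ q -> E.trans (E.sym (cj i b)) (cong (aD i) q)) (\ q -> E.trans (cong (aD i) q) (cj i e)))) (E.sym (aj P _))))
 al : ∀ {k} -> Poly (suc k)
 al = (1ℤ , 1 ∷ bo) ∷ []
 X : ∀ k -> Vec (Poly k) k
 X zero = []
 X (suc k) = al ∷ Vec.map am (X k)
 cM : ∀ {A B : Set} {k} (f : A -> B) i (v : Vec A k) -> Vec.map f (aD i v) ≡ aD i (Vec.map f v)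
 cM f zero [] = E.refl
 cM f zero (a ∷ []) = E.refl
 cM f zero (a ∷ b ∷ v) = E.refl
 cM f (suc i) [] = E.refl
 cM f (suc i) (a ∷ v) = cong (f a ∷_) (cM f i v)
 fe : ∀ {k} i -> Vec.map (bZ i) (X k) ≡ aD i (X k)
 fe {zero} zero = E.refl
 fe {suc zero} zero = E.refl
 fe {suc (suc k)} zero = cong₂ _∷_ E.refl (cong₂ _∷_ E.refl (E.trans (cong (Vec.map (bZ 0)) (E.sym (VP.map-∘ am am (X k)))) (E.trans (E.sym (VP.map-∘ (bZ 0) _ (X k))) (E.trans (VP.map-cong twice (X k)) (VP.map-∘ am am (X k)))))) where
  twice : ∀ {k} (P : Poly k) -> bZ 0 (am (am P)) ≡ am (am P)
  twice P = E.trans (cong (bZ 0) (E.sym (LP.map-∘ P))) (E.trans (E.sym (LP.map-∘ P)) (LP.map-∘ P))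
 fe {zero} (suc i) = E.refl
 fe {suc k} (suc i) = cong₂ _∷_ (cong (\ z -> (1ℤ , 1 ∷ z) ∷ []) (bw i)) (E.trans (E.sym (VP.map-∘ (bZ (suc i)) am (X k))) (E.trans (VP.map-cong comm (X k)) (E.trans (VP.map-∘ am (bZ i) (X k)) (E.trans (cong (Vec.map am) (fe i)) (cM am i (X k)))))) where
  comm : ∀ P -> bZ (suc i) (am P) ≡ am (bZ i P)
  comm P = E.trans (E.sym (LP.map-∘ P)) (LP.map-∘ P)
 -- The coefficient of x_1^j, as a polynomial in the other variables; `aw 0` is the substitution x_1
 -- = 0.
 aw : ∀ {k} -> ℕ -> Poly (suc k) -> Poly k
 aw j [] = []
 aw j ((c , i ∷ b) ∷ P) with i M.≟ j
 ... | yes _ = (c , b) ∷ aw j P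
 ... | no _ = aw j P
 -- The transpose of `aw j` on functionals.
 eR : ∀ {k} -> ℕ -> (Vec ℕ k -> ℤ) -> Vec ℕ (suc k) -> ℤ
 eR j φ (i ∷ b) with i M.≟ j
 ... | yes _ = φ b
 ... | no _ = 0ℤ
 pJ : ∀ {k} j (φ : Vec ℕ k -> ℤ) b -> eR j φ (j ∷ b) ≡ φ b
 pJ j φ b with j M.≟ j
 ... | yes _ = E.refl
 ... | no n = ⊥-elim (n E.refl)
 pick-no : ∀ {k} j (φ : Vec ℕ k -> ℤ) i b -> i ≢ j -> eR j φ (i ∷ b) ≡ 0ℤ
 pick-no j φ i b n with i M.≟ j
 ... | yes e = ⊥-elim (n e)
 ... | no _ = E.refl
 aI : ∀ {k} j (P : Poly (suc k)) φ -> val (aw j P) φ ≡ val P (eR j φ)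
 aI j [] φ = E.refl
 aI j ((c , i ∷ b) ∷ P) φ with i M.≟ j
 ... | yes _ = cong (I._+_ (c I.* φ b)) (aI j P φ)
 ... | no _ = E.trans (aI j P φ) (E.sym (E.trans (cong (I._+ val P (eR j φ)) (Z.*-zeroʳ c)) (Z.+-identityˡ _)))
 ba : ∀ {k} j (P : Poly (suc k)) e -> coeff P (j ∷ e) ≡ coeff (aw j P) e
 ba j P e = E.trans (aj P _) (E.trans (ao P eqn) (E.trans (E.sym (aI j P _)) (E.sym (aj (aw j P) e)))) where
  eqn : ∀ b -> δ[ j ∷ e ] b ≡ eR j δ[ e ] b
  eqn (i ∷ b) with i M.≟ j
  ... | yes E.refl = hx (j ∷ e) (j ∷ b) e b VP.∷-injectiveʳ (cong (j ∷_))
  ... | no n = d8 (j ∷ e) (i ∷ b) (\ q -> n (VP.∷-injectiveˡ q))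
 kp : ∀ {k} j {P Q : Poly (suc k)} -> P ≋ Q -> aw j P ≋ aw j Q
 kp j {P} {Q} e = mk≋ (\ φ -> E.trans (aI j P φ) (E.trans (at e _) (E.sym (aI j Q φ))))
 mP : ∀ {k} j (P Q : Poly (suc k)) -> aw j (P ++ Q) ≋ aw j P ++ aw j Q
 mP j P Q = mk≋ (\ φ -> E.trans (aI j (P ++ Q) φ) (E.trans (aK P Q _) (E.sym (E.trans (aK (aw j P) (aw j Q) φ) (cong₂ I._+_ (aI j P φ) (aI j Q φ))))))
 ko : ∀ {k} (P Q : Poly (suc k)) -> aw 0 (P *P Q) ≋ aw 0 P *P aw 0 Q
 ko P Q = mk≋ (\ φ -> E.trans (aI 0 (P *P Q) φ) (E.trans (ap P Q _) (E.trans (ao P (aQ φ)) (E.sym (E.trans (ap (aw 0 P) (aw 0 Q) φ) (aI 0 P _)))))) where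
  aQ : ∀ φ a -> val Q (\ b -> eR 0 φ (a ⊞ b)) ≡ eR 0 (\ a -> val (aw 0 Q) (\ b -> φ (a ⊞ b))) a
  aQ φ (zero ∷ a) = E.trans (ao Q (\ { (zero ∷ b) -> E.refl ; (suc _ ∷ b) -> E.refl })) (E.sym (aI 0 Q _))
  aQ φ (suc i ∷ a) = hl Q (\ { (_ ∷ b) -> E.refl })
 b4 : ∀ {k} (P : Poly k) -> aw 0 (am P) ≡ P
 b4 [] = E.refl
 b4 ((c , b) ∷ P) = cong (_ ∷_) (b4 P)
 module p9 {k : ℕ} = Hom (ai (suc k)) (ai k) (aw 0) (kp 0) (mP 0) ko (CommutativeRing.refl (ai k)) (CommutativeRing.refl (ai k))
 br : ∀ {k} (P : Poly (suc k)) j e -> coeff (al *P P) (suc j ∷ e) ≡ coeff P (j ∷ e)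
 br P j e = E.trans (aj (al *P P) _) (E.trans (ap al P _) (E.trans (E.trans (Z.+-identityʳ _) (Z.*-identityˡ _)) (E.trans (ao P eqn) (E.sym (aj P _))))) where
  eqn : ∀ b -> δ[ suc j ∷ e ] ((1 ∷ bo) ⊞ b) ≡ δ[ j ∷ e ] b
  eqn (i ∷ b) = hx (suc j ∷ e) (suc i ∷ (bo ⊞ b)) (j ∷ e) (i ∷ b) (\ q -> cong₂ _∷_ (N.suc-injective (VP.∷-injectiveˡ q)) (E.trans (E.sym (aG b)) (VP.∷-injectiveʳ q))) (\ q -> cong₂ _∷_ (cong suc (VP.∷-injectiveˡ q)) (E.trans (aG b) (VP.∷-injectiveʳ q)))
 cz : ∀ {k} (A : Poly k) Q j e -> coeff (am A *P Q) (j ∷ e) ≡ coeff (A *P aw j Q) e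
 cz A Q j e = E.trans (aj (am A *P Q) _) (E.trans (ap (am A) Q _) (E.trans (aL (0 ∷_) A _) (E.trans (ao A aQ) (E.sym (E.trans (aj (A *P aw j Q) e) (ap A (aw j Q) _)))))) where
  aQ : ∀ a -> val Q (\ b -> δ[ j ∷ e ] ((0 ∷ a) ⊞ b)) ≡ val (aw j Q) (\ b -> δ[ e ] (a ⊞ b))
  aQ a = E.trans (ao Q eqn) (E.sym (aI j Q _)) where
   eqn : ∀ b -> δ[ j ∷ e ] ((0 ∷ a) ⊞ b) ≡ eR j (\ b -> δ[ e ] (a ⊞ b)) b
   eqn (i ∷ b) with i M.≟ j
   ... | yes E.refl = hx (j ∷ e) (j ∷ a ⊞ b) e (a ⊞ b) VP.∷-injectiveʳ (cong (j ∷_))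
   ... | no n = d8 (j ∷ e) (i ∷ a ⊞ b) (\ q -> n (VP.∷-injectiveˡ q))
 cN : ∀ {k} (A : Poly k) e -> coeff (am A) (0 ∷ e) ≡ coeff A e
 cN A e = E.trans (ba 0 (am A) e) (cong (\ z -> coeff z e) (b4 A))
 bi : ∀ {k} (A : Poly k) j e -> coeff (am A) (suc j ∷ e) ≡ 0ℤ
 bi A j e = E.trans (aj (am A) _) (E.trans (aL (0 ∷_) A _) (hl A (\ b -> d8 (suc j ∷ e) (0 ∷ b) (\ ()))))
 jc : ∀ {k} (A Q : Poly k) -> (∀ e -> coeff Q e ≡ 0ℤ) -> ∀ e -> coeff (A *P Q) e ≡ 0ℤ
 jc A Q z e = E.trans (jj A {Q} {[]} z e) (ac (CommutativeRing.zeroʳ (ai _) A) e)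
 -- F starts at x_1^c, so only the part of M free of x_1 can contribute.
 iH : ∀ {k} (M F : Poly (suc k)) c e -> (∀ j -> j M.< c -> ∀ e -> coeff F (j ∷ e) ≡ 0ℤ) -> coeff (M *P F) (c ∷ e) ≡ coeff (aw 0 M *P aw c F) e
 iH M F c e z = E.trans (aj (M *P F) _) (E.trans (ap M F _) (E.trans (ao M aQ) (E.sym (E.trans (aj (aw 0 M *P aw c F) e) (E.trans (ap (aw 0 M) (aw c F) _) (aI 0 M _)))))) where
  aQ : ∀ a -> val F (\ b -> δ[ c ∷ e ] (a ⊞ b)) ≡ eR 0 (\ a -> val (aw c F) (\ b -> δ[ e ] (a ⊞ b))) a
  aQ (zero ∷ a) = E.trans (ao F eqn) (E.sym (aI c F _)) where
   eqn : ∀ b -> δ[ c ∷ e ] ((0 ∷ a) ⊞ b) ≡ eR c (\ b -> δ[ e ] (a ⊞ b)) b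
   eqn (i ∷ b) with i M.≟ c
   ... | yes E.refl = hx (c ∷ e) (c ∷ a ⊞ b) e (a ⊞ b) VP.∷-injectiveʳ (cong (c ∷_))
   ... | no n = d8 (c ∷ e) (i ∷ a ⊞ b) (\ q -> n (VP.∷-injectiveˡ q))
  aQ (suc i ∷ a) with en (suc i ∷ a) (c ∷ e)
  ... | inj₁ (j ∷ e' , q , f) = E.trans (f F) (z j (E.subst (j M.<_) (VP.∷-injectiveˡ q) (M.s≤s (N.m≤n+m j i))) e')
  ... | inj₂ f = f F

-- The Vandermonde determinant and alternating coefficient functions

module Alt where
 open import Defs using (Poly; coeff; _≈P_; _*P_)
 open dK
 open iM
 open kZ
 open import Data.Vec using (replicate)
 open import Data.Vec.Relation.Unary.All as All using (All; []; _∷_)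
 open import Data.Vec.Relation.Unary.Any as Any using (Any; here; there; any?)
 open import Data.Product using (_×_)
 private
  module Q {k : ℕ} = CommutativeRing (ai k)
  module A {k : ℕ} = dQ (ai k)
 open A public using (vand; prodDiff)
 private
  oE : ∀ {k l} (ys : Vec (Poly k) l) x y Q -> prodDiff x (y ∷ ys) *P Q ≋ (x *P (prodDiff x ys *P Q)) ++ dd (y *P (prodDiff x ys *P Q))
  oE {k} ys x y Q = P.solve 4 (\ x y p q -> ((x P.:- y) P.:* p) P.:* q P.:= (x P.:* (p P.:* q)) P.:+ (P.:- (y P.:* (p P.:* q)))) Q.refl x y (prodDiff x ys) Q
  iG : ∀ {k l} (ys : Vec (Poly (suc k)) l) x y Q e -> coeff (prodDiff x (y ∷ ys) *P Q) e ≡ coeff (x *P (prodDiff x ys *P Q)) e I.- coeff (y *P (prodDiff x ys *P Q)) e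
  iG ys x y Q e = E.trans (ac (oE ys x y Q) e) (E.trans (a0 (x *P (prodDiff x ys *P Q)) _ e) (cong (I._+_ (coeff (x *P (prodDiff x ys *P Q)) e)) (eZ (y *P (prodDiff x ys *P Q)) e)))
 mutual
  -- Only l factors contain x_1. Mutual with `hK`, because expanding x_1 - y produces the product
  -- over the remaining ys multiplied by y.
  dI : ∀ {k l} (ys : Vec (Poly k) l) P j e -> l M.< j -> coeff (prodDiff al (Vec.map am ys) *P am P) (j ∷ e) ≡ 0ℤ
  dI [] P (suc j) e p = E.trans (ac (Q.*-identityˡ (am P)) (suc j ∷ e)) (bi P j e)
  dI (y ∷ ys) P (suc j) e (M.s≤s p) = E.trans (iG (Vec.map am ys) al (am y) (am P) (suc j ∷ e)) (cong₂ I._-_ (E.trans (br (prodDiff al (Vec.map am ys) *P am P) j e) (dI ys P j e p)) (hK ys P y j e (N.m≤n⇒m≤1+n p)))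
  private
   hK : ∀ {k l} (ys : Vec (Poly k) l) P y j e -> l M.< suc j -> coeff (am y *P (prodDiff al (Vec.map am ys) *P am P)) (suc j ∷ e) ≡ 0ℤ
   hK ys P y j e p = E.trans (cz y U (suc j) e) (jc y (aw (suc j) U) (\ e -> E.trans (E.sym (ba (suc j) U e)) (dI ys P (suc j) e p)) e) where U = prodDiff al (Vec.map am ys) *P am P
 gX : ∀ {k l} (ys : Vec (Poly k) l) P e -> coeff (prodDiff al (Vec.map am ys) *P am P) (l ∷ e) ≡ coeff P e
 gX [] P e = E.trans (ac (Q.*-identityˡ (am P)) (0 ∷ e)) (cN P e)
 gX {l = suc l} (y ∷ ys) P e = E.trans (iG (Vec.map am ys) al (am y) (am P) (suc l ∷ e)) (E.trans (cong₂ I._-_ (E.trans (br (prodDiff al (Vec.map am ys) *P am P) l e) (gX ys P e)) (hK ys P y l e N.≤-refl)) (Z.+-identityʳ _))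
 hY : ∀ {k} -> Vec ℕ k
 hY = replicate _ 1
 ±_ : ℕ -> ℤ
 ± zero = 1ℤ
 ± suc k = I.- (± k)
 gB : ∀ k -> (± k) I.* (± k) ≡ 1ℤ
 gB zero = E.refl
 gB (suc k) = E.trans (solve 1 (\ a -> (:- a) :* (:- a) := a :* a) E.refl (± k)) (gB k) where open L hiding (I; O)
 -- `[]` is the polynomial 0, so the product is (-1)^k x_1 ... x_k.
 cy : ∀ k (P : Poly k) e -> coeff (prodDiff [] (X k) *P P) (hY ⊞ e) ≡ (± k) I.* coeff P e
 cy zero P [] = E.trans (ac (Q.*-identityˡ P) []) (E.sym (Z.*-identityˡ _))
 cy (suc k) P (j ∷ e) = begin coeff (prodDiff [] (X (suc k)) *P P) (suc j ∷ hY ⊞ e) ≡⟨ ac (Q.trans (Q.*-congʳ {x = P} (Q.*-congˡ {x = [] Q.- al} (Q.sym (qm.c6 [] (X k))))) (P.solve 3 (\ x p q -> ((P.con 0ℤ P.:- x) P.:* p) P.:* q P.:= P.:- (x P.:* (p P.:* q))) Q.refl al (am m) P)) (suc j ∷ hY ⊞ e) ⟩ coeff (dd (al *P (am m *P P))) (suc j ∷ hY ⊞ e) ≡⟨ eZ (al *P (am m *P P)) (suc j ∷ hY ⊞ e) ⟩ I.- coeff (al *P (am m *P P)) (suc j ∷ hY ⊞ e) ≡⟨ cong I.-_ (E.trans (br (am m *P P) j (hY ⊞ e)) (cz m P j (hY ⊞ e))) ⟩ I.- coeff (m *P aw j P) (hY ⊞ e) ≡⟨ cong I.-_ (E.trans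 (cy k (aw j P) e) (cong ((± k) I.*_) (E.sym (ba j P e)))) ⟩ I.- ((± k) I.* coeff P (j ∷ e)) ≡⟨ Z.neg-distribˡ-* (± k) _ ⟩ I.- (± k) I.* coeff P (j ∷ e) ∎ where
  open E.≡-Reasoning
  m = prodDiff [] (X k)
 -- The staircase c, c+1, ..., c+k-1; for c = 0 it is the exponent vector of a monomial of the
 -- Vandermonde determinant.
 T : ℕ -> ∀ k -> Vec ℕ k
 T c zero = []
 T c (suc k) = c ∷ T (suc c) k
 nr : ∀ c k -> T (suc c) k ≡ hY ⊞ T c k
 nr c zero = E.refl
 nr c (suc k) = cong (suc c ∷_) (nr (suc c) k)
 -- (-1)^(k(k-1)/2), the coefficient of the staircase monomial in the product of the x_i - x_j with
 -- i < j.
 sg : ℕ -> ℤ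
 sg zero = 1ℤ
 sg (suc k) = (± k) I.* sg k
 dL : ∀ k -> sg k I.* sg k ≡ 1ℤ
 dL zero = E.refl
 dL (suc k) = E.trans (solve 2 (\ a b -> (a :* b) :* (a :* b) := (a :* a) :* (b :* b)) E.refl (± k) (sg k)) (cong₂ I._*_ (gB k) (dL k)) where open L hiding (I; O)
 lI : ∀ k -> vand (X (suc k)) ≋ prodDiff al (Vec.map am (X k)) *P am (vand (X k))
 lI k = Q.*-congˡ {x = prodDiff al (Vec.map am (X k))} (Q.sym (qm.e9 (X k)))
 bC : ∀ {k l} (ys : Vec (Poly k) l) -> Vec.map (aw 0) (Vec.map am ys) ≡ ys
 bC [] = E.refl
 bC (y ∷ ys) = cong₂ _∷_ (b4 y) (bC ys)
 -- All exponents of P are at least c, so x_1^c forces x_1 = 0 in the determinant. There it becomes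
 -- the product of the -x_j times the smaller determinant, and the remaining variables follow by
 -- induction.
 fz : ∀ k c (P : Poly k) -> (∀ e -> Any (M._< c) e -> coeff P e ≡ 0ℤ) -> coeff (vand (X k) *P P) (T c k) ≡ sg k I.* coeff P (replicate k c)
 fz zero c P z = E.trans (ac (Q.*-identityˡ P) []) (E.sym (Z.*-identityˡ _))
 fz (suc k) c P z = begin coeff (vand (X (suc k)) *P P) (c ∷ T (suc c) k) ≡⟨ iH (vand (X (suc k))) P c (T (suc c) k) (\ j p e -> z (j ∷ e) (here p)) ⟩ coeff (aw 0 (vand (X (suc k))) *P aw c P) (T (suc c) k) ≡⟨ ac (Q.trans (Q.*-congʳ {x = aw c P} (Q.trans (p9.e9 (X (suc k))) (Q.reflexive (cong (\ z -> vand ([] ∷ z)) (bC (X k)))))) (Q.*-assoc (prodDiff [] (X k)) (vand (X k)) (aw c P))) (T (suc c) k) ⟩ coeff (prodDiff [] (X k) *P (vand (X k) *P aw c P)) (T (suc c) k) ≡⟨ cong (coeff (prodDiff [] (X k) *P (vand (X k) *P aw c P))) (nr c k) ⟩ coeff (prodDiff [] (X k) *P (vand (X k) *P aw c P)) (hY ⊞ T c k) ≡⟨ cy k (vand (X k) *P aw c P) (T c k) ⟩ (± k) I.* coeff (vand (X k) *P aw c P) (T c k) ≡⟨ cong ((± k) I.*_) (fz k c (aw c P) (\ e q -> E.trans (E.sym (ba c P e)) (z (c ∷ e) (there q)))) ⟩ (± k) I.* (sg k I.* coeff (aw c P) (replicate k c)) ≡⟨ cong (\ z -> (± k) I.* (sg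 k I.* z)) (E.sym (ba c P (replicate k c))) ⟩ (± k) I.* (sg k I.* coeff P (c ∷ replicate k c)) ≡⟨ E.sym (Z.*-assoc (± k) (sg k) _) ⟩ sg (suc k) I.* coeff P (c ∷ replicate k c) ∎ where open E.≡-Reasoning
 data er {k : ℕ} : Vec ℕ k -> Vec ℕ k -> Set where
  kW : ∀ {v} -> er v v
  bp : ∀ {v w} i -> suc i M.< k -> er (aD i v) w -> er v w
 bN : ∀ {k} {u v w : Vec ℕ k} -> er u v -> er v w -> er u w
 bN kW q = q
 bN (bp i p s) q = bp i p (bN s q)
 cO : ∀ {k} a {v w : Vec ℕ k} -> er v w -> er (a ∷ v) (a ∷ w)
 cO a kW = kW
 cO a (bp i p s) = bp (suc i) (M.s≤s p) (cO a s)
 m6 : ∀ {k z} {Q : ℕ -> Set} (v : Vec ℕ (suc k)) -> Any (z ≡_) v -> All Q v -> Σ (Vec ℕ k) \ v' -> er v (z ∷ v') × All Q v'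
 m6 (a ∷ v) (here E.refl) (_ ∷ qs) = v , kW , qs
 m6 {suc k} (a ∷ v) (there p) (q ∷ qs) with m6 v p qs
 ... | v' , s , qs' = a ∷ v' , bN (cO a s) (bp 0 (M.s≤s (M.s≤s M.z≤n)) kW) , q ∷ qs'
 -- `dG` excludes 2-torsion: without it an alternating function could be nonzero at repeated
 -- entries.
 module jz (R : CommutativeRing 0ℓ 0ℓ) (dG : ∀ a -> CommutativeRing._≈_ R a (CommutativeRing.-_ R a) -> CommutativeRing._≈_ R a (CommutativeRing.0# R)) where
  open CommutativeRing R renaming (Carrier to C)
  Alt : ∀ {k} -> (Vec ℕ k -> C) -> Set
  Alt {k} A = ∀ i -> suc i M.< k -> ∀ v -> A (aD i v) ≈ - A v
  mA : ∀ {k} {A : Vec ℕ (suc k) -> C} a -> Alt A -> Alt (\ v -> A (a ∷ v))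
  mA a h i p v = h (suc i) (M.s≤s p) (a ∷ v)
  di : ∀ {k} {A B : Vec ℕ k -> C} -> Alt A -> Alt B -> ∀ {v w} -> er v w -> A w ≈ B w -> A v ≈ B v
  di {A = A} {B} f g kW e = e
  di {A = A} {B} f g {v} (bp i p s) e = trans (sym (jE f)) (trans (-‿cong (di f g s e)) (jE g)) where
   open import Algebra.Properties.Ring ring using (-‿involutive)
   jE : ∀ {A} -> Alt A -> - A (aD i v) ≈ A v
   jE f = trans (-‿cong (f i p v)) (-‿involutive _)
  ks : ∀ {k} {A : Vec ℕ (suc (suc k)) -> C} -> Alt A -> ∀ a v -> A (a ∷ a ∷ v) ≈ 0#
  ks f a v = dG _ (f 0 (M.s≤s (M.s≤s M.z≤n)) (a ∷ a ∷ v))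
  -- An alternating function on vectors of length k with entries in an interval of length
  -- b ≤ k vanishes when b < k and is determined by one value when b = k.
  js : ∀ b c {k} (v : Vec ℕ k) -> b M.≤ k -> All (\ z -> c M.≤ z × z M.< c M.+ b) v -> ∀ {A B : Vec ℕ k -> C} -> Alt A -> Alt B -> (b ≡ k -> A (T c k) ≈ B (T c k)) -> A v ≈ B v
  js zero c [] p q f g e = e E.refl
  js zero c (z ∷ v) p ((q , r) ∷ _) f g e = ⊥-elim (N.<⇒≱ r (E.subst (M._≤ z) (E.sym (N.+-identityʳ c)) q))
  js (suc b) c {suc k} v (M.s≤s p) q {A} {B} f g e with any? (c M.≟_) v
  ... | no n = js b (suc c) v (N.m≤n⇒m≤1+n p) (fm v q n) f g (\ b≡ -> ⊥-elim (N.<-irrefl b≡ (M.s≤s p))) where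
   fm : ∀ {k} (v : Vec ℕ k) -> All (\ z -> c M.≤ z × z M.< c M.+ suc b) v -> ¬ Any (c ≡_) v -> All (\ z -> suc c M.≤ z × z M.< suc c M.+ b) v
   fm [] [] n = []
   fm (z ∷ v) ((p , r) ∷ qs) n = (N.≤∧≢⇒< p (\ e -> n (here e)) , E.subst (z M.<_) (N.+-suc c b) r) ∷ fm v qs (\ m -> n (there m))
  ... | yes m with m6 v m q
  ... | v' , s , q' with any? (c M.≟_) v'
  ... | no n = di f g s (js b (suc c) v' p (fm v' q' n) (mA c f) (mA c g) (\ b≡ -> e (cong suc b≡))) where
   fm : ∀ {k} (v : Vec ℕ k) -> All (\ z -> c M.≤ z × z M.< c M.+ suc b) v -> ¬ Any (c ≡_) v -> All (\ z -> suc c M.≤ z × z M.< suc c M.+ b) v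
   fm [] [] n = []
   fm (z ∷ v) ((p , r) ∷ qs) n = (N.≤∧≢⇒< p (\ e -> n (here e)) , E.subst (z M.<_) (N.+-suc c b) r) ∷ fm v qs (\ m -> n (there m))
  js (suc b) c {suc (suc k)} v (M.s≤s p) q {A} {B} f g e | yes m | v' , s , q' | yes m' with m6 v' m' q'
  ... | v″ , s' , _ = di f g (bN s (cO c s')) (trans (ks f c v″) (sym (ks g c v″)))
 bc : ∀ a -> a ≡ I.- a -> a ≡ 0ℤ
 bc (+ zero) e = E.refl
 bc (+ suc m) ()
 bc I.-[1+ m ] ()
 h7 : ∀ {k} i -> suc i M.< k -> bZ i (vand (X k)) ≋ dd (vand (X k))
 h7 {k} i p = Q.trans (mi.e9 i (X k)) (Q.trans (Q.reflexive (cong vand (fe i))) (A.eK i (X k) p))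
 li : ∀ {k} (F : Poly k) -> (∀ i -> suc i M.< k -> bZ i F ≋ F) -> ∀ i -> suc i M.< k -> ∀ e -> coeff (vand (X k) *P F) (aD i e) ≡ I.- coeff (vand (X k) *P F) e
 li {k} F s i p e = E.trans (E.sym (hL i (vand (X k) *P F) e)) (E.trans (ac eqn e) (eZ (vand (X k) *P F) e)) where
  eqn : bZ i (vand (X k) *P F) ≋ dd (vand (X k) *P F)
  eqn = Q.trans (fo (aD i) (bH i) (vand (X k)) F) (Q.trans (Q.*-cong (h7 i p) (s i p)) (Q.sym (P.-‿distribˡ-* (vand (X k)) F)))
 -- With n variables and exponents below n, an alternating coefficient function is determined by its
 -- value at the staircase, which is up to sign the constant term of F.
 m1 : ∀ {n} (F : Poly n) -> (∀ i -> suc i M.< n -> bZ i F ≋ F) -> coeff F bo ≡ 0ℤ -> Low n (vand (X n) *P F)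
 m1 {n} F s z = mkLow (\ e q -> js n 0 e N.≤-refl (All.map (\ p -> M.z≤n , p) q) (li F s) (\ _ _ _ -> E.refl) (\ _ -> E.trans (fz n 0 F (\ e a -> ⊥-elim (gf a))) (E.trans (cong (sg n I.*_) z) (Z.*-zeroʳ (sg n))))) where
  open jz Z.+-*-commutativeRing bc
  gf : ∀ {k} {e : Vec ℕ k} -> ¬ Any (M._< 0) e
  gf (there a) = gf a
 -- Compare coefficients of x_1^k, the highest power of x_1 in the product of the x_1 - x_i, where
 -- its coefficient is 1; k < n makes this exponent admissible.
 m0 : ∀ {n k} (F : Poly k) -> k M.< n -> Low n (vand (X (suc k)) *P am F) -> Low n (vand (X k) *P F)
 m0 {n} {k} F p l = mkLow (\ e q -> E.trans (E.sym (gX (X k) (vand (X k) *P F) e)) (E.trans (ac (Q.sym eqn) (k ∷ e)) (low l (k ∷ e) (p ∷ q)))) where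
  eqn : vand (X (suc k)) *P am F ≋ prodDiff al (Vec.map am (X k)) *P am (vand (X k) *P F)
  eqn = Q.trans (Q.*-congʳ {x = am F} (lI k)) (Q.trans (Q.*-assoc (prodDiff al (Vec.map am (X k))) (am (vand (X k))) (am F)) (Q.*-congˡ {x = prodDiff al (Vec.map am (X k))} (Q.sym (fo (0 ∷_) (\ _ _ -> E.refl) (vand (X k)) F))))
 private
  dH : ∀ {k} (Q : Poly (suc k)) -> Σ ℕ \ J -> ∀ j -> J M.≤ j -> aw j Q ≡ []
  dH [] = 0 , \ _ _ -> E.refl
  dH ((c , i ∷ b) ∷ Q) with dH Q
  ... | J , f = suc i M.⊔ J , g where
   g : ∀ j -> suc i M.⊔ J M.≤ j -> aw j ((c , i ∷ b) ∷ Q) ≡ []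
   g j p with i M.≟ j
   ... | yes E.refl = ⊥-elim (N.<-irrefl E.refl (N.≤-trans (N.m≤m⊔n (suc i) J) p))
   ... | no _ = f j (N.≤-trans (N.m≤n⊔m (suc i) J) p)
  -- The coefficient of x_1^j in Q is y times the next one, and the coefficients vanish from some
  -- index on.
  ho : ∀ {k} y (Q : Poly (suc k)) -> (∀ e -> coeff (al *P Q) e ≡ coeff (am y *P Q) e) -> ∀ e -> coeff Q e ≡ 0ℤ
  ho {k} y Q h (j ∷ e) with dH Q
  ... | J , f = go J j (N.m≤n+m J j) e where
   go : ∀ m j -> J M.≤ j M.+ m -> ∀ e -> coeff Q (j ∷ e) ≡ 0ℤ
   go zero j p e = E.trans (ba j Q e) (cong (\ z -> coeff z e) (f j (E.subst (J M.≤_) (N.+-identityʳ j) p)))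
   go (suc m) j p e = E.trans (E.sym (br Q j e)) (E.trans (h (suc j ∷ e)) (E.trans (cz y Q (suc j) e) (jc y (aw (suc j) Q) (\ e -> E.trans (E.sym (ba (suc j) Q e)) (go m (suc j) (E.subst (J M.≤_) (N.+-suc j m) p) e)) e)))
  gY : ∀ {k l} (ys : Vec (Poly k) l) Q -> (∀ e -> coeff (prodDiff al (Vec.map am ys) *P Q) e ≡ 0ℤ) -> ∀ e -> coeff Q e ≡ 0ℤ
  gY [] Q h e = E.trans (E.sym (ac (Q.*-identityˡ Q) e)) (h e)
  gY (y ∷ ys) Q h = gY ys Q (ho y U (\ e -> Z.i-j≡0⇒i≡j _ _ (E.trans (E.sym (iG (Vec.map am ys) al (am y) Q e)) (h e)))) where U = prodDiff al (Vec.map am ys) *P Q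
 -- The factors x_1 - x_i are cancelled one by one with `ho`, then the determinant in the remaining
 -- variables is.
 eo : ∀ k (Q : Poly k) -> (∀ e -> coeff (vand (X k) *P Q) e ≡ 0ℤ) -> ∀ e -> coeff Q e ≡ 0ℤ
 eo zero Q h e = E.trans (E.sym (ac (Q.*-identityˡ Q) e)) (h e)
 eo (suc k) Q h (j ∷ e) = E.trans (ba j Q e) (eo k (aw j Q) (\ e -> E.trans (E.sym (cz (vand (X k)) Q j e)) (aQ (j ∷ e))) e) where
  aQ : ∀ e -> coeff (am (vand (X k)) *P Q) e ≡ 0ℤ
  aQ = gY (X k) (am (vand (X k)) *P Q) (\ e -> E.trans (ac (Q.trans (Q.sym (Q.*-assoc (prodDiff al (Vec.map am (X k))) (am (vand (X k))) Q)) (Q.*-congʳ {x = Q} (Q.sym (lI k)))) e) (h e))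

-- Complete homogeneous polynomials

module nJ where
 open dK
 open kZ
 open import Data.Vec.Relation.Unary.All as All using (All; []; _∷_)
 open import Data.Vec.Relation.Unary.Any as Any using (Any; here; there)
 open import Data.Product using (_×_)
 module bD (R : CommutativeRing 0ℓ 0ℓ) where
  open aE R
  open dQ R
  hh : ∀ {k} -> ℕ -> Vec C k -> C
  hh zero xs = 1#
  hh (suc d) [] = 0#
  hh (suc d) (x ∷ xs) = x * hh d (x ∷ xs) + hh (suc d) xs
  kA : ∀ {k l} x {ys : Vec C k} {zs : Vec C l} -> (∀ d -> hh d ys ≈ hh d zs) -> ∀ d -> hh d (x ∷ ys) ≈ hh d (x ∷ zs)
  kA x e zero = refl
  kA x e (suc d) = +-cong (*-congˡ (kA x e d)) (e (suc d))
  aR : ∀ {k} d x y (zs : Vec C k) -> hh d (x ∷ y ∷ zs) ≈ hh d (y ∷ x ∷ zs)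
  aR zero x y zs = refl
  aR (suc zero) x y zs = solve 4 (\ x y z o -> x :* o :+ (y :* o :+ z) := y :* o :+ (x :* o :+ z)) refl x y (hh 1 zs) 1#
  aR (suc (suc d)) x y zs = begin x * hh (suc d) (x ∷ y ∷ zs) + (y * hh (suc d) (y ∷ zs) + hh (suc (suc d)) zs) ≈⟨ +-congʳ (*-congˡ (aR (suc d) x y zs)) ⟩ x * (y * hh d (y ∷ x ∷ zs) + a) + (y * b + c) ≈⟨ +-congʳ (*-congˡ (+-congʳ (*-congˡ (sym (aR d x y zs))))) ⟩ x * (y * hh d (x ∷ y ∷ zs) + a) + (y * b + c) ≈⟨ solve 6 (\ x y h a b c -> x :* (y :* h :+ a) :+ (y :* b :+ c) := y :* (x :* h :+ b) :+ (x :* a :+ c)) refl x y (hh d (x ∷ y ∷ zs)) a b c ⟩ y * (x * hh d (x ∷ y ∷ zs) + b) + (x * a + c) ≈⟨ +-congʳ (*-congˡ (aR (suc d) x y zs)) ⟩ y * hh (suc d) (y ∷ x ∷ zs) + (x * a + c) ∎ where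
   a = hh (suc d) (x ∷ zs)
   b = hh (suc d) (y ∷ zs)
   c = hh (suc (suc d)) zs
  ft : ∀ {k} i (xs : Vec C k) d -> hh d (aD i xs) ≈ hh d xs
  ft zero [] d = refl
  ft zero (x ∷ []) d = refl
  ft zero (x ∷ y ∷ xs) d = aR d y x xs
  ft (suc i) [] d = refl
  ft (suc i) (x ∷ xs) d = kA x (ft i xs) d
  gP : ∀ {x n} d -> pow x n ≈ 0# -> n M.≤ d -> pow x d ≈ 0#
  gP {x} {zero} zero z p = z
  gP {x} {zero} (suc d) z p = trans (*-congˡ (gP {x} {zero} d z M.z≤n)) (zeroʳ x)
  gP {x} {suc n} (suc d) z p with n M.≟ d
  ... | yes E.refl = z
  ... | no q = trans (*-congˡ (gP d z (N.≤∧≢⇒< (M.s≤s⁻¹ p) q))) (zeroʳ x)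
  eV : ∀ d x -> hh d (x ∷ []) ≈ pow x d
  eV zero x = refl
  eV (suc d) x = trans (+-identityʳ _) (*-congˡ (eV d x))
  -- (x - y) h_d(x, y, zs) = h_{d+1}(x, zs) - h_{d+1}(y, zs) lowers the number of variables.
  cm : ∀ {n k} (xs : Vec C k) d -> All (\ x -> pow x n ≈ 0#) xs -> n M.< d M.+ k -> 0 M.< d -> hh d xs * vand xs ≈ 0#
  cm [] (suc d) _ p _ = zeroˡ _
  cm {n} (x ∷ []) d (z ∷ []) p _ = trans (*-congʳ (trans (eV d x) (gP d z (M.s≤s⁻¹ (E.subst (n M.<_) (N.+-comm d 1) p))))) (zeroˡ _)
  cm {n} (x ∷ y ∷ zs) d (p ∷ q ∷ rs) lt _ = begin hh d (x ∷ y ∷ zs) * (((x - y) * a) * (b * v)) ≈⟨ solve 6 (\ h x y a b v -> h :* (((x :- y) :* a) :* (b :* v)) := ((x :* h :- y :* h) :* a) :* (b :* v)) refl (hh d (x ∷ y ∷ zs)) x y a b v ⟩ ((x * H - y * H) * a) * (b * v) ≈⟨ *-congʳ (*-congʳ (trans (solve 4 (\ p q r s -> p :- q := ((p :+ r) :- (q :+ s)) :+ (s :- r)) refl (x * H) (y * H) (hh (suc d) (y ∷ zs)) (hh (suc d) (x ∷ zs))) (trans (+-congʳ (trans (+-congˡ (-‿cong (trans (+-congʳ (*-congˡ (aR d x y zs))) (aR (suc d) y x zs)))) (-‿inverseʳ _))) (+-identityˡ _)))) ⟩ ((hh (suc d) (x ∷ zs) - hh (suc d) (y ∷ zs)) *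 a) * (b * v) ≈⟨ solve 5 (\ p q a b v -> ((p :- q) :* a) :* (b :* v) := b :* (p :* (a :* v)) :- a :* (q :* (b :* v))) refl (hh (suc d) (x ∷ zs)) (hh (suc d) (y ∷ zs)) a b v ⟩ b * (hh (suc d) (x ∷ zs) * (a * v)) - a * (hh (suc d) (y ∷ zs) * (b * v)) ≈⟨ +-cong (*-congˡ (cm (x ∷ zs) (suc d) (p ∷ rs) lt' (M.s≤s M.z≤n))) (-‿cong (*-congˡ (cm (y ∷ zs) (suc d) (q ∷ rs) lt' (M.s≤s M.z≤n)))) ⟩ b * 0# - a * 0# ≈⟨ solve 2 (\ a b -> b :* con 0ℤ :- a :* con 0ℤ := con 0ℤ) refl a b ⟩ 0# ∎ where
   H = hh d (x ∷ y ∷ zs)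
   a = prodDiff x zs
   b = prodDiff y zs
   v = vand zs
   lt' = E.subst (n M.<_) (N.+-suc d _) lt
  cG : ℕ -> (ℕ -> C) -> C
  cG zero f = 0#
  cG (suc k) f = f 0 + cG k (\ l -> f (suc l))
  bf : ∀ k {f g : ℕ -> C} -> (∀ l -> l M.< k -> f l ≈ g l) -> cG k f ≈ cG k g
  bf zero e = refl
  bf (suc k) e = +-cong (e 0 (M.s≤s M.z≤n)) (bf k (\ l p -> e (suc l) (M.s≤s p)))
  kl : ∀ k (f g : ℕ -> C) -> cG k (\ l -> f l + g l) ≈ cG k f + cG k g
  kl zero f g = sym (+-identityˡ 0#)
  kl (suc k) f g = trans (+-congˡ (kl k _ _)) (dh _ _ _ _)
  km : ∀ k a (f : ℕ -> C) -> cG k (\ l -> a * f l) ≈ a * cG k f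
  km zero a f = sym (zeroʳ a)
  km (suc k) a f = trans (+-congˡ (km k a _)) (sym (distribˡ a _ _))
  -- This is a (N - l), but 0 for l > N, where truncated subtraction would give a 0.
  sub : (ℕ -> C) -> ℕ -> ℕ -> C
  sub a N zero = a N
  sub a zero (suc l) = 0#
  sub a (suc N) (suc l) = sub a N l
  eO : ∀ {a b : ℕ -> C} -> (∀ N -> a N ≈ b N) -> ∀ N l -> sub a N l ≈ sub b N l
  eO e N zero = e N
  eO e zero (suc l) = refl
  eO e (suc N) (suc l) = eO e N l
  -- (-1)^l times the l-th elementary symmetric polynomial.
  eps : ∀ {k} -> ℕ -> Vec C k -> C
  eps zero ys = 1#
  eps (suc l) [] = 0#
  eps (suc l) (y ∷ ys) = eps (suc l) ys - y * eps l ys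
  private
   op : C -> (ℕ -> C) -> ℕ -> C
   op y a N = a N - y * sub a N 1
   kn : ∀ y a N l -> sub (op y a) N l ≈ sub a N l - y * sub a N (suc l)
   kn y a N zero = refl
   kn y a zero (suc l) = solve 1 (\ y -> con 0ℤ := con 0ℤ :- y :* con 0ℤ) refl y
   kn y a (suc N) (suc l) = kn y a N l
   dY : ∀ {k} (ys : Vec C k) l -> k M.< l -> eps l ys ≈ 0#
   dY [] (suc l) p = refl
   dY (y ∷ ys) (suc l) (M.s≤s p) = trans (+-cong (dY ys (suc l) (N.m≤n⇒m≤1+n p)) (-‿cong (*-congˡ (dY ys l p)))) (solve 1 (\ y -> con 0ℤ :- y :* con 0ℤ := con 0ℤ) refl y)
   gJ : ∀ k (f : ℕ -> C) -> f k ≈ 0# -> cG (suc k) f ≈ cG k f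
   gJ zero f z = trans (+-identityʳ _) z
   gJ (suc k) f z = +-congˡ (gJ k _ z)
  -- Coefficients in 1/(1 - xt) = (generating series of the h_d(x, ys)) times (product of the 1 -
  -- yt); a further y divides the first factor and multiplies the second.
  lP : ∀ {k} x (ys : Vec C k) N -> pow x N ≈ cG (suc k) (\ l -> sub (\ d -> hh d (x ∷ ys)) N l * eps l ys)
  lP x [] N = trans (sym (eV N x)) (trans (sym (*-identityʳ _)) (sym (+-identityʳ _)))
  lP {suc k} x (y ∷ ys) N = begin pow x N ≈⟨ lP x ys N ⟩ cG (suc k) (\ l -> sub (\ d -> hh d (x ∷ ys)) N l * eps l ys) ≈⟨ bf (suc k) (\ l _ -> *-congʳ {x = eps l ys} (trans (eO b2 N l) (kn y a N l))) ⟩ cG (suc k) (\ l -> (sub a N l - y * sub a N (suc l)) * eps l ys) ≈⟨ bf (suc k) (\ l _ -> solve 4 (\ p q r y -> (p :- y :* q) :* r := p :* r :+ q :* (:- (y :* r))) refl (sub a N l) (sub a N (suc l)) (eps l ys) y) ⟩ cG (suc k) (\ l -> sub a N l * eps l ys + sub a N (suc l) * (- (y * eps l ys))) ≈⟨ kl (suc k) (\ l -> sub a N l * eps l ys) (\ l -> sub a N (suc l) * (- (y * eps l ys))) ⟩ (sub a N 0 * 1# + cG k (\ l -> sub a N (suc l) * eps (suc l) ys)) + S ≈⟨ +-congʳ (+-congˡ (sym (gJ k _ (trans (*-congˡ (dY ys _ (N.n<1+n k))) (zeroʳ _))))) ⟩ (sub a N 0 * 1# + cG (suc k) (\ l ->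 sub a N (suc l) * eps (suc l) ys)) + S ≈⟨ +-assoc _ _ _ ⟩ sub a N 0 * 1# + (cG (suc k) (\ l -> sub a N (suc l) * eps (suc l) ys) + S) ≈⟨ +-congˡ (trans (sym (kl (suc k) (\ l -> sub a N (suc l) * eps (suc l) ys) (\ l -> sub a N (suc l) * (- (y * eps l ys))))) (bf (suc k) (\ l _ -> sym (distribˡ (sub a N (suc l)) (eps (suc l) ys) (- (y * eps l ys)))))) ⟩ cG (suc (suc k)) (\ l -> sub a N l * eps l (y ∷ ys)) ∎ where
   a : ℕ -> C
   a d = hh d (x ∷ y ∷ ys)
   S = cG (suc k) (\ l -> sub a N (suc l) * (- (y * eps l ys)))
   b2 : ∀ d -> hh d (x ∷ ys) ≈ op y a d
   b2 zero = solve 2 (\ y o -> o := o :- y :* con 0ℤ) refl y 1#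
   b2 (suc d) = trans (solve 2 (\ p q -> q := (p :+ q) :- p) refl (y * hh d (y ∷ x ∷ ys)) (hh (suc d) (x ∷ ys))) (+-cong (aR (suc d) y x ys) (-‿cong (*-congˡ (aR d y x ys))))
  -- The coefficients q must not depend on N: all powers of x are expressed through the same k of
  -- them.
  g2 : ∀ {k} -> C -> Vec C k -> Set
  g2 {k} x xs = Σ (ℕ -> C) \ q -> ∀ N -> pow x N ≈ cG k (\ l -> sub (\ d -> hh d xs) N l * q l)
  private
   pb : ∀ {k} -> C -> Vec C (suc k) -> Set
   pb {k} x xs = Σ (Vec C k) \ ys -> ∀ d -> hh d xs ≈ hh d (x ∷ ys)
   jT : ∀ {k} (xs : Vec C (suc k)) -> All (\ x -> pb x xs) xs
   jT (x ∷ []) = ([] , \ d -> refl) ∷ []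
   jT (x ∷ y ∷ ys) = (y ∷ ys , \ d -> refl) ∷ All.map (\ {z} (zs , e) -> x ∷ zs , \ d -> trans (kA x e d) (aR d x z zs)) (jT (y ∷ ys))
  hF : ∀ {k} (xs : Vec C k) -> All (\ x -> g2 x xs) xs
  hF [] = []
  hF {suc k} xs@(_ ∷ _) = All.map (\ {x} (ys , e) -> (\ l -> eps l ys) , \ N -> trans (lP x ys N) (bf (suc k) (\ l _ -> *-congʳ {x = eps l ys} (eO (\ d -> sym (e d)) N l)))) (jT xs)

-- From the ideal to vanishing coefficients

module mk where
 open import Defs using (Poly; coeff; _≈P_; _*P_; sumP; comps; h; InIdeal; Symmetric)
 open dK
 open iM
 open kZ
 open Alt
 open nJ
 open import Data.Bool using (if_then_else_; not)
 open import Data.Fin as Fin using (Fin)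
 open import Data.Fin.Permutation using (Permutation′; _⟨$⟩ʳ_; remove; punchIn-permute)
 open import Data.List using (map; concatMap)
 open import Data.Vec using (replicate; tabulate; lookup; removeAt)
 open import Data.Vec.Relation.Unary.All as All using (All; []; _∷_; all?)
 open import Data.Vec.Relation.Unary.Any as Any using (Any; here; there)
 open import Data.Product using (_×_)
 private
  module Q {k : ℕ} = CommutativeRing (ai k)
  module H {k : ℕ} = bD (ai k)
 open H using (hh; sub; cG)
 Sym : ∀ {k} -> Poly k -> Set
 Sym P = ∀ i -> bZ i P ≋ P
 p8 : ∀ {k} {P Q : Poly k} -> Sym P -> Sym Q -> Sym (P *P Q)
 p8 {P = P} {Q} p q i = Q.trans (fo (aD i) (bH i) P Q) (Q.*-cong (p i) (q i))
 Sym-1 : ∀ {k} -> Sym (du {k})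
 Sym-1 i = lZ (aD i) (bw i)
 private
  ke : ∀ {k l} (f : Vec ℕ k -> Vec ℕ l) (f-⊞ : ∀ a b -> f (a ⊞ b) ≡ f a ⊞ f b) -> f bo ≡ bo -> ∀ {j} d (xs : Vec (Poly k) j) -> fp f (hh d xs) ≋ hh d (Vec.map (fp f) xs)
  ke f p z zero xs = lZ f z
  ke f p z (suc d) [] = Q.refl
  ke f p z (suc d) (x ∷ xs) = Q.trans (l0 f (x *P hh d (x ∷ xs)) (hh (suc d) xs)) (Q.+-cong (Q.trans (fo f p x (hh d (x ∷ xs))) (Q.*-congˡ {x = fp f x} (ke f p z d (x ∷ xs)))) (ke f p z (suc d) xs))
 p7 : ∀ {k} d -> Sym (hh d (X k))
 p7 {k} d i = Q.trans (ke (aD i) (bH i) (bw i) d (X k)) (Q.trans (Q.reflexive (cong (hh d) (fe i))) (H.ft i (X k) d))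
 private
  jl : ∀ {k} (L : List (Vec ℕ k)) φ -> val (map (\ a -> 1ℤ , a) L) φ ≡ List.foldr (\ a z -> φ a I.+ z) 0ℤ L
  jl [] φ = E.refl
  jl (a ∷ L) φ = cong₂ I._+_ (Z.*-identityˡ (φ a)) (jl L φ)
  Vs : ∀ {k} -> List (Vec ℕ k) -> (Vec ℕ k -> ℤ) -> ℤ
  Vs L φ = List.foldr (\ a z -> φ a I.+ z) 0ℤ L
  lm : ∀ {k} (L M : List (Vec ℕ k)) φ -> Vs (L ++ M) φ ≡ Vs L φ I.+ Vs M φ
  lm [] M φ = E.sym (Z.+-identityˡ _)
  lm (a ∷ L) M φ = E.trans (cong (I._+_ (φ a)) (lm L M φ)) (E.sym (Z.+-assoc (φ a) _ _))
  hO : ∀ {k l} (f : Vec ℕ k -> Vec ℕ l) L φ -> Vs (map f L) φ ≡ Vs L (\ b -> φ (f b))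
  hO f [] φ = E.refl
  hO f (a ∷ L) φ = cong (I._+_ (φ (f a))) (hO f L φ)
  i1 : ∀ {k} -> (ℕ -> ℕ) -> (Vec ℕ (suc k) -> ℤ) -> Vec ℕ (suc k) -> ℤ
  i1 g φ (i ∷ b) = φ (g i ∷ b)
  jY : ∀ {k d} (g : ℕ -> ℕ) (φ : Vec ℕ (suc k) -> ℤ) m (u : ℕ -> ℕ) -> Vs (concatMap (\ i -> map (g i ∷_) (comps k (d M.∸ i))) (List.applyUpTo u m)) φ ≡ Vs (concatMap (\ i -> map (i ∷_) (comps k (d M.∸ i))) (List.applyUpTo u m)) (i1 g φ)
  jY g φ zero u = E.refl
  jY {k} {d} g φ (suc m) u = E.trans (lm (map (g (u 0) ∷_) c) _ φ) (E.trans (cong₂ I._+_ (E.trans (hO (g (u 0) ∷_) c φ) (E.sym (hO (u 0 ∷_) c (i1 g φ)))) (jY g φ m (\ i -> u (suc i)))) (E.sym (lm (map (u 0 ∷_) c) _ (i1 g φ)))) where c = comps k (d M.∸ u 0)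
  a1 : ∀ {k} d m (u : ℕ -> ℕ) -> concatMap (\ i -> map (i ∷_) (comps k (suc d M.∸ i))) (List.applyUpTo (\ i -> suc (u i)) m) ≡ concatMap (\ i -> map (suc i ∷_) (comps k (d M.∸ i))) (List.applyUpTo u m)
  a1 d zero u = E.refl
  a1 {k} d (suc m) u = cong (map (suc (u 0) ∷_) (comps k (d M.∸ u 0)) ++_) (a1 d m (\ i -> u (suc i)))
 -- Both sides are split by whether x_1 occurs; `a1` and `jY` reindex the list of compositions
 -- accordingly.
 fr : ∀ k d -> h k d ≋ hh d (X k)
 fr zero zero = Q.refl
 fr zero (suc d) = Q.refl
 fr (suc k) zero = mk≋ (\ φ -> E.trans (jl (comps (suc k) 0) φ) (E.trans (cong (\ z -> Vs z φ) (LP.++-identityʳ (map (0 ∷_) (comps k 0)))) (E.trans (hO (0 ∷_) (comps k 0) φ) (E.trans (E.sym (jl (comps k 0) (\ b -> φ (0 ∷ b)))) (E.trans (at (fr k 0) (\ b -> φ (0 ∷ b))) (E.trans (ed (\ b -> φ (0 ∷ b))) (E.sym (ed φ))))))))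
 fr (suc k) (suc d) = mk≋ (\ φ -> E.trans (jl (comps (suc k) (suc d)) φ) (E.trans (lm (map (0 ∷_) (comps k (suc d))) f3 φ) (E.trans (Z.+-comm (Vs (map (0 ∷_) (comps k (suc d))) φ) (Vs f3 φ)) (E.trans (cong₂ I._+_ (mL φ) (m4 φ)) (E.sym (aK (al *P hh d (X (suc k))) (hh (suc d) (Vec.map am (X k))) φ)))))) where
  f3 : List (Vec ℕ (suc k))
  f3 = concatMap (\ i -> map (i ∷_) (comps k (suc d M.∸ i))) (List.applyUpTo (\ i -> suc i) (suc d))
  m4 : ∀ φ -> Vs (map (0 ∷_) (comps k (suc d))) φ ≡ val (hh (suc d) (Vec.map am (X k))) φ
  m4 φ = E.trans (hO (0 ∷_) (comps k (suc d)) φ) (E.trans (E.sym (jl (comps k (suc d)) (\ b -> φ (0 ∷ b)))) (E.trans (at (fr k (suc d)) (\ b -> φ (0 ∷ b))) (E.trans (E.sym (aL (0 ∷_) (hh (suc d) (X k)) φ)) (at (ke (0 ∷_) (\ _ _ -> E.refl) E.refl (suc d) (X k)) φ))))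
  mL : ∀ φ -> Vs f3 φ ≡ val (al *P hh d (X (suc k))) φ
  mL φ = E.trans (cong (\ z -> Vs z φ) (a1 d (suc d) (\ i -> i))) (E.trans (jY {d = d} suc φ (suc d) (\ i -> i)) (E.trans (E.sym (jl (comps (suc k) d) (i1 suc φ))) (E.trans (at (fr (suc k) d) (i1 suc φ)) (E.sym (E.trans (ap al (hh d (X (suc k))) φ) (E.trans (E.trans (Z.+-identityʳ _) (Z.*-identityˡ _)) (ao (hh d (X (suc k))) (\ { (i ∷ b) -> cong (\ z -> φ (suc i ∷ z)) (aG b) }))))))))
 -- Polynomials in k variables modulo the n-th powers of the variables.
 module j0 (k n : ℕ) where
  open qe (ai k) (Low n) (mkLow (\ _ _ -> E.refl)) (qk n) (nt n) (dJ n) public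
  private
   gT : ∀ {a b : Poly k} -> a ≋ b -> CommutativeRing._≈_ quotient a b
   gT {a} {b} = ht {a} {b}
  module Id = Hom (ai k) quotient (\ P -> P) gT (\ a b -> gT (Q.refl {x = a ++ b})) (\ a b -> gT (Q.refl {x = a *P b})) (gT (Q.refl {x = []})) (gT (Q.refl {x = du}))
  or : ∀ {j} (xs : Vec (Poly k) j) -> CommutativeRing._≈_ quotient (vand xs) (dQ.vand quotient xs)
  or xs = E.subst (\ z -> CommutativeRing._≈_ quotient (vand xs) (dQ.vand quotient z)) (VP.map-id xs) (Id.e9 xs)
  gU : ∀ {j} d (xs : Vec (Poly k) j) -> bD.hh quotient d xs ≡ hh d xs
  gU zero xs = E.refl
  gU (suc d) [] = E.refl
  gU (suc d) (x ∷ xs) = cong₂ _++_ (cong (x *P_) (gU d (x ∷ xs))) (gU (suc d) xs)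
 fk : ∀ {k} n -> All (\ x -> Low n (P.pow x n)) (X k)
 fk {zero} n = []
 fk {suc k} n = ek ∷ ik (X k) (fk n) where
  dO : ∀ m e -> coeff (P.pow (al {k}) m) e ≡ (if does (Vec.head e M.≟ m) then coeff du (Vec.tail e) else 0ℤ)
  dO zero (zero ∷ e) = cN {k} du e
  dO zero (suc i ∷ e) = bi {k} du i e
  dO (suc m) (zero ∷ e) = E.trans (ac (Q.*-comm al (P.pow al m)) (0 ∷ e)) (E.trans (aj (P.pow al m *P al) _) (E.trans (ap (P.pow al m) al _) (hl (P.pow al m) (\ { (i ∷ a) -> E.trans (E.trans (Z.+-identityʳ _) (Z.*-identityˡ _)) (d8 (0 ∷ e) ((i ∷ a) ⊞ (1 ∷ bo)) (\ q -> N.1+n≢0 (E.trans (N.+-comm 1 i) (VP.∷-injectiveˡ q)))) }))))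
  dO (suc m) (suc i ∷ e) = E.trans (br (P.pow al m) i e) (dO m (i ∷ e))
  ek : Low n (P.pow al n)
  ek = mkLow (\ { (i ∷ e) (p ∷ q) -> E.trans (dO n (i ∷ e)) (cong (\ z -> if z then coeff du e else 0ℤ) (pZ i p)) }) where
   pZ : ∀ i -> i M.< n -> does (i M.≟ n) ≡ false
   pZ i p = dec-false (i M.≟ n) (N.<⇒≢ p)
  iy : ∀ x m -> P.pow (am {k} x) m ≋ am (P.pow x m)
  iy x zero = Q.refl
  iy x (suc m) = Q.trans (Q.*-congˡ {x = am x} (iy x m)) (Q.sym (fo (0 ∷_) (\ _ _ -> E.refl) x (P.pow x m)))
  m2 : ∀ {P : Poly k} -> Low n P -> Low n (am P)
  m2 {P} l = mkLow (\ { (zero ∷ e) (_ ∷ q) -> E.trans (cN P e) (low l e q) ; (suc i ∷ e) _ -> bi P i e })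
  ik : ∀ {j} (xs : Vec (Poly k) j) -> All (\ x -> Low n (P.pow x n)) xs -> All (\ x -> Low n (P.pow x n)) (Vec.map am xs)
  ik [] [] = []
  ik (x ∷ xs) (l ∷ ls) = dJ n (Q.sym (iy x n)) (m2 l) ∷ ik xs ls
 -- Modulo n-th powers, h_d times the determinant is 0 as soon as d > n - k, by `cm`; the
 -- coefficients of the ideal combination only multiply this.
 eF : ∀ n k (P : Poly k) -> k M.≤ n -> InIdeal n k P -> Low n (vand (X k) *P P)
 eF n k P k≤n (L , ok , e) = mkLow (\ a q -> E.trans (jj (vand (X k)) {P} {sumP (map (\ { (c , d) -> c *P h k d }) L)} e a) (low (go L ok) a q)) where
  module W = j0 k n
  hd : ∀ d -> n M.∸ k M.< d -> Low n (hh d (X k) *P vand (X k))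
  hd d p = W.h1 (WR.trans {hh d (X k) *P vand (X k)} (WR.*-cong {hh d (X k)} (WR.reflexive (E.sym (W.gU d (X k)))) (W.or (X k))) (bD.cm W.quotient (X k) d (All.map (\ {x} l -> WR.trans {_} {P.pow x n} (WR.sym {P.pow x n} (W.Id.hv x n)) (W.e0 l)) (fk n)) (E.subst (M._< d M.+ k) (N.m∸n+n≡m k≤n) (N.+-monoˡ-< k p)) (N.≤-<-trans M.z≤n p))) where module WR = CommutativeRing W.quotient
  go : ∀ L -> LAll.All (\ { (c , d) -> Symmetric c × n M.∸ k M.< d }) L -> Low n (vand (X k) *P sumP (map (\ { (c , d) -> c *P h k d }) L))
  go [] LAll.[] = dJ n (Q.sym (Q.zeroʳ (vand (X k)))) (mkLow (\ _ _ -> E.refl))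
  go ((c , d) ∷ L) ((_ , p) LAll.∷ ps) = dJ n (Q.sym (Q.distribˡ (vand (X k)) (c *P h k d) _)) (qk n (dJ n (Q.trans (P.solve 3 (\ c h v -> c P.:* (h P.:* v) P.:= v P.:* (c P.:* h)) Q.refl c (hh d (X k)) (vand (X k))) (Q.*-congˡ {x = vand (X k)} (Q.*-congˡ {x = c} (Q.sym (fr k d))))) (nt n c (hd d p))) (go L ps))

-- From vanishing coefficients back to the ideal

module Ideal where
 open import Defs using (Poly; coeff; _≈P_; _*P_; sumP; h; InIdeal; Symmetric)
 open dK
 open iM
 open kZ
 open Alt
 open nJ
 open mk
 open import Data.Bool using (if_then_else_; not)
 open import Data.Fin as Fin using (Fin)
 open import Data.Fin.Permutation using (Permutation′; _⟨$⟩ʳ_; remove; punchIn-permute)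
 open import Data.List using (map)
 open import Data.Vec using (replicate; tabulate; lookup; removeAt)
 open import Data.Vec.Relation.Unary.All as All using (All; []; _∷_; all?)
 open import Data.Vec.Relation.Unary.Any as Any using (Any; here; there)
 open import Data.Product using (_×_)
 private
  module Q {k : ℕ} = CommutativeRing (ai k)
  module H {k : ℕ} = bD (ai k)
 open H using (hh; sub; cG)
 eT : ∀ {k} -> (Vec ℕ k -> Bool) -> Poly k -> Poly k
 eT p [] = []
 eT p ((c , b) ∷ P) = if p b then (c , b) ∷ eT p P else eT p P
 lR : ∀ {k} -> (Vec ℕ k -> Bool) -> (Vec ℕ k -> ℤ) -> Vec ℕ k -> ℤ
 lR p φ b = if p b then φ b else 0ℤ
 c8 : ∀ {k} p (P : Poly k) φ -> val (eT p P) φ ≡ val P (lR p φ)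
 c8 p [] φ = E.refl
 c8 p ((c , b) ∷ P) φ with p b
 ... | true = cong (I._+_ (c I.* φ b)) (c8 p P φ)
 ... | false = E.trans (c8 p P φ) (E.sym (E.trans (cong (I._+ val P (lR p φ)) (Z.*-zeroʳ c)) (Z.+-identityˡ _)))
 hM : ∀ {k} p (P : Poly k) a -> coeff (eT p P) a ≡ (if p a then coeff P a else 0ℤ)
 hM p P a = E.trans (aj (eT p P) a) (E.trans (c8 p P δ[ a ]) m8) where
  bF : p a ≡ true -> ∀ b -> lR p δ[ a ] b ≡ δ[ a ] b
  bF e b with p b in q
  ... | true = E.refl
  ... | false = E.sym (d8 a b (\ r -> cq (E.trans (E.sym e) (E.trans (cong p (E.sym r)) q)))) where
   cq : true ≢ false
   cq ()
  gf : p a ≡ false -> ∀ b -> lR p δ[ a ] b ≡ 0ℤ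
  gf e b with p b in q
  ... | false = E.refl
  ... | true = d8 a b (\ r -> cq (E.trans (E.sym q) (E.trans (cong p r) e))) where
   cq : true ≢ false
   cq ()
  m8 : val P (lR p δ[ a ]) ≡ (if p a then coeff P a else 0ℤ)
  m8 with p a in q
  ... | true = E.trans (ao P (bF q)) (E.sym (aj P a))
  ... | false = hl P (gf q)
 private
  df : ∀ {k} p (P : Poly k) -> length (eT p P) M.≤ length P
  df p [] = M.z≤n
  df p ((c , b) ∷ P) with p b
  ... | true = M.s≤s (df p P)
  ... | false = N.m≤n⇒m≤1+n (df p P)
 -- Lists of terms are not normalised. All terms with the exponent of the first one are removed
 -- together, and the length decreases.
 kg : ∀ {k} (P : Poly k) -> (∀ a -> coeff P a ≡ 0ℤ) -> ∀ φ -> val P φ ≡ 0ℤ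
 kg {k} P z φ = go (length P) P N.≤-refl z where
  go : ∀ m (P : Poly k) -> length P M.≤ m -> (∀ a -> coeff P a ≡ 0ℤ) -> val P φ ≡ 0ℤ
  go m [] _ z = E.refl
  go (suc m) P@((c , b) ∷ P') (M.s≤s l) z = E.trans (ao P a8) (E.trans (jm P _ _) (cong₂ I._+_ (E.trans (jn P (φ b) δ[ b ]) (E.trans (cong (φ b I.*_) (E.trans (E.sym (aj P b)) (z b))) (Z.*-zeroʳ (φ b)))) (E.trans (E.sym (c8 p P φ)) (go m (eT p P) fh hk)))) where
   p : Vec ℕ k -> Bool
   p a = not (does (a ≟V b))
   a8 : ∀ a -> φ a ≡ φ b I.* δ[ b ] a I.+ lR p φ a
   a8 a with a ≟V b
   ... | yes E.refl = E.sym (E.trans (Z.+-identityʳ _) (E.trans (cong (φ b I.*_) (iV b b E.refl)) (Z.*-identityʳ _)))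
   ... | no n = E.sym (E.trans (cong (I._+ φ a) (E.trans (cong (φ b I.*_) (d8 b a n)) (Z.*-zeroʳ (φ b)))) (Z.+-identityˡ _))
   fh : length (eT p P) M.≤ m
   fh with does (b ≟V b) | dec-true (b ≟V b) E.refl
   ... | .true | E.refl = N.≤-trans (df p P') l
   hk : ∀ a -> coeff (eT p P) a ≡ 0ℤ
   hk a = E.trans (hM p P a) (bF (p a)) where
    bF : ∀ q -> (if q then coeff P a else 0ℤ) ≡ 0ℤ
    bF true = z a
    bF false = E.refl
 -- The linear map that sends the monomial b to Φ b.
 lin : ∀ {k l} -> Poly l -> (Vec ℕ l -> Poly k) -> Poly k
 lin [] Φ = []
 lin ((c , b) ∷ P) Φ = map (\ t -> c I.* proj₁ t , proj₂ t) (Φ b) ++ lin P Φ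
 bd : ∀ {k} c (P : Poly k) φ -> val (map (\ t -> c I.* proj₁ t , proj₂ t) P) φ ≡ c I.* val P φ
 bd c [] φ = E.sym (Z.*-zeroʳ c)
 bd c ((d , b) ∷ P) φ = E.trans (cong₂ I._+_ (Z.*-assoc c d (φ b)) (bd c P φ)) (E.sym (Z.*-distribˡ-+ c _ _))
 aN : ∀ {k l} (P : Poly l) (Φ : Vec ℕ l -> Poly k) φ -> val (lin P Φ) φ ≡ val P (\ b -> val (Φ b) φ)
 aN [] Φ φ = E.refl
 aN ((c , b) ∷ P) Φ φ = E.trans (aK (map _ (Φ b)) (lin P Φ) φ) (cong₂ I._+_ (bd c (Φ b) φ) (aN P Φ φ))
 kz : ∀ {k l} {P P' : Poly l} -> P ≋ P' -> (Φ : Vec ℕ l -> Poly k) -> lin P Φ ≋ lin P' Φ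
 kz {P = P} {P'} e Φ = mk≋ (\ φ -> E.trans (aN P Φ φ) (E.trans (at e _) (E.sym (aN P' Φ φ))))
 hG : ∀ {k l} (P : Poly l) {Φ Φ' : Vec ℕ l -> Poly k} -> (∀ b -> Φ b ≋ Φ' b) -> lin P Φ ≋ lin P Φ'
 hG P {Φ} {Φ'} e = mk≋ (\ φ -> E.trans (aN P Φ φ) (E.trans (ao P (\ b -> at (e b) φ)) (E.sym (aN P Φ' φ))))
 oH : ∀ {k l} (P : Poly l) (Φ : Vec ℕ l -> Poly k) -> lin (dd P) Φ ≋ dd (lin P Φ)
 oH P Φ = mk≋ (\ φ -> E.trans (aN (dd P) Φ φ) (E.trans (bR P _) (E.sym (E.trans (bR (lin P Φ) φ) (cong I.-_ (aN P Φ φ))))))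
 pN : ∀ {k l} (P : Poly l) (Φ Φ' : Vec ℕ l -> Poly k) -> lin P (\ b -> Φ b ++ Φ' b) ≋ lin P Φ ++ lin P Φ'
 pN P Φ Φ' = mk≋ (\ φ -> E.trans (aN P _ φ) (E.trans (ao P (\ b -> aK (Φ b) (Φ' b) φ)) (E.trans (jm P _ _) (E.sym (E.trans (aK (lin P Φ) (lin P Φ') φ) (cong₂ I._+_ (aN P Φ φ) (aN P Φ' φ)))))))
 lin-* : ∀ {k l} (P : Poly l) (Φ : Vec ℕ l -> Poly k) A -> lin P (\ b -> Φ b *P A) ≋ lin P Φ *P A
 lin-* P Φ A = mk≋ (\ φ -> E.trans (aN P _ φ) (E.trans (ao P (\ b -> ap (Φ b) A φ)) (E.sym (E.trans (ap (lin P Φ) A φ) (aN P Φ _)))))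
 mon : ∀ {k j} -> Vec (Poly k) j -> Vec ℕ j -> Poly k
 mon [] [] = du
 mon (x ∷ xs) (e ∷ es) = P.pow x e *P mon xs es
 private
  iv : ∀ {k j} (xs : Vec (Poly k) j) b -> mon (Vec.map am xs) b ≋ am (mon xs b)
  iv [] [] = Q.refl
  iv {k} (x ∷ xs) (e ∷ es) = Q.trans (Q.*-cong (Q.sym (qm.hv x e)) (iv xs es)) (Q.sym (fo (0 ∷_) (\ _ _ -> E.refl) (P.pow x e) (mon xs es)))
  dD : ∀ {k} m (P : Poly (suc k)) φ -> val (P.pow al m *P P) φ ≡ val P (\ b -> φ ((m ∷ bo) ⊞ b))
  dD zero P φ = E.trans (ap du P φ) (E.trans (Z.+-identityʳ _) (Z.*-identityˡ _))
  dD (suc m) P φ = E.trans (at (Q.*-assoc al (P.pow al m) P) φ) (E.trans (ap al (P.pow al m *P P) φ) (E.trans (E.trans (Z.+-identityʳ _) (Z.*-identityˡ _)) (E.trans (dD m P _) (ao P (\ { (i ∷ b) -> cong φ (cong (suc (m M.+ i) ∷_) (aG (bo ⊞ b))) })))))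
 k7 : ∀ k b φ -> val (mon (X k) b) φ ≡ φ b
 k7 zero [] φ = ed φ
 k7 (suc k) (e ∷ es) φ = E.trans (dD e (mon (Vec.map am (X k)) es) φ) (E.trans (at (iv (X k) es) _) (E.trans (aL (0 ∷_) (mon (X k) es) _) (E.trans (k7 k es _) (cong φ (cong₂ _∷_ (N.+-identityʳ e) (aG es))))))
 oI : ∀ {k} (P : Poly k) -> lin P (mon (X k)) ≋ P
 oI {k} P = mk≋ (\ φ -> E.trans (aN P _ φ) (ao P (\ b -> k7 k b φ)))
 iu : ∀ {k} (m : ℕ) j -> (Vec ℕ j -> Poly k) -> Poly k
 iu m zero f = f []
 iu m (suc j) f = cG m (\ l -> iu m j (\ v -> f (l ∷ v)))
 dM : ∀ {k} m j {f g : Vec ℕ j -> Poly k} -> (∀ v -> All (M._< m) v -> f v ≋ g v) -> iu m j f ≋ iu m j g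
 dM m zero e = e [] []
 dM m (suc j) e = H.bf m (\ l p -> dM m j (\ v q -> e (l ∷ v) (p ∷ q)))
 i4 : ∀ {k} m j A (f : Vec ℕ j -> Poly k) -> iu m j (\ v -> A *P f v) ≋ A *P iu m j f
 i4 m zero A f = Q.refl
 i4 m (suc j) A f = Q.trans (H.bf m (\ l _ -> i4 m j A (\ v -> f (l ∷ v)))) (H.km m A _)
 iw : ∀ {k l} (P : Poly l) m (f : ℕ -> Vec ℕ l -> Poly k) -> lin P (\ b -> cG m (\ i -> f i b)) ≋ cG m (\ i -> lin P (f i))
 iw P zero f = mk≋ (\ φ -> E.trans (aN P _ φ) (hl P (\ _ -> E.refl)))
 iw P (suc m) f = Q.trans (pN P (f 0) _) (Q.+-congˡ {x = lin P (f 0)} (iw P m (\ i -> f (suc i))))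
 ix : ∀ {k l} (P : Poly l) m j (f : Vec ℕ l -> Vec ℕ j -> Poly k) -> lin P (\ b -> iu m j (f b)) ≋ iu m j (\ v -> lin P (\ b -> f b v))
 ix P m zero f = Q.refl
 ix P m (suc j) f = Q.trans (iw P m (\ i b -> iu m j (\ v -> f b (i ∷ v)))) (H.bf m (\ i _ -> ix P m j (\ b v -> f b (i ∷ v))))
 module _ {k : ℕ} where
  private
   Xs : Vec (Poly k) k
   Xs = X k
   hs : ℕ -> ℕ -> Poly k
   hs = sub (\ d -> hh d Xs)
  -- The product of the h with indices b_i - t_i, one term of a Jacobi-Trudi determinant.
  Hp : ∀ {j} -> Vec ℕ j -> Vec ℕ j -> Poly k
  Hp [] [] = du
  Hp (b ∷ bs) (t ∷ ts) = hs b t *P Hp bs ts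
  private
   Qp : ∀ {j} {xs : Vec (Poly k) j} -> All (\ x -> H.g2 x Xs) xs -> Vec ℕ j -> Poly k
   Qp [] [] = du
   Qp ((q , _) ∷ rs) (l ∷ ls) = q l *P Qp rs ls
   fn : ∀ {j} {xs : Vec (Poly k) j} (rs : All (\ x -> H.g2 x Xs) xs) b -> mon xs b ≋ iu k j (\ l -> Hp b l *P Qp rs l)
   fn [] [] = Q.sym (Q.*-identityˡ du)
   fn {suc j} {x ∷ xs} ((q , e) ∷ rs) (b ∷ bs) = Q.trans (Q.*-cong (e b) (fn rs bs)) (Q.trans (Q.trans (Q.*-comm (cG k (\ l -> hs b l *P q l)) S) (Q.sym (H.km k S (\ l -> hs b l *P q l)))) (H.bf k (\ l _ -> Q.trans (Q.*-comm S (hs b l *P q l)) (Q.trans (Q.sym (i4 k j (hs b l *P q l) (\ v -> Hp bs v *P Qp rs v))) (dM k j (\ v _ -> P.solve 4 (\ a b c d -> (a P.:* b) P.:* (c P.:* d) P.:= (a P.:* c) P.:* (b P.:* d)) Q.refl (hs b l) (q l) (Hp bs v) (Qp rs v))))))) where S = iu k j (\ v -> Hp bs v *P Qp rs v)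
   rX = H.hF Xs
  -- For alternating A a combination of Jacobi-Trudi determinants; at the staircase it recovers, up
  -- to sign, the quotient of A by the Vandermonde determinant.
  D : Poly k -> Vec ℕ k -> Poly k
  D A l = lin A (\ b -> Hp b l)
  hC : Vec ℕ k -> Poly k
  hC = Qp rX
  -- Every power of a variable is expanded by `hF`, and the sums are interchanged.
  n2 : ∀ A -> A ≋ iu k k (\ l -> D A l *P hC l)
  n2 A = Q.trans (Q.sym (oI A)) (Q.trans (hG A (fn rX)) (Q.trans (ix A k k (\ b l -> Hp b l *P Qp rX l)) (dM k k (\ l _ -> lin-* A (\ b -> Hp b l) (Qp rX l)))))
  private
   fE : ∀ {j} i (b l : Vec ℕ j) -> Hp b (aD i l) ≋ Hp (aD i b) l
   fE zero [] [] = Q.refl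
   fE zero (b ∷ []) (l ∷ []) = Q.refl
   fE zero (b ∷ b' ∷ bs) (l ∷ l' ∷ ls) = P.solve 3 (\ a b c -> a P.:* (b P.:* c) P.:= b P.:* (a P.:* c)) Q.refl (hs b l') (hs b' l) (Hp bs ls)
   fE (suc i) [] [] = Q.refl
   fE (suc i) (b ∷ bs) (l ∷ ls) = Q.*-congˡ {x = hs b l} (fE i bs ls)
  qy : ∀ A -> (∀ i -> suc i M.< k -> bZ i A ≋ dd A) -> ∀ i -> suc i M.< k -> ∀ l -> D A (aD i l) ≋ dd (D A l)
  qy A s i p l = Q.trans (hG A (\ b -> fE i b l)) (Q.trans (mk≋ (\ φ -> E.trans (aN A _ φ) (E.sym (E.trans (aN (bZ i A) _ φ) (aL (aD i) A _))))) (Q.trans (kz (s i p) (\ b -> Hp b l)) (oH A (\ b -> Hp b l))))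
  dG : (P : Poly k) -> P ≋ dd P -> P ≋ []
  dG P e = mk≋ (\ φ -> bc _ (E.trans (at e φ) (bR P φ)))
 -- Homogeneity of degree d, in terms of functionals.
 aq : ∀ {k} -> ℕ -> Poly k -> Set
 aq d P = ∀ φ ψ -> (∀ b -> Vec.sum b ≡ d -> φ b ≡ ψ b) -> val P φ ≡ val P ψ
 private
  id : ∀ {k} (a b : Vec ℕ k) -> Vec.sum (a ⊞ b) ≡ Vec.sum a M.+ Vec.sum b
  id [] [] = E.refl
  id (a ∷ as) (b ∷ bs) = E.trans (cong (a M.+ b M.+_) (id as bs)) (solve 4 (\ a b c d -> (a :+ b) :+ (c :+ d) := (a :+ c) :+ (b :+ d)) E.refl a b (Vec.sum as) (Vec.sum bs)) where
   open import Data.Nat.Solver using (module +-*-Solver)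
   open +-*-Solver
  fZ : ∀ k -> Vec.sum (bo {k}) ≡ 0
  fZ zero = E.refl
  fZ (suc k) = fZ k
  ic : ∀ k -> Vec.sum (hY {k}) ≡ k
  ic zero = E.refl
  ic (suc k) = cong suc (ic k)
  qt : ∀ {k d} {P Q : Poly k} -> P ≋ Q -> aq d P -> aq d Q
  qt e p φ ψ q = E.trans (E.sym (at e φ)) (E.trans (p φ ψ q) (at e ψ))
  Hg-* : ∀ {k d e} (P Q : Poly k) -> aq d P -> aq e Q -> aq (d M.+ e) (P *P Q)
  Hg-* P Q p q φ ψ r = E.trans (ap P Q φ) (E.trans (p _ _ (\ a ea -> q _ _ (\ b eb -> r (a ⊞ b) (E.trans (id a b) (cong₂ M._+_ ea eb))))) (E.sym (ap P Q ψ)))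
  o8 : ∀ {k d} (P Q : Poly k) -> aq d P -> aq d Q -> aq d (P Q.- Q)
  o8 P Q p q φ ψ r = E.trans (aK P (dd Q) φ) (E.trans (cong₂ I._+_ (p φ ψ r) (E.trans (bR Q φ) (E.trans (cong I.-_ (q φ ψ r)) (E.sym (bR Q ψ))))) (E.sym (aK P (dd Q) ψ)))
  Hg-1 : ∀ {k} -> aq 0 (du {k})
  Hg-1 {k} φ ψ r = cong (\ z -> 1ℤ I.* z I.+ 0ℤ) (r bo (fZ k))
  mo : ∀ {k} -> aq 1 (al {k})
  mo {k} φ ψ r = cong (\ z -> 1ℤ I.* z I.+ 0ℤ) (r (1 ∷ bo) (cong suc (fZ k)))
  mp : ∀ {k d} (P : Poly k) -> aq d P -> aq d (am P)
  mp P p φ ψ r = E.trans (aL (0 ∷_) P φ) (E.trans (p _ _ (\ b e -> r (0 ∷ b) e)) (E.sym (aL (0 ∷_) P ψ)))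
  o7 : ∀ {k l} x (ys : Vec (Poly k) l) -> aq 1 x -> All (aq 1) ys -> aq l (prodDiff x ys)
  o7 x [] p [] = Hg-1
  o7 x (y ∷ ys) p (q ∷ qs) = Hg-* (x Q.- y) (prodDiff x ys) (o8 x y p q) (o7 x ys p qs)
  kx : ∀ {k j} (xs : Vec (Poly k) j) -> All (aq 1) xs -> All (aq 1) (Vec.map am xs)
  kx [] [] = []
  kx (x ∷ xs) (p ∷ ps) = mp x p ∷ kx xs ps
  Hg-X : ∀ k -> All (aq 1) (X k)
  Hg-X zero = []
  Hg-X (suc k) = mo ∷ kx (X k) (Hg-X k)
 j6 : ∀ k -> aq (Vec.sum (T 0 k)) (vand (X k))
 j6 zero = Hg-1
 j6 (suc k) = E.subst (\ d -> aq d (vand (X (suc k)))) kD (qt (Q.sym (lI k)) (Hg-* (prodDiff al (Vec.map am (X k))) (am (vand (X k))) (o7 al (Vec.map am (X k)) mo (kx (X k) (Hg-X k))) (mp (vand (X k)) (j6 k)))) where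
  kD : k M.+ Vec.sum (T 0 k) ≡ Vec.sum (T 1 k)
  kD = E.sym (E.trans (cong Vec.sum (nr 0 k)) (E.trans (id hY (T 0 k)) (cong (M._+ Vec.sum (T 0 k)) (ic k))))
 jZ : ∀ c k -> All (\ z -> c M.≤ z × z M.< c M.+ k) (T c k)
 jZ c zero = []
 jZ c (suc k) = (N.≤-refl , N.m<m+n c (M.s≤s M.z≤n)) ∷ All.map (\ {x} (p , q) -> N.<⇒≤ p , E.subst (x M.<_) (E.sym (N.+-suc c k)) q) (jZ (suc c) k)
 private
  ii : ∀ {k} (a : ℕ -> Poly k) N l -> l M.≤ N -> sub a N l ≡ a (N M.∸ l)
  ii a N zero p = E.refl
  ii a (suc N) (suc l) (M.s≤s p) = ii a N l p
  ox : ∀ {k} (a : ℕ -> Poly k) N l -> N M.< l -> sub a N l ≡ []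
  ox a zero (suc l) p = E.refl
  ox a (suc N) (suc l) (M.s≤s p) = ox a N l p
  et : ∀ {k j} (t : Vec ℕ j) -> Hp {k} t t ≋ du
  et [] = Q.refl
  et {k} (t ∷ ts) = Q.trans (Q.*-cong (Q.reflexive (E.trans (ii _ t t N.≤-refl) (cong (\ d -> hh d (X k)) (N.n∸n≡0 t)))) (et ts)) (Q.*-identityˡ du)
  -- If b is not t, the inequality of the sums forces some b_i < t_i, where the factor h is 0.
  fF : ∀ {k j} (b t : Vec ℕ j) -> Vec.sum b M.≤ Vec.sum t -> b ≡ t ⊎ Hp {k} b t ≋ []
  fF [] [] _ = inj₁ E.refl
  fF {k} (b ∷ bs) (t ∷ ts) p with b M.<? t
  ... | yes q = inj₂ (Q.trans (Q.*-congʳ {x = Hp bs ts} (Q.reflexive (ox _ b t q))) (Q.zeroˡ (Hp {k} bs ts)))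
  ... | no q with fF {k} bs ts (N.+-cancelˡ-≤ t _ _ (N.≤-trans (N.+-monoˡ-≤ (Vec.sum bs) (N.≮⇒≥ q)) p))
  ... | inj₂ e = inj₂ (Q.trans (Q.*-congˡ {x = sub (\ d -> hh d (X k)) b t} e) (Q.zeroʳ (sub (\ d -> hh d (X k)) b t)))
  ... | inj₁ E.refl = inj₁ (cong (_∷ ts) (N.≤-antisym (N.+-cancelʳ-≤ (Vec.sum ts) b t p) (N.≮⇒≥ q)))
 -- By homogeneity only exponents with the same sum as the staircase occur in the determinant, and
 -- by `fF` only the staircase itself survives.
 qx : ∀ k φ -> val (D (vand (X k)) (T 0 k)) φ ≡ sg k I.* φ bo
 qx k φ = E.trans (aN (vand (X k)) (\ b -> Hp b (T 0 k)) φ) (E.trans (j6 k _ _ ll) (E.trans (jn (vand (X k)) (φ bo) δ[ T 0 k ]) (E.trans (Z.*-comm (φ bo) _) (cong (I._* φ bo) oJ)))) where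
  ll : ∀ b -> Vec.sum b ≡ Vec.sum (T 0 k) -> val (Hp b (T 0 k)) φ ≡ φ bo I.* δ[ T 0 k ] b
  ll b e with b ≟V T 0 k
  ... | yes E.refl = E.trans (at (et b) φ) (E.trans (ed φ) (E.sym (E.trans (cong (φ bo I.*_) (iV b b E.refl)) (Z.*-identityʳ _))))
  ... | no n with fF {k} b (T 0 k) (N.≤-reflexive e)
  ... | inj₁ r = ⊥-elim (n r)
  ... | inj₂ z = E.trans (at z φ) (E.sym (E.trans (cong (φ bo I.*_) (d8 (T 0 k) b n)) (Z.*-zeroʳ (φ bo))))
  oJ : val (vand (X k)) δ[ T 0 k ] ≡ sg k
  oJ = E.trans (E.sym (aj (vand (X k)) (T 0 k))) (E.trans (ac (Q.sym (Q.*-identityʳ (vand (X k)))) (T 0 k)) (E.trans (fz k 0 du (\ e a -> ⊥-elim (gf a))) (E.trans (cong (sg k I.*_) (E.trans (aj (du {k}) bo) (E.trans (ed δ[ bo ]) (iV bo bo E.refl)))) (Z.*-identityʳ (sg k))))) where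
   gf : ∀ {k} {e : Vec ℕ k} -> ¬ Any (M._< 0) e
   gf (there a) = gf a
 a9 : ∀ {k} -> ℤ -> Poly k -> Poly k
 a9 c = map (\ t -> c I.* proj₁ t , proj₂ t)
 private
  jL : ∀ {k} (a : Vec ℕ (suc k)) p -> er a (lookup a p ∷ removeAt a p)
  jL (a ∷ as) Fin.zero = kW
  jL {suc k} (a ∷ as@(_ ∷ _)) (Fin.suc p) = bN (cO a (jL as p)) (bp 0 (M.s≤s (M.s≤s M.z≤n)) kW)
  bM : ∀ {k} (a : Vec ℕ (suc k)) p j -> lookup a (Fin.punchIn p j) ≡ lookup (removeAt a p) j
  bM (a ∷ as) Fin.zero j = E.refl
  bM {suc k} (a ∷ as@(_ ∷ _)) (Fin.suc p) Fin.zero = E.refl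
  bM {suc k} (a ∷ as@(_ ∷ _)) (Fin.suc p) (Fin.suc j) = bM as p j
  bB : ∀ {k} (σ : Permutation′ k) (a : Vec ℕ k) -> er a (tabulate (\ i -> lookup a (σ ⟨$⟩ʳ i)))
  bB {zero} σ [] = kW
  bB {suc k} σ a = bN (jL a p) (cO (lookup a p) (E.subst (er (removeAt a p)) (VP.tabulate-cong (\ j -> E.trans (E.sym (bM a p _)) (cong (lookup a) (E.sym (punchIn-permute σ Fin.zero j))))) (bB (remove Fin.zero σ) (removeAt a p)))) where p = σ ⟨$⟩ʳ Fin.zero
 fM : ∀ {k} {P : Poly k} -> Sym P -> Symmetric P
 fM {k} {P} s σ a = go (bB σ a) where
  go : ∀ {v w} -> er v w -> coeff P v ≡ coeff P w
  go kW = E.refl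
  go (bp {v} i _ q) = E.trans (E.trans (E.sym (ac (s i) v)) (hL i P v)) (go q)
 module _ (n k : ℕ) (k≤n : k M.≤ n) where
  private
   mn : ∀ {P Q : Poly k} -> Q ≈P P -> InIdeal n k P -> InIdeal n k Q
   mn e (L , ok , f) = L , ok , \ a -> E.trans (e a) (f a)
   jN : ∀ (L M : List (Poly k)) -> sumP (L ++ M) ≡ sumP L ++ sumP M
   jN [] M = E.refl
   jN (P ∷ L) M = E.trans (cong (P ++_) (jN L M)) (E.sym (LP.++-assoc P _ _))
   Id-++ : ∀ {P Q : Poly k} -> InIdeal n k P -> InIdeal n k Q -> InIdeal n k (P ++ Q)
   Id-++ {P} {Q} (L , ok , f) (M , ok' , g) = L ++ M , AP.++⁺ ok ok' , \ a -> E.trans (a0 P Q a) (E.trans (cong₂ I._+_ (f a) (g a)) (E.trans (E.sym (a0 (sumP (map _ L)) _ a)) (cong (\ z -> coeff z a) (E.sym (E.trans (cong sumP (LP.map-++ _ L M)) (jN (map _ L) (map _ M)))))))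
   lx : ∀ {c : Poly k} {d} -> Sym c -> n M.∸ k M.< d -> InIdeal n k (c *P hh d (X k))
   lx {c} {d} s p = (c , d) ∷ [] , (fM {P = c} s , p) LAll.∷ LAll.[] , ac (Q.trans (Q.*-congˡ {x = c} (Q.sym (fr k d))) (Q.sym (Q.+-identityʳ (c *P h k d))))
   jh : ∀ c {P : Poly k} -> Sym P -> Sym (a9 c P)
   jh c {P} s i = mk≋ (\ φ -> E.trans (aL (aD i) (a9 c P) φ) (E.trans (bd c P _) (E.trans (cong (c I.*_) (E.trans (E.sym (aL (aD i) P φ)) (at (s i) φ))) (E.sym (bd c P φ)))))
   ji : ∀ b t -> Sym (sub (\ d -> hh d (X k)) b t)
   ji b zero = p7 b
   ji zero (suc t) i = Q.refl
   ji (suc b) (suc t) = ji b t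
   mh : ∀ {j} (b t : Vec ℕ j) -> Sym (Hp {k} b t)
   mh [] [] = Sym-1
   mh (b ∷ bs) (t ∷ ts) = p8 {P = sub (\ d -> hh d (X k)) b t} {Hp bs ts} (ji b t) (mh bs ts)
   -- An entry b_i ≥ n and t_i ≤ k - 1 give the index b_i - t_i > n - k; the remaining factors are
   -- symmetric.
   i7 : ∀ {j} (b t : Vec ℕ j) -> Any (n M.≤_) b -> All (M._< k) t -> Σ (Poly k) \ r -> Σ ℕ \ d -> Hp b t ≋ r *P hh d (X k) × Sym r × n M.∸ k M.< d
   i7 (b ∷ bs) (t ∷ ts) (here p) (q ∷ _) = Hp bs ts , b M.∸ t , Q.trans (Q.*-congʳ {x = Hp bs ts} (Q.reflexive (ii _ b t (N.≤-trans (N.<⇒≤ q) (N.≤-trans k≤n p))))) (Q.*-comm (hh (b M.∸ t) (X k)) (Hp bs ts)) , mh bs ts , N.<-≤-trans (N.∸-monoʳ-< q k≤n) (N.∸-monoˡ-≤ t p)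
   i7 (b ∷ bs) (t ∷ ts) (there p) (q ∷ qs) with i7 bs ts p qs
   ... | r , d , e , s , l = s₀ *P r , d , Q.trans (Q.*-congˡ {x = s₀} e) (Q.sym (Q.*-assoc s₀ r (hh d (X k)))) , p8 {P = s₀} {r} (ji b t) s , l where s₀ = sub (\ d -> hh d (X k)) b t
   lM : ∀ c (P Q : Poly k) -> a9 c (P *P Q) ≋ a9 c P *P Q
   lM c P Q = mk≋ (\ φ -> E.trans (bd c (P *P Q) φ) (E.trans (cong (c I.*_) (ap P Q φ)) (E.sym (E.trans (ap (a9 c P) Q φ) (bd c P _)))))
   fi : ∀ c {P Q : Poly k} -> P ≋ Q -> a9 c P ≋ a9 c Q
   fi c {P} {Q} e = mk≋ (\ φ -> E.trans (bd c P φ) (E.trans (cong (c I.*_) (at e φ)) (E.sym (bd c Q φ))))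
   cc : ∀ {j} (v : Vec ℕ j) -> All (M._< n) v ⊎ Any (n M.≤_) v
   cc [] = inj₁ []
   cc (a ∷ v) with a M.<? n | cc v
   ... | no p | _ = inj₂ (here (N.≮⇒≥ p))
   ... | yes p | inj₁ q = inj₁ (p ∷ q)
   ... | yes _ | inj₂ q = inj₂ (there q)
   bq : ∀ {j} -> Vec ℕ j -> Bool
   bq v with cc v
   ... | inj₁ _ = true
   ... | inj₂ _ = false
   -- The terms with all exponents below n add up to 0 and are dropped from the list; every other
   -- term has a generator as a factor by `i7`.
   Id-D : ∀ c (A : Poly k) -> (∀ e -> All (M._< n) e -> coeff A e ≡ 0ℤ) -> InIdeal n k (a9 c (D A (T 0 k)))
   Id-D s A l = mn {a9 s (lin (eT (\ v -> not (bq v)) A) Φ)} {a9 s (D A (T 0 k))} (ac (fi s {D A (T 0 k)} a8)) (go A) where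
    Φ : Vec ℕ k -> Poly k
    Φ b = Hp b (T 0 k)
    oK : ∀ φ -> val (eT bq A) φ ≡ 0ℤ
    oK = kg (eT bq A) (\ a -> E.trans (hM bq A a) (zero? a)) where
     zero? : ∀ a -> (if bq a then coeff A a else 0ℤ) ≡ 0ℤ
     zero? a with cc a
     ... | inj₁ q = l a q
     ... | inj₂ _ = E.refl
    a8 : D A (T 0 k) ≋ lin (eT (\ v -> not (bq v)) A) Φ
    a8 = mk≋ (\ φ -> E.trans (aN A Φ φ) (E.trans (ao A (parts (\ b -> val (Φ b) φ))) (E.trans (jm A _ _) (E.trans (cong₂ I._+_ (E.trans (E.sym (c8 bq A _)) (oK _)) (E.sym (c8 (\ v -> not (bq v)) A _))) (E.trans (Z.+-identityˡ _) (E.sym (aN (eT (\ v -> not (bq v)) A) Φ φ))))))) where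
     parts : ∀ (ψ : Vec ℕ k -> ℤ) b -> ψ b ≡ lR bq ψ b I.+ lR (\ v -> not (bq v)) ψ b
     parts ψ b with bq b
     ... | true = E.sym (Z.+-identityʳ _)
     ... | false = E.sym (Z.+-identityˡ _)
    Tk : All (M._< k) (T 0 k)
    Tk = All.map proj₂ (jZ 0 k)
    b1 : ∀ c b -> Any (n M.≤_) b -> InIdeal n k (a9 s (a9 c (Φ b)))
    b1 c b p with i7 b (T 0 k) p Tk
    ... | r , d , e , sy , lt = mn {a9 s (a9 c r) *P hh d (X k)} {a9 s (a9 c (Φ b))} (ac (Q.trans (fi s {a9 c (Φ b)} (Q.trans (fi c {Φ b} e) (lM c r (hh d (X k))))) (lM s (a9 c r) (hh d (X k))))) (lx {a9 s (a9 c r)} (jh s {a9 c r} (jh c {r} sy)) lt)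
    go : ∀ A -> InIdeal n k (a9 s (lin (eT (\ v -> not (bq v)) A) Φ))
    go [] = [] , LAll.[] , \ _ -> E.refl
    go ((c , b) ∷ A) with cc b
    ... | inj₁ _ = go A
    ... | inj₂ p = E.subst (InIdeal n k) (E.sym (LP.map-++ _ (a9 c (Φ b)) (lin (eT (\ v -> not (bq v)) A) Φ))) (Id-++ {a9 s (a9 c (Φ b))} (b1 c b p) (go A))
  -- Let a be the determinant, A = aF and T the staircase. The alternating functions D(A)(l) D(a)(T)
  -- and D(a)(l) D(A)(T) of l agree at T, hence at all l with entries below k. Summed up by `n2`
  -- this reads a F D(a)(T) = a D(A)(T). Here D(a)(T) is a sign, and cancelling a leaves F = D(A)(T)
  -- up to this sign, which lies in the ideal.
  eE : (F : Poly k) -> Sym F -> Low n (vand (X k) *P F) -> InIdeal n k F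
  eE F s l = mn {a9 (sg k) (D A (T 0 k))} {F} F≈ (Id-D (sg k) A (low l)) where
   A = vand (X k) *P F
   d' = D (vand (X k)) (T 0 k)
   open jz (ai k) dG
   altA : ∀ i -> suc i M.< k -> bZ i A ≋ dd A
   altA i p = Q.trans (fo (aD i) (bH i) (vand (X k)) F) (Q.trans (Q.*-cong (h7 i p) (s i)) (Q.sym (P.-‿distribˡ-* (vand (X k)) F)))
   ov : ∀ {B : Vec ℕ k -> Poly k} c -> Alt B -> Alt (\ l -> B l *P c)
   ov {B} c f i p v = Q.trans (Q.*-congʳ {x = c} (f i p v)) (Q.sym (P.-‿distribˡ-* (B v) c))
   il : ∀ v -> All (M._< k) v -> D A v *P d' ≋ D (vand (X k)) v *P D A (T 0 k)
   il v q = js k 0 v N.≤-refl (All.map (\ p -> M.z≤n , p) q) (ov d' (qy A altA)) (ov (D A (T 0 k)) (qy (vand (X k)) h7)) (\ _ -> Q.*-comm (D A (T 0 k)) d')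
   Qv : Vec ℕ k -> Poly k
   Qv = hC
   eh : vand (X k) *P (F *P d') ≋ vand (X k) *P D A (T 0 k)
   eh = Q.trans (Q.sym (Q.*-assoc (vand (X k)) F d')) (Q.trans (Q.*-congʳ {x = d'} (n2 A)) (Q.trans (Q.*-comm (iu k k (\ l -> D A l *P Qv l)) d') (Q.trans (Q.sym (i4 k k d' (\ l -> D A l *P Qv l))) (Q.trans (dM k k (\ v q -> Q.trans (P.solve 3 (\ d a q -> d P.:* (a P.:* q) P.:= (a P.:* d) P.:* q) Q.refl d' (D A v) (Qv v)) (Q.trans (Q.*-congʳ {x = Qv v} (il v q)) (P.solve 3 (\ d a q -> (d P.:* a) P.:* q P.:= a P.:* (d P.:* q)) Q.refl (D (vand (X k)) v) (D A (T 0 k)) (Qv v))))) (Q.trans (i4 k k (D A (T 0 k)) (\ l -> D (vand (X k)) l *P Qv l)) (Q.trans (Q.*-congˡ {x = D A (T 0 k)} (Q.sym (n2 (vand (X k))))) (Q.*-comm (D A (T 0 k)) (vand (X k)))))))))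
   lk : ∀ e -> coeff (F *P d') e ≡ coeff (D A (T 0 k)) e
   lk e = Z.i-j≡0⇒i≡j _ _ (E.trans (E.sym (E.trans (a0 (F *P d') _ e) (cong (I._+_ (coeff (F *P d') e)) (eZ (D A (T 0 k)) e)))) (eo k ((F *P d') Q.- D A (T 0 k)) (\ e -> ac (Q.trans (Q.distribˡ (vand (X k)) (F *P d') (dd (D A (T 0 k)))) (Q.trans (Q.+-cong eh (Q.sym (P.-‿distribʳ-* (vand (X k)) (D A (T 0 k))))) (Q.-‿inverseʳ (vand (X k) *P D A (T 0 k))))) e) e))
   mK : ∀ e -> coeff (F *P d') e ≡ sg k I.* coeff F e
   mK e = E.trans (aj (F *P d') e) (E.trans (ap F d' _) (E.trans (ao F (\ a -> E.trans (qx k _) (cong (\ z -> sg k I.* δ[ e ] z) (E.trans (hZ a bo) (aG a))))) (E.trans (jn F (sg k) δ[ e ]) (cong (sg k I.*_) (E.sym (aj F e))))))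
   F≈ : F ≈P a9 (sg k) (D A (T 0 k))
   F≈ e = E.sym (E.trans (aj (a9 (sg k) (D A (T 0 k))) e) (E.trans (bd (sg k) (D A (T 0 k)) _) (E.trans (cong (sg k I.*_) (E.trans (E.sym (aj (D A (T 0 k)) e)) (E.trans (E.sym (lk e)) (mK e)))) (E.trans (E.sym (Z.*-assoc (sg k) (sg k) _)) (E.trans (cong (I._* coeff F e) (dL k)) (Z.*-identityˡ _))))))

-- Vanishing for permutations that are not bounded

module Bad where
 open import Defs using (Poly; coeff; _≈P_; _*P_)
 open dK
 open lq
 open o3
 open iM
 open kZ
 open Alt
 open mk
 open ad
 open import Data.Vec.Relation.Unary.All as All using (All; []; _∷_)
 open import Data.Product using (_×_)
 open import Data.Unit using (⊤; tt)
 idw : ℕ -> List ℤ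
 idw zero = []
 idw (suc m) = + suc m ∷ idw m
 jD : ℕ -> List ℤ -> Bool
 jD n o = does (LP.≡-dec I._≟_ o (idw n))
 dX : ∀ n -> length (idw n) ≡ n
 dX zero = E.refl
 dX (suc n) = cong suc (dX n)
 gR : ∀ n -> a5 0ℤ (idw n)
 gR zero = tt
 gR (suc n) = Z.≤-reflexive (E.trans (cong (\ z -> + suc z) (E.sym (dX n))) (E.sym (Z.+-identityʳ _))) , gR n
 gS : ∀ n -> bE (idw n)
 gS zero = tt
 gS (suc n) = Z.≤-reflexive (cong (\ z -> + suc z) (dX n)) , gS n
 module fD (n' : ℕ) (lo : ℤ) (m : ℕ) where
  n : ℕ
  n = suc n'
  module _ (R : CommutativeRing 0ℓ 0ℓ) where
   open aE R
   open fH R n lo m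
   open cA.Trace R n lo m
   open ln R n' lo m
   -- At x = 0 each of the k sweeps only shifts the window and costs one unit of the bound (`kL`).
   eu : ∀ {k} (xs : Vec C k) -> All (_≈ 0#) xs -> ∀ M φ -> (∀ o -> length o ≡ n -> ¬ a5 M o -> φ o ≈ 0#) -> ∀ v -> length v ≡ n -> ¬ a5 (+ k I.+ M) v -> Fop xs φ v ≈ 0#
   eu [] [] M φ z v l b = z v l (E.subst (\ N -> ¬ a5 N v) (Z.+-identityˡ M) b)
   eu {suc k} (x ∷ xs) (p ∷ ps) M φ z v l b = eu xs ps (1ℤ I.+ M) (HH x φ) (\ o l b -> kL p l b z) v l (E.subst (\ N -> ¬ a5 N v) (L.solve 2 (\ k M -> (L.I L.:+ k) L.:+ M L.:= k L.:+ (L.I L.:+ M)) E.refl (+ k) M) b)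
   iP : ∀ {k} (xs : Vec C k) φ -> (∀ o -> length o ≡ n -> ¬ bE o -> φ o ≈ 0#) -> ∀ v -> length v ≡ n -> ¬ bE v -> Fop xs φ v ≈ 0#
   iP [] φ z v l b = z v l b
   iP (x ∷ xs) φ z v l b = iP xs (HH x φ) (\ o l b -> pa l b z) v l b
   EE-* : ∀ y a φ v -> a * EE y φ v ≈ EE y (\ w -> a * φ w) v
   EE-* y a φ v = trans (sym (bJ lo m a _)) (sumR-cong lo m (\ c -> trans (sym (cA.og R y v (c I.+ + n) a _)) (cA.d3 R y v (c I.+ + n) (\ o l -> solve 3 (\ a i p -> a :* (i :* p) := i :* (a :* p)) refl a (ind (eq l c)) (φ o)))))
   δw : List ℤ -> C
   δw o = ind (jD n o)
   nP : ∀ o -> o ≢ idw n -> δw o ≈ 0#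
   nP o ne = reflexive (cong ind (dec-false (LP.≡-dec I._≟_ o (idw n)) ne))
  module FP {k : ℕ} = fH (ai k) n lo m
  private
   module Q {k : ℕ} = CommutativeRing (ai k)
  F : ∀ k -> List ℤ -> Poly k
  F k = FP.Fop (X k) (δw (ai k))
  qv : ∀ k v -> Sym (F k v)
  qv k v i = Q.trans (mi.hw i n lo m (X k) (δw (ai k)) v) (Q.trans (Q.reflexive (cong (\ z -> FP.Fop z (\ w -> bZ i (δw (ai k) w)) v) (fe i))) (Q.trans (FP.Fop-swap i (X k) (\ w -> bZ i (δw (ai k) w)) v) (FP.Fop-cong (X k) (\ w -> mi.fQ i (jD n w)) v)))
  j8 : ∀ k v -> length v ≡ n -> ¬ bE v -> F k v ≋ []
  j8 k = iP (ai k) (X k) (δw (ai k)) (\ o _ na -> nP (ai k) o (\ e -> na (E.subst bE (E.sym e) (gS n))))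
  nD : ∀ k v -> F (suc k) v ≋ cA.Trace.HH (ai (suc k)) n lo m al (\ w -> am (F k w)) v
  nD k v = Q.trans (FP.Fop-out al (Vec.map am (X k)) (δw (ai (suc k))) v) (cA.Trace.mr (ai (suc k)) n lo m al (\ w -> Q.sym (Q.trans (qm.hw n lo m (X k) (δw (ai k)) w) (FP.Fop-cong (Vec.map am (X k)) (\ u -> qm.fQ (jD n u)) w))) v)
  -- Room for j inverse sweeps: each brings in entries increased by n, and all carriers have to stay
  -- in the range of summation.
  Rng : ℕ -> ℤ -> Set
  Rng j z = lo I.≤ z × z I.+ + (j M.* n) I.< lo I.+ + m
  dr : ∀ j k -> k M.+ j ≡ n -> ∀ v -> length v ≡ n -> LAll.All (Rng j) v -> ¬ a5 (+ n) v -> Low n (vand (X k) *P F k v)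
  -- In n variables only the constant term matters (`m1`). It is computed modulo the first powers of
  -- the variables, where n shifts connect the bound n of v with the bound 0 of the identity.
  dr zero k e v l r b with E.trans (E.sym (N.+-identityʳ k)) e
  ... | E.refl = m1 (F n v) (\ i _ -> qv n v i) (low (W.h1 {F n v} (≈-trans {F n v} hom iY)) bo hk) where
   module W = j0 n 1
   open CommutativeRing W.quotient using (_≈_) renaming (trans to ≈-trans; sym to ≈-sym; reflexive to ≈-reflexive)
   module FW = fH W.quotient n lo m
   hk : ∀ {k} -> All (M._< 1) (bo {k})
   hk {zero} = []
   hk {suc k} = M.s≤s M.z≤n ∷ hk
   hom : F n v ≈ FW.Fop (X n) (δw W.quotient) v
   hom = ≈-trans {F n v} (W.Id.hw n lo m (X n) (δw (ai n)) v) (≈-trans {FW.Fop (Vec.map (\ P -> P) (X n)) (δw (ai n)) v} (≈-reflexive (cong (\ z -> FW.Fop z (δw (ai n)) v) (VP.map-id (X n)))) (FW.Fop-cong (X n) (\ w -> W.Id.fQ (jD n w)) v))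
   iY : FW.Fop (X n) (δw W.quotient) v ≈ []
   iY = eu W.quotient (X n) (All.map (\ {x} p -> W.e0 {x} (dJ 1 (Q.*-identityʳ x) p)) (fk 1)) 0ℤ (δw W.quotient) (\ o _ nb -> nP W.quotient o (\ e -> nb (E.subst (a5 0ℤ) (E.sym e) (gR n)))) v l (E.subst (\ N -> ¬ a5 N v) (E.sym (Z.+-identityʳ (+ n))) b)
  -- Modulo x_1^n the polynomial in k variables is an inverse sweep of the one in k + 1 variables,
  -- and the inverse sweep only meets windows that still violate the bound.
  dr (suc j) k e v l r b = m0 (F k v) k<n (W.h1 {V *P am (F k v)} m8) where
   module W = j0 (suc k) n
   open CommutativeRing W.quotient using (_≈_; *-congˡ) renaming (trans to ≈-trans; sym to ≈-sym)
   module TW = cA.Trace W.quotient n lo m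
   V = vand (X (suc k))
   φ : List ℤ -> Poly (suc k)
   φ w = am (F k w)
   k<n : k M.< n
   k<n = E.subst (k M.<_) e (N.m<m+n k (M.s≤s M.z≤n))
   qb : ∀ {z} -> Rng (suc j) z -> Rng j z
   qb {z} (p , q) = p , Z.≤-<-trans (Z.+-monoʳ-≤ z (I.+≤+ (N.m≤n+m (j M.* n) n))) q
   lr : ∀ {z} -> Rng (suc j) z -> Rng j (z I.+ + n)
   lr {z} (p , q) = Z.≤-trans p (Z.i≤i+j z (+ n)) , E.subst (I._< lo I.+ + m) (E.sym (Z.+-assoc z (+ n) (+ (j M.* n)))) q
   oL : ∀ {z} -> Rng (suc j) z -> TW.bW z
   oL {z} (p , q) = p , Z.≤-<-trans (Z.i≤i+j z _) q
   nil : aE.pow W.quotient al n ≈ []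
   nil with fk {suc k} n
   ... | p ∷ _ = ≈-trans {aE.pow W.quotient al n} (≈-sym {P.pow al n} (W.Id.hv al n)) (W.e0 p)
   inverse : ∀ v -> length v ≡ n -> LAll.All (Rng (suc j)) v -> φ v ≈ TW.EE (dd al) (TW.HH al φ) v
   inverse (u ∷ us) l r = ≈-sym {TW.EE (dd al) (TW.HH al φ) (u ∷ us)} (TW.EE-HH al φ u us (LAll.map oL r) (E.subst (\ z -> aE.pow W.quotient al z ≈ []) (E.sym l) nil))
   cY : ∀ o -> length o ≡ n -> LAll.All (Rng j) o -> ¬ a5 (+ n) o -> V *P TW.HH al φ o ≈ []
   cY o l r b = ≈-trans {V *P TW.HH al φ o} (*-congˡ {V} (≈-sym {cA.Trace.HH (ai (suc k)) n lo m al φ o} (W.Id.pr n lo m al φ o))) (W.e0 (dJ n (Q.*-congˡ {x = V} (nD k o)) (dr j (suc k) (E.trans (E.sym (N.+-suc k j)) e) o l r b)))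
   m8 : V *P am (F k v) ≈ []
   m8 = ≈-trans {V *P φ v} (*-congˡ {V} (inverse v l r)) (≈-trans {V *P TW.EE (dd al) (TW.HH al φ) v} (EE-* W.quotient (dd al) V (TW.HH al φ) v) (ln.pd W.quotient n' lo m {Q = Rng (suc j)} {Q' = Rng j} {y = dd al} {φ = \ w -> V *P TW.HH al φ w} qb lr l r b cY))

-- Affine transpositions and functions of bounded displacement

module cV where
 open dK
 open ad
 open import Data.Integer using (_+_; _*_; -_; _-_; _≤_; _<_)
 open import Data.Product using (_×_)
 open E using (sym; trans; subst; refl)
 open L hiding (I; O)
 module ay (n : ℕ) .{{nz : NonZero n}} where
  infix 4 _∼_ _≁_ _∼?_
  record _∼_ (x y : ℤ) : Set where
   constructor mk∼
   field
    quotient : ℤ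
    equation : x ≡ y + quotient * + n
  open _∼_ public
  _≁_ : ℤ -> ℤ -> Set
  x ≁ y = ¬ x ∼ y
  b3 : ∀ {x} -> x ∼ x
  b3 {x} = mk∼ 0ℤ (sym (trans (cong (I._+_ x) (Z.*-zeroˡ (+ n))) (Z.+-identityʳ x)))
  ae : ∀ {x y} -> x ∼ y -> y ∼ x
  ae {x} {y} (mk∼ q e) = mk∼ (- q) (trans (solve 3 (\ y q n -> y := (y :+ q :* n) :+ (:- q) :* n) refl y q (+ n)) (cong (_+ - q * + n) (sym e)))
  af : ∀ {x y z} -> x ∼ y -> y ∼ z -> x ∼ z
  af {x} {y} {z} (mk∼ q e) (mk∼ r f) = mk∼ (r + q) (trans e (trans (cong (_+ q * + n) f) (solve 4 (\ z r q n -> (z :+ r :* n) :+ q :* n := z :+ (r :+ q) :* n) refl z r q (+ n))))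
  fO : ∀ {x y} z -> x ∼ y -> x + z ∼ y + z
  fO {x} {y} z (mk∼ q e) = mk∼ q (trans (cong (_+ z) e) (solve 4 (\ y q n z -> (y :+ q :* n) :+ z := (y :+ z) :+ q :* n) refl y q (+ n) z))
  bv : ∀ {x} -> x + + n ∼ x
  bv {x} = mk∼ 1ℤ (cong (I._+_ x) (sym (Z.*-identityˡ (+ n))))
  private
   mX : 1ℤ ≤ + n
   mX = I.+≤+ (M.>-nonZero⁻¹ n)
   kw : ∀ q -> 1ℤ ≤ q -> + n ≤ q * + n
   kw q p = Z.≤-trans (Z.≤-reflexive (sym (Z.*-identityˡ (+ n)))) (Z.*-monoʳ-≤-nonNeg (+ n) p)
  bQ : ∀ {x y} -> x ∼ y -> x < y + + n -> y < x + + n -> x ≡ y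
  bQ {x} {y} (mk∼ q e) p r with Z.<-cmp q 0ℤ
  ... | tri≈ _ refl _ = trans e (trans (cong (I._+_ y) (Z.*-zeroˡ (+ n))) (Z.+-identityʳ y))
  ... | tri< a _ _ = ⊥-elim (Z.<⇒≱ r (lin 0 (kw (- q) (lin 0 (st a) (solve 1 (\ q -> (:- q) :- con 1ℤ := (con 0ℤ :- (q :+ con 1ℤ)) :+ con 0ℤ) refl q))) (trans (cong (\ z -> y - (z + + n)) e) (solve 3 (\ y q n -> y :- ((y :+ q :* n) :+ n) := ((:- q) :* n :- n) :+ con 0ℤ) refl y q (+ n)))))
  ... | tri> _ _ c = ⊥-elim (Z.<⇒≱ p (lin 0 (kw q (Z.i<j⇒suc[i]≤j c)) (trans (cong (_- (y + + n)) e) (solve 3 (\ y q n -> (y :+ q :* n) :- (y :+ n) := (q :* n :- n) :+ con 0ℤ) refl y q (+ n)))))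
  private
   a2 : ∀ x -> x ∼ + (x %ℕ n)
   a2 x = mk∼ (x /ℕ n) (a≡a%ℕn+[a/ℕn]*n x n)
  _∼?_ : ∀ x y -> Dec (x ∼ y)
  x ∼? y with x %ℕ n M.≟ y %ℕ n
  ... | yes e = yes (af (a2 x) (subst (\ z -> + z ∼ y) (sym e) (ae (a2 y))))
  ... | no ne = no (\ e -> ne (Z.+-injective (bQ (af (ae (a2 x)) (af e (a2 y))) (mO x y) (mO y x)))) where
   mO : ∀ x y -> + (x %ℕ n) < + (y %ℕ n) + + n
   mO x y = Z.<-≤-trans (I.+<+ (n%ℕd<d x n)) (Z.i≤j+i (+ n) (+ (y %ℕ n)))
  QP : (ℤ -> ℤ) -> Set
  QP g = ∀ x -> g (x + + n) ≡ g x + + n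
  d2 : ∀ {g} -> QP g -> ∀ x q -> g (x + q * + n) ≡ g x + q * + n
  d2 {g} h x (+ m) = up x m where
   up : ∀ x m -> g (x + + m * + n) ≡ g x + + m * + n
   up x zero = trans (cong g (trans (cong (I._+_ x) (Z.*-zeroˡ (+ n))) (Z.+-identityʳ x))) (sym (trans (cong (I._+_ (g x)) (Z.*-zeroˡ (+ n))) (Z.+-identityʳ (g x))))
   up x (suc m) = trans (cong g (bp x)) (trans (h _) (trans (cong (_+ + n) (up x m)) (sym (bp (g x))))) where
    bp : ∀ x -> x + + suc m * + n ≡ x + + m * + n + + n
    bp x = solve 3 (\ x m n -> x :+ (con 1ℤ :+ m) :* n := (x :+ m :* n) :+ n) refl x (+ m) (+ n)
  d2 {g} h x -[1+ m ] = trans (sym (solve 2 (\ a b -> (a :+ b) :- b := a) refl _ (+ suc m * + n))) (trans (cong (_- + suc m * + n) (trans (sym (d2 {g} h (x + -[1+ m ] * + n) (+ suc m))) (cong g (je x)))) (kV (g x))) where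
   je : ∀ x -> x + -[1+ m ] * + n + + suc m * + n ≡ x
   je x = trans (cong (\ z -> x + z * + n + + suc m * + n) (refl {x = - + suc m})) (solve 3 (\ x m n -> (x :+ (:- m) :* n) :+ m :* n := x) refl x (+ suc m) (+ n))
   kV : ∀ y -> y - + suc m * + n ≡ y + -[1+ m ] * + n
   kV y = solve 3 (\ y m n -> y :- m :* n := y :+ (:- m) :* n) refl y (+ suc m) (+ n)
  abstract
   tr : ℤ -> ℤ -> ℤ -> ℤ
   tr a b x with x ∼? a | x ∼? b
   ... | yes _ | _ = x + (b - a)
   ... | no _ | yes _ = x + (a - b)
   ... | no _ | no _ = x
   fW : ∀ {a b x} -> x ∼ a -> tr a b x ≡ x + (b - a)
   fW {a} {b} {x} p with x ∼? a | x ∼? b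
   ... | yes _ | _ = refl
   ... | no q | _ = ⊥-elim (q p)
   fV : ∀ {a b x} -> a ≁ b -> x ∼ b -> tr a b x ≡ x + (a - b)
   fV {a} {b} {x} h p with x ∼? a | x ∼? b
   ... | yes q | _ = ⊥-elim (h (af (ae q) p))
   ... | no _ | yes _ = refl
   ... | no _ | no q = ⊥-elim (q p)
   aY : ∀ {a b x} -> x ≁ a -> x ≁ b -> tr a b x ≡ x
   aY {a} {b} {x} p q with x ∼? a | x ∼? b
   ... | yes r | _ = ⊥-elim (p r)
   ... | no _ | yes r = ⊥-elim (q r)
   ... | no _ | no _ = refl
  dF : ∀ a b -> tr a b a ≡ b
  dF a b = trans (fW b3) (solve 2 (\ a b -> a :+ (b :- a) := b) refl a b)
  dE : ∀ {a b} -> a ≁ b -> tr a b b ≡ a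
  dE {a} {b} h = trans (fV h b3) (solve 2 (\ a b -> b :+ (a :- b) := a) refl a b)
  private
   move : ∀ {x a} b -> x ∼ a -> x + (b - a) ∼ b
   move {x} {a} b p = subst (x + (b - a) ∼_) (solve 2 (\ a b -> a :+ (b :- a) := b) refl a b) (fO (b - a) p)
  mJ : ∀ {a b} -> a ≁ b -> ∀ x -> tr a b (tr a b x) ≡ x
  mJ {a} {b} h x with x ∼? a
  ... | yes p = trans (cong (tr a b) (fW p)) (trans (fV h (move b p)) (solve 3 (\ x a b -> x :+ (b :- a) :+ (a :- b) := x) refl x a b))
  ... | no p with x ∼? b
  ... | yes q = trans (cong (tr a b) (fV h q)) (trans (fW (move a q)) (solve 3 (\ x a b -> x :+ (a :- b) :+ (b :- a) := x) refl x a b))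
  ... | no q = trans (cong (tr a b) (aY p q)) (aY p q)
  kh : ∀ {a b} -> a ≁ b -> QP (tr a b)
  kh {a} {b} h x with x ∼? a
  ... | yes p = trans (fW (af bv p)) (trans (solve 4 (\ x n a b -> (x :+ n) :+ (b :- a) := (x :+ (b :- a)) :+ n) refl x (+ n) a b) (cong (_+ + n) (sym (fW p))))
  ... | no p with x ∼? b
  ... | yes q = trans (fV h (af bv q)) (trans (solve 4 (\ x n a b -> (x :+ n) :+ (a :- b) := (x :+ (a :- b)) :+ n) refl x (+ n) a b) (cong (_+ + n) (sym (fV h q))))
  ... | no q = trans (aY (\ r -> p (af (ae bv) r)) (\ r -> q (af (ae bv) r))) (cong (_+ + n) (sym (aY p q)))
  nS : ∀ {a b} -> a ≁ b -> ∀ {x y} -> tr a b x ≡ tr a b y -> x ≡ y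
  nS {a} {b} h {x} {y} e = trans (sym (mJ h x)) (trans (cong (tr a b) e) (mJ h y))
  fc : ∀ {a b} d -> a ≁ b -> b ≤ a + + d -> a ≤ b + + d -> ∀ x -> x ≤ tr a b x + + d × tr a b x ≤ x + + d
  fc {a} {b} d h p q x with x ∼? a
  ... | yes r = subst (\ z -> x ≤ z + + d × z ≤ x + + d) (sym (fW r)) (lin 0 q (solve 4 (\ x a b d -> (x :+ (b :- a)) :+ d :- x := ((b :+ d) :- a) :+ con 0ℤ) refl x a b (+ d)) , lin 0 p (solve 4 (\ x a b d -> (x :+ d) :- (x :+ (b :- a)) := ((a :+ d) :- b) :+ con 0ℤ) refl x a b (+ d)))
  ... | no r with x ∼? b
  ... | yes s = subst (\ z -> x ≤ z + + d × z ≤ x + + d) (sym (fV h s)) (lin 0 p (solve 4 (\ x a b d -> (x :+ (a :- b)) :+ d :- x := ((a :+ d) :- b) :+ con 0ℤ) refl x a b (+ d)) , lin 0 q (solve 4 (\ x a b d -> (x :+ d) :- (x :+ (a :- b)) := ((b :+ d) :- a) :+ con 0ℤ) refl x a b (+ d)))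
  ... | no s = subst (\ z -> x ≤ z + + d × z ≤ x + + d) (sym (aY r s)) (Z.i≤i+j x (+ d) , Z.i≤i+j x (+ d))
  -- `D` bounds the displacement. It is tracked because all sums over pairs of positions are cut off
  -- at a finite distance.
  record Adm (D : ℕ) (g : ℤ -> ℤ) : Set where
   field
    qp : QP g
    inj : ∀ x y -> g x ≡ g y -> x ≡ y
    ej : ∀ x -> x ≤ g x + + D
    ee : ∀ x -> g x ≤ x + + D
   dA : ∀ x q -> g (x + q * + n) ≡ g x + q * + n
   dA = d2 {g} qp
   pH : ∀ x y q -> g x ≡ g y + q * + n -> x ≡ y + q * + n
   pH x y q e = inj _ _ (trans e (sym (dA y q)))
  open Adm public
  kR : ∀ {D g a b} d -> a ≁ b -> b ≤ a + + d -> a ≤ b + + d -> Adm D g -> Adm (D M.+ d) (\ x -> g (tr a b x))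
  kR {D} {g} {a} {b} d h p q w = record { qp = \ x -> trans (cong g (kh h x)) (qp w _) ; inj = \ x y e -> nS h (inj w _ _ e) ; ej = \ x -> lin 0 (proj₁ (fc d h p q x) & ej w (tr a b x)) (solve 5 (\ x t g D d -> g :+ (D :+ d) :- x := ((t :+ d) :+ (g :+ D)) :- (x :+ t) :+ con 0ℤ) refl x (tr a b x) (g (tr a b x)) (+ D) (+ d)) ; ee = \ x -> lin 0 (proj₂ (fc d h p q x) & ee w (tr a b x)) (solve 5 (\ x t g D d -> x :+ (D :+ d) :- g := ((x :+ d) :+ (t :+ D)) :- (t :+ g) :+ con 0ℤ) refl x (tr a b x) (g (tr a b x)) (+ D) (+ d)) }
  d6 : ∀ {D D' g} -> D M.≤ D' -> Adm D g -> Adm D' g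
  d6 {D} {D'} {g} p w = record { qp = qp w ; inj = inj w ; ej = \ x -> Z.≤-trans (ej w x) (Z.+-monoʳ-≤ (g x) (I.+≤+ p)) ; ee = \ x -> Z.≤-trans (ee w x) (Z.+-monoʳ-≤ x (I.+≤+ p)) }
  mC : ∀ {D g h} -> (∀ x -> g x ≡ h x) -> Adm D g -> Adm D h
  mC {D} {g} {h} e w = record { qp = \ x -> trans (sym (e _)) (trans (qp w x) (cong (_+ + n) (e x))) ; inj = \ x y q -> inj w x y (trans (e x) (trans q (sym (e y)))) ; ej = \ x -> subst (\ z -> x ≤ z + + D) (e x) (ej w x) ; ee = \ x -> subst (_≤ x + + D) (e x) (ee w x) }
  module _ (aa : 2 M.≤ n) where
   kv : ∀ x {d} -> 1 M.≤ d -> d M.< n -> x ≁ x + + d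
   kv x {d} p q e with bQ e (Z.≤-<-trans (Z.i≤i+j x (+ d)) (aB 0 (I.+≤+ (M.>-nonZero⁻¹ n)) (solve 3 (\ x d n -> (x :+ d :+ n) :- (x :+ d) := (n :- con 1ℤ) :+ con 1ℤ) refl x (+ d) (+ n)))) (Z.+-monoʳ-< x (I.+<+ q))
   ... | r with aS x 0ℤ (+ d) (trans (Z.+-identityˡ x) (trans r (Z.+-comm x (+ d))))
   kv x {suc d} p q e | r | ()
   ar : ∀ i -> i ≁ i + 1ℤ
   ar i = kv i N.≤-refl aa
   sw : ℤ -> ℤ -> ℤ
   sw i = tr i (i + 1ℤ)
   eI : ∀ {D g} i -> Adm D g -> Adm (D M.+ 1) (\ x -> g (sw i x))
   eI i = kR 1 (ar i) Z.≤-refl (Z.≤-trans (Z.i≤i+j i 1ℤ) (Z.i≤i+j _ 1ℤ))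
   pi : ∀ i -> sw i i ≡ i + 1ℤ
   pi i = dF i (i + 1ℤ)
   hE : ∀ i -> sw i (i + 1ℤ) ≡ i
   hE i = dE (ar i)

-- A sweep is a sum over proper sets of letters

module cB where
 open dK
 open lq
 open cV
 open ad
 open import Data.List using (map)
 open import Data.List.Relation.Unary.All as All using (All; []; _∷_)
 open import Data.Product using (_×_)
 -- The window of length m starting at b, last entry first.
 win : ℤ -> ℕ -> (ℤ -> ℤ) -> List ℤ
 win b zero g = []
 win b (suc m) g = g (b I.+ + m) ∷ win b m g
 cp : ∀ b m {g g' : ℤ -> ℤ} -> (∀ s -> s M.< m -> g' (b I.+ + s) ≡ g (b I.+ + s)) -> win b m g' ≡ win b m g
 cp b zero e = E.refl
 cp b (suc m) e = cong₂ _∷_ (e m N.≤-refl) (cp b m (\ s p -> e s (N.m≤n⇒m≤1+n p)))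
 gy : ∀ b m -> b I.+ 1ℤ I.+ + m ≡ b I.+ + suc m
 gy b m = Z.+-assoc b 1ℤ (+ m)
 jB : ∀ b m -> b I.+ + m I.+ 1ℤ ≡ b I.+ + suc m
 jB b m = E.trans (Z.+-assoc b (+ m) 1ℤ) (cong (\ z -> b I.+ + z) (N.+-comm m 1))
 h5 : ∀ b m g -> win b (suc m) g ≡ win (b I.+ 1ℤ) m g ++ g b ∷ []
 h5 b zero g = cong (\ z -> g z ∷ []) (Z.+-identityʳ b)
 h5 b (suc m) g = cong₂ _∷_ (cong g (E.sym (gy b m))) (h5 b m g)
 lG : ∀ b p q g -> win b (q M.+ p) g ≡ win (b I.+ + p) q g ++ win b p g
 lG b p zero g = E.refl
 lG b p (suc q) g = cong₂ _∷_ (cong g (L.solve 3 (\ b q p -> b L.:+ (q L.:+ p) L.:= (b L.:+ p) L.:+ q) E.refl b (+ q) (+ p))) (lG b p q g)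
 h6 : ∀ b m (f : ℤ -> ℤ) {g h : ℤ -> ℤ} c -> (∀ x -> h (x I.+ c) ≡ f (g x)) -> win (b I.+ c) m h ≡ map f (win b m g)
 h6 b zero f c e = E.refl
 h6 b (suc m) f {g} {h} c e = cong₂ _∷_ (E.trans (cong h (L.solve 3 (\ b c m -> b L.:+ c L.:+ m L.:= b L.:+ m L.:+ c) E.refl b c (+ m))) (e (b I.+ + m))) (h6 b m f c e)
 aM : ∀ b m g -> length (win b m g) ≡ m
 aM b zero g = E.refl
 aM b (suc m) g = cong suc (aM b m g)
 gD : ∀ {Q : ℤ -> Set} b m {g} -> (∀ s -> s M.< m -> Q (g (b I.+ + s))) -> All Q (win b m g)
 gD b zero h = []
 gD b (suc m) h = h m N.≤-refl ∷ gD b m (\ s p -> h s (N.m≤n⇒m≤1+n p))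
 Fn : Set
 Fn = ℤ -> ℤ
 module kI (R : CommutativeRing 0ℓ 0ℓ) (n : ℕ) .{{nz : NonZero n}} (aa : 2 M.≤ n) where
  open aE R
  open cA R
  open ay n
  s[_] : ℤ -> Fn -> Fn
  s[ i ] g y = g (sw aa i y)
  -- One letter of a reduced factor: s_i is applied only at a descent, at the price x.
  U : C -> ℤ -> (Fn -> C) -> Fn -> C
  U x i Φ g = ind (lt (g (i I.+ 1ℤ)) (g i)) * (x * Φ (s[ i ] g))
  -- The letters i, ..., i+m-1 in order, each used through `U` or skipped with weight e: e = 1 sums
  -- over all subsets, e = 0 uses all letters.
  Ch : C -> C -> ℤ -> ℕ -> (Fn -> C) -> Fn -> C
  Ch e x i zero Φ = Φ
  Ch e x i (suc m) Φ = Ch e x i m (\ g -> e * Φ g + U x (i I.+ + m) Φ g)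
  -- If b + p is the first missing letter, those after it up to b + n - 1 are free, and b + n, ...,
  -- b + n + p - 1, which modulo n are b, ..., b + p - 1, are forced.
  Hgo : C -> ℤ -> (Fn -> C) -> Fn -> ℕ -> ℕ -> C
  Hgo x b Φ g p zero = 0#
  Hgo x b Φ g p (suc q) = Ch 1# x (b I.+ 1ℤ I.+ + p) q (Ch 0# x (b I.+ + n) p Φ) g + Hgo x b Φ g (suc p) q
  -- The sum over all proper subsets of ℤ/n; p is the first missing letter after b - 1.
  Hb : C -> ℤ -> (Fn -> C) -> Fn -> C
  Hb x b Φ g = Hgo x b Φ g 0 n
  bm : ∀ {y z} -> y I.< z -> z I.< y I.+ + n -> y ≁ z
  bm {y} {z} p q e = Z.<-irrefl (bQ e (Z.<-≤-trans p (Z.i≤i+j z (+ n))) q) p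
  private
   jA : ℤ -> ℕ -> Fn -> Fn -> Set
   jA i m g g' = ∀ y -> (∀ s -> s M.≤ m -> y ≁ i I.+ + s) -> g' y ≡ g y
   Ks : C -> C -> List ℤ -> ℤ -> (List ℤ -> ℤ -> C) -> C
   Ks e x [] c Ψ = Ψ [] c
   Ks e x (u ∷ us) c Ψ = Ks e x us c (\ o c' -> e * Ψ (c' ∷ o) u + ind (lt u c') * (x * Ψ (u ∷ o) c'))
   j1 : ∀ e x us c {Ψ Ψ'} -> (∀ o c' -> Ψ o c' ≈ Ψ' o c') -> Ks e x us c Ψ ≈ Ks e x us c Ψ'
   j1 e x [] c h = h [] c
   j1 e x (u ∷ us) c h = j1 e x us c (\ o c' -> +-cong (*-congˡ (h _ _)) (*-congˡ (*-congˡ (h _ _))))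
   Ks-1 : ∀ x us c Ψ -> Ks 1# x us c Ψ ≈ Hs x us c Ψ
   Ks-1 x [] c Ψ = refl
   Ks-1 x (u ∷ us) c Ψ = trans (j1 1# x us c (\ o c' -> +-congʳ (*-identityˡ _))) (Ks-1 x us c _)
   AL : List ℤ -> ℤ -> C
   AL [] c = 1#
   AL (z ∷ zs) c = ind (lt z c) * AL zs c
   Ks-0 : ∀ x us c Ψ -> Ks 0# x us c Ψ ≈ pow x (length us) * (AL us c * Ψ us c)
   Ks-0 x [] c Ψ = sym (trans (*-identityˡ _) (*-identityˡ _))
   Ks-0 x (u ∷ us) c Ψ = trans (Ks-0 x us c _) (solve 6 (\ p a b i x y -> p :* (a :* (con 0ℤ :* b :+ i :* (x :* y))) := (x :* p) :* ((i :* a) :* y)) refl (pow x (length us)) (AL us c) (Ψ (c ∷ us) u) (ind (lt u c)) x (Ψ (u ∷ us) c))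
   -- In order, these letters move a carrier that starts as g(i) through the next m values: using a
   -- letter is a jump, skipping it an exchange.
   nL : ∀ e x i m g Φ Ψ -> m M.< n -> QP g -> (∀ g' -> QP g' -> jA i m g g' -> Φ g' ≈ Ψ (win i m g') (g' (i I.+ + m))) -> Ch e x i m Φ g ≈ Ks e x (win (i I.+ 1ℤ) m g) (g i) Ψ
   nL e x i zero g Φ Ψ p w h = trans (h g w (\ _ _ -> E.refl)) (reflexive (cong (\ z -> Ψ [] (g z)) (Z.+-identityʳ i)))
   nL e x i (suc m) g Φ Ψ p w h = nL e x i m g _ _ (N.<-trans (N.n<1+n m) p) w aQ where
    j = i I.+ + m
    u = g (i I.+ 1ℤ I.+ + m)
    hX : ∀ {g'} -> jA i m g g' -> jA i (suc m) g g'
    hX a y q = a y (\ s r -> q s (N.m≤n⇒m≤1+n r))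
    a4 : ∀ {s} t -> s M.< t -> t M.≤ suc m -> i I.+ + s ≁ i I.+ + t
    a4 {s} t q r = bm (Z.+-monoʳ-< i (I.+<+ q)) (aB 0 (I.+≤+ (N.≤-trans (M.s≤s r) p) & I.+≤+ {0} {s} M.z≤n) (L.solve 4 (\ i s t n -> (i L.:+ s L.:+ n) L.:- (i L.:+ t) L.:= ((n L.:+ s) L.:- (L.I L.:+ t L.:+ L.O)) L.:+ L.I) E.refl i (+ s) (+ t) (+ n)))
    aQ : ∀ g' -> QP g' -> jA i m g g' -> e * Φ g' + U x j Φ g' ≈ e * Ψ (g' j ∷ win i m g') u + ind (lt u (g' j)) * (x * Ψ (u ∷ win i m g') (g' j))
    aQ g' w' a = +-cong (*-congˡ (trans (h g' w' (hX {g'} a)) (reflexive (cong (Ψ (g' j ∷ win i m g')) me)))) (*-cong (reflexive (cong (\ z -> ind (lt z (g' j))) (E.trans (cong g' (jB i m)) me))) (*-congˡ (trans (h (s[ j ] g') px a″) (reflexive (cong₂ Ψ (cong₂ _∷_ here ik) there))))) where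
     me : g' (i I.+ + suc m) ≡ u
     me = E.trans (a _ (\ s q e -> a4 (suc m) (M.s≤s q) N.≤-refl (ae e))) (cong g (E.sym (gy i m)))
     px : QP (s[ j ] g')
     px x = E.trans (cong g' (kh (ar aa j) x)) (w' _)
     a″ : jA i (suc m) g (s[ j ] g')
     a″ y q = E.trans (cong g' (aY (q m (N.n≤1+n m)) (E.subst (y ≁_) (E.sym (jB i m)) (q (suc m) N.≤-refl)))) (hX {g'} a y q)
     here : s[ j ] g' j ≡ u
     here = E.trans (cong g' (E.trans (pi aa j) (jB i m))) me
     there : s[ j ] g' (i I.+ + suc m) ≡ g' j
     there = cong g' (E.trans (cong (sw aa j) (E.sym (jB i m))) (hE aa j))
     ik : win i m (s[ j ] g') ≡ win i m g'
     ik = cp i m (\ s q -> cong g' (aY (a4 m q (N.n≤1+n m)) (E.subst (i I.+ + s ≁_) (E.sym (jB i m)) (a4 (suc m) (N.m≤n⇒m≤1+n q) N.≤-refl))))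
   j2 : ∀ x ys z c Ψ -> Hs x (ys ++ z ∷ []) c Ψ ≈ Hs x ys z (\ o c' -> Ψ (o ++ c ∷ []) c') + ind (lt z c) * (x * Hs x ys c (\ o c' -> Ψ (o ++ z ∷ []) c'))
   j2 x [] z c Ψ = refl
   j2 x (y ∷ ys) z c Ψ = j2 x ys z c _
  module _ (lo : ℤ) (m : ℕ) where
   open Trace n lo m
   private
    e2 : ∀ {Q : ℤ -> Set} {us c o c'} -> Q c -> All Q us -> bu us c o c' -> Q c'
    e2 q [] eD = q
    e2 q (r ∷ rs) (b2 p) = r
    e2 q (r ∷ rs) (f8 p _) = e2 q rs p
    nf : ∀ a c -> eq a (c I.+ + n) ≡ eq (a I.- + n) c
    nf a c with eq (a I.- + n) c in q
    ... | true = cw (E.trans (L.solve 2 (\ a n -> a L.:= (a L.:- n) L.:+ n) E.refl a (+ n)) (cong (I._+ + n) (c3 q)))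
    ... | false = b7 (\ r -> kC q (E.trans (cong (I._- + n) r) (L.solve 2 (\ c n -> (c L.:+ n) L.:- n L.:= c) E.refl c (+ n))))
    iR : ∀ zs c -> AL (map (I._+ + n) zs) c ≈ AL zs (c I.- + n)
    iR [] c = refl
    iR (z ∷ zs) c = *-cong (reflexive (cong ind bF)) (iR zs c) where
     bF : lt (z I.+ + n) c ≡ lt z (c I.- + n)
     bF with lt z (c I.- + n) in q
     ... | true = bg (aB 0 (st (aO q)) (L.solve 3 (\ z c n -> c L.:- (z L.:+ n) L.:= ((c L.:- n) L.:- (z L.:+ L.I)) L.:+ L.I) E.refl z c (+ n)))
     ... | false = bk (\ r -> ky q (aB 0 (st r) (L.solve 3 (\ z c n -> (c L.:- n) L.:- z L.:= (c L.:- (z L.:+ n L.:+ L.I)) L.:+ L.I) E.refl z c (+ n))))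
    module ql (x : C) (b : ℤ) (φ : List ℤ -> C) (g : Fn) (w : QP g) (f4 : ∀ s -> s M.< n -> bW (g (b I.+ 1ℤ I.+ + s) I.- + n)) where
     B = b I.+ 1ℤ
     zs : ℕ -> List ℤ
     zs p = win B p g
     Θ : ℕ -> List ℤ -> ℤ -> C
     Θ p o c' = pow x p * (AL (zs p) (c' I.- + n) * φ (o ++ (c' I.- + n) ∷ zs p))
     chain : ∀ p q -> suc (q M.+ p) ≡ n -> Ch 1# x (B I.+ + p) q (Ch 0# x (b I.+ + n) p (\ g' -> φ (win b n g'))) g ≈ Hs x (win (B I.+ + p I.+ 1ℤ) q g) (g (B I.+ + p)) (Θ p)
     chain p q e = trans (nL 1# x (B I.+ + p) q g _ (Θ p) (E.subst (q M.<_) e (M.s≤s (N.m≤m+n q p))) w aQ) (Ks-1 x (win (B I.+ + p I.+ 1ℤ) q g) (g (B I.+ + p)) (Θ p)) where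
      E : + n ≡ 1ℤ I.+ (+ q I.+ + p)
      E = cong +_ (E.sym e)
      bn : B I.+ + p I.+ + q ≡ b I.+ + n
      bn = E.trans (L.solve 3 (\ b p q -> b L.:+ L.I L.:+ p L.:+ q L.:= b L.:+ (L.I L.:+ (q L.:+ p))) E.refl b (+ p) (+ q)) (cong (\ z -> b I.+ z) (E.sym E))
      aQ : ∀ g' -> QP g' -> jA (B I.+ + p) q g g' -> Ch 0# x (b I.+ + n) p (\ g″ -> φ (win b n g″)) g' ≈ Θ p (win (B I.+ + p) q g') (g' (B I.+ + p I.+ + q))
      aQ g' w' a = begin Ch 0# x (b I.+ + n) p (\ g″ -> φ (win b n g″)) g' ≈⟨ nL 0# x (b I.+ + n) p g' _ k3 (E.subst (p M.<_) e (M.s≤s (N.m≤n+m p q))) w' fq ⟩ Ks 0# x us (g' (b I.+ + n)) k3 ≈⟨ Ks-0 x us (g' (b I.+ + n)) k3 ⟩ pow x (length us) * (AL us (g' (b I.+ + n)) * k3 us (g' (b I.+ + n))) ≈⟨ *-cong (reflexive (cong (pow x) (aM _ p g'))) (*-cong (trans (reflexive (cong (\ z -> AL z (g' (b I.+ + n))) py)) (iR (zs p) (g' (b I.+ + n)))) (reflexive (cong (\ z -> φ (W ++ (g' (b I.+ + n) I.- + n) ∷ z)) (E.trans (cong (map (I._- + n)) py) (h9 (zs p)))))) ⟩ Θ p W (g' (b I.+ + n)) ≈⟨ reflexive (cong (\ z -> Θ p W (g' z)) (E.sym bn)) ⟩ Θ p W (g' (B I.+ + p I.+ + q)) ∎ 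where
       W = win (B I.+ + p) q g'
       us = win (b I.+ + n I.+ 1ℤ) p g'
       k3 : List ℤ -> ℤ -> C
       k3 us c = φ (W ++ (c I.- + n) ∷ map (I._- + n) us)
       h9 : ∀ l -> map (I._- + n) (map (I._+ + n) l) ≡ l
       h9 [] = E.refl
       h9 (z ∷ l) = cong₂ _∷_ (L.solve 2 (\ z n -> (z L.:+ n) L.:- n L.:= z) E.refl z (+ n)) (h9 l)
       py : us ≡ map (I._+ + n) (zs p)
       py = E.trans (cong (\ z -> win z p g') (L.solve 2 (\ b n -> b L.:+ n L.:+ L.I L.:= b L.:+ L.I L.:+ n) E.refl b (+ n))) (E.trans (h6 B p (I._+ + n) {g'} {g'} (+ n) w') (cong (map (I._+ + n)) (cp B p (\ s r -> a _ (\ t t≤ -> cc s t r t≤))))) where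
        cc : ∀ s t -> s M.< p -> t M.≤ q -> B I.+ + s ≁ B I.+ + p I.+ + t
        cc s t r t≤ = bm (aB 0 (I.+≤+ r & I.+≤+ {0} {t} M.z≤n) (L.solve 4 (\ B s p t -> (B L.:+ p L.:+ t) L.:- (B L.:+ s) L.:= ((p L.:+ t) L.:- (L.I L.:+ s L.:+ L.O)) L.:+ L.I) E.refl B (+ s) (+ p) (+ t))) (aB 0 (I.+≤+ t≤ & I.+≤+ {0} {s} M.z≤n) (E.trans (cong (\ z -> (B I.+ + s I.+ z) I.- (B I.+ + p I.+ + t)) E) (L.solve 5 (\ B s p t q -> (B L.:+ s L.:+ (L.I L.:+ (q L.:+ p))) L.:- (B L.:+ p L.:+ t) L.:= ((q L.:+ s) L.:- (t L.:+ L.O)) L.:+ L.I) E.refl B (+ s) (+ p) (+ t) (+ q))))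
       fq : ∀ g″ -> QP g″ -> jA (b I.+ + n) p g' g″ -> φ (win b n g″) ≈ k3 (win (b I.+ + n) p g″) (g″ (b I.+ + n I.+ + p))
       fq g″ px a' = reflexive (cong φ (E.trans (cong (\ z -> win b z g″) (E.trans (E.sym e) (E.sym (N.+-suc q p)))) (E.trans (lG b (suc p) q g″) (cong₂ _++_ (E.trans (cong (\ z -> win z q g″) (E.sym (gy b p))) (cp (B I.+ + p) q (\ s r -> a' _ (\ t t≤ -> cc s t r t≤)))) (cong₂ _∷_ (hJ (b I.+ + p) _ (L.solve 3 (\ b n p -> b L.:+ n L.:+ p L.:= b L.:+ p L.:+ n) E.refl b (+ n) (+ p))) wins))))) where
        hJ : ∀ y z -> z ≡ y I.+ + n -> g″ y ≡ g″ z I.- + n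
        hJ y z E.refl = E.trans (L.solve 2 (\ a n -> a L.:= (a L.:+ n) L.:- n) E.refl (g″ y) (+ n)) (cong (I._- + n) (E.sym (px y)))
        wins : win b p g″ ≡ map (I._- + n) (win (b I.+ + n) p g″)
        wins = E.trans (E.sym (mI (win b p g″))) (cong (map (I._- + n)) (E.sym (h6 b p (I._+ + n) (+ n) px))) where
         mI : ∀ l -> map (I._- + n) (map (I._+ + n) l) ≡ l
         mI = h9
        cc : ∀ s t -> s M.< q -> t M.≤ p -> B I.+ + p I.+ + s ≁ b I.+ + n I.+ + t
        cc s t r t≤ = bm (aB 0 (I.+≤+ r & I.+≤+ {0} {t} M.z≤n) (E.trans (cong (\ z -> (b I.+ z I.+ + t) I.- (B I.+ + p I.+ + s)) E) (L.solve 5 (\ b s p t q -> (b L.:+ (L.I L.:+ (q L.:+ p)) L.:+ t) L.:- (b L.:+ L.I L.:+ p L.:+ s) L.:= ((q L.:+ t) L.:- (L.I L.:+ s L.:+ L.O)) L.:+ L.I) E.refl b (+ s) (+ p) (+ t) (+ q)))) (aB 0 (I.+≤+ t≤ & I.+≤+ {0} {s} M.z≤n) (L.solve 5 (\ b s p t n -> (b L.:+ L.I L.:+ p L.:+ s L.:+ n) L.:- (b L.:+ n L.:+ t) L.:= ((p L.:+ s) L.:- (t L.:+ L.O)) L.:+ L.I) E.refl b (+ s) (+ p) (+ t) (+ n)))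
     bl : ℤ -> List ℤ -> ℤ -> C
     bl c o c' = ind (eq c' (c I.+ + n)) * φ o
     -- The part of the trace in which the carrier has jumped over the first p entries.
     oD : ℕ -> ℕ -> C
     oD p q = Σc (\ c -> pow x p * (AL (zs p) c * Hs x (win (B I.+ + p) q g) c (\ o c' -> bl c (o ++ zs p) c')))
     oA : ∀ p q -> q M.+ p ≡ n -> All (\ z -> bW (z I.- + n)) (win (B I.+ + p) q g)
     oA p q e = gD (B I.+ + p) q (\ s r -> E.subst (\ z -> bW (g z I.- + n)) (E.sym (Z.+-assoc B (+ p) (+ s))) (f4 (p M.+ s) (E.subst (p M.+ s M.<_) (E.trans (N.+-comm p q) e) (N.+-monoʳ-< p r))))
     oP : ∀ p q -> suc (q M.+ p) ≡ n -> Σc (\ c -> pow x p * (AL (zs p) c * Hs x (win (B I.+ + p I.+ 1ℤ) q g) (g (B I.+ + p)) (\ o c' -> bl c (o ++ c ∷ zs p) c'))) ≈ Hs x (win (B I.+ + p I.+ 1ℤ) q g) (g (B I.+ + p)) (Θ p)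
     oP p q e = begin _ ≈⟨ sumR-cong lo m (\ c -> trans (*-congˡ (sym (hS x ys z (AL (zs p) c) (\ o c' -> bl c (o ++ c ∷ zs p) c')))) (sym (hS x ys z (pow x p) _))) ⟩ Σc (\ c -> Hs x ys z (\ o c' -> pow x p * (AL (zs p) c * bl c (o ++ c ∷ zs p) c'))) ≈⟨ sym (kK x ys z lo m (\ c o c' -> pow x p * (AL (zs p) c * bl c (o ++ c ∷ zs p) c'))) ⟩ Hs x ys z (\ o c' -> Σc (\ c -> pow x p * (AL (zs p) c * bl c (o ++ c ∷ zs p) c'))) ≈⟨ g4 x ys z (\ o c' eS -> let r = e2 {Q = \ v -> bW (v I.- + n)} mN ik eS in trans (sumR-cong lo m (\ c -> trans (solve 4 (\ p a i f -> p :* (a :* (i :* f)) := i :* (p :* (a :* f))) refl (pow x p) (AL (zs p) c) (ind (eq c' (c I.+ + n))) (φ (o ++ c ∷ zs p))) (*-congʳ (reflexive (cong ind (nf c' c)))))) (bj lo m (c' I.- + n) (\ c -> pow x p * (AL (zs p) c * φ (o ++ c ∷ zs p))) (proj₁ r) (proj₂ r))) ⟩ Hs x ys z (Θ p) ∎ where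
      ys = win (B I.+ + p I.+ 1ℤ) q g
      z = g (B I.+ + p)
      whole = oA p (suc q) e
      mN : bW (z I.- + n)
      mN = E.subst (\ v -> bW (g v I.- + n)) E.refl (f4 p (E.subst (p M.<_) e (M.s≤s (N.m≤n+m p q))))
      ik : All (\ v -> bW (v I.- + n)) ys
      ik = gD (B I.+ + p I.+ 1ℤ) q (\ s r -> E.subst (\ v -> bW (g v I.- + n)) (L.solve 3 (\ B p s -> B L.:+ (p L.:+ (L.I L.:+ s)) L.:= B L.:+ p L.:+ L.I L.:+ s) E.refl B (+ p) (+ s)) (f4 (p M.+ suc s) (E.subst (p M.+ suc s M.<_) (E.trans (N.+-comm p (suc q)) e) (N.+-monoʳ-< p (M.s≤s r)))))
     -- Either the carrier is exchanged at the next entry, which makes b + p the first missing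
     -- letter, or it jumps once more. It cannot jump over all n entries, since it has to leave with
     -- its value increased by n.
     lQ : ∀ p q -> q M.+ p ≡ n -> oD p q ≈ Hgo x b (\ g' -> φ (win b n g')) g p q
     lQ p zero e = ff lo m (\ c -> trans (*-congˡ (trans (*-congˡ (ind-false _ (b7 (\ r -> loop c r)))) (zeroʳ _))) (zeroʳ _)) where
      loop : ∀ c -> c ≡ c I.+ + n -> ⊥
      loop c r = Z.<-irrefl r (aB 0 (I.+≤+ (M.>-nonZero⁻¹ n)) (L.solve 2 (\ c n -> (c L.:+ n) L.:- c L.:= (n L.:- L.I) L.:+ L.I) E.refl c (+ n)))
     lQ p (suc q) e = begin oD p (suc q) ≈⟨ sumR-cong lo m a8 ⟩ Σc (\ c -> jG c + qf c) ≈⟨ bI lo m jG qf ⟩ Σc jG + oD (suc p) q ≈⟨ +-cong (trans (oP p q e) (sym (chain p q e))) (lQ (suc p) q (E.trans (N.+-suc q p) e)) ⟩ _ ∎ where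
      ys = win (B I.+ + p I.+ 1ℤ) q g
      z = g (B I.+ + p)
      jG qf : ℤ -> C
      jG c = pow x p * (AL (zs p) c * Hs x ys z (\ o c' -> bl c (o ++ c ∷ zs p) c'))
      qf c = pow x (suc p) * (AL (zs (suc p)) c * Hs x (win (B I.+ + suc p) q g) c (\ o c' -> bl c (o ++ zs (suc p)) c'))
      a8 : ∀ c -> pow x p * (AL (zs p) c * Hs x (win (B I.+ + p) (suc q) g) c (\ o c' -> bl c (o ++ zs p) c')) ≈ jG c + qf c
      a8 c = begin _ ≈⟨ *-congˡ (*-congˡ (trans (reflexive (cong (\ l -> Hs x l c (\ o c' -> bl c (o ++ zs p) c')) (h5 (B I.+ + p) q g))) (j2 x ys z c _))) ⟩ _ ≈⟨ *-congˡ (*-congˡ (+-cong (Hs-cong' x ys z (\ o c' -> reflexive (cong (\ l -> bl c l c') (LP.++-assoc o (c ∷ []) (zs p))))) (*-congˡ (*-congˡ (trans (Hs-cong' x ys c (\ o c' -> reflexive (cong (\ l -> bl c l c') (LP.++-assoc o (z ∷ []) (zs p))))) (reflexive (cong (\ y -> Hs x (win y q g) c (\ o c' -> bl c (o ++ zs (suc p)) c')) (jB B p)))))))) ⟩ _ ≈⟨ solve 6 (\ p a h i x k -> p :* (a :* (h :+ i :* (x :* k))) := p :* (a :* h) :+ (x :* p) :* ((i :* a) :* k)) refl (pow x p) (AL (zs p) c) _ (ind (lt z c)) x _ ⟩ jG c + qf c ∎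
   -- A carrier that contributes is an entry of the window minus n; the last hypothesis places all
   -- of these in the range of summation.
   Hb-HH : ∀ x b φ g -> QP g -> (∀ s -> s M.< n -> bW (g (b I.+ 1ℤ I.+ + s) I.- + n)) -> Hb x b (\ g' -> φ (win b n g')) g ≈ HH x φ (win (b I.+ 1ℤ) n g)
   Hb-HH x b φ g w f4 = sym (trans (sumR-cong lo m (\ c -> trans (reflexive (cong (\ y -> Hs x (win y n g) c (bl c)) (E.sym (Z.+-identityʳ B)))) (trans (Hs-cong' x (win (B I.+ + 0) n g) c (\ o c' -> reflexive (cong (\ l -> bl c l c') (E.sym (LP.++-identityʳ o))))) (sym (trans (*-identityˡ _) (*-identityˡ _)))))) (lQ 0 n (N.+-identityʳ n))) where open ql x b φ g w f4

-- Periodic sums over positions and pairs of positions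

module mj where
 open dK
 open cV
 open ad
 open import Data.Product using (_×_)
 module dj (n : ℕ) .{{nz : NonZero n}} where
  open ay n
  abstract
   cg : ℤ -> ℤ -> Bool
   cg a i = does (a ∼? i)
   d0 : ∀ {a i} -> a ∼ i -> cg a i ≡ true
   d0 {a} {i} p = dec-true (a ∼? i) p
   d1 : ∀ {a i} -> a ≁ i -> cg a i ≡ false
   d1 {a} {i} p = dec-false (a ∼? i) p
  rep : ∀ i -> Σ ℤ \ a -> a ∼ i × 1ℤ I.≤ a × a I.< 1ℤ I.+ + n
  rep i = 1ℤ I.+ + r , ae (mk∼ ((i I.- 1ℤ) /ℕ n) (E.trans (L.solve 1 (\ i -> i L.:= L.I L.:+ (i L.:- L.I)) E.refl i) (E.trans (cong (I._+_ 1ℤ) (a≡a%ℕn+[a/ℕn]*n (i I.- 1ℤ) n)) (E.sym (Z.+-assoc 1ℤ (+ r) ((i I.- 1ℤ) /ℕ n I.* + n)))))) , Z.i≤i+j 1ℤ (+ r) , Z.+-monoʳ-< 1ℤ (I.+<+ (n%ℕd<d (i I.- 1ℤ) n)) where r = (i I.- 1ℤ) %ℕ n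
 module e4 (R : CommutativeRing 0ℓ 0ℓ) (n : ℕ) .{{nz : NonZero n}} (aa : 2 M.≤ n) where
  open aE R
  open ay n
  open dj n
  private
   fg : ∀ lo m -> lo I.+ 1ℤ I.+ + m ≡ lo I.+ + suc m
   fg lo m = Z.+-assoc lo 1ℤ (+ m)
  eM : ∀ lo m (e : ℤ -> C) -> sumR lo m (\ b -> e b - e (b I.- 1ℤ)) ≈ e (lo I.+ + m I.- 1ℤ) - e (lo I.- 1ℤ)
  eM lo zero e = sym (trans (+-congʳ (reflexive (cong (\ z -> e (z I.- 1ℤ)) (Z.+-identityʳ lo)))) (-‿inverseʳ _))
  eM lo (suc m) e = trans (+-congˡ (trans (eM (lo I.+ 1ℤ) m e) (+-cong (reflexive (cong (\ z -> e (z I.- 1ℤ)) (fg lo m))) (-‿cong (reflexive (cong e (L.solve 1 (\ l -> l L.:+ L.I L.:- L.I L.:= l) E.refl lo))))))) (solve 3 (\ a b c -> (a :- b) :+ (c :- a) := c :- b) refl (e lo) (e (lo I.- 1ℤ)) (e (lo I.+ + suc m I.- 1ℤ)))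
  module _ (i : ℤ) where
   private
    σ : ℤ -> ℤ
    σ = sw aa i
   jC : (ℤ -> C) -> ℤ -> C
   jC h b = ind (cg b i) * (h (b I.+ 1ℤ) - h b)
   private
    az : ∀ {b} -> b ∼ i I.+ 1ℤ -> b I.- 1ℤ ∼ i
    az {b} p = E.subst (b I.- 1ℤ ∼_) (L.solve 1 (\ i -> i L.:+ L.I L.:- L.I L.:= i) E.refl i) (fO (I.- 1ℤ) p)
    a7 : ∀ {b} -> b I.- 1ℤ ∼ i -> b ∼ i I.+ 1ℤ
    a7 {b} p = E.subst (_∼ i I.+ 1ℤ) (L.solve 1 (\ b -> b L.:- L.I L.:+ L.I L.:= b) E.refl b) (fO 1ℤ p)
   nZ : ∀ h b -> h b ≈ 0# -> h (b I.+ 1ℤ) ≈ 0# -> jC h b ≈ 0#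
   nZ h b p q = aU (cg b i) (\ _ -> trans (+-cong q (-‿cong p)) (-‿inverseʳ 0#))
   -- The exchange of neighbouring values is written as a difference, so that its sum over an
   -- interval is a boundary term (`eM`).
   la : ∀ (h : ℤ -> C) b -> h (σ b) ≈ h b + (jC h b - jC h (b I.- 1ℤ))
   la h b with b ∼? i
   ... | yes p = trans (reflexive (cong h (E.trans (fW p) (L.solve 2 (\ b i -> b L.:+ (i L.:+ L.I L.:- i) L.:= b L.:+ L.I) E.refl b i)))) (trans (solve 2 (\ a b -> a := b :+ ((a :- b) :- con 0ℤ)) refl (h (b I.+ 1ℤ)) (h b)) (+-congˡ (+-cong (sym (ind-true _ (d0 p))) (-‿cong (sym (ind-false _ (d1 (\ q -> ar aa i (af (ae p) (a7 q))))))))))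
   ... | no p with b ∼? (i I.+ 1ℤ)
   ... | yes q = trans (reflexive (cong h (E.trans (fV (ar aa i) q) (L.solve 2 (\ b i -> b L.:+ (i L.:- (i L.:+ L.I)) L.:= b L.:- L.I) E.refl b i)))) (trans (solve 2 (\ a b -> a := b :+ (con 0ℤ :- (b :- a))) refl (h (b I.- 1ℤ)) (h b)) (+-congˡ (+-cong (sym (ind-false _ (d1 p))) (-‿cong (trans (+-congʳ (reflexive (cong h (L.solve 1 (\ b -> b L.:= b L.:- L.I L.:+ L.I) E.refl b)))) (sym (ind-true _ (d0 (az q)))))))))
   ... | no q = trans (reflexive (cong h (aY p q))) (trans (solve 1 (\ b -> b := b :+ (con 0ℤ :- con 0ℤ)) refl (h b)) (+-congˡ (+-cong (sym (ind-false _ (d1 p))) (-‿cong (sym (ind-false _ (d1 (\ r -> q (a7 r)))))))))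
   f0 : ∀ lo m h -> jC h (lo I.+ + m I.- 1ℤ) ≈ jC h (lo I.- 1ℤ) -> sumR lo m (\ b -> h (σ b)) ≈ sumR lo m h
   f0 lo m h e = begin sumR lo m (\ b -> h (σ b)) ≈⟨ sumR-cong lo m (la h) ⟩ sumR lo m (\ b -> h b + (jC h b - jC h (b I.- 1ℤ))) ≈⟨ bI lo m h _ ⟩ sumR lo m h + sumR lo m (\ b -> jC h b - jC h (b I.- 1ℤ)) ≈⟨ +-congˡ (trans (eM lo m (jC h)) (trans (+-congʳ e) (-‿inverseʳ _))) ⟩ sumR lo m h + 0# ≈⟨ +-identityʳ _ ⟩ sumR lo m h ∎
  kj : ∀ lo m (h : ℤ -> C) -> h lo ≈ 0# -> h (lo I.+ + m) ≈ 0# -> sumR lo m h ≈ sumR (lo I.+ 1ℤ) m h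
  kj lo m h p q = begin sumR lo m h ≈⟨ sym (+-identityʳ _) ⟩ sumR lo m h + 0# ≈⟨ +-congˡ (sym q) ⟩ sumR lo m h + h (lo I.+ + m) ≈⟨ sym (fq lo m) ⟩ h lo + sumR (lo I.+ 1ℤ) m h ≈⟨ +-congʳ p ⟩ 0# + sumR (lo I.+ 1ℤ) m h ≈⟨ +-identityˡ _ ⟩ sumR (lo I.+ 1ℤ) m h ∎ where
   fq : ∀ lo m -> sumR lo (suc m) h ≈ sumR lo m h + h (lo I.+ + m)
   fq lo zero = trans (+-comm _ _) (+-congˡ (reflexive (cong h (E.sym (Z.+-identityʳ lo)))))
   fq lo (suc m) = trans (+-congˡ (trans (fq (lo I.+ 1ℤ) m) (+-congˡ (reflexive (cong h (fg lo m)))))) (sym (+-assoc _ _ _))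
  d7 : (ℤ -> C) -> C
  d7 = sumR 1ℤ n
  -- Over one period the two boundary terms agree, because h grows by the same amount over every
  -- distance n.
  fb : ∀ i h -> (∀ a -> h (a I.+ + n) - h a ≈ h (1ℤ I.+ + n) - h 1ℤ) -> d7 (\ a -> h (sw aa i a)) ≈ d7 h
  fb i h per = f0 i 1ℤ n h (trans (*-cong (reflexive (cong ind bF)) ck) (reflexive (cong (jC i h) E.refl))) where
   hI : 1ℤ I.+ + n I.- 1ℤ ≡ 0ℤ I.+ + n
   hI = L.solve 1 (\ n -> L.I L.:+ n L.:- L.I L.:= L.O L.:+ n) E.refl (+ n)
   bF : cg (1ℤ I.+ + n I.- 1ℤ) i ≡ cg 0ℤ i
   bF with 0ℤ ∼? i
   ... | yes p = E.trans (d0 (E.subst (_∼ i) (E.sym hI) (af bv p))) (E.sym (d0 p))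
   ... | no p = E.trans (d1 (\ q -> p (af (ae bv) (E.subst (_∼ i) hI q)))) (E.sym (d1 p))
   ck : h (1ℤ I.+ + n I.- 1ℤ I.+ 1ℤ) - h (1ℤ I.+ + n I.- 1ℤ) ≈ h (0ℤ I.+ 1ℤ) - h 0ℤ
   ck = begin h (1ℤ I.+ + n I.- 1ℤ I.+ 1ℤ) - h (1ℤ I.+ + n I.- 1ℤ) ≈⟨ +-cong (reflexive (cong h (L.solve 1 (\ n -> L.I L.:+ n L.:- L.I L.:+ L.I L.:= L.I L.:+ n) E.refl (+ n)))) (-‿cong (reflexive (cong h hI))) ⟩ h (1ℤ I.+ + n) - h (0ℤ I.+ + n) ≈⟨ solve 4 (\ a b c d -> a :- b := ((a :- c) :- (b :- d)) :+ (c :- d)) refl (h (1ℤ I.+ + n)) (h (0ℤ I.+ + n)) (h 1ℤ) (h 0ℤ) ⟩ ((h (1ℤ I.+ + n) - h 1ℤ) - (h (0ℤ I.+ + n) - h 0ℤ)) + (h 1ℤ - h 0ℤ) ≈⟨ +-congʳ (trans (+-congˡ (-‿cong (per 0ℤ))) (-‿inverseʳ _)) ⟩ 0# + (h 1ℤ - h 0ℤ) ≈⟨ +-identityˡ _ ⟩ h 1ℤ - h 0ℤ ∎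
  ec : ∀ i z -> d7 (\ a -> ind (cg a i) * z) ≈ z
  ec i z = let a , p , q , r = rep i in trans (aV 1ℤ n (\ x lo hi -> *-congʳ (reflexive (cong ind (bF a p q r x lo hi))))) (bj 1ℤ n a (\ _ -> z) q r) where
   bF : ∀ a -> a ∼ i -> 1ℤ I.≤ a -> a I.< 1ℤ I.+ + n -> ∀ x -> 1ℤ I.≤ x -> x I.< 1ℤ I.+ + n -> cg x i ≡ eq a x
   bF a p q r x lo hi with a I.≟ x
   ... | yes E.refl = E.trans (d0 p) (E.sym (cw E.refl))
   ... | no ne = E.trans (d1 (\ s -> ne (bQ (af p (ae s)) (Z.<-≤-trans r (Z.+-monoˡ-≤ (+ n) lo)) (Z.<-≤-trans hi (Z.+-monoˡ-≤ (+ n) q))))) (E.sym (b7 ne))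
  iA : ℕ -> (ℤ -> ℤ -> C) -> ℤ -> C
  iA N φ a = sumR (a I.- + N) (N M.+ N) (φ a)
  -- Pairs up to simultaneous translation by n: one period for a, distance N for b.
  fw : ℕ -> (ℤ -> ℤ -> C) -> C
  fw N φ = d7 (iA N φ)
  bh : ∀ N {φ ψ : ℤ -> ℤ -> C} -> (∀ a b -> φ a b ≈ ψ a b) -> fw N φ ≈ fw N ψ
  bh N e = sumR-cong 1ℤ n (\ a -> sumR-cong (a I.- + N) (N M.+ N) (e a))
  l8 : ∀ N (φ ψ : ℤ -> ℤ -> C) -> fw N (\ a b -> φ a b + ψ a b) ≈ fw N φ + fw N ψ
  l8 N φ ψ = trans (sumR-cong 1ℤ n (\ a -> bI (a I.- + N) (N M.+ N) (φ a) (ψ a))) (bI 1ℤ n _ _)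
  l9 : ∀ N z (φ : ℤ -> ℤ -> C) -> fw N (\ a b -> z * φ a b) ≈ z * fw N φ
  l9 N z φ = trans (sumR-cong 1ℤ n (\ a -> bJ (a I.- + N) (N M.+ N) z (φ a))) (bJ 1ℤ n z _)
  record iO (M : ℕ) (φ : ℤ -> ℤ -> C) : Set where
   field
    i6 : ∀ a b -> φ (a I.+ + n) (b I.+ + n) ≈ φ a b
    pj : ∀ a b -> b I.+ + M I.< a -> φ a b ≈ 0#
    kr : ∀ a b -> a I.+ + M I.< b -> φ a b ≈ 0#
  open iO
  private
   end : ∀ a N -> a I.- + N I.+ + (N M.+ N) ≡ a I.+ + N
   end a N = L.solve 2 (\ a N -> a L.:- N L.:+ (N L.:+ N) L.:= a L.:+ N) E.refl a (+ N)
  eB : ∀ {M N φ} -> iO M φ -> ∀ a -> iA N φ (a I.+ + n) ≈ iA N φ a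
  eB {M} {N} {φ} L a = trans (reflexive (cong (\ z -> sumR z (N M.+ N) (φ (a I.+ + n))) (L.solve 3 (\ a n N -> a L.:+ n L.:- N L.:= a L.:- N L.:+ n) E.refl a (+ n) (+ N)))) (go (a I.- + N) (N M.+ N)) where
   go : ∀ lo m -> sumR (lo I.+ + n) m (φ (a I.+ + n)) ≈ sumR lo m (φ a)
   go lo zero = refl
   go lo (suc m) = +-cong (i6 L a lo) (trans (reflexive (cong (\ z -> sumR z m (φ (a I.+ + n))) (L.solve 2 (\ l n -> l L.:+ n L.:+ L.I L.:= l L.:+ L.I L.:+ n) E.refl lo (+ n)))) (go (lo I.+ 1ℤ) m))
  private
   iI : ∀ {M N} -> M M.+ 2 M.< N -> ∀ a c -> a I.≤ c I.+ 1ℤ -> ∀ b -> b I.≤ a I.- + N -> b I.+ + M I.< c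
   iI {M} {N} p a c q b r = aB 1 (I.+≤+ p & q & r) (L.solve 5 (\ a b c M N -> c L.:- (b L.:+ M) L.:= ((N L.:+ (c L.:+ L.I L.:+ (a L.:- N))) L.:- (L.I L.:+ (M L.:+ L.con (+ 2)) L.:+ (a L.:+ b))) L.:+ L.con (+ 2)) E.refl a b c (+ M) (+ N))
   gm : ∀ {M N} -> M M.+ 2 M.< N -> ∀ a c -> c I.≤ a I.+ 1ℤ -> ∀ b -> a I.+ + N I.≤ b I.+ 1ℤ -> c I.+ + M I.< b
   gm {M} {N} p a c q b r = aB 0 (I.+≤+ p & q & r) (L.solve 5 (\ a b c M N -> b L.:- (c L.:+ M) L.:= ((N L.:+ (a L.:+ L.I L.:+ (b L.:+ L.I))) L.:- (L.I L.:+ (M L.:+ L.con (+ 2)) L.:+ (c L.:+ (a L.:+ N)))) L.:+ L.I) E.refl a b c (+ M) (+ N))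
   lY : ∀ i a -> sw aa i a I.≤ a I.+ 1ℤ × a I.≤ sw aa i a I.+ 1ℤ
   lY i a = let p , q = fc 1 (ar aa i) Z.≤-refl (Z.≤-trans (Z.i≤i+j i 1ℤ) (Z.i≤i+j _ 1ℤ)) a in q , p
  eA : ∀ {M N φ} -> iO M φ -> M M.+ 2 M.< N -> ∀ a c -> c ≡ a I.+ 1ℤ -> sumR (a I.- + N) (N M.+ N) (φ c) ≈ iA N φ c × sumR (c I.- + N) (N M.+ N) (φ a) ≈ iA N φ a
  eA {M} {N} {φ} L p a .(a I.+ 1ℤ) E.refl = trans (ck (a I.+ 1ℤ) Z.≤-refl (Z.≤-trans (Z.i≤i+j a 1ℤ) (Z.i≤i+j _ 1ℤ))) (reflexive (cong (\ z -> sumR z (N M.+ N) (φ (a I.+ 1ℤ))) e)) , sym (trans (ck a (Z.i≤i+j a 1ℤ) (Z.i≤i+j a 1ℤ)) (reflexive (cong (\ z -> sumR z (N M.+ N) (φ a)) e))) where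
   e : a I.- + N I.+ 1ℤ ≡ a I.+ 1ℤ I.- + N
   e = L.solve 2 (\ a N -> a L.:- N L.:+ L.I L.:= a L.:+ L.I L.:- N) E.refl a (+ N)
   ck : ∀ c -> c I.≤ a I.+ 1ℤ -> a I.≤ c I.+ 1ℤ -> sumR (a I.- + N) (N M.+ N) (φ c) ≈ sumR (a I.- + N I.+ 1ℤ) (N M.+ N) (φ c)
   ck c q r = kj (a I.- + N) (N M.+ N) (φ c) (pj L c _ (iI p a c r _ Z.≤-refl)) (kr L c _ (gm p a c q _ (Z.≤-trans (Z.≤-reflexive (E.sym (end a N))) (Z.i≤i+j _ 1ℤ))))
  -- s_i only permutes the pairs. It changes the distance of a pair by at most 2, which is the slack
  -- in M + 2 < N.
  fv : ∀ {M N φ} i -> iO M φ -> M M.+ 2 M.< N -> fw N (\ a b -> φ (sw aa i a) (sw aa i b)) ≈ fw N φ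
  fv {M} {N} {φ} i L p = trans (sumR-cong 1ℤ n aQ) (fb i (iA N φ) (\ a -> trans (trans (+-congʳ (eB {N = N} L a)) (-‿inverseʳ _)) (sym (trans (+-congʳ (eB {N = N} L 1ℤ)) (-‿inverseʳ _))))) where
   σ = sw aa i
   mU : ∀ a -> sumR (a I.- + N) (N M.+ N) (φ (σ a)) ≈ iA N φ (σ a)
   mU a with a ∼? i
   ... | yes q = trans (proj₁ (eA L p a _ e)) refl where
    e : σ a ≡ a I.+ 1ℤ
    e = E.trans (fW q) (L.solve 2 (\ b i -> b L.:+ (i L.:+ L.I L.:- i) L.:= b L.:+ L.I) E.refl a i)
   ... | no q with a ∼? (i I.+ 1ℤ)
   ... | yes r = proj₂ (eA L p (σ a) a (E.sym (E.trans (cong (I._+ 1ℤ) (fV (ar aa i) r)) (L.solve 2 (\ b i -> b L.:+ (i L.:- (i L.:+ L.I)) L.:+ L.I L.:= b) E.refl a i))))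
   ... | no r = reflexive (cong (\ z -> sumR (z I.- + N) (N M.+ N) (φ (σ a))) (E.sym (aY q r)))
   aQ : ∀ a -> sumR (a I.- + N) (N M.+ N) (\ b -> φ (σ a) (σ b)) ≈ iA N φ (σ a)
   aQ a = trans (f0 i (a I.- + N) (N M.+ N) (φ (σ a)) (trans (nZ i (φ (σ a)) _ (kr L _ _ hi) (kr L _ _ (Z.<-≤-trans hi (Z.i≤i+j _ 1ℤ)))) (sym (nZ i (φ (σ a)) _ (pj L _ _ (iI p a (σ a) (proj₂ (lY i a)) _ (Z.i-j≤i (a I.- + N) 1ℤ))) (pj L _ _ (iI p a (σ a) (proj₂ (lY i a)) _ (Z.≤-reflexive (L.solve 1 (\ x -> x L.:- L.I L.:+ L.I L.:= x) E.refl (a I.- + N))))))))) (mU a) where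
    hi : σ a I.+ + M I.< a I.- + N I.+ + (N M.+ N) I.- 1ℤ
    hi = gm p a (σ a) (proj₁ (lY i a)) _ (Z.≤-reflexive (L.solve 2 (\ a N -> a L.:+ N L.:= a L.:- N L.:+ (N L.:+ N) L.:- L.I L.:+ L.I) E.refl a (+ N)))
  el : ∀ N i c z -> I.- + N I.≤ c -> c I.< + N -> fw N (\ a b -> ind (cg a i) * (ind (eq (a I.+ c) b) * z)) ≈ z
  el N i c z p q = trans (sumR-cong 1ℤ n (\ a -> trans (bJ (a I.- + N) (N M.+ N) (ind (cg a i)) (\ b -> ind (eq (a I.+ c) b) * z)) (*-congˡ (bj (a I.- + N) (N M.+ N) (a I.+ c) (\ _ -> z) (Z.+-monoʳ-≤ a p) (E.subst (a I.+ c I.<_) (E.sym (end a N)) (Z.+-monoʳ-< a q)))))) (ec i z)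
  nh : ∀ {M N φ} -> iO M φ -> M M.< N -> fw N φ ≈ fw (suc N) φ
  nh {M} {N} {φ} L p = sumR-cong 1ℤ n (\ a -> begin iA N φ a ≈⟨ sym (trans (+-cong (pj L a _ (lo a)) refl) (+-identityˡ _)) ⟩ φ a (a I.- + suc N) + iA N φ a ≈⟨ +-congˡ (sym (trans (+-congˡ (kr L a _ (hi a))) (+-identityʳ _))) ⟩ φ a (a I.- + suc N) + (iA N φ a + φ a (a I.- + N I.+ + (N M.+ N))) ≈⟨ +-congˡ (trans (sym (fq (a I.- + N) (N M.+ N) (φ a))) (reflexive (cong₂ (\ y z -> sumR y z (φ a)) (L.solve 2 (\ a N -> a L.:- N L.:= a L.:- (L.I L.:+ N) L.:+ L.I) E.refl a (+ N)) (E.sym (N.+-suc N N))))) ⟩ iA (suc N) φ a ∎) where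
   fq : ∀ lo m h -> sumR lo (suc m) h ≈ sumR lo m h + h (lo I.+ + m)
   fq lo zero h = trans (+-comm _ _) (+-congˡ (reflexive (cong h (E.sym (Z.+-identityʳ lo)))))
   fq lo (suc m) h = trans (+-congˡ (trans (fq (lo I.+ 1ℤ) m h) (+-congˡ (reflexive (cong h (fg lo m)))))) (sym (+-assoc _ _ _))
   lo : ∀ a -> a I.- + suc N I.+ + M I.< a
   lo a = aB 1 (I.+≤+ p) (L.solve 3 (\ a N M -> a L.:- (a L.:- (L.I L.:+ N) L.:+ M) L.:= (N L.:- (L.I L.:+ M)) L.:+ L.con (+ 2)) E.refl a (+ N) (+ M))
   hi : ∀ a -> a I.+ + M I.< a I.- + N I.+ + (N M.+ N)
   hi a = aB 0 (I.+≤+ p) (L.solve 3 (\ a N M -> (a L.:- N L.:+ (N L.:+ N)) L.:- (a L.:+ M) L.:= (N L.:- (L.I L.:+ M)) L.:+ L.I) E.refl a (+ N) (+ M))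

-- Covers and simple reflections

module fJ where
 open dK
 open cV
 open cB using (Fn)
 open ad
 open import Data.Integer using (_+_; _*_; -_; _-_; _≤_; _<_)
 open import Data.Product using (_×_)
 open import Relation.Nullary.Decidable using (_×-dec_; ¬?; map′)
 open E using (sym; trans; subst; refl)
 open L hiding (I; O)
 module e6 (n : ℕ) .{{nz : NonZero n}} (aa : 2 M.≤ n) where
  open ay n
  -- The Bruhat covers g < g t_ab of the affine symmetric group, read off from positions and values.
  record Cov (g : Fn) (a b : ℤ) : Set where
   constructor mkCov
   field
    ord : a < b
    a4 : a ≁ b
    asc : g a < g b
    gap : ∀ c -> a < c -> c < b -> ¬ (g a < g c × g c < g b)
  open Cov public
  private
   lS : ∀ {a c} -> a < c -> Σ ℕ \ s -> c ≡ a + + s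
   lS {a} {c} p with Z.i≤j⇒0≤j-i (Z.<⇒≤ p)
   ... | q with c - a in e
   ... | + s = s , trans (solve 2 (\ c a -> c := a :+ (c :- a)) refl c a) (cong (\ z -> a + z) e)
   lS p | () | -[1+ _ ]
  nH : ∀ g a b -> Dec (Cov g a b)
  nH g a b with a I.<? b
  ... | no p = no (\ c -> p (ord c))
  ... | yes p with lS p
  ... | m , e = map′ to from (¬? (a ∼? b) ×-dec (g a I.<? g b) ×-dec N.allUpTo? (\ s -> ¬? ((g a I.<? g (a + + s)) ×-dec (g (a + + s) I.<? g b))) m) where
   to : (a ≁ b × g a < g b × (∀ {s} -> s M.< m -> ¬ (g a < g (a + + s) × g (a + + s) < g b))) -> Cov g a b
   to (x , y , z) = mkCov p x y (\ c q r -> let s , f = lS q in subst (\ w -> ¬ (g a < g w × g w < g b)) (sym f) (z (Z.drop‿+<+ (aB 0 (st (subst₂ _<_ f e r)) (solve 3 (\ a s m -> m :- s := ((a :+ m) :- (a :+ s :+ con 1ℤ)) :+ con 1ℤ) refl a (+ s) (+ m)))))) where open E using (subst₂)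
   from : Cov g a b -> a ≁ b × g a < g b × (∀ {s} -> s M.< m -> ¬ (g a < g (a + + s) × g (a + + s) < g b))
   from c = a4 c , asc c , \ { {zero} _ (q , _) -> Z.<-irrefl (cong g (sym (Z.+-identityʳ a))) q ; {suc s} r -> gap c (a + + suc s) (aB s (Z.≤-refl {a}) (solve 2 (\ a s -> (a :+ s) :- a := (a :- a) :+ s) refl a (+ suc s))) (subst (a + + suc s <_) (sym e) (Z.+-monoʳ-< a (I.+<+ r))) }
  abstract
   cv : Fn -> ℤ -> ℤ -> Bool
   cv g a b = does (nH g a b)
   fx : ∀ {g a b} -> Cov g a b -> cv g a b ≡ true
   fx {g} {a} {b} c = dec-true (nH g a b) c
   hn : ∀ {g a b} -> ¬ Cov g a b -> cv g a b ≡ false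
   hn {g} {a} {b} c = dec-false (nH g a b) c
   gW : ∀ {g a b} -> cv g a b ≡ true -> Cov g a b
   gW {g} {a} {b} e with nH g a b | e
   ... | yes p | _ = p
   ... | no _ | ()
  n8 : ∀ {g h a b c d} -> (Cov g a b -> Cov h c d) -> (Cov h c d -> Cov g a b) -> cv g a b ≡ cv h c d
  n8 {g} {h} {a} {b} f f' with nH g a b
  ... | yes p = trans (fx p) (sym (fx (f p)))
  ... | no p = trans (hn p) (sym (hn (\ q -> p (f' q))))
  mx : ∀ {g h a b} -> (∀ x -> g x ≡ h x) -> Cov g a b -> Cov h a b
  mx {g} {h} {a} {b} e c = mkCov (ord c) (a4 c) (subst₂ _<_ (e a) (e b) (asc c)) (\ d p q (r , s) -> gap c d p q (subst₂ _<_ (sym (e a)) (sym (e d)) r , subst₂ _<_ (sym (e d)) (sym (e b)) s)) where open E using (subst₂)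
  g8 : ∀ {g a b} -> QP g -> ∀ q -> Cov g a b -> Cov g (a + q * + n) (b + q * + n)
  g8 {g} {a} {b} w q c = mkCov (Z.+-monoˡ-< m (ord c)) (\ e -> a4 c (subst₂ _∼_ (un a) (un b) (fO (- m) e))) (subst₂ _<_ (sym (qpm a)) (sym (qpm b)) (Z.+-monoˡ-< m (asc c))) (\ d p r (s , t) -> gap c (d - m) (left' p) (pG r) (pM s , pz t)) where
   open E using (subst₂)
   m = q * + n
   qpm : ∀ x -> g (x + m) ≡ g x + m
   qpm x = d2 {g} w x q
   un : ∀ x -> x + m + - m ≡ x
   un x = solve 2 (\ x m -> x :+ m :+ (:- m) := x) refl x m
   re : ∀ d -> d - m + m ≡ d
   re d = solve 2 (\ d m -> d :- m :+ m := d) refl d m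
   left' : ∀ {d} -> a + m < d -> a < d - m
   left' {d} p = aB 0 (st p) (solve 3 (\ d m a -> d :- m :- a := (d :- (a :+ m :+ con 1ℤ)) :+ con 1ℤ) refl d m a)
   pG : ∀ {d} -> d < b + m -> d - m < b
   pG {d} p = aB 0 (st p) (solve 3 (\ d m b -> b :- (d :- m) := ((b :+ m) :- (d :+ con 1ℤ)) :+ con 1ℤ) refl d m b)
   gd : ∀ d -> g d ≡ g (d - m) + m
   gd d = trans (cong g (sym (re d))) (qpm (d - m))
   pM : ∀ {d} -> g (a + m) < g d -> g a < g (d - m)
   pM {d} p = aB 0 (st (subst₂ _<_ (qpm a) (gd d) p)) (solve 3 (\ x m y -> y :- x := ((y :+ m) :- (x :+ m :+ con 1ℤ)) :+ con 1ℤ) refl (g a) m (g (d - m)))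
   pz : ∀ {d} -> g d < g (b + m) -> g (d - m) < g b
   pz {d} p = aB 0 (st (subst₂ _<_ (gd d) (qpm b) p)) (solve 3 (\ x m y -> y :- x := ((y :+ m) :- (x :+ m :+ con 1ℤ)) :+ con 1ℤ) refl (g (d - m)) m (g b))
  -- If a + n lies before b, then g(a + n) > g(a), so the gap condition forces g(b) ≤ g(a) + n, and
  -- the displacement bounds the positions.
  dP : ∀ {D g a b} -> Adm D g -> Cov g a b -> b ≤ a + + (D M.+ D M.+ n)
  dP {D} {g} {a} {b} w c with Z.<-cmp (a + + n) b
  ... | tri< p _ _ = lin 0 (ej w b & Z.≮⇒≥ (\ q -> gap c (a + + n) (aB 0 mX (solve 2 (\ a n -> (a :+ n) :- a := (n :- con 1ℤ) :+ con 1ℤ) refl a (+ n))) p (subst (g a <_) (sym (qp w a)) (aB 0 mX (solve 2 (\ a n -> (a :+ n) :- a := (n :- con 1ℤ) :+ con 1ℤ) refl (g a) (+ n))) , q)) & Z.≤-reflexive (qp w a) & ee w a) (solve 7 (\ a b D n x y z -> (a :+ (D :+ D :+ n)) :- b := ((y :+ D) :+ (z :+ ((x :+ n) :+ (a :+ D)))) :- (b :+ (y :+ (z :+ x))) :+ con 0ℤ) refl a b (+ D) (+ n) (g a) (g b) (g (a + + n))) where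
   mX : 1ℤ ≤ + n
   mX = I.+≤+ (M.>-nonZero⁻¹ n)
  ... | tri≈ _ e _ = Z.≤-trans (Z.≤-reflexive (sym e)) (Z.+-monoʳ-≤ a (I.+≤+ (N.m≤n+m n (D M.+ D))))
  ... | tri> _ _ p = Z.≤-trans (Z.<⇒≤ p) (Z.+-monoʳ-≤ a (I.+≤+ (N.m≤n+m n (D M.+ D))))
  fU : ∀ {a b a' b'} -> a ≁ b -> a' ∼ a -> b' - a' ≡ b - a -> ∀ x -> tr a' b' x ≡ tr a b x
  fU {a} {b} {a'} {b'} h p e x with x ∼? a
  ... | yes q = trans (fW (af q (ae p))) (trans (cong (\ z -> x + z) e) (sym (fW q)))
  ... | no q with x ∼? b
  ... | yes r = trans (fV h' (af r (ae p'))) (trans (cong (\ z -> x + z) neg) (sym (fV h r))) where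
   p' : b' ∼ b
   p' = subst₂ _∼_ (trans (cong (\ z -> a' + z) (sym e)) (solve 2 (\ a b -> a :+ (b :- a) := b) refl a' b')) (solve 2 (\ a b -> a :+ (b :- a) := b) refl a b) (fO (b - a) p) where open E using (subst₂)
   h' : a' ≁ b'
   h' s = h (af (ae p) (af s p'))
   neg : a' - b' ≡ a - b
   neg = trans (solve 2 (\ a b -> a :- b := :- (b :- a)) refl a' b') (trans (cong -_ e) (solve 2 (\ a b -> :- (b :- a) := a :- b) refl a b))
  ... | no r = trans (aY (\ s -> q (af s p)) (\ s -> r (af s p'))) (sym (aY q r)) where
   p' : b' ∼ b
   p' = subst₂ _∼_ (trans (cong (\ z -> a' + z) (sym e)) (solve 2 (\ a b -> a :+ (b :- a) := b) refl a' b')) (solve 2 (\ a b -> a :+ (b :- a) := b) refl a b) (fO (b - a) p) where open E using (subst₂)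
  module _ (i : ℤ) where
   private
    σ : ℤ -> ℤ
    σ = sw aa i
   aJ : ∀ x -> σ (σ x) ≡ x
   aJ = mJ (ar aa i)
   k1 : ∀ x q -> σ (x + q * + n) ≡ σ x + q * + n
   k1 = d2 {σ} (kh (ar aa i))
   e7 : ∀ {x y} -> x ∼ y -> σ x ∼ σ y
   e7 {x} {y} (mk∼ q e) = mk∼ q (trans (cong σ e) (k1 y q))
   dy : ∀ {x} -> x ∼ i -> σ x ≡ x + 1ℤ
   dy {x} p = trans (fW p) (solve 2 (\ x i -> x :+ (i :+ con 1ℤ :- i) := x :+ con 1ℤ) refl x i)
   bA : ∀ {x} -> x ∼ i + 1ℤ -> σ x ≡ x - 1ℤ
   bA {x} p = trans (fV (ar aa i) p) (solve 2 (\ x i -> x :+ (i :- (i :+ con 1ℤ)) := x :- con 1ℤ) refl x i)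
   az : ∀ {b} -> b ∼ i + 1ℤ -> b - 1ℤ ∼ i
   az {b} p = subst (b - 1ℤ ∼_) (solve 1 (\ i -> i :+ con 1ℤ :- con 1ℤ := i) refl i) (fO (- 1ℤ) p)
   a7 : ∀ {b} -> b ∼ i -> b + 1ℤ ∼ i + 1ℤ
   a7 = fO 1ℤ
   conj : ∀ {a b} -> a ≁ b -> ∀ x -> σ (tr (σ a) (σ b) x) ≡ tr a b (σ x)
   conj {a} {b} h x with x ∼? σ a
   ... | yes p@(mk∼ q e) = trans (cong σ (trans (fW p) (trans (cong (_+ (σ b - σ a)) e) (solve 3 (\ a b q -> a :+ q :+ (b :- a) := b :+ q) refl (σ a) (σ b) (q * + n))))) (trans (k1 (σ b) q) (trans (cong (_+ q * + n) (aJ b)) (sym (trans (fW σx) (trans (cong (_+ (b - a)) hu) (solve 3 (\ a b q -> a :+ q :+ (b :- a) := b :+ q) refl a b (q * + n))))))) where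
    hu : σ x ≡ a + q * + n
    hu = trans (cong σ e) (trans (k1 (σ a) q) (cong (_+ q * + n) (aJ a)))
    σx : σ x ∼ a
    σx = mk∼ q hu
   ... | no p with x ∼? σ b
   ... | yes r@(mk∼ q e) = trans (cong σ (trans (fV h' r) (trans (cong (_+ (σ a - σ b)) e) (solve 3 (\ a b q -> b :+ q :+ (a :- b) := a :+ q) refl (σ a) (σ b) (q * + n))))) (trans (k1 (σ a) q) (trans (cong (_+ q * + n) (aJ a)) (sym (trans (fV h σx) (trans (cong (_+ (a - b)) hu) (solve 3 (\ a b q -> b :+ q :+ (a :- b) := a :+ q) refl a b (q * + n))))))) where
    h' : σ a ≁ σ b
    h' s = h (subst₂ _∼_ (aJ a) (aJ b) (e7 s)) where open E using (subst₂)
    hu : σ x ≡ b + q * + n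
    hu = trans (cong σ e) (trans (k1 (σ b) q) (cong (_+ q * + n) (aJ b)))
    σx : σ x ∼ b
    σx = mk∼ q hu
   ... | no r = trans (cong σ (aY p r)) (sym (aY (\ s -> p (subst (_∼ σ a) (aJ x) (e7 s))) (\ s -> r (subst (_∼ σ b) (aJ x) (e7 s)))))
   dC : ∀ {c d} -> c < d -> ¬ (c ∼ i × d ≡ c + 1ℤ) -> σ c < σ d
   dC {c} {d} p h with c ∼? i
   ... | yes q = subst (_< σ d) (sym (dy q)) (Z.≤∧≢⇒< (lin 0 (st (Z.≤∧≢⇒< (lin 0 (st p) (solve 2 (\ c d -> d :- (c :+ con 1ℤ) := (d :- (c :+ con 1ℤ)) :+ con 0ℤ) refl c d)) (\ e -> h (q , sym e))) & proj₁ (fc 1 (ar aa i) Z.≤-refl (Z.≤-trans (Z.i≤i+j i 1ℤ) (Z.i≤i+j _ 1ℤ)) d)) (solve 3 (\ c d s -> s :- (c :+ con 1ℤ) := (d :+ (s :+ con 1ℤ)) :- (c :+ con 1ℤ :+ con 1ℤ :+ d) :+ con 0ℤ) refl c d (σ d))) (\ e -> Z.<-irrefl (trans (sym (aJ c)) (trans (cong σ (trans (dy q) e)) (aJ d))) p))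
   ... | no q with c ∼? (i + 1ℤ)
   ... | yes r = subst (_< σ d) (sym (bA r)) (aB 0 (st p & proj₁ (fc 1 (ar aa i) Z.≤-refl (Z.≤-trans (Z.i≤i+j i 1ℤ) (Z.i≤i+j _ 1ℤ)) d)) (solve 3 (\ c d s -> s :- (c :- con 1ℤ) := (d :+ (s :+ con 1ℤ)) :- (c :+ con 1ℤ :+ d) :+ con 1ℤ) refl c d (σ d)))
   ... | no r = subst (_< σ d) (sym (aY q r)) (Z.≤∧≢⇒< (lin 0 (st p & proj₁ (fc 1 (ar aa i) Z.≤-refl (Z.≤-trans (Z.i≤i+j i 1ℤ) (Z.i≤i+j _ 1ℤ)) d)) (solve 3 (\ c d s -> s :- c := (d :+ (s :+ con 1ℤ)) :- (c :+ con 1ℤ :+ d) :+ con 0ℤ) refl c d (σ d))) (\ e -> Z.<-irrefl (trans (sym (aJ c)) (trans (cong σ (trans (aY q r) e)) (aJ d))) p))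
   dx : Fn -> Set
   dx g = g (i + 1ℤ) < g i
   iE : ∀ {g y} -> QP g -> y ∼ i -> dx g -> g (y + 1ℤ) < g y
   iE {g} {y} w (mk∼ q e) d = subst₂ _<_ (sym (trans (cong g (trans (cong (_+ 1ℤ) e) (solve 2 (\ i q -> i :+ q :+ con 1ℤ := i :+ con 1ℤ :+ q) refl i (q * + n)))) (d2 {g} w (i + 1ℤ) q))) (sym (trans (cong g e) (d2 {g} w i q))) (Z.+-monoˡ-< (q * + n) d) where open E using (subst₂)
   iK : ∀ {g y} -> QP g -> y ∼ i -> g (y + 1ℤ) < g y -> dx g
   iK {g} {y} w p@(mk∼ q e) d = aB 0 (st (subst₂ _<_ (trans (cong g (trans (cong (_+ 1ℤ) e) (solve 2 (\ i q -> i :+ q :+ con 1ℤ := i :+ con 1ℤ :+ q) refl i (q * + n)))) (d2 {g} w (i + 1ℤ) q)) (trans (cong g e) (d2 {g} w i q)) d)) (solve 3 (\ x y q -> y :- x := ((y :+ q) :- (x :+ q :+ con 1ℤ)) :+ con 1ℤ) refl (g (i + 1ℤ)) (g i) (q * + n)) where open E using (subst₂)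
   module _ {D g} (w : Adm D g) {a b : ℤ} where
    private
     h : Fn
     h x = g (σ x)
     k : Fn
     k x = g (tr a b x)
     m3 : a ≁ b -> QP k
     m3 p x = trans (cong g (kh p x)) (qp w _)
     pos : ∀ q -> 0ℤ < q -> + n ≤ q * + n
     pos q p = Z.≤-trans (Z.≤-reflexive (sym (Z.*-identityˡ (+ n)))) (Z.*-monoʳ-≤-nonNeg (+ n) (Z.i<j⇒suc[i]≤j p))
     je : ∀ y z q -> y ≡ z + q * + n -> z < y -> g z < g y
     je y z q e p = subst (g z <_) (sym (trans (cong g e) (dA w z q))) (aB 0 (st p) (trans (solve 3 (\ z q g -> (g :+ q) :- g := q) refl z (q * + n) (g z)) (trans (solve 2 (\ z q -> q := (z :+ q :- (z :+ con 1ℤ)) :+ con 1ℤ) refl z (q * + n)) (cong (\ y -> y - (z + 1ℤ) + 1ℤ) (sym e)))))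
    gx : dx g -> ∀ y -> y ∼ i -> g (y + 1ℤ) < g y
    gx d y p = iE {g} (qp w) p d
    -- s_i keeps the order of positions except for i, i + 1 and their translates, so a new value in
    -- the gap could only sit next to an end point (`exL`, `exR`). There the descent of g t_ab at i
    -- is contradicted.
    kE : dx g -> Cov g a b -> dx (\ x -> g (tr a b x)) -> Cov (\ x -> g (σ x)) (σ a) (σ b)
    kE dg c dk = mkCov (dC (ord c) (\ (p , e) -> Z.<-asym (asc c) (subst (\ z -> g z < g a) (sym e) (gx dg a p)))) (\ s -> a4 c (subst₂ _∼_ (aJ a) (aJ b) (e7 s))) (subst₂ _<_ (cong g (sym (aJ a))) (cong g (sym (aJ b))) (asc c)) pQ where
     open E using (subst₂)
     pQ : ∀ c' -> σ a < c' -> c' < σ b -> ¬ (h (σ a) < h c' × h c' < h (σ b))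
     pQ c' p q (r₀ , s₀) = a8 (a ∼? (i + 1ℤ)) (b ∼? i) where
      r : g a < g (σ c')
      r = subst (\ z -> g z < h c') (aJ a) r₀
      s : g (σ c') < g b
      s = subst (\ z -> h c' < g z) (aJ b) s₀
      inL : ¬ (σ a ∼ i × c' ≡ σ a + 1ℤ) -> a < σ c'
      inL z = subst (_< σ c') (aJ a) (dC p z)
      inR : ¬ (c' ∼ i × σ b ≡ c' + 1ℤ) -> σ c' < b
      inR z = subst (σ c' <_) (aJ b) (dC q z)
      exL : a ∼ i + 1ℤ -> c' ≡ σ a + 1ℤ -> ⊥
      exL p₁ e = p1 (a - 1ℤ ∼? b) where
       ca : c' ≡ a
       ca = trans e (trans (cong (_+ 1ℤ) (bA p₁)) (solve 1 (\ a -> a :- con 1ℤ :+ con 1ℤ := a) refl a))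
       gc : g (a - 1ℤ) < g b
       gc = subst (\ z -> g z < g b) (trans (cong σ ca) (bA p₁)) s
       d : k a < k (a - 1ℤ)
       d = subst (\ z -> k z < k (a - 1ℤ)) (solve 1 (\ a -> a :- con 1ℤ :+ con 1ℤ := a) refl a) (iE {k} (m3 (a4 c)) (az p₁) dk)
       ka : k a ≡ g b
       ka = cong g (dF a b)
       p1 : Dec (a - 1ℤ ∼ b) -> ⊥
       p1 (no z) = Z.<-asym gc (subst₂ _<_ ka (cong g (aY (\ s -> ar aa (a - 1ℤ) (subst (a - 1ℤ ∼_) (solve 1 (\ a -> a := a :- con 1ℤ :+ con 1ℤ) refl a) s)) z)) d)
       p1 (yes z@(mk∼ q e')) = Z.<-asym (Z.<-trans (subst₂ _<_ ka refl d) (subst (_< g a) (sym kk) (je a _ (- q) eqn cY))) (asc c) where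
        kk : k (a - 1ℤ) ≡ g (a - 1ℤ + (a - b))
        kk = cong g (fV (a4 c) z)
        eqn : a ≡ a - 1ℤ + (a - b) + - q * + n
        eqn = trans (solve 3 (\ a b q -> a := (b :+ q) :+ (a :- b) :+ (:- q)) refl a b (q * + n)) (cong₂ (\ y z -> y + (a - b) + z) (sym e') (Z.neg-distribˡ-* q (+ n)))
        cY : a - 1ℤ + (a - b) < a
        cY = aB 1 (st (ord c)) (solve 2 (\ a b -> a :- (a :- con 1ℤ :+ (a :- b)) := (b :- (a :+ con 1ℤ)) :+ con (+ 2)) refl a b)
      exR : b ∼ i -> σ b ≡ c' + 1ℤ -> ⊥
      exR p₁ e = p2 (b + 1ℤ ∼? a) where
       cb : c' ≡ b
       cb = aS 1ℤ c' b (trans (sym e) (dy p₁))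
       gc : g a < g (b + 1ℤ)
       gc = subst (\ z -> g a < g z) (trans (cong σ cb) (dy p₁)) r
       d : k (b + 1ℤ) < k b
       d = iE {k} (m3 (a4 c)) p₁ dk
       kb : k b ≡ g a
       kb = cong g (dE (a4 c))
       p2 : Dec (b + 1ℤ ∼ a) -> ⊥
       p2 (no z) = Z.<-asym gc (subst₂ _<_ (cong g (aY z (\ s -> ar aa b (ae s)))) kb d)
       p2 (yes z@(mk∼ q e')) = Z.<-asym (Z.<-trans (asc c) (subst (g b <_) (sym kk) (je (b + 1ℤ + (b - a)) b q eqn fB))) (subst₂ _<_ refl kb d) where
        kk : k (b + 1ℤ) ≡ g (b + 1ℤ + (b - a))
        kk = cong g (fW z)
        eqn : b + 1ℤ + (b - a) ≡ b + q * + n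
        eqn = trans (cong (_+ (b - a)) e') (solve 3 (\ a b q -> a :+ q :+ (b :- a) := b :+ q) refl a b (q * + n))
        fB : b < b + 1ℤ + (b - a)
        fB = aB 1 (st (ord c)) (solve 2 (\ a b -> (b :+ con 1ℤ :+ (b :- a)) :- b := (b :- (a :+ con 1ℤ)) :+ con (+ 2)) refl a b)
      n0 : σ a ∼ i -> a ∼ i + 1ℤ
      n0 z = subst₂ _∼_ (aJ a) (pi aa i) (e7 z)
      l7 : c' ∼ i -> σ b ≡ c' + 1ℤ -> b ∼ i
      l7 z e = subst₂ _∼_ (aJ b) (hE aa i) (e7 (subst (_∼ i + 1ℤ) (sym e) (a7 z)))
      a8 : Dec (a ∼ i + 1ℤ) -> Dec (b ∼ i) -> ⊥
      a8 da db with c' I.≟ σ a + 1ℤ | σ b I.≟ c' + 1ℤ | da | db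
      ... | yes e | _ | yes z | _ = exL z e
      ... | _ | yes e | _ | yes z = exR z e
      ... | no ne | no ne' | _ | _ = gap c (σ c') (inL (\ (_ , e) -> ne e)) (inR (\ (_ , e) -> ne' e)) (r , s)
      ... | no ne | yes e' | _ | no z = gap c (σ c') (inL (\ (_ , e) -> ne e)) (inR (\ (y , e) -> z (l7 y e))) (r , s)
      ... | yes _ | no ne' | no z | _ = gap c (σ c') (inL (\ (y , _) -> z (n0 y))) (inR (\ (_ , e) -> ne' e)) (r , s)
      ... | yes _ | yes _ | no z | no z' = gap c (σ c') (inL (\ (y , _) -> z (n0 y))) (inR (\ (y , e) -> z' (l7 y e))) (r , s)
    private
     dt : ∀ a -> a - 1ℤ + 1ℤ ≡ a
     dt a = solve 1 (\ a -> a :- con 1ℤ :+ con 1ℤ := a) refl a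
     f6 : ∀ a -> a - 1ℤ ≁ a
     f6 a s = ar aa (a - 1ℤ) (subst (a - 1ℤ ∼_) (sym (dt a)) s)
     oB : ∀ a -> a - 1ℤ < a
     oB a = aB 0 (Z.≤-refl {a}) (solve 1 (\ a -> a :- (a :- con 1ℤ) := (a :- a) :+ con 1ℤ) refl a)
     mY : ∀ a -> a < a + 1ℤ
     mY a = aB 0 (Z.≤-refl {a}) (solve 1 (\ a -> (a :+ con 1ℤ) :- a := (a :- a) :+ con 1ℤ) refl a)
     h0 : ∀ {x y} -> x < y + 1ℤ -> x ≤ y
     h0 {x} {y} p = lin 0 (st p) (solve 2 (\ x y -> y :- x := ((y :+ con 1ℤ) :- (x :+ con 1ℤ)) :+ con 0ℤ) refl x y)
     lX : ∀ {x y} -> x < y -> x + 1ℤ ≤ y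
     lX = st
    -- Converse of `kE`. The excluded pair is s_i itself, which takes g s_i back to g. The descent
    -- of g t_ab is checked according to which of a, b meets i or i + 1.
    nl : dx g -> a ≁ b -> ¬ (σ a ∼ i × σ b ≡ σ a + 1ℤ) -> Cov (\ x -> g (σ x)) (σ a) (σ b) -> Cov g a b × dx (\ x -> g (tr a b x))
    nl dg ab ne c = cov , i8 (a ∼? i) (b ∼? i) (a ∼? i + 1ℤ) (b ∼? i + 1ℤ) where
     open E using (subst₂)
     a<b : a < b
     a<b = subst₂ _<_ (aJ a) (aJ b) (dC (ord c) ne)
     m5 : g a < g b
     m5 = subst₂ _<_ (cong g (aJ a)) (cong g (aJ b)) (asc c)
     cov : Cov g a b
     cov = mkCov a<b ab m5 (\ d p q (r , s) -> gap c (σ d) (dC p (\ (z , e) -> Z.<-asym r (subst (\ y -> g y < g a) (sym e) (gx dg a z)))) (dC q (\ (z , e) -> Z.<-asym s (subst (\ y -> g y < g d) (sym e) (gx dg d z)))) (subst₂ _<_ (cong g (sym (aJ a))) (cong g (sym (aJ d))) r , subst₂ _<_ (cong g (sym (aJ d))) (cong g (sym (aJ b))) s))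
     hgap : ∀ y -> σ a < y -> y < σ b -> g a < g (σ y) -> ¬ (g (σ y) < g b)
     hgap y p q r s = gap c y p q (subst (_< g (σ y)) (cong g (sym (aJ a))) r , subst (g (σ y) <_) (cong g (sym (aJ b))) s)
     i8 : Dec (a ∼ i) -> Dec (b ∼ i) -> Dec (a ∼ i + 1ℤ) -> Dec (b ∼ i + 1ℤ) -> dx k
     i8 (yes p) _ _ _ = iK {k} (m3 ab) p (subst (k (a + 1ℤ) <_) (cong g (sym (dF a b))) (sub (a + 1ℤ ∼? b))) where
      sub : Dec (a + 1ℤ ∼ b) -> k (a + 1ℤ) < g b
      sub (no z) = subst (_< g b) (cong g (sym (aY (\ s -> ar aa a (ae s)) z))) (Z.<-trans (gx dg a p) m5)
      sub (yes z@(mk∼ q e)) = subst (_< g b) (cong g (sym (fV ab z))) (Z.≤-<-trans le m5) where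
       eqn : a ≡ a + 1ℤ + (a - b) + (- q) * + n
       eqn = trans (solve 3 (\ a b q -> a := (b :+ q) :+ (a :- b) :+ (:- q)) refl a b (q * + n)) (cong₂ (\ y z -> y + (a - b) + z) (sym e) (Z.neg-distribˡ-* q (+ n)))
       le : g (a + 1ℤ + (a - b)) ≤ g a
       le with Z.<-cmp (a + 1ℤ + (a - b)) a
       ... | tri< r _ _ = Z.<⇒≤ (je a _ (- q) eqn r)
       ... | tri≈ _ r _ = Z.≤-reflexive (cong g r)
       ... | tri> _ _ r = ⊥-elim (Z.<⇒≱ r (lin 0 (lX a<b) (solve 2 (\ a b -> a :- (a :+ con 1ℤ :+ (a :- b)) := (b :- (a :+ con 1ℤ)) :+ con 0ℤ) refl a b)))
     i8 (no _) (yes p) _ _ = iK {k} (m3 ab) p (subst (k (b + 1ℤ) <_) (cong g (sym (dE ab))) (sub (b + 1ℤ ∼? a))) where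
      σb : σ b ≡ b + 1ℤ
      σb = dy p
      σa<b : σ a < b
      σa<b = Z.≤∧≢⇒< (h0 (subst (σ a <_) σb (ord c))) (\ e -> Z.<-asym a<b (subst (b <_) (trans (sym σb) (trans (cong σ (sym e)) (aJ a))) (mY b)))
      f9 : g a < g (b + 1ℤ) -> ⊥
      f9 r = hgap b σa<b (subst (b <_) (sym σb) (mY b)) (subst (\ z -> g a < g z) (sym σb) r) (subst (\ z -> g z < g b) (sym σb) (gx dg b p))
      sub : Dec (b + 1ℤ ∼ a) -> k (b + 1ℤ) < g a
      sub (no z) = subst (_< g a) (cong g (sym (aY z (\ s -> ar aa b (ae s))))) (Z.≤∧≢⇒< (Z.≮⇒≥ f9) (\ e -> z (subst (_∼ a) (sym (inj w _ _ e)) b3)))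
      sub (yes z@(mk∼ q e)) = ⊥-elim (f9 (je (b + 1ℤ) a q e (Z.<-trans a<b (mY b))))
     i8 (no _) (no q) (yes p) _ = iK {k} (m3 ab) (az p) (subst₂ _<_ (cong g (sym (trans (cong (tr a b) (dt a)) (dF a b)))) (cong g (sym (aY (f6 a) mf))) gb<) where
      mf : a - 1ℤ ≁ b
      mf s = q (af (ae s) (az p))
      σa : σ a ≡ a - 1ℤ
      σa = bA p
      a<σb : a < σ b
      a<σb = Z.≤∧≢⇒< (h0 (subst (_< σ b + 1ℤ) (dt a) (Z.+-monoˡ-< 1ℤ (subst (_< σ b) σa (ord c))))) (\ e -> Z.<-asym a<b (subst (_< a) (trans (sym σa) (trans (cong σ e) (aJ b))) (oB a)))
      up : g a < g (a - 1ℤ)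
      up = subst (\ z -> g z < g (a - 1ℤ)) (dt a) (gx dg (a - 1ℤ) (az p))
      gb< : g b < g (a - 1ℤ)
      gb< = Z.≤∧≢⇒< (Z.≮⇒≥ (\ r -> hgap a (subst (_< a) (sym σa) (oB a)) a<σb (subst (\ z -> g a < g z) (sym σa) up) (subst (\ z -> g z < g b) (sym σa) r))) (\ e -> mf (subst (_∼ b) (inj w _ _ e) b3))
     i8 (no p') (no _) (no _) (yes p) = iK {k} (m3 ab) (az p) (subst₂ _<_ (cong g (sym (trans (cong (tr a b) (dt b)) (dE ab)))) (cong g (sym (aY (\ s -> p' (af (ae s) (az p))) (f6 b)))) (Z.<-trans m5 (subst (\ z -> g z < g (b - 1ℤ)) (dt b) (gx dg (b - 1ℤ) (az p)))))
     i8 (no p) (no q) (no r) (no s) = subst₂ _<_ (cong g (sym (aY (\ z -> r (ae z)) (\ z -> s (ae z))))) (cong g (sym (aY (\ z -> p (ae z)) (\ z -> q (ae z))))) dg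
    -- An ascent at i becomes a descent only through s_i: otherwise a value at i or i + 1 would lie
    -- in the gap of the cover, or an order already known would be reversed.
    i9 : g i < g (i + 1ℤ) -> Cov g a b -> dx (\ x -> g (tr a b x)) -> a ∼ i × b ≡ a + 1ℤ
    i9 ag c dk = go (a ∼? i) (b ∼? i) (a ∼? i + 1ℤ) (b ∼? i + 1ℤ) where
     open E using (subst₂)
     mH : ∀ y -> y ∼ i -> g y < g (y + 1ℤ)
     mH y (mk∼ q e) = subst₂ _<_ (sym (trans (cong g e) (dA w i q))) (sym (trans (cong g (trans (cong (_+ 1ℤ) e) (solve 2 (\ i q -> i :+ q :+ con 1ℤ := i :+ con 1ℤ :+ q) refl i (q * + n)))) (dA w (i + 1ℤ) q))) (Z.+-monoˡ-< (q * + n) ag)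
     ni : ∀ y -> y ∼ i -> k (y + 1ℤ) < k y
     ni y p = iE {k} (m3 (a4 c)) p dk
     go : Dec (a ∼ i) -> Dec (b ∼ i) -> Dec (a ∼ i + 1ℤ) -> Dec (b ∼ i + 1ℤ) -> a ∼ i × b ≡ a + 1ℤ
     go (yes p) _ _ _ with b I.≟ a + 1ℤ
     ... | yes e = p , e
     ... | no ne = ⊥-elim (gap c (a + 1ℤ) (mY a) p3 (mH a p , sub (a + 1ℤ ∼? b))) where
      p3 : a + 1ℤ < b
      p3 = Z.≤∧≢⇒< (lX (ord c)) (\ e -> ne (sym e))
      sub : Dec (a + 1ℤ ∼ b) -> g (a + 1ℤ) < g b
      sub (no z) = subst₂ _<_ (cong g (aY (\ s -> ar aa a (ae s)) z)) (cong g (dF a b)) (ni a p)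
      sub (yes z) with ae z
      ... | mk∼ q e = je b (a + 1ℤ) q e p3
     go (no _) (yes p) _ _ = ⊥-elim (sub (b + 1ℤ ∼? a)) where
      d : k (b + 1ℤ) < g a
      d = subst (k (b + 1ℤ) <_) (cong g (dE (a4 c))) (ni b p)
      sub : Dec (b + 1ℤ ∼ a) -> ⊥
      sub (no z) = Z.<-asym (Z.<-trans (asc c) (mH b p)) (subst (_< g a) (cong g (aY z (\ s -> ar aa b (ae s)))) d)
      sub (yes z@(mk∼ q e)) = Z.<-asym (Z.<-trans (asc c) (je (b + 1ℤ + (b - a)) b q eqn fB)) (subst (_< g a) (cong g (fW z)) d) where
       eqn : b + 1ℤ + (b - a) ≡ b + q * + n
       eqn = trans (cong (_+ (b - a)) e) (solve 3 (\ a b q -> a :+ q :+ (b :- a) := b :+ q) refl a b (q * + n))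
       fB : b < b + 1ℤ + (b - a)
       fB = aB 1 (st (ord c)) (solve 2 (\ a b -> (b :+ con 1ℤ :+ (b :- a)) :- b := (b :- (a :+ con 1ℤ)) :+ con (+ 2)) refl a b)
     go (no _) (no q) (yes p) _ = ⊥-elim (Z.<-asym (Z.<-trans (subst (\ z -> g (a - 1ℤ) < g z) (dt a) (mH (a - 1ℤ) (az p))) (asc c)) (subst₂ _<_ (cong g (trans (cong (tr a b) (dt a)) (dF a b))) (cong g (aY (f6 a) (\ s -> q (af (ae s) (az p))))) (ni (a - 1ℤ) (az p))))
     go (no p') (no _) (no _) (yes p) = ⊥-elim (gap c (b - 1ℤ) (Z.≤∧≢⇒< (h0 (subst (a <_) (sym (dt b)) (ord c))) (\ e -> p' (subst (_∼ i) (sym e) (az p)))) (oB b) (subst₂ _<_ (cong g (trans (cong (tr a b) (dt b)) (dE (a4 c)))) (cong g (aY (\ s -> p' (af (ae s) (az p))) (f6 b))) (ni (b - 1ℤ) (az p)) , subst (\ z -> g (b - 1ℤ) < g z) (dt b) (mH (b - 1ℤ) (az p))))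
     go (no p) (no q) (no r) (no s) = ⊥-elim (Z.<-asym ag (subst₂ _<_ (cong g (aY (\ z -> r (ae z)) (\ z -> s (ae z)))) (cong g (aY (\ z -> p (ae z)) (\ z -> q (ae z)))) dk))
  fy : ∀ {g a} -> g a < g (a + 1ℤ) -> Cov g a (a + 1ℤ)
  fy {g} {a} p = mkCov (aB 0 (Z.≤-refl {a}) (solve 1 (\ a -> (a :+ con 1ℤ) :- a := (a :- a) :+ con 1ℤ) refl a)) (ar aa a) p (\ c q r _ -> Z.<⇒≱ r (lin 0 (st q) (solve 2 (\ a c -> c :- (a :+ con 1ℤ) := (c :- (a :+ con 1ℤ)) :+ con 0ℤ) refl a c)))

-- The Chevalley operator against letters and chains of letters

module qA where
 open dK
 open cV
 open cB
 open mj
 open fJ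
 open ad
 open import Data.Product using (_×_)
 module bz (R : CommutativeRing 0ℓ 0ℓ) (n : ℕ) .{{nz : NonZero n}} (aa : 2 M.≤ n) where
  open aE R
  open ay n
  open dj n
  open kI R n aa
  open e4 R n aa
  open e6 n aa
  open iO
  -- Permutations are functions compared pointwise, so functions of permutations have to respect
  -- this.
  Ext : (Fn -> C) -> Set
  Ext Φ = ∀ {g h : Fn} -> (∀ x -> g x ≡ h x) -> Φ g ≈ Φ h
  eY : (Fn -> C) -> Fn -> ℤ -> ℤ -> C
  eY Φ g a b = ind (cv g a b) * (ι (g b I.- g a) * Φ (\ x -> g (tr a b x)))
  Δ : ℕ -> (Fn -> C) -> Fn -> C
  Δ N Φ g = fw N (eY Φ g)
  -- D + 1 is the displacement after one letter, 2(D + 1) + n the reach of a cover by `dP`, and 2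
  -- the slack of `fv`.
  Bud : ℕ -> ℕ -> Set
  Bud N D = (D M.+ 1 M.+ (D M.+ 1) M.+ n) M.+ 2 M.< N
  cE : ∀ {N D D'} -> D M.≤ D' -> Bud N D' -> Bud N D
  cE p = N.≤-<-trans (N.+-monoˡ-≤ 2 (N.+-monoˡ-≤ n (N.+-mono-≤ (N.+-monoˡ-≤ 1 p) (N.+-monoˡ-≤ 1 p))))
  jr : ∀ {D g Φ} -> Adm D g -> Ext Φ -> iO (D M.+ D M.+ n) (eY Φ g)
  jr {D} {g} {Φ} w ext = record { i6 = \ a b -> trans (*-congʳ (reflexive (cong ind (n8 (mR a b) (mS a b))))) (aZ (cv g a b) (\ t -> *-cong (reflexive (cong ι (E.trans (cong₂ I._-_ (qp w b) (qp w a)) (L.solve 3 (\ x y n -> (x L.:+ n) L.:- (y L.:+ n) L.:= x L.:- y) E.refl (g b) (g a) (+ n))))) (ext (\ x -> cong g (fU (a4 (gW t)) bv (L.solve 3 (\ x y n -> (x L.:+ n) L.:- (y L.:+ n) L.:= x L.:- y) E.refl b a (+ n)) x))))) ; pj = \ a b p -> ind-false _ (hn (\ c -> Z.<-asym (ord c) (Z.≤-<-trans (Z.i≤i+j b _) p))) ; kr = \ a b p -> ind-false _ (hn (\ c -> Z.<⇒≱ p (dP w c))) } where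
   one : ∀ x -> x I.+ 1ℤ I.* + n ≡ x I.+ + n
   one x = cong (I._+_ x) (Z.*-identityˡ (+ n))
   mS : ∀ a b -> Cov g a b -> Cov g (a I.+ + n) (b I.+ + n)
   mS a b c = E.subst₂ (Cov g) (one a) (one b) (g8 (qp w) 1ℤ c)
   mR : ∀ a b -> Cov g (a I.+ + n) (b I.+ + n) -> Cov g a b
   mR a b c = E.subst₂ (Cov g) (pL a) (pL b) (g8 (qp w) (I.- 1ℤ) c) where
    pL : ∀ x -> x I.+ + n I.+ (I.- 1ℤ) I.* + n ≡ x
    pL x = L.solve 2 (\ x n -> x L.:+ n L.:+ (L.:- L.I) L.:* n L.:= x) E.refl x (+ n)
  lp : ∀ {Φ} x i -> Ext Φ -> Ext (U x i Φ)
  lp x i ext {g} {h} e = *-cong (reflexive (cong ind (cong₂ lt (e _) (e _)))) (*-congˡ (ext (\ y -> e _)))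
  private
   nI : ∀ {g h} -> (∀ x -> g x ≡ h x) -> ∀ a b -> cv g a b ≡ cv h a b
   nI e a b = n8 (mx e) (mx (\ x -> E.sym (e x)))
  Δ-Ext : ∀ {N Φ} -> Ext Φ -> Ext (Δ N Φ)
  Δ-Ext {N} ext e = bh N (\ a b -> *-cong (reflexive (cong ind (nI e a b))) (*-cong (reflexive (cong ι (cong₂ I._-_ (e b) (e a)))) (ext (\ x -> e _))))
  d9 : ∀ N {Φ Φ'} g -> (∀ a b -> Cov g a b -> Φ (\ x -> g (tr a b x)) ≈ Φ' (\ x -> g (tr a b x))) -> Δ N Φ g ≈ Δ N Φ' g
  d9 N g e = bh N (\ a b -> aZ (cv g a b) (\ t -> *-congˡ (e a b (gW t))))
  nQ : ∀ N a Φ g -> Δ N (\ h -> a * Φ h) g ≈ a * Δ N Φ g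
  nQ N a Φ g = trans (bh N (\ p q -> solve 4 (\ i w a f -> i :* (w :* (a :* f)) := a :* (i :* (w :* f))) refl _ _ a _)) (l9 N a _)
  pw : ∀ N Φ Φ' g -> Δ N (\ h -> Φ h + Φ' h) g ≈ Δ N Φ g + Δ N Φ' g
  pw N Φ Φ' g = trans (bh N (\ p q -> solve 4 (\ i w a f -> i :* (w :* (a :+ f)) := i :* (w :* a) :+ i :* (w :* f)) refl _ _ _ _)) (l8 N _ _)
  private
   module pe {D g Φ} (x : C) (i : ℤ) (w : Adm D g) (ext : Ext Φ) (dn : g (i I.+ 1ℤ) I.< g i) where
    σ : ℤ -> ℤ
    σ = sw aa i
    h : Fn
    h = s[ i ] g
    fu : ∀ a b -> ¬ (a ∼ i I.+ 1ℤ × a I.- 1ℤ ≡ b) -> eY (U x i Φ) g a b ≈ x * eY Φ h (σ a) (σ b)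
    fu a b ns with a ∼? b
    ... | yes p = trans (ind-false _ (hn (\ c -> a4 c p))) (sym (trans (*-congˡ (ind-false _ (hn (\ c -> a4 c (e7 i p))))) (zeroʳ x)))
    ... | no p with nH h (σ a) (σ b)
    ... | no nc = trans (aU (cv g a b) (\ t -> trans (*-congˡ (ind-false _ (bk (\ d -> nc (kE i w dn (gW t) d))))) (zeroʳ _))) (sym (trans (*-congˡ (ind-false _ (hn nc))) (zeroʳ x)))
    ... | yes c = begin eY (U x i Φ) g a b ≈⟨ ind-true _ (fx (proj₁ md)) ⟩ ι (g b I.- g a) * (ind (lt (g (tr a b (i I.+ 1ℤ))) (g (tr a b i))) * (x * Φ (\ y -> g (tr a b (σ y))))) ≈⟨ *-congˡ (ind-true _ (bg (proj₂ md))) ⟩ ι (g b I.- g a) * (x * Φ (\ y -> g (tr a b (σ y)))) ≈⟨ *-cong (reflexive (cong ι (cong₂ I._-_ (cong g (E.sym (aJ i b))) (cong g (E.sym (aJ i a)))))) (*-congˡ (ext (\ y -> cong g (E.sym (conj i p y))))) ⟩ ι (h (σ b) I.- h (σ a)) * (x * Φ (\ y -> h (tr (σ a) (σ b) y))) ≈⟨ solve 3 (\ a b c -> a :* (b :* c) := b :* (a :* c)) refl _ x _ ⟩ x * (ι (h (σ b) I.- h (σ a)) * Φ (\ y -> h (tr (σ a) (σ b) y))) ≈⟨ *-congˡ (sym (ind-true _ (fx c))) ⟩ x * eY Φ h (σ a) (σ b) ∎ where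
     ne : ¬ (σ a ∼ i × σ b ≡ σ a I.+ 1ℤ)
     ne (q , e) = ns (a∼ , E.trans (E.sym (bA i a∼)) (E.trans pp (aJ i b))) where
      a∼ : a ∼ i I.+ 1ℤ
      a∼ = E.subst₂ _∼_ (aJ i a) (pi aa i) (e7 i q)
      pp : σ a ≡ σ (σ b)
      pp = E.sym (E.trans (cong σ e) (E.trans (bA i (a7 i q)) (L.solve 1 (\ a -> a L.:+ L.I L.:- L.I L.:= a) E.refl (σ a))))
     md = nl i w dn p ne c
  -- The commutator with one letter. `kE`, `nl` and `i9` match the covers of g after which the
  -- letter still acts with the covers of g s_i; only the reflection s_i itself is left over.
  pu : ∀ {N D g Φ} x i -> Adm D g -> Bud N D -> Ext Φ -> Δ N (U x i Φ) g ≈ U x i (Δ N Φ) g + x * (ι (g (i I.+ 1ℤ) I.- g i) * Φ g)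
  pu {N} {D} {g} {Φ} x i w bud ext with Z.<-cmp (g (i I.+ 1ℤ)) (g i)
  ... | tri≈ _ e _ = ⊥-elim (ar aa i (E.subst (i ∼_) (E.sym (inj w _ _ e)) b3))
  -- Ascent at i: the letter can act only after the cover s_i, so one pair per period remains.
  ... | tri> nd _ up = begin Δ N (U x i Φ) g ≈⟨ bh N f7 ⟩ fw N (\ a b -> ind (cg a i) * (ind (eq (a I.+ 1ℤ) b) * z)) ≈⟨ el N i 1ℤ z (Z.≤-trans (Z.neg-≤-pos {N} {0}) (I.+≤+ M.z≤n)) (I.+<+ (N.<-trans (N.≤-trans (M.s≤s (M.s≤s M.z≤n)) (N.m≤n+m 2 _)) bud)) ⟩ z ≈⟨ sym (trans (+-congʳ (ind-false _ (bk nd))) (+-identityˡ z)) ⟩ U x i (Δ N Φ) g + z ∎ where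
   z : C
   z = x * (ι (g (i I.+ 1ℤ) I.- g i) * Φ g)
   f7 : ∀ a b -> eY (U x i Φ) g a b ≈ ind (cg a i) * (ind (eq (a I.+ 1ℤ) b) * z)
   f7 a b with a ∼? i | a I.+ 1ℤ I.≟ b
   ... | yes p@(mk∼ q e) | yes E.refl = begin _ ≈⟨ ind-true _ (fx (fy up')) ⟩ _ ≈⟨ *-cong (reflexive (cong ι pY)) (trans (ind-true _ (bg i8)) (*-congˡ (ext bF))) ⟩ ι (g (i I.+ 1ℤ) I.- g i) * (x * Φ g) ≈⟨ solve 3 (\ a b c -> a :* (b :* c) := b :* (a :* c)) refl _ x (Φ g) ⟩ z ≈⟨ sym (trans (ind-true _ (d0 p)) (ind-true _ (cw E.refl))) ⟩ _ ∎ where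
    ga : g a ≡ g i I.+ q I.* + n
    ga = E.trans (cong g e) (dA w i q)
    ga+1 : g (a I.+ 1ℤ) ≡ g (i I.+ 1ℤ) I.+ q I.* + n
    ga+1 = E.trans (cong g (E.trans (cong (I._+ 1ℤ) e) (L.solve 2 (\ i q -> i L.:+ q L.:+ L.I L.:= i L.:+ L.I L.:+ q) E.refl i (q I.* + n)))) (dA w (i I.+ 1ℤ) q)
    up' : g a I.< g (a I.+ 1ℤ)
    up' = E.subst₂ I._<_ (E.sym ga) (E.sym ga+1) (Z.+-monoˡ-< (q I.* + n) up)
    pY : g (a I.+ 1ℤ) I.- g a ≡ g (i I.+ 1ℤ) I.- g i
    pY = E.trans (cong₂ I._-_ ga+1 ga) (L.solve 3 (\ x y q -> (x L.:+ q) L.:- (y L.:+ q) L.:= x L.:- y) E.refl (g (i I.+ 1ℤ)) (g i) (q I.* + n))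
    ot : ∀ y -> tr a (a I.+ 1ℤ) y ≡ sw aa i y
    ot = fU (ar aa i) p (L.solve 2 (\ a i -> (a L.:+ L.I) L.:- a L.:= (i L.:+ L.I) L.:- i) E.refl a i)
    i8 : g (tr a (a I.+ 1ℤ) (i I.+ 1ℤ)) I.< g (tr a (a I.+ 1ℤ) i)
    i8 = E.subst₂ I._<_ (cong g (E.sym (E.trans (ot _) (hE aa i)))) (cong g (E.sym (E.trans (ot _) (pi aa i)))) up
    bF : ∀ y -> g (tr a (a I.+ 1ℤ) (sw aa i y)) ≡ g y
    bF y = cong g (E.trans (ot _) (mJ (ar aa i) y))
   ... | no p | _ = trans (mF (\ q -> p (proj₁ q))) (sym (ind-false _ (d1 p))) where
    mF : ¬ (a ∼ i × b ≡ a I.+ 1ℤ) -> eY (U x i Φ) g a b ≈ 0#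
    mF no' = aU (cv g a b) (\ t -> trans (*-congˡ (ind-false _ (bk (\ d -> no' (i9 i w up (gW t) d))))) (zeroʳ _))
   ... | yes p | no e = trans (mF (\ q -> e (E.sym (proj₂ q)))) (sym (trans (*-congˡ (ind-false _ (b7 e))) (zeroʳ _))) where
    mF : ¬ (a ∼ i × b ≡ a I.+ 1ℤ) -> eY (U x i Φ) g a b ≈ 0#
    mF no' = aU (cv g a b) (\ t -> trans (*-congˡ (ind-false _ (bk (\ d -> no' (i9 i w up (gW t) d))))) (zeroʳ _))
  -- Descent at i: s_i is a cover of g s_i but not of g. The pair (i + 1, i) carries a correction
  -- that cancels this extra term.
  pu {N} {D} {g} {Φ} x i w bud ext | tri< dn _ _ = begin Δ N (U x i Φ) g ≈⟨ bh N f7 ⟩ fw N (\ a b -> x * φ (σ a) (σ b) + ind (cg a (i I.+ 1ℤ)) * (ind (eq (a I.- 1ℤ) b) * z)) ≈⟨ l8 N _ _ ⟩ fw N (\ a b -> x * φ (σ a) (σ b)) + fw N (\ a b -> ind (cg a (i I.+ 1ℤ)) * (ind (eq (a I.- 1ℤ) b) * z)) ≈⟨ +-cong (trans (l9 N x (\ a b -> φ (σ a) (σ b))) (*-congˡ (fv {φ = φ} i (jr (eI aa i w) ext) bud))) (el N (i I.+ 1ℤ) (I.- 1ℤ) z (Z.neg-mono-≤ (I.+≤+ (N.≤-trans (M.s≤s M.z≤n) bud))) (Z.<-≤-trans I.-<+ (I.+≤+ {0} M.z≤n))) ⟩ x * Δ N Φ h + z ≈⟨ +-congʳ (sym (ind-true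 _ (bg dn))) ⟩ U x i (Δ N Φ) g + z ∎ where
   σ = sw aa i
   h : Fn
   h = s[ i ] g
   φ : ℤ -> ℤ -> C
   φ = eY Φ h
   z : C
   z = x * (ι (g (i I.+ 1ℤ) I.- g i) * Φ g)
   f7 : ∀ a b -> eY (U x i Φ) g a b ≈ x * φ (σ a) (σ b) + ind (cg a (i I.+ 1ℤ)) * (ind (eq (a I.- 1ℤ) b) * z)
   f7 a b with a ∼? i I.+ 1ℤ | a I.- 1ℤ I.≟ b
   ... | yes p@(mk∼ q e) | yes E.refl = trans (ind-false _ (hn (\ c -> Z.<-asym (ord c) a-1<a))) (sym (begin _ ≈⟨ +-cong (*-congˡ (trans (reflexive (cong₂ φ σa σb)) (trans (ind-true _ (fx cov)) (*-cong (reflexive (cong ι pY)) (ext bF))))) (trans (ind-true _ (d0 p)) (ind-true _ (cw E.refl))) ⟩ x * (ι (g i I.- g (i I.+ 1ℤ)) * Φ g) + z ≈⟨ +-congʳ (*-congˡ (*-congʳ (trans (reflexive (cong ι (L.solve 2 (\ a b -> a L.:- b L.:= L.:- (b L.:- a)) E.refl (g i) (g (i I.+ 1ℤ))))) (e8 (g (i I.+ 1ℤ) I.- g i))))) ⟩ _ ≈⟨ solve 3 (\ x a f -> x :* ((:- a) :* f) :+ x :* (a :* f) := con 0ℤ) refl x _ (Φ g) ⟩ 0# ∎)) where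
    a-1<a : a I.- 1ℤ I.< a
    a-1<a = aB 0 (Z.≤-refl {a}) (L.solve 1 (\ a -> a L.:- (a L.:- L.I) L.:= (a L.:- a) L.:+ L.I) E.refl a)
    σa : σ a ≡ a I.- 1ℤ
    σa = bA i p
    σb : σ (a I.- 1ℤ) ≡ a
    σb = E.trans (cong σ (E.sym σa)) (aJ i a)
    oT : a I.- 1ℤ ∼ i
    oT = az i p
    ga : g a ≡ g (i I.+ 1ℤ) I.+ q I.* + n
    ga = E.trans (cong g e) (dA w _ q)
    ga-1 : g (a I.- 1ℤ) ≡ g i I.+ q I.* + n
    ga-1 = E.trans (cong g (E.trans (cong (I._- 1ℤ) e) (L.solve 2 (\ i q -> i L.:+ L.I L.:+ q L.:- L.I L.:= i L.:+ q) E.refl i (q I.* + n)))) (dA w i q)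
    cov : Cov h (a I.- 1ℤ) a
    cov = E.subst (Cov h (a I.- 1ℤ)) (L.solve 1 (\ a -> a L.:- L.I L.:+ L.I L.:= a) E.refl a) (fy {h} (E.subst₂ I._<_ (E.trans (E.sym ga) (cong g (E.sym σb))) (E.trans (E.sym ga-1) (cong g (E.sym (E.trans (cong σ (L.solve 1 (\ a -> a L.:- L.I L.:+ L.I L.:= a) E.refl a)) σa)))) (Z.+-monoˡ-< (q I.* + n) dn)))
    pY : h a I.- h (a I.- 1ℤ) ≡ g i I.- g (i I.+ 1ℤ)
    pY = E.trans (cong₂ I._-_ (E.trans (cong g σa) ga-1) (E.trans (cong g σb) ga)) (L.solve 3 (\ x y q -> (x L.:+ q) L.:- (y L.:+ q) L.:= x L.:- y) E.refl (g i) (g (i I.+ 1ℤ)) (q I.* + n))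
    bF : ∀ y -> h (tr (a I.- 1ℤ) a y) ≡ g y
    bF y = cong g (E.trans (cong σ (fU (ar aa i) oT (L.solve 2 (\ a i -> a L.:- (a L.:- L.I) L.:= (i L.:+ L.I) L.:- i) E.refl a i) y)) (aJ i y))
   ... | no p | _ = trans (pe.fu x i w ext dn a b (\ (y , _) -> p y)) (sym (trans (+-congˡ (ind-false _ (d1 p))) (+-identityʳ _)))
   ... | yes p | no e = trans (pe.fu x i w ext dn a b (\ (_ , y) -> e y)) (sym (trans (+-congˡ (trans (*-congˡ (ind-false _ (b7 e))) (zeroʳ _))) (+-identityʳ _)))
  a3 : ∀ e x i m {Φ Φ' : Fn -> C} -> (∀ g -> Φ g ≈ Φ' g) -> ∀ g -> Ch e x i m Φ g ≈ Ch e x i m Φ' g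
  a3 e x i zero h g = h g
  a3 e x i (suc m) h = a3 e x i m (\ g -> +-cong (*-congˡ (h g)) (*-congˡ (*-congˡ (h _))))
  cD : ∀ {D} e x i m {Φ Φ' : Fn -> C} -> (∀ g -> Adm (D M.+ m) g -> Φ g ≈ Φ' g) -> ∀ g -> Adm D g -> Ch e x i m Φ g ≈ Ch e x i m Φ' g
  cD {D} e x i zero h g w = h g (E.subst (\ z -> Adm z g) (E.sym (N.+-identityʳ D)) w)
  cD {D} e x i (suc m) h = cD e x i m (\ g w -> +-cong (*-congˡ (h g (d6 (N.+-monoʳ-≤ D (N.n≤1+n m)) w))) (*-congˡ (*-congˡ (h _ (E.subst (\ z -> Adm z (s[ i I.+ + m ] g)) (E.trans (N.+-assoc D m 1) (cong (D M.+_) (N.+-comm m 1))) (eI aa (i I.+ + m) w))))))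
  fK : ∀ {Φ} e x i m -> Ext Φ -> Ext (Ch e x i m Φ)
  fK e x i zero ext = ext
  fK e x i (suc m) ext = fK e x i m (\ q -> +-cong (*-congˡ (ext q)) (lp x (i I.+ + m) ext q))
  cC : ∀ e x i m a (Φ Φ' : Fn -> C) g -> Ch e x i m (\ h -> Φ h + a * Φ' h) g ≈ Ch e x i m Φ g + a * Ch e x i m Φ' g
  cC e x i zero a Φ Φ' g = refl
  cC e x i (suc m) a Φ Φ' g = trans (a3 e x i m (\ g -> solve 8 (\ e p a q i x r t -> e :* (p :+ a :* q) :+ i :* (x :* (r :+ a :* t)) := (e :* p :+ i :* (x :* r)) :+ a :* (e :* q :+ i :* (x :* t))) refl e (Φ g) a (Φ' g) (ind (lt (g (i I.+ + m I.+ 1ℤ)) (g (i I.+ + m)))) x (Φ (s[ i I.+ + m ] g)) (Φ' (s[ i I.+ + m ] g))) g) (cC e x i m a _ _ g)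
  hc : ∀ e x i m (Φ : Fn -> C) g -> Ch e x i (suc m) Φ g ≈ e * Ch e x (i I.+ 1ℤ) m Φ g + U x i (Ch e x (i I.+ 1ℤ) m Φ) g
  hc e x i zero Φ g = reflexive (cong (\ z -> e * Φ g + U x z Φ g) (Z.+-identityʳ i))
  hc e x i (suc m) Φ g = trans (hc e x i m _ g) (+-cong (*-congˡ (reflexive (cong (\ z -> Ch e x (i I.+ 1ℤ) m (\ g -> e * Φ g + U x z Φ g) g) (E.sym (gy i m))))) (*-congˡ (*-congˡ (reflexive (cong (\ z -> Ch e x (i I.+ 1ℤ) m (\ g -> e * Φ g + U x z Φ g) (s[ i ] g)) (E.sym (gy i m)))))))
  mul : ℤ -> (Fn -> C) -> Fn -> C
  mul y Φ g = ι (g y) * Φ g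
  bY : ∀ e x i m y (Φ : Fn -> C) -> (∀ s -> s M.≤ m -> y ≁ i I.+ + s) -> ∀ g -> Ch e x i m (mul y Φ) g ≈ mul y (Ch e x i m Φ) g
  bY e x i zero y Φ h g = refl
  bY e x i (suc m) y Φ h g = trans (a3 e x i m (\ g -> trans (+-congˡ (*-congˡ (*-congˡ (*-congʳ (reflexive (cong (\ z -> ι (g z)) (aY (h m (N.n≤1+n m)) (E.subst (y ≁_) (E.sym (jB i m)) (h (suc m) N.≤-refl))))))))) (solve 6 (\ e u p i x r -> e :* (u :* p) :+ i :* (x :* (u :* r)) := u :* (e :* p :+ i :* (x :* r))) refl e (ι (g y)) (Φ g) _ x _)) g) (bY e x i m y _ (\ s p -> h s (N.m≤n⇒m≤1+n p)) g)
  -- When all letters are used, the value at i is carried to position i + m.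
  d5 : ∀ x i m (Φ : Fn -> C) g -> Ch 0# x i m (mul (i I.+ + m) Φ) g ≈ mul i (Ch 0# x i m Φ) g
  d5 x i zero Φ g = *-congʳ (reflexive (cong (\ z -> ι (g z)) (Z.+-identityʳ i)))
  d5 x i (suc m) Φ g = trans (a3 0# x i m (\ g -> trans (+-congˡ (*-congˡ (*-congˡ (*-congʳ (reflexive (cong (\ z -> ι (g z)) (E.trans (cong (sw aa (i I.+ + m)) (E.sym (jB i m))) (hE aa (i I.+ + m))))))))) (solve 6 (\ a u v i x r -> con 0ℤ :* a :+ i :* (x :* (u :* r)) := u :* (con 0ℤ :* v :+ i :* (x :* r))) refl _ (ι (g (i I.+ + m))) (Φ g) _ x _)) g) (d5 x i m _ g)
  kP : ∀ x i m (Φ : Fn -> C) g -> Ch 0# x i m Φ g ≈ pow x m * Ch 0# 1# i m Φ g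
  kP x i zero Φ g = sym (*-identityˡ _)
  kP x i (suc m) Φ g = trans (a3 0# x i m (\ g -> trans (solve 4 (\ a j x r -> con 0ℤ :* a :+ j :* (x :* r) := con 0ℤ :+ x :* (j :* r)) refl (Φ g) _ x _) (+-congˡ (*-congˡ (trans (*-congˡ (sym (*-identityˡ _))) (sym (trans (+-congʳ (zeroˡ _)) (+-identityˡ _)))))) ) g) (trans (cC 0# x i m x (\ _ -> 0#) _ g) (trans (+-congʳ (lT i m g)) (trans (+-identityˡ _) (trans (*-congˡ (kP x i m _ g)) (sym (*-assoc _ _ _)))))) where
   lT : ∀ i m g -> Ch 0# x i m (\ _ -> 0#) g ≈ 0#
   lT i zero g = refl
   lT i (suc m) g = trans (a3 0# x i m (\ g -> solve 3 (\ a b c -> a :* con 0ℤ :+ b :* (c :* con 0ℤ) := con 0ℤ) refl 0# _ x) g) (lT i m g)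
  ow : ∀ {i j} -> i ≁ j -> i ≁ j I.+ 1ℤ -> i I.+ 1ℤ ≁ j -> i I.+ 1ℤ ≁ j I.+ 1ℤ -> ∀ x -> sw aa i (sw aa j x) ≡ sw aa j (sw aa i x)
  ow {i} {j} p q r s x with x ∼? i | x ∼? i I.+ 1ℤ
  ... | yes e | _ = E.trans (cong (sw aa i) (aY (\ z -> p (af (ae e) z)) (\ z -> q (af (ae e) z)))) (E.trans (dy i e) (E.sym (E.trans (cong (sw aa j) (dy i e)) (aY (\ z -> r (af (ae (a7 i e)) z)) (\ z -> s (af (ae (a7 i e)) z))))))
  ... | no _ | yes e = E.trans (cong (sw aa i) (aY (\ z -> r (af (ae e) z)) (\ z -> s (af (ae e) z)))) (E.trans (bA i e) (E.sym (E.trans (cong (sw aa j) (bA i e)) (aY (\ z -> p (af (ae (az i e)) z)) (\ z -> q (af (ae (az i e)) z))))))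
  ... | no a | no b = E.trans (outer (sw aa j x) (mZ (x ∼? j) (x ∼? j I.+ 1ℤ) a p q) (mZ (x ∼? j) (x ∼? j I.+ 1ℤ) b r s)) (cong (sw aa j) (E.sym (aY a b))) where
   outer : ∀ y -> y ≁ i -> y ≁ i I.+ 1ℤ -> sw aa i y ≡ y
   outer y = aY
   mZ : Dec (x ∼ j) -> Dec (x ∼ j I.+ 1ℤ) -> ∀ {t} -> x ≁ t -> t ≁ j -> t ≁ j I.+ 1ℤ -> sw aa j x ≁ t
   mZ (yes e) _ {t} _ h h' z = h' (ae (af (ae (E.subst (_∼ j I.+ 1ℤ) (E.sym (dy j e)) (a7 j e))) z))
   mZ (no _) (yes e) {t} _ h h' z = h (ae (af (ae (E.subst (_∼ j) (E.sym (bA j e)) (az j e))) z))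
   mZ (no e) (no e') {t} h₀ h h' z = h₀ (E.subst (_∼ t) (aY e e') z)
  record Far (i j : ℤ) : Set where
   constructor far
   field
    f₀₀ : i ≁ j
    f₀₁ : i ≁ j I.+ 1ℤ
    f₁₀ : i I.+ 1ℤ ≁ j
    f₁₁ : i I.+ 1ℤ ≁ j I.+ 1ℤ
  U-U : ∀ x i j {Φ} -> Far i j -> Ext Φ -> ∀ g -> U x i (U x j Φ) g ≈ U x j (U x i Φ) g
  U-U x i j {Φ} (far p q r s) ext g = begin ind (lt (g (i I.+ 1ℤ)) (g i)) * (x * (ind (lt (g (sw aa i (j I.+ 1ℤ))) (g (sw aa i j))) * (x * Φ (\ y -> g (sw aa i (sw aa j y)))))) ≈⟨ *-congˡ (*-congˡ (*-cong (reflexive (cong₂ (\ a b -> ind (lt (g a) (g b))) (aY (\ z -> q (ae z)) (\ z -> s (ae z))) (aY (\ z -> p (ae z)) (\ z -> r (ae z))))) (*-congˡ (ext (\ y -> cong g (ow p q r s y)))))) ⟩ ind (lt (g (i I.+ 1ℤ)) (g i)) * (x * (ind (lt (g (j I.+ 1ℤ)) (g j)) * (x * Φ (\ y -> g (sw aa j (sw aa i y)))))) ≈⟨ solve 4 (\ a b x f -> a :* (x :* (b :* (x :* f))) := b :* (x :* (a :* (x :* f)))) refl _ _ x _ ⟩ ind (lt (g (j I.+ 1ℤ)) (g j)) * (x * (ind (lt (g (i I.+ 1ℤ)) (g i)) * (x * Φ (\ y -> g (sw aa j (sw aa i y)))))) ≈⟨ *-congˡ (*-congˡ (*-congʳ (reflexive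 (cong₂ (\ a b -> ind (lt (g a) (g b))) (E.sym (aY r s)) (E.sym (aY p q)))))) ⟩ U x j (U x i Φ) g ∎
  U-Ch : ∀ e x l i m {Φ} -> (∀ s -> s M.< m -> Far l (i I.+ + s)) -> Ext Φ -> ∀ g -> U x l (Ch e x i m Φ) g ≈ Ch e x i m (U x l Φ) g
  U-Ch e x l i zero h ext g = refl
  U-Ch e x l i (suc m) {Φ} h ext g = trans (U-Ch e x l i m (\ s p -> h s (N.m≤n⇒m≤1+n p)) (\ q -> +-cong (*-congˡ (ext q)) (lp x (i I.+ + m) ext q)) g) (a3 e x i m (\ g -> trans (trans (*-congˡ (distribˡ _ _ _)) (distribˡ _ _ _)) (+-cong (solve 4 (\ i x e f -> i :* (x :* (e :* f)) := e :* (i :* (x :* f))) refl _ x e _) (U-U x l (i I.+ + m) (h m N.≤-refl) ext g))) g)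
  kO : ∀ e x l r i m {Φ} -> (∀ t s -> t M.< r -> s M.< m -> Far (l I.+ + t) (i I.+ + s)) -> Ext Φ -> ∀ g -> Ch 0# x l r (Ch e x i m Φ) g ≈ Ch e x i m (Ch 0# x l r Φ) g
  kO e x l zero i m h ext g = refl
  kO e x l (suc r) i m {Φ} h ext g = trans (a3 0# x l r (\ g -> trans (trans (+-congʳ (zeroˡ _)) (+-identityˡ _)) (trans (U-Ch e x (l I.+ + r) i m (\ s p -> h r s N.≤-refl p) ext g) (a3 e x i m (\ g -> sym (trans (+-congʳ (zeroˡ _)) (+-identityˡ _))) g))) g) (kO e x l r i m (\ t s p q -> h t s (N.m≤n⇒m≤1+n p) q) (\ q -> +-cong (*-congˡ (ext q)) (lp x (l I.+ + r) ext q)) g)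
  -- The one-letter commutators telescope along the chain to the difference between the value that
  -- arrives at i + m and the value that was at i.
  lE : ∀ {N D g Φ} x i m -> Adm D g -> Bud N (D M.+ m) -> Ext Φ -> Δ N (Ch 1# x i m Φ) g ≈ Ch 1# x i m (Δ N Φ) g + x * (Ch 1# x i m (mul (i I.+ + m) Φ) g - ι (g i) * Ch 1# x i m Φ g)
  lE {N} {D} {g} {Φ} x i zero w bud ext = solve 5 (\ d x u f v -> d := d :+ x :* (u :* f :- u :* f)) refl _ x (ι (g i)) (Φ g) x ⟨≈⟩ +-congˡ (*-congˡ (+-congʳ (*-congʳ (reflexive (cong (\ z -> ι (g z)) (E.sym (Z.+-identityʳ i))))))) where
   infixl 1 _⟨≈⟩_
   _⟨≈⟩_ : ∀ {a b c} -> a ≈ b -> b ≈ c -> a ≈ c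
   _⟨≈⟩_ = trans
  lE {N} {D} {g} {Φ} x i (suc m) w bud ext = begin Δ N (Ch 1# x i (suc m) Φ) g ≈⟨ d9 N {Ch 1# x i (suc m) Φ} {\ g -> Ψ g + U x i Ψ g} g (\ a b _ -> trans (hc 1# x i m Φ (\ y -> g (tr a b y))) (+-congʳ (*-identityˡ _))) ⟩ Δ N (\ g -> Ψ g + U x i Ψ g) g ≈⟨ pw N Ψ (U x i Ψ) g ⟩ Δ N Ψ g + Δ N (U x i Ψ) g ≈⟨ +-cong (ih w (cE (N.+-monoʳ-≤ D (N.n≤1+n m)) bud)) (pu x i w (cE (N.m≤m+n D (suc m)) bud) (fK 1# x (i I.+ 1ℤ) m ext)) ⟩ G g + (U x i (Δ N Ψ) g + x * (ι (g (i I.+ 1ℤ) I.- g i) * Ψ g)) ≈⟨ +-congˡ (+-cong (*-congˡ (*-congˡ (ih (eI aa i w) (E.subst (Bud N) (E.sym (N.+-assoc D 1 m)) bud)))) (*-congˡ (*-congʳ (trans (kd (g (i I.+ 1ℤ)) (I.- g i)) (+-congˡ (e8 (g i))))))) ⟩ G g + (j * (x * G g') + x * ((u - v) * Ψ g)) ≈⟨ +-congˡ (+-congʳ (*-congˡ (*-congˡ (+-congˡ (*-congˡ (+-congˡ (-‿cong (*-congʳ (reflexive (cong (\ z -> ι (g z)) (hE aa i)))))))))) ) ⟩ (n7 + x * (n4 - u * Ψ g)) + (j * (x * (n6 + x * (n3 - v * Ψ g'))) + x * ((u - v) * Ψ g)) ≈⟨ solve 10 (\ n7 x n4 u p j n6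 n3 v p' -> (n7 :+ x :* (n4 :- u :* p)) :+ (j :* (x :* (n6 :+ x :* (n3 :- v :* p'))) :+ x :* ((u :- v) :* p)) := (n7 :+ j :* (x :* n6)) :+ x :* ((n4 :+ j :* (x :* n3)) :- v :* (p :+ j :* (x :* p')))) refl n7 x n4 u (Ψ g) j n6 n3 v (Ψ g') ⟩ (n7 + j * (x * n6)) + x * ((n4 + j * (x * n3)) - v * (Ψ g + j * (x * Ψ g'))) ≈⟨ +-cong (kV (Δ N Φ)) (*-congˡ (+-cong (trans (kV (mul (i I.+ 1ℤ I.+ + m) Φ)) (reflexive (cong (\ z -> Ch 1# x i (suc m) (mul z Φ) g) (gy i m)))) (-‿cong (*-congˡ (kV Φ))))) ⟩ _ ∎ where
   Ψ : Fn -> C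
   Ψ = Ch 1# x (i I.+ 1ℤ) m Φ
   g' : Fn
   g' = s[ i ] g
   G : Fn -> C
   G h = Ch 1# x (i I.+ 1ℤ) m (Δ N Φ) h + x * (Ch 1# x (i I.+ 1ℤ) m (mul (i I.+ 1ℤ I.+ + m) Φ) h - ι (h (i I.+ 1ℤ)) * Ψ h)
   ih : ∀ {D h} -> Adm D h -> Bud N (D M.+ m) -> Δ N Ψ h ≈ G h
   ih w b = lE x (i I.+ 1ℤ) m w b ext
   j u v n7 n6 n4 n3 : C
   j = ind (lt (g (i I.+ 1ℤ)) (g i))
   u = ι (g (i I.+ 1ℤ))
   v = ι (g i)
   n7 = Ch 1# x (i I.+ 1ℤ) m (Δ N Φ) g
   n6 = Ch 1# x (i I.+ 1ℤ) m (Δ N Φ) g'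
   n4 = Ch 1# x (i I.+ 1ℤ) m (mul (i I.+ 1ℤ I.+ + m) Φ) g
   n3 = Ch 1# x (i I.+ 1ℤ) m (mul (i I.+ 1ℤ I.+ + m) Φ) g'
   kV : ∀ Φ -> Ch 1# x (i I.+ 1ℤ) m Φ g + j * (x * Ch 1# x (i I.+ 1ℤ) m Φ g') ≈ Ch 1# x i (suc m) Φ g
   kV Φ = sym (trans (hc 1# x i m Φ g) (+-congʳ (*-identityˡ _)))

-- The Chevalley operator against one factor

module Sweepd where
 open dK
 open cV
 open cB
 open mj
 open fJ
 open qA
 open ad
 open import Data.Product using (_×_)
 lz : ∀ {j p} -> j M.< p -> p ∸ j ≡ suc (p ∸ suc j)
 lz (M.s≤s q) = N.+-∸-assoc 1 q
 module kN (R : CommutativeRing 0ℓ 0ℓ) (n : ℕ) .{{nz : NonZero n}} (aa : 2 M.≤ n) where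
  open aE R
  open ay n
  open kI R n aa
  open bz R n aa
  Σ< : ℕ -> (ℕ -> C) -> C
  Σ< zero f = 0#
  Σ< (suc q) f = Σ< q f + f q
  c7 : ∀ q {f f'} -> (∀ j -> j M.< q -> f j ≈ f' j) -> Σ< q f ≈ Σ< q f'
  c7 zero e = refl
  c7 (suc q) e = +-cong (c7 q (\ j p -> e j (N.m≤n⇒m≤1+n p))) (e q N.≤-refl)
  mD : ∀ q f f' -> Σ< q (\ j -> f j + f' j) ≈ Σ< q f + Σ< q f'
  mD zero f f' = sym (+-identityˡ 0#)
  mD (suc q) f f' = trans (+-congʳ (mD q f f')) (dh _ _ _ _)
  k4 : ∀ q a f -> Σ< q (\ j -> a * f j) ≈ a * Σ< q f
  k4 zero a f = sym (zeroʳ a)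
  k4 (suc q) a f = trans (+-congʳ (k4 q a f)) (sym (distribˡ _ _ _))
  nK : ∀ e x i m q (f : ℕ -> Fn -> C) g -> Ch e x i m (\ h -> Σ< q (\ j -> f j h)) g ≈ Σ< q (\ j -> Ch e x i m (f j) g)
  nK e x i m zero f g = lT m where
   lT : ∀ m {g} -> Ch e x i m (\ _ -> 0#) g ≈ 0#
   lT zero = refl
   lT (suc m) {g} = trans (a3 e x i m (\ g -> solve 3 (\ a b c -> a :* con 0ℤ :+ b :* (c :* con 0ℤ) := con 0ℤ) refl e _ x) g) (lT m)
  nK e x i m (suc q) f g = trans (a3 e x i m (\ h -> +-congˡ (sym (*-identityˡ _))) g) (trans (cC e x i m 1# (\ h -> Σ< q (\ j -> f j h)) (f q) g) (+-cong (nK e x i m q f g) (*-identityˡ _)))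
  o0 : ∀ x i {Φ g} -> QP g -> Ext Φ -> U x (i I.+ + n) Φ g ≈ U x i Φ g
  o0 x i {Φ} {g} w ext = *-cong (reflexive (cong ind bF)) (*-congˡ (ext (\ y -> cong g (ou y)))) where
   ou : ∀ y -> sw aa (i I.+ + n) y ≡ sw aa i y
   ou y = e6.fU n aa (ar aa i) bv (L.solve 2 (\ i n -> (i L.:+ n L.:+ L.I) L.:- (i L.:+ n) L.:= (i L.:+ L.I) L.:- i) E.refl i (+ n)) y
   hI : g (i I.+ + n I.+ 1ℤ) ≡ g (i I.+ 1ℤ) I.+ + n
   hI = E.trans (cong g (L.solve 2 (\ i n -> i L.:+ n L.:+ L.I L.:= i L.:+ L.I L.:+ n) E.refl i (+ n))) (w _)
   bF : lt (g (i I.+ + n I.+ 1ℤ)) (g (i I.+ + n)) ≡ lt (g (i I.+ 1ℤ)) (g i)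
   bF with g (i I.+ 1ℤ) I.<? g i
   ... | yes p = E.trans (bg (E.subst₂ I._<_ (E.sym hI) (E.sym (w i)) (Z.+-monoˡ-< (+ n) p))) (E.sym (bg p))
   ... | no p = E.trans (bk (\ q -> p (aB 0 (st (E.subst₂ I._<_ hI (w i) q)) (L.solve 3 (\ a b n -> b L.:- a L.:= ((b L.:+ n) L.:- (a L.:+ n L.:+ L.I)) L.:+ L.I) E.refl (g (i I.+ 1ℤ)) (g i) (+ n))))) (E.sym (bk p))
  gj : ∀ {y z} -> y I.+ 1ℤ I.< z -> z I.+ 1ℤ I.< y I.+ + n -> Far z y
  gj {y} {z} p q = far (jE y<z (Z.<-trans z<z+1 q)) (jE p z<) (jE (Z.<-trans y<z z<z+1) q) (jE (Z.+-monoˡ-< 1ℤ y<z) (Z.<-trans q (E.subst (y I.+ + n I.<_) (L.solve 2 (\ y n -> y L.:+ n L.:+ L.I L.:= y L.:+ L.I L.:+ n) E.refl y (+ n)) (up _)))) where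
   up : ∀ y -> y I.< y I.+ 1ℤ
   up y = aB 0 (Z.≤-refl {y}) (L.solve 1 (\ a -> (a L.:+ L.I) L.:- a L.:= (a L.:- a) L.:+ L.I) E.refl y)
   y<z : y I.< z
   y<z = Z.<-trans (up y) p
   z<z+1 = up z
   z< : z I.< y I.+ 1ℤ I.+ + n
   z< = Z.<-trans z<z+1 (Z.<-trans q (E.subst (y I.+ + n I.<_) (L.solve 2 (\ y n -> y L.:+ n L.:+ L.I L.:= y L.:+ L.I L.:+ n) E.refl y (+ n)) (up _)))
   jE : ∀ {y z} -> y I.< z -> z I.< y I.+ + n -> z ≁ y
   jE p q e = bm p q (ae e)
  module _ (x : C) (b : ℤ) where
   private
    -- For the missing letter b + q: `P` takes the free letters behind it, `Q` the forced letters
    -- before it. `B j t` forces the t letters after b + n + j.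
    P : ℕ -> (Fn -> C) -> Fn -> C
    P q Ψ = Ch 1# x (b I.+ 1ℤ I.+ + q) (n ∸ suc q) Ψ
    Q : ℕ -> (Fn -> C) -> Fn -> C
    Q q Φ = Ch 0# x (b I.+ + n) q Φ
    B : ℕ -> ℕ -> (Fn -> C) -> Fn -> C
    B j t Ψ = Ch 0# x (b I.+ + n I.+ + suc j) t Ψ
    d : ℕ -> (Fn -> C) -> Fn -> C
    d j Ψ h = ι (h (b I.+ + n I.+ + j I.+ 1ℤ) I.- h (b I.+ + n I.+ + j)) * Ψ h
   -- In the j-th term of the sum the forced letter b + n + j is replaced by a difference of two
   -- neighbouring values.
   Δ-Q : ∀ {N D g Φ} p -> Adm D g -> Bud N (D M.+ p) -> Ext Φ -> Δ N (Q p Φ) g ≈ Q p (Δ N Φ) g + x * Σ< p (\ j -> Q j (d j (B j (p ∸ suc j) Φ)) g)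
   Δ-Q {N} {D} {g} {Φ} zero w bud ext = sym (trans (+-congˡ (zeroʳ x)) (+-identityʳ _))
   Δ-Q {N} {D} {g} {Φ} (suc p) w bud ext = begin Δ N (Q p Φ') g ≈⟨ Δ-Q p w (cE (N.+-monoʳ-≤ D (N.n≤1+n p)) bud) ext' ⟩ Q p (Δ N Φ') g + x * Σ< p (\ j -> Q j (d j (B j (p ∸ suc j) Φ')) g) ≈⟨ +-cong (trans (cD 0# x (b I.+ + n) p aQ g w) (cC 0# x (b I.+ + n) p x _ (d p Φ) g)) (*-congˡ (c7 p (\ j r -> reflexive (E.sym (hm j r))))) ⟩ (Q (suc p) (Δ N Φ) g + x * Q p (d p Φ) g) + x * Σ< p (\ j -> Q j (d j (B j (suc p ∸ suc j) Φ)) g) ≈⟨ solve 4 (\ a x b c -> (a :+ x :* b) :+ x :* c := a :+ x :* (c :+ b)) refl _ x _ _ ⟩ Q (suc p) (Δ N Φ) g + x * (Σ< p (\ j -> Q j (d j (B j (suc p ∸ suc j) Φ)) g) + Q p (d p Φ) g) ≈⟨ +-congˡ (*-congˡ (+-congˡ (reflexive (cong (\ z -> Q p (d p (B p z Φ)) g) (E.sym (N.n∸n≡0 p)))))) ⟩ _ ∎ where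
    l = b I.+ + n I.+ + p
    Φ' : Fn -> C
    Φ' g = 0# * Φ g + U x l Φ g
    ext' : Ext Φ'
    ext' q = +-cong (*-congˡ (ext q)) (lp x l ext q)
    hm : ∀ j -> j M.< p -> Q j (d j (B j (suc p ∸ suc j) Φ)) g ≡ Q j (d j (B j (p ∸ suc j) Φ')) g
    hm j r = E.trans (cong (\ z -> Q j (d j (B j z Φ)) g) (lz r)) (cong (\ z -> Q j (d j (B j (p ∸ suc j) (\ g -> 0# * Φ g + U x z Φ g))) g) (E.trans (Z.+-assoc (b I.+ + n) (+ suc j) (+ (p ∸ suc j))) (cong (\ z -> b I.+ + n I.+ + z) (N.m+[n∸m]≡n r))))
    aQ : ∀ h -> Adm (D M.+ p) h -> Δ N Φ' h ≈ (0# * Δ N Φ h + U x l (Δ N Φ) h) + x * d p Φ h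
    aQ h w' = trans (pw N (\ g -> 0# * Φ g) (U x l Φ) h) (trans (+-cong (nQ N 0# Φ h) (pu x l w' (cE (N.+-monoʳ-≤ D (N.n≤1+n p)) bud) ext)) (sym (+-assoc _ _ _)))
   private
    Q-d : ∀ j Ψ g -> suc j M.< n -> Q j (d j Ψ) g ≈ mul (b I.+ + n I.+ + suc j) (Q j Ψ) g + (- 1#) * mul (b I.+ + n) (Q j Ψ) g
    Q-d j Ψ g p = begin Q j (d j Ψ) g ≈⟨ a3 0# x (b I.+ + n) j a8 g ⟩ Q j (\ h -> mul (b I.+ + n I.+ + suc j) Ψ h + (- 1#) * mul (b I.+ + n I.+ + j) Ψ h) g ≈⟨ cC 0# x (b I.+ + n) j (- 1#) _ _ g ⟩ Q j (mul (b I.+ + n I.+ + suc j) Ψ) g + (- 1#) * Q j (mul (b I.+ + n I.+ + j) Ψ) g ≈⟨ +-cong (bY 0# x (b I.+ + n) j _ Ψ (\ s r e -> bm (Z.+-monoʳ-< (b I.+ + n) (I.+<+ (M.s≤s r))) (gm s) (ae e)) g) (*-congˡ (d5 x (b I.+ + n) j Ψ g)) ⟩ _ ∎ where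
     gm : ∀ s -> b I.+ + n I.+ + suc j I.< b I.+ + n I.+ + s I.+ + n
     gm s = aB 0 (I.+≤+ p & I.+≤+ {0} {s} M.z≤n) (L.solve 4 (\ b n j s -> (b L.:+ s L.:+ n) L.:- (b L.:+ (L.I L.:+ j)) L.:= ((n L.:+ s) L.:- (L.con (+ 2) L.:+ j L.:+ L.O)) L.:+ L.I) E.refl (b I.+ + n) (+ n) (+ j) (+ s))
     a8 : ∀ h -> d j Ψ h ≈ mul (b I.+ + n I.+ + suc j) Ψ h + (- 1#) * mul (b I.+ + n I.+ + j) Ψ h
     a8 h = trans (*-congʳ (trans (kd (h (b I.+ + n I.+ + j I.+ 1ℤ)) (I.- h (b I.+ + n I.+ + j))) (+-cong (reflexive (cong (\ z -> ι (h z)) (jB (b I.+ + n) j))) (e8 (h (b I.+ + n I.+ + j)))))) (trans (distribʳ _ _ _) (+-congˡ (trans (sym (-‿distribˡ-* _ _)) (trans (-‿cong (sym (*-identityˡ _))) (-‿distribˡ-* _ _)))))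
    r+ : ∀ q -> q M.< n -> + n ≡ 1ℤ I.+ + q I.+ + (n ∸ suc q)
    r+ q p = cong +_ (E.sym (N.m+[n∸m]≡n p))
    endP : ∀ q -> q M.< n -> b I.+ 1ℤ I.+ + q I.+ + (n ∸ suc q) ≡ b I.+ + n
    endP q p = E.trans (L.solve 3 (\ b q r -> b L.:+ L.I L.:+ q L.:+ r L.:= b L.:+ (L.I L.:+ q L.:+ r)) E.refl b (+ q) (+ (n ∸ suc q))) (cong (I._+_ b) (E.sym (r+ q p)))
    P-mul : ∀ q j Ψ g -> q M.< n -> j M.< q -> P q (mul (b I.+ + n I.+ + suc j) Ψ) g ≈ mul (b I.+ + n I.+ + suc j) (P q Ψ) g
    P-mul q j Ψ g p r = bY 1# x _ (n ∸ suc q) _ Ψ (\ s t e -> bm (low s t) (high s) (ae e)) g where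
     low : ∀ s -> s M.≤ n ∸ suc q -> b I.+ 1ℤ I.+ + q I.+ + s I.< b I.+ + n I.+ + suc j
     low s t = aB 0 (I.+≤+ t & I.+≤+ {0} {j} M.z≤n) (E.trans (cong (\ z -> b I.+ z I.+ + suc j I.- (b I.+ 1ℤ I.+ + q I.+ + s)) (r+ q p)) (L.solve 5 (\ b q r j s -> (b L.:+ (L.I L.:+ q L.:+ r) L.:+ (L.I L.:+ j)) L.:- (b L.:+ L.I L.:+ q L.:+ s) L.:= ((r L.:+ j) L.:- (s L.:+ L.O)) L.:+ L.I) E.refl b (+ q) (+ (n ∸ suc q)) (+ j) (+ s)))
     high : ∀ s -> b I.+ + n I.+ + suc j I.< b I.+ 1ℤ I.+ + q I.+ + s I.+ + n
     high s = aB 0 (I.+≤+ r & I.+≤+ {0} {s} M.z≤n) (L.solve 5 (\ b q n j s -> (b L.:+ L.I L.:+ q L.:+ s L.:+ n) L.:- (b L.:+ n L.:+ (L.I L.:+ j)) L.:= ((q L.:+ s) L.:- (L.I L.:+ j L.:+ L.O)) L.:+ L.I) E.refl b (+ q) (+ n) (+ j) (+ s))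
    -- `M` is the identity or the factor g(b + n); the commutator involves both. With letters
    -- counted from b: in `V q j` the letter j is missing, j + 1 to q - 1 are forced and the later
    -- ones are free; in `Z q j` the letter q is missing too.
    module Block (Φ : Fn -> C) (ext : Ext Φ) (g : Fn) (D : ℕ) (w : Adm D g) (M : (Fn -> C) -> Fn -> C) (M-Ext : ∀ {Ψ} -> Ext Ψ -> Ext (M Ψ)) (M-cong : ∀ {Ψ Ψ'} -> (∀ h -> Ψ h ≈ Ψ' h) -> ∀ h -> M Ψ h ≈ M Ψ' h) (M-comm : ∀ j t -> suc j M.+ t M.< n -> ∀ Ψ h -> B j t (M Ψ) h ≈ M (B j t Ψ) h) where
     Z V : ℕ -> ℕ -> C
     Z q j = P q (M (Q j (B j (q ∸ suc j) Φ))) g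
     V zero j = 0#
     V (suc q) j = B j (q ∸ j) (P q (M (Q j Φ))) g
     W : ℕ -> C
     W q = P q (M (Q q Φ)) g
     p5 : ∀ q -> V (suc q) q ≡ W q
     p5 q = cong (\ z -> B q z (P q (M (Q q Φ))) g) (N.n∸n≡0 q)
     -- A forced letter is a free letter minus an absent one, applied to the letter q.
     ob : ∀ q j -> q M.< n -> j M.< q -> V (suc q) j ≈ V q j - Z q j
     ob (suc q) j p (M.s≤s j≤q) = begin B j (suc q ∸ j) (P (suc q) Ψ) g ≡⟨ cong (\ z -> B j z (P (suc q) Ψ) g) (N.+-∸-assoc 1 j≤q) ⟩ B j t (\ h -> 0# * P (suc q) Ψ h + U x (b I.+ + n I.+ + suc j I.+ + t) (P (suc q) Ψ) h) g ≈⟨ cD 0# x (b I.+ + n I.+ + suc j) t (\ h w' -> trans (trans (+-congʳ (zeroˡ _)) (+-identityˡ _)) (aQ h (qp w'))) g w ⟩ B j t (\ h -> P q Ψ h + (- 1#) * P (suc q) Ψ h) g ≈⟨ cC 0# x (b I.+ + n I.+ + suc j) t (- 1#) _ _ g ⟩ B j t (P q Ψ) g + (- 1#) * B j t (P (suc q) Ψ) g ≈⟨ +-congˡ (trans (sym (-‿distribˡ-* _ _)) (-‿cong (trans (*-identityˡ _) jM))) ⟩ V (suc q) j - Z (suc q) j ∎ where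
      t = q ∸ j
      Ψ : Fn -> C
      Ψ = M (Q j Φ)
      jt : j M.+ t ≡ q
      jt = N.m+[n∸m]≡n j≤q
      lg : Ext Ψ
      lg = M-Ext (fK 0# x (b I.+ + n) j ext)
      nY : b I.+ + n I.+ + suc j I.+ + t ≡ b I.+ 1ℤ I.+ + q I.+ + n
      nY = E.trans (L.solve 4 (\ b n j t -> b L.:+ n L.:+ (L.I L.:+ j) L.:+ t L.:= b L.:+ L.I L.:+ (j L.:+ t) L.:+ n) E.refl b (+ n) (+ j) (+ t)) (cong (\ z -> b I.+ 1ℤ I.+ + z I.+ + n) jt)
      aQ : ∀ h -> QP h -> U x (b I.+ + n I.+ + suc j I.+ + t) (P (suc q) Ψ) h ≈ P q Ψ h + (- 1#) * P (suc q) Ψ h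
      aQ h w' = begin U x (b I.+ + n I.+ + suc j I.+ + t) (P (suc q) Ψ) h ≡⟨ cong (\ z -> U x z (P (suc q) Ψ) h) nY ⟩ U x (b I.+ 1ℤ I.+ + q I.+ + n) (P (suc q) Ψ) h ≈⟨ o0 x (b I.+ 1ℤ I.+ + q) {P (suc q) Ψ} {h} w' (fK 1# x _ (n ∸ suc (suc q)) lg) ⟩ U x (b I.+ 1ℤ I.+ + q) (P (suc q) Ψ) h ≈⟨ solve 2 (\ u p -> u := (p :+ u) :+ (:- p)) refl _ (P (suc q) Ψ h) ⟩ (P (suc q) Ψ h + U x (b I.+ 1ℤ I.+ + q) (P (suc q) Ψ) h) - P (suc q) Ψ h ≈⟨ +-cong kV (trans (-‿cong (sym (*-identityˡ _))) (-‿distribˡ-* _ _)) ⟩ P q Ψ h + (- 1#) * P (suc q) Ψ h ∎ where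
       pos : b I.+ 1ℤ I.+ + q I.+ 1ℤ ≡ b I.+ 1ℤ I.+ + suc q
       pos = jB (b I.+ 1ℤ) q
       kV : P (suc q) Ψ h + U x (b I.+ 1ℤ I.+ + q) (P (suc q) Ψ) h ≈ P q Ψ h
       kV = trans (+-congʳ (sym (*-identityˡ _))) (trans (reflexive (cong (\ z -> 1# * Ch 1# x z (n ∸ suc (suc q)) Ψ h + U x (b I.+ 1ℤ I.+ + q) (Ch 1# x z (n ∸ suc (suc q)) Ψ) h) (E.sym pos))) (trans (sym (hc 1# x (b I.+ 1ℤ I.+ + q) (n ∸ suc (suc q)) Ψ h)) (reflexive (cong (\ z -> Ch 1# x (b I.+ 1ℤ I.+ + q) z Ψ h) (E.sym (lz p))))))
      r = n ∸ suc (suc q)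
      nE : + n ≡ 1ℤ I.+ (1ℤ I.+ + q) I.+ + r
      nE = r+ (suc q) p
      jM : B j t (P (suc q) Ψ) g ≈ Z (suc q) j
      jM = trans (kO 1# x _ t _ r farP lg g) (a3 1# x _ r (\ h -> trans (M-comm j t (N.≤-trans (M.s≤s (M.s≤s (N.≤-reflexive jt))) p) (Q j Φ) h) (M-cong (\ h -> kO 0# x _ t _ j farQ ext h) h)) g) where
       farP : ∀ u s -> u M.< t -> s M.< r -> Far (b I.+ + n I.+ + suc j I.+ + u) (b I.+ 1ℤ I.+ + suc q I.+ + s)
       farP u s p₁ p₂ = gj (aB 0 (I.+≤+ p₂ & I.+≤+ {0} {j} M.z≤n & I.+≤+ {0} {u} M.z≤n) (E.trans (cong (\ z -> b I.+ z I.+ + suc j I.+ + u I.- (b I.+ 1ℤ I.+ + suc q I.+ + s I.+ 1ℤ)) nE) (L.solve 6 (\ b q r j u s -> (b L.:+ (L.I L.:+ (L.I L.:+ q) L.:+ r) L.:+ (L.I L.:+ j) L.:+ u) L.:- (b L.:+ L.I L.:+ (L.I L.:+ q) L.:+ s L.:+ L.I) L.:= ((r L.:+ (j L.:+ u)) L.:- ((L.I L.:+ s) L.:+ (L.O L.:+ L.O))) L.:+ L.I) E.refl b (+ q) (+ r) (+ j) (+ u) (+ s)))) (aB 0 (I.+≤+ p₁ & I.+≤+ {0} {s} M.z≤n) (E.trans (cong (\ z -> b I.+ 1ℤ I.+ + suc z I.+ + s I.+ + n I.- (b I.+ + n I.+ + suc j I.+ + u I.+ 1ℤ)) (E.sym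 jt)) (L.solve 6 (\ b n t j u s -> (b L.:+ L.I L.:+ (L.I L.:+ (j L.:+ t)) L.:+ s L.:+ n) L.:- (b L.:+ n L.:+ (L.I L.:+ j) L.:+ u L.:+ L.I) L.:= ((t L.:+ s) L.:- (L.I L.:+ u L.:+ L.O)) L.:+ L.I) E.refl b (+ n) (+ t) (+ j) (+ u) (+ s))))
       farQ : ∀ u s -> u M.< t -> s M.< j -> Far (b I.+ + n I.+ + suc j I.+ + u) (b I.+ + n I.+ + s)
       farQ u s p₁ p₂ = gj (aB 0 (I.+≤+ p₂ & I.+≤+ {0} {u} M.z≤n) (L.solve 4 (\ b j u s -> (b L.:+ (L.I L.:+ j) L.:+ u) L.:- (b L.:+ s L.:+ L.I) L.:= ((j L.:+ u) L.:- (L.I L.:+ s L.:+ L.O)) L.:+ L.I) E.refl (b I.+ + n) (+ j) (+ u) (+ s))) (aB 0 (I.+≤+ p₁ & I.+≤+ {0} {r} M.z≤n & I.+≤+ {0} {s} M.z≤n) (E.trans (cong (\ z -> (b I.+ + n) I.+ + s I.+ z I.- ((b I.+ + n) I.+ + suc j I.+ + u I.+ 1ℤ)) (E.trans nE (cong (\ z -> 1ℤ I.+ (1ℤ I.+ + z) I.+ + r) (E.sym jt)))) (L.solve 6 (\ b j t u s r -> (b L.:+ s L.:+ (L.I L.:+ (L.I L.:+ (j L.:+ t)) L.:+ r)) L.:- (b L.:+ (L.I L.:+ j) L.:+ u L.:+ L.I) L.:= ((t L.:+ (r L.:+ s)) L.:- (L.I L.:+ u L.:+ (L.O L.:+ L.O)))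 L.:+ L.I) E.refl (b I.+ + n) (+ j) (+ t) (+ u) (+ s) (+ r))))
   private
    module Total {Φ : Fn -> C} (ext : Ext Φ) {g : Fn} {D : ℕ} (w : Adm D g) where
     M : (Fn -> C) -> Fn -> C
     M = mul (b I.+ + n)
     module bG = Block Φ ext g D w (\ Ψ -> Ψ) (\ e -> e) (\ e -> e) (\ _ _ _ _ _ -> refl)
     module K = Block Φ ext g D w M (\ e q -> *-cong (reflexive (cong ι (q _))) (e q)) (\ e h -> *-congˡ (e h)) (\ j t p Ψ h -> bY 0# x _ t _ Ψ (\ s r -> bm (aB 0 (I.+≤+ {0} {j} M.z≤n & I.+≤+ {0} {s} M.z≤n) (L.solve 3 (\ b j s -> (b L.:+ (L.I L.:+ j) L.:+ s) L.:- b L.:= ((j L.:+ s) L.:- (L.O L.:+ L.O)) L.:+ L.I) E.refl (b I.+ + n) (+ j) (+ s))) (aB 0 (I.+≤+ p & I.+≤+ r) (L.solve 5 (\ b n j t s -> (b L.:+ n) L.:- (b L.:+ (L.I L.:+ j) L.:+ s) L.:= ((n L.:+ t) L.:- (L.I L.:+ (L.I L.:+ j L.:+ t) L.:+ s)) L.:+ L.I) E.refl (b I.+ + n) (+ n) (+ j) (+ t) (+ s)))) h)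
     a : ℕ -> C
     a j = ι (g (b I.+ 1ℤ I.+ + j))
     ν : C
     ν = ι (+ n)
     -- x times this is the commutator of `Δ` with the term of the missing letter q, see `Δ-W`.
     kX : ℕ -> C
     kX q = (K.W q - a q * bG.W q) + Σ< q (\ j -> (a j + ν) * bG.Z q j - K.Z q j)
     -- Chosen so that the sum over q telescopes: `b1 (suc q) j` minus `b1 q j` is the j-th
     -- correction in `kX q`, and `b1 (suc q) q` is its main term.
     b1 : ℕ -> ℕ -> C
     b1 q j = (K.V q j + ν * bG.W j) - (a j + ν) * bG.V q j
     iF : ∀ q -> q M.≤ n -> Σ< q kX ≈ Σ< q (b1 q)
     iF zero p = refl
     iF (suc q) p = begin Σ< q kX + kX q ≈⟨ +-congʳ (iF q (N.≤-trans (N.n≤1+n q) p)) ⟩ Σ< q (b1 q) + ((K.W q - a q * bG.W q) + Σ< q (\ j -> (a j + ν) * bG.Z q j - K.Z q j)) ≈⟨ solve 3 (\ s w z -> s :+ (w :+ z) := (s :+ z) :+ w) refl _ _ _ ⟩ (Σ< q (b1 q) + Σ< q (\ j -> (a j + ν) * bG.Z q j - K.Z q j)) + (K.W q - a q * bG.W q) ≈⟨ +-cong (trans (sym (mD q _ _)) (c7 q (\ j r -> trans (ij _ _ _ _ _ _) (sym (+-cong (+-congʳ (K.ob q j p r)) (-‿cong (*-congˡ (bG.ob q j p r)))))))) new ⟩ Σ< (suc q) (b1 (suc q)) ∎ where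
      ij : ∀ k w c v z m -> ((k + w) - c * v) + (c * z - m) ≈ ((k - m) + w) - c * (v - z)
      ij = solve 6 (\ k w c v z m -> ((k :+ w) :- c :* v) :+ (c :* z :- m) := ((k :- m) :+ w) :- c :* (v :- z)) refl
      new : K.W q - a q * bG.W q ≈ b1 (suc q) q
      new = trans (solve 4 (\ k a w v -> k :- a :* w := (k :+ v :* w) :- (a :+ v) :* w) refl _ (a q) _ ν) (sym (+-cong (+-congʳ (reflexive (K.p5 q))) (-‿cong (*-congˡ (reflexive (bG.p5 q))))))
     -- For q = n all letters except j are forced. The factor g(b + n) moves through this full chain
     -- and becomes a j; what then remains of `V n j` has n - 1 letters and gets the factor x^n.
     k9 : ∀ j -> j M.< n -> x * b1 n j ≈ x * (ν * bG.W j) + (x * pow x (n ∸ 1)) * - (ν * (Ch 0# 1# (b I.+ + n I.+ + suc j) (n ∸ suc j) (Ch 0# 1# (b I.+ + n) j Φ) g))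
     k9 j p = begin x * ((K.V n j + ν * bG.W j) - (a j + ν) * bG.V n j) ≈⟨ *-congˡ (+-congʳ (+-congʳ oS)) ⟩ x * ((a j * bG.V n j + ν * bG.W j) - (a j + ν) * bG.V n j) ≈⟨ solve 5 (\ x a v u w -> x :* ((a :* v :+ u :* w) :- (a :+ u) :* v) := x :* (u :* w) :+ x :* (:- (u :* v))) refl x (a j) _ ν _ ⟩ x * (ν * bG.W j) + x * - (ν * bG.V n j) ≈⟨ +-congˡ (*-congˡ (-‿cong (*-congˡ power))) ⟩ x * (ν * bG.W j) + x * - (ν * (pow x (n ∸ 1) * E)) ≈⟨ +-congˡ (solve 4 (\ x u p e -> x :* (:- (u :* (p :* e))) := (x :* p) :* (:- (u :* e))) refl x ν _ E) ⟩ _ ∎ where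
      l = b I.+ + n I.+ + suc j
      t = n ∸ suc j
      E = Ch 0# 1# l t (Ch 0# 1# (b I.+ + n) j Φ) g
      n' = n ∸ 1
      n≡ : n ≡ suc n'
      n≡ = E.sym (N.m+[n∸m]≡n {1} (N.≤-trans (M.s≤s M.z≤n) p))
      hm : ∀ (V : ℕ -> ℕ -> C) (M : (Fn -> C) -> Fn -> C) -> (∀ q -> V (suc q) j ≡ B j (q ∸ j) (P q (M (Q j Φ))) g) -> V n j ≡ B j t (M (Q j Φ)) g
      hm V M e = E.trans (cong (\ z -> V z j) n≡) (E.trans (e n') (E.trans (cong (\ z -> B j z (P n' (M (Q j Φ))) g) (N.∸-+-assoc n 1 j)) (cong (\ z -> B j t (Ch 1# x (b I.+ 1ℤ I.+ + n') z (M (Q j Φ))) g) (E.trans (cong (n ∸_) (E.sym n≡)) (N.n∸n≡0 n)))))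
      end : l I.+ + t ≡ b I.+ + n I.+ + n
      end = E.trans (Z.+-assoc (b I.+ + n) (+ suc j) (+ t)) (cong (\ z -> b I.+ + n I.+ + z) (N.m+[n∸m]≡n p))
      oS : K.V n j ≈ a j * bG.V n j
      oS = begin K.V n j ≡⟨ hm K.V M (\ _ -> E.refl) ⟩ B j t (M (Q j Φ)) g ≈⟨ cD 0# x l t (\ h w' -> trans (*-congʳ (trans (reflexive (cong ι (E.trans (L.solve 2 (\ a n -> a L.:= (a L.:+ n) L.:- n) E.refl (h (b I.+ + n)) (+ n)) (cong (I._- + n) (E.trans (E.sym (qp w' _)) (cong h (E.sym end))))))) (trans (kd (h (l I.+ + t)) (I.- + n)) (+-congˡ (e8 (+ n)))))) (solve 3 (\ m v q -> (m :+ (:- v)) :* q := m :* q :+ (:- v) :* q) refl _ ν (Q j Φ h))) g w ⟩ B j t (\ h -> mul (l I.+ + t) (Q j Φ) h + (- ν) * Q j Φ h) g ≈⟨ cC 0# x l t (- ν) _ _ g ⟩ B j t (mul (l I.+ + t) (Q j Φ)) g + (- ν) * B j t (Q j Φ) g ≈⟨ +-congʳ (trans (d5 x l t (Q j Φ) g) (*-congʳ (trans (reflexive (cong ι (E.trans (cong g (L.solve 3 (\ b n j -> b L.:+ n L.:+ (L.I L.:+ j) L.:= b L.:+ L.I L.:+ j L.:+ n) E.refl b (+ n) (+ j))) (qp w (b I.+ 1ℤ I.+ + j))))) (kd (g (b I.+ 1ℤ I.+ + j)) (+ n))))) ⟩ (a j + ν) * B j t (Q j Φ) g + (- ν) * B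 j t (Q j Φ) g ≈⟨ solve 3 (\ a u v -> (a :+ u) :* v :+ (:- u) :* v := a :* v) refl (a j) ν _ ⟩ a j * B j t (Q j Φ) g ≈⟨ *-congˡ (reflexive (E.sym (hm bG.V (\ z -> z) (\ _ -> E.refl)))) ⟩ a j * bG.V n j ∎
      power : bG.V n j ≈ pow x (n ∸ 1) * E
      power = begin bG.V n j ≡⟨ hm bG.V (\ z -> z) (\ _ -> E.refl) ⟩ B j t (Q j Φ) g ≈⟨ kP x l t (Q j Φ) g ⟩ pow x t * Ch 0# 1# l t (Q j Φ) g ≈⟨ *-congˡ (trans (a3 0# 1# l t (\ h -> trans (kP x (b I.+ + n) j Φ h) (sym (+-identityˡ _))) g) (trans (cC 0# 1# l t (pow x j) (\ _ -> 0#) _ g) (trans (+-congʳ (nK 0# 1# l t 0 (\ _ _ -> 0#) g)) (+-identityˡ _)))) ⟩ pow x t * (pow x j * E) ≈⟨ sym (*-assoc _ _ _) ⟩ (pow x t * pow x j) * E ≈⟨ *-congʳ (trans (oC t j) (reflexive (cong (pow x) tj))) ⟩ pow x (n ∸ 1) * E ∎ where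
       oC : ∀ s t -> pow x s * pow x t ≈ pow x (s M.+ t)
       oC zero t = *-identityˡ _
       oC (suc s) t = trans (*-assoc _ _ _) (*-congˡ (oC s t))
       tj : t M.+ j ≡ n ∸ 1
       tj = E.trans (cong (M._+ j) (E.trans (E.sym (N.∸-+-assoc n 1 j)) E.refl)) (N.m∸n+n≡m (N.≤-pred (E.subst (suc j M.≤_) n≡ p)))
     ia : pow x n ≈ 0# -> x * Σ< n kX ≈ x * (ν * Σ< n bG.W)
     ia z = begin x * Σ< n kX ≈⟨ *-congˡ (iF n N.≤-refl) ⟩ x * Σ< n (b1 n) ≈⟨ sym (k4 n x _) ⟩ Σ< n (\ j -> x * b1 n j) ≈⟨ c7 n (\ j p -> trans (k9 j p) (trans (+-congˡ (trans (*-congʳ (x^ p)) (zeroˡ _))) (trans (+-identityʳ _) (sym (*-assoc _ _ _))))) ⟩ Σ< n (\ j -> (x * ν) * bG.W j) ≈⟨ trans (k4 n (x * ν) bG.W) (*-assoc _ _ _) ⟩ x * (ν * Σ< n bG.W) ∎ where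
      x^ : ∀ {j} -> j M.< n -> x * pow x (n ∸ 1) ≈ 0#
      x^ p = trans (reflexive (cong (pow x) (N.m+[n∸m]≡n {1} (N.≤-trans (M.s≤s M.z≤n) p)))) z
     Δ-W : ∀ {N} q -> q M.< n -> Bud N (D M.+ n) -> Δ N (P q (Q q Φ)) g ≈ P q (Q q (Δ N Φ)) g + x * kX q
     Δ-W {N} q p bud = begin Δ N (P q (Q q Φ)) g ≈⟨ lE x i m w (cE (N.+-monoʳ-≤ D (N.m∸n≤m n (suc q))) bud) (fK 0# x (b I.+ + n) q ext) ⟩ P q (Δ N (Q q Φ)) g + x * (P q (mul (i I.+ + m) (Q q Φ)) g - a q * bG.W q) ≈⟨ +-cong aQ (*-congˡ (+-congʳ (reflexive (cong (\ z -> P q (mul z (Q q Φ)) g) (endP q p))))) ⟩ (P q (Q q (Δ N Φ)) g + x * Σ< q (\ j -> (a j + ν) * bG.Z q j - K.Z q j)) + x * (K.W q - a q * bG.W q) ≈⟨ solve 4 (\ a x s c -> (a :+ x :* s) :+ x :* c := a :+ x :* (c :+ s)) refl _ x _ _ ⟩ _ ∎ where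
      i = b I.+ 1ℤ I.+ + q
      m = n ∸ suc q
      mq : D M.+ m M.+ q M.≤ D M.+ n
      mq = N.≤-trans (N.≤-reflexive (N.+-assoc D m q)) (N.+-monoʳ-≤ D (N.≤-trans (N.≤-reflexive (N.+-comm m q)) (N.≤-trans (N.n≤1+n _) (N.≤-reflexive (N.m+[n∸m]≡n p)))))
      jF : ∀ j -> j M.< q -> P q (Q j (d j (B j (q ∸ suc j) Φ))) g ≈ (a j + ν) * bG.Z q j - K.Z q j
      jF j r = begin P q (Q j (d j Ψ)) g ≈⟨ a3 1# x i m (\ h -> Q-d j Ψ h (N.≤-<-trans r p)) g ⟩ P q (\ h -> mul (b I.+ + n I.+ + suc j) (Q j Ψ) h + (- 1#) * M (Q j Ψ) h) g ≈⟨ cC 1# x i m (- 1#) _ _ g ⟩ P q (mul (b I.+ + n I.+ + suc j) (Q j Ψ)) g + (- 1#) * K.Z q j ≈⟨ +-cong (trans (P-mul q j (Q j Ψ) g p r) (*-congʳ (trans (reflexive (cong ι (E.trans (cong g (L.solve 3 (\ b n j -> b L.:+ n L.:+ (L.I L.:+ j) L.:= b L.:+ L.I L.:+ j L.:+ n) E.refl b (+ n) (+ j))) (qp w (b I.+ 1ℤ I.+ + j))))) (kd (g (b I.+ 1ℤ I.+ + j)) (+ n))))) (trans (sym (-‿distribˡ-* _ _)) (-‿cong (*-identityˡ _))) ⟩ (a j + ν) * bG.Z q j - K.Z q j ∎ where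
       Ψ : Fn -> C
       Ψ = B j (q ∸ suc j) Φ
      aQ : P q (Δ N (Q q Φ)) g ≈ P q (Q q (Δ N Φ)) g + x * Σ< q (\ j -> (a j + ν) * bG.Z q j - K.Z q j)
      aQ = begin P q (Δ N (Q q Φ)) g ≈⟨ cD 1# x i m (\ h w' -> Δ-Q q w' (cE mq bud) ext) g w ⟩ P q (\ h -> Q q (Δ N Φ) h + x * Σ< q (\ j -> Q j (d j (B j (q ∸ suc j) Φ)) h)) g ≈⟨ cC 1# x i m x _ _ g ⟩ P q (Q q (Δ N Φ)) g + x * P q (\ h -> Σ< q (\ j -> Q j (d j (B j (q ∸ suc j) Φ)) h)) g ≈⟨ +-congˡ (*-congˡ (trans (nK 1# x i m q (\ j -> Q j (d j (B j (q ∸ suc j) Φ))) g) (c7 q jF))) ⟩ _ ∎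
    o9 : ∀ Φ g -> Hb x b Φ g ≈ Σ< n (\ q -> P q (Q q Φ) g)
    o9 Φ g = sym (trans (go 0 n E.refl) (+-identityˡ _)) where
     go : ∀ p q -> p M.+ q ≡ n -> Σ< n (\ q -> P q (Q q Φ) g) ≈ Σ< p (\ q -> P q (Q q Φ) g) + Hgo x b Φ g p q
     go p zero e = trans (reflexive (cong (\ z -> Σ< z (\ q -> P q (Q q Φ) g)) (E.trans (E.sym e) (N.+-identityʳ p)))) (sym (+-identityʳ _))
     go p (suc q) e = trans (go (suc p) q (E.trans (E.sym (N.+-suc p q)) e)) (trans (+-assoc _ _ _) (+-congˡ (+-congʳ (reflexive (cong (\ z -> Ch 1# x (b I.+ 1ℤ I.+ + p) z (Q p Φ) g) (E.trans (cong (_∸ suc p) (E.trans (E.sym e) (N.+-suc p q))) (N.m+n∸m≡n (suc p) q)))))))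
    om : ∀ N q (f : ℕ -> Fn -> C) g -> Δ N (\ h -> Σ< q (\ j -> f j h)) g ≈ Σ< q (\ j -> Δ N (f j) g)
    om N zero f g = trans (trans (d9 N {\ _ -> 0#} {\ _ -> 0# * 0#} g (\ _ _ _ -> sym (zeroˡ _))) (nQ N 0# (\ _ -> 0#) g)) (zeroˡ _)
    om N (suc q) f g = trans (pw N (\ h -> Σ< q (\ j -> f j h)) (f q) g) (+-congʳ (om N q f g))
   -- The Chevalley operator on one factor of the Stanley function: everything but n·x telescopes, up to xⁿ.
   Δ-Hb : ∀ {N D g Φ} -> Adm D g -> Bud N (D M.+ n) -> Ext Φ -> pow x n ≈ 0# -> Δ N (Hb x b Φ) g ≈ Hb x b (Δ N Φ) g + x * (ι (+ n) * Hb x b Φ g)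
   Δ-Hb {N} {D} {g} {Φ} w bud ext z = begin Δ N (Hb x b Φ) g ≈⟨ d9 N {Hb x b Φ} {\ h -> Σ< n (\ q -> P q (Q q Φ) h)} g (\ s t _ -> o9 Φ (\ y -> g (tr s t y))) ⟩ Δ N (\ h -> Σ< n (\ q -> P q (Q q Φ) h)) g ≈⟨ om N n (\ q -> P q (Q q Φ)) g ⟩ Σ< n (\ q -> Δ N (P q (Q q Φ)) g) ≈⟨ c7 n (\ q p -> Δ-W q p bud) ⟩ Σ< n (\ q -> P q (Q q (Δ N Φ)) g + x * kX q) ≈⟨ trans (mD n _ _) (+-congˡ (k4 n x kX)) ⟩ Σ< n (\ q -> P q (Q q (Δ N Φ)) g) + x * Σ< n kX ≈⟨ +-cong (sym (o9 (Δ N Φ) g)) (trans (ia z) (*-congˡ (*-congˡ (sym (o9 Φ g))))) ⟩ _ ∎ where open Total ext w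

-- The Chevalley operator against all factors

module Lop where
 open dK
 open lq
 open kZ
 open cV
 open cB
 open mj
 open fJ
 open qA
 open Sweepd
 open ad
 open import Data.Vec.Relation.Unary.All using (All; []; _∷_)
 open import Data.Product using (_×_)
 module bt (R : CommutativeRing 0ℓ 0ℓ) (n : ℕ) .{{nz : NonZero n}} (aa : 2 M.≤ n) where
  open aE R
  open ay n
  open kI R n aa
  open bz R n aa
  open kN R n aa
  private
   g6 : ∀ {D} x b {Φ Φ' : Fn -> C} -> (∀ g -> Adm (D M.+ n) g -> Φ g ≈ Φ' g) -> ∀ p q -> q M.+ p ≡ n -> ∀ g -> Adm D g -> Hgo x b Φ g p q ≈ Hgo x b Φ' g p q
   g6 x b h p zero e g w = refl
   g6 {D} x b h p (suc q) e g w = +-cong (cD 1# x _ q (\ g w -> cD 0# x _ p (\ g w -> h g (d6 le w)) g w) g w) (g6 x b h (suc p) q (E.trans (N.+-suc q p) e) g w) where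
    le : D M.+ q M.+ p M.≤ D M.+ n
    le = N.≤-trans (N.≤-reflexive (N.+-assoc D q p)) (N.+-monoʳ-≤ D (N.≤-trans (N.n≤1+n _) (N.≤-reflexive e)))
   j5 : ∀ x b {Φ} -> Ext Φ -> ∀ p q -> Ext (\ g -> Hgo x b Φ g p q)
   j5 x b ext p zero e = refl
   j5 x b ext p (suc q) e = +-cong (fK 1# x _ q (fK 0# x _ p ext) e) (j5 x b ext (suc p) q e)
   j4 : ∀ x b a Φ Φ' g p q -> Hgo x b (\ h -> Φ h + a * Φ' h) g p q ≈ Hgo x b Φ g p q + a * Hgo x b Φ' g p q
   j4 x b a Φ Φ' g p zero = sym (trans (+-identityˡ _) (zeroʳ a))
   j4 x b a Φ Φ' g p (suc q) = trans (+-cong (trans (a3 1# x _ q (cC 0# x _ p a Φ Φ') g) (cC 1# x _ q a _ _ g)) (j4 x b a Φ Φ' g (suc p) q)) (solve 5 (\ a s t u v -> (s :+ a :* t) :+ (u :+ a :* v) := (s :+ u) :+ a :* (t :+ v)) refl a _ _ _ _)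
  nB : ∀ {D} x b {Φ Φ' : Fn -> C} -> (∀ g -> Adm (D M.+ n) g -> Φ g ≈ Φ' g) -> ∀ g -> Adm D g -> Hb x b Φ g ≈ Hb x b Φ' g
  nB x b h = g6 x b h 0 n (N.+-identityʳ n)
  -- The base moves by one with each factor, as the window does in a sweep, see `Hb-HH`.
  Lop : ∀ {k} -> ℤ -> Vec C k -> (Fn -> C) -> Fn -> C
  Lop b [] Φ = Φ
  Lop b (x ∷ xs) Φ = Lop (b I.+ 1ℤ) xs (Hb x b Φ)
  dz : ℕ -> ℕ -> ℕ
  dz D k = D M.+ k M.* n
  private
   gN : ∀ D k -> dz D k M.+ n ≡ dz D (suc k)
   gN D k = E.trans (N.+-assoc D (k M.* n) n) (cong (D M.+_) (N.+-comm (k M.* n) n))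
  cR : ∀ {D k} b (xs : Vec C k) {Φ Φ' : Fn -> C} -> (∀ g -> Adm (dz D k) g -> Φ g ≈ Φ' g) -> ∀ g -> Adm D g -> Lop b xs Φ g ≈ Lop b xs Φ' g
  cR {D} b [] h g w = h g (E.subst (\ z -> Adm z g) (E.sym (N.+-identityʳ D)) w)
  cR {D} {suc k} b (x ∷ xs) h = cR (b I.+ 1ℤ) xs (nB x b (\ g w -> h g (E.subst (\ z -> Adm z g) (gN D k) w)))
  iN : ∀ {D k} b (xs : Vec C k) a Φ Φ' g -> Adm D g -> Lop b xs (\ h -> Φ h + a * Φ' h) g ≈ Lop b xs Φ g + a * Lop b xs Φ' g
  iN b [] a Φ Φ' g w = refl
  iN b (x ∷ xs) a Φ Φ' g w = trans (cR (b I.+ 1ℤ) xs (\ g _ -> j4 x b a Φ Φ' g 0 n) g w) (iN (b I.+ 1ℤ) xs a _ _ g w)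
  mM : ∀ {k} -> Vec C k -> C
  mM [] = 0#
  mM (x ∷ xs) = x + mM xs
  lD : ∀ {N D k g Φ} b (xs : Vec C k) -> Adm D g -> Bud N (dz D k) -> Ext Φ -> All (\ x -> pow x n ≈ 0#) xs -> Δ N (Lop b xs Φ) g ≈ Lop b xs (Δ N Φ) g + mM xs * (ι (+ n) * Lop b xs Φ g)
  lD b [] w bud ext [] = sym (trans (+-congˡ (zeroˡ _)) (+-identityʳ _))
  lD {N} {D} {suc k} {g} {Φ} b (x ∷ xs) w bud ext (z ∷ zs) = begin Δ N (Lop B xs Ψ) g ≈⟨ lD B xs w (cE (N.+-monoʳ-≤ D (N.m≤n+m (k M.* n) n)) bud) (j5 x b ext 0 n) zs ⟩ Lop B xs (Δ N Ψ) g + mM xs * (ι (+ n) * Lop B xs Ψ g) ≈⟨ +-congʳ (trans (cR B xs (\ h w' -> trans (Δ-Hb x b w' (E.subst (Bud N) (E.sym (gN D k)) bud) ext z) (+-congˡ (sym (*-assoc x (ι (+ n)) (Ψ h))))) g w) (iN B xs (x * ι (+ n)) (Hb x b (Δ N Φ)) Ψ g w)) ⟩ (Lop B xs (Hb x b (Δ N Φ)) g + x * ι (+ n) * Lop B xs Ψ g) + mM xs * (ι (+ n) * Lop B xs Ψ g) ≈⟨ solve 5 (\ l x n f s -> (l :+ x :* n :* f) :+ s :* (n :* f) := l :+ (x :+ s) :* (n :* f)) refl _ x (ι (+ n)) _ (mM xs) ⟩ _ ∎ where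
   B = b I.+ 1ℤ
   Ψ : Fn -> C
   Ψ = Hb x b Φ
  module _ (lo : ℤ) (m : ℕ) where
   open fH R n lo m
   open cA.Trace R n lo m
   -- The inequalities on lo, m and d provide the range hypothesis of `Hb-HH` for each of the
   -- sweeps; d bounds the bases that occur.
   j7 : ∀ {D d k} b (xs : Vec C k) φ g -> Adm D g -> (lo I.+ + (dz D k M.+ n M.+ d) I.≤ 0ℤ) -> + (dz D k M.+ n M.+ d) I.≤ lo I.+ + m -> I.- + d I.≤ b -> b I.+ + k I.≤ + d -> Fop xs φ (win (b I.+ + k) n g) ≈ Lop b xs (\ h -> φ (win b n h)) g
   j7 b [] φ g w l u p q = reflexive (cong (\ z -> φ (win z n g)) (Z.+-identityʳ b))
   j7 {D} {d} {suc k} b (x ∷ xs) φ g w l u p q = begin Fop xs (HH x φ) (win (b I.+ + suc k) n g) ≡⟨ cong (\ z -> Fop xs (HH x φ) (win z n g)) (E.sym (gy b k)) ⟩ Fop xs (HH x φ) (win (b I.+ 1ℤ I.+ + k) n g) ≈⟨ j7 {D} {d} (b I.+ 1ℤ) xs (HH x φ) g w (Z.≤-trans (Z.+-monoʳ-≤ lo (I.+≤+ cY)) l) (Z.≤-trans (I.+≤+ cY) u) (Z.≤-trans p (Z.i≤i+j b 1ℤ)) (Z.≤-trans (Z.≤-reflexive (gy b k)) q) ⟩ Lop (b I.+ 1ℤ) xs (\ h -> HH x φ (win (b I.+ 1ℤ) n h)) g ≈⟨ sym (cR (b I.+ 1ℤ) xs (\ h w' -> Hb-HH lo m x b φ h (qp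 w') (f4 h w')) g w) ⟩ Lop (b I.+ 1ℤ) xs (Hb x b (\ h -> φ (win b n h))) g ∎ where
    cY : dz D k M.+ n M.+ d M.≤ dz D (suc k) M.+ n M.+ d
    cY = N.+-monoˡ-≤ d (N.+-monoˡ-≤ n (N.+-monoʳ-≤ D (N.m≤n+m (k M.* n) n)))
    E : + dz D (suc k) ≡ + dz D k I.+ + n
    E = cong +_ (E.sym (gN D k))
    f4 : ∀ h -> Adm (dz D k) h -> ∀ s -> s M.< n -> bW (h (b I.+ 1ℤ I.+ + s) I.- + n)
    f4 h w' s r = lin 1 (l & p & ej w' y & I.+≤+ {0} {s} M.z≤n & I.+≤+ {0} {n} M.z≤n) (E.trans (L.solve 8 (\ lo h b s r n d y -> (h L.:- n) L.:- lo L.:= ((L.O L.:+ (b L.:+ ((h L.:+ r) L.:+ (s L.:+ n)))) L.:- ((lo L.:+ ((r L.:+ n) L.:+ n L.:+ d)) L.:+ ((L.:- d) L.:+ ((b L.:+ L.I L.:+ s) L.:+ (L.O L.:+ L.O))))) L.:+ L.I) E.refl lo (h y) b (+ s) (+ dz D k) (+ n) (+ d) 0ℤ) (cong (\ z -> ((0ℤ I.+ (b I.+ ((h y I.+ + dz D k) I.+ (+ s I.+ + n)))) I.- ((lo I.+ (z I.+ + n I.+ + d)) I.+ (I.- + d I.+ (y I.+ (0ℤ I.+ 0ℤ))))) I.+ 1ℤ) (E.sym E))) , aB 0 (u & q & ee w' y & I.+≤+ r & I.+≤+ {0} {k} M.z≤n & I.+≤+ {0} {n} M.z≤n & I.+≤+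 {0} {n} M.z≤n) (E.trans (L.solve 9 (\ lo m h b s r n d k -> (lo L.:+ m) L.:- (h L.:- n) L.:= (((lo L.:+ m) L.:+ (d L.:+ ((b L.:+ L.I L.:+ s L.:+ r) L.:+ (n L.:+ (k L.:+ (n L.:+ n)))))) L.:- (((r L.:+ n) L.:+ n L.:+ d) L.:+ ((b L.:+ (L.I L.:+ k)) L.:+ (h L.:+ ((L.I L.:+ s) L.:+ (L.O L.:+ (L.O L.:+ L.O))))))) L.:+ L.I) E.refl lo (+ m) (h y) b (+ s) (+ dz D k) (+ n) (+ d) (+ k)) (cong (\ z -> (((lo I.+ + m) I.+ (+ d I.+ ((y I.+ + dz D k) I.+ (+ n I.+ (+ k I.+ (+ n I.+ + n)))))) I.- ((z I.+ + n I.+ + d) I.+ ((b I.+ + suc k) I.+ (h y I.+ (+ suc s I.+ (0ℤ I.+ (0ℤ I.+ 0ℤ))))))) I.+ 1ℤ) (E.sym E))) where y = b I.+ 1ℤ I.+ + s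

-- Length as a number of inversions

module Len where
 open import Defs using (HasLength)
 open dK
 open cV
 open cB
 open mj
 open fJ
 open ad
 open import Data.Bool using (if_then_else_)
 open import Data.List using (map)
 open import Data.List.Relation.Unary.All as All using (All; []; _∷_)
 open import Data.List.Relation.Unary.Any as Any using (Any; here; there)
 open import Data.List.Relation.Unary.AllPairs using (AllPairs; []; _∷_)
 open import Data.List.Relation.Unary.Unique.Propositional using (Unique)
 open import Data.List.Membership.Propositional using (_∈_)
 open import Data.List.Membership.Propositional.Properties using (∈-++⁺ˡ; ∈-++⁺ʳ; ∈-++⁻; ∈-map⁺; ∈-map⁻)
 open import Data.Product using (_×_)
 open import Data.Product.Properties using (,-injectiveʳ)
 open import Function using (_⇔_; Equivalence; mk⇔)
 open E using (refl; sym; trans; subst)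
 -- Pigeonhole for a symmetric and transitive relation: the partner of the head is deleted from the
 -- second list, and distinctness preserves the partners of the others.
 cL : ∀ {X : Set} {_≈_ : X -> X -> Set} -> (∀ {x y} -> x ≈ y -> y ≈ x) -> (∀ {x y z} -> x ≈ y -> y ≈ z -> x ≈ z) -> ∀ {xs ys} -> AllPairs (\ x y -> ¬ x ≈ y) xs -> All (\ x -> Any (x ≈_) ys) xs -> length xs M.≤ length ys
 cL s t [] [] = M.z≤n
 cL {_≈_ = _≈_} s t {x ∷ xs} {ys} (d ∷ ds) (a ∷ as) = N.≤-trans (M.s≤s (cL s t ds (All.zipWith (\ (ne , h) -> b2 a h ne) (d , as)))) (N.≤-reflexive (fh a)) where
  del : ∀ {ys} -> Any (x ≈_) ys -> List _
  del {y ∷ ys} (here _) = ys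
  del {y ∷ ys} (there p) = y ∷ del p
  fh : ∀ {ys} (p : Any (x ≈_) ys) -> suc (length (del p)) ≡ length ys
  fh (here _) = refl
  fh (there p) = cong suc (fh p)
  b2 : ∀ {ys z} (p : Any (x ≈_) ys) -> Any (z ≈_) ys -> ¬ x ≈ z -> Any (z ≈_) (del p)
  b2 (here p) (here q) ne = ⊥-elim (ne (t p (s q)))
  b2 (here p) (there q) ne = q
  b2 (there p) (here q) ne = here q
  b2 (there p) (there q) ne = there (b2 p q ne)
 module kJ (n : ℕ) .{{nz : NonZero n}} (aa : 2 M.≤ n) where
  open ay n
  open dj n
  open e4 Z.+-*-commutativeRing n aa
  open h2 using (ind; sumR; ind-false; aZ)
  open e6 n aa
  open iO
  inv : Fn -> ℤ -> ℤ -> ℤ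
  inv g a b = ind (lt a b) I.* ind (lt (g b) (g a))
  ℓ : ℕ -> Fn -> ℤ
  ℓ N g = fw N (inv g)
  -- As in `Bud`, with the reach 2(D + 1) of an inversion.
  gq : ℕ -> ℕ -> Set
  gq N D = D M.+ 1 M.+ (D M.+ 1) M.+ 2 M.< N
  cP : ∀ {N D D'} -> D M.≤ D' -> gq N D' -> gq N D
  cP p = N.≤-<-trans (N.+-monoˡ-≤ 2 (N.+-mono-≤ (N.+-monoˡ-≤ 1 p) (N.+-monoˡ-≤ 1 p)))
  private
   l1 : ∀ {a b c d} -> (a I.< b -> c I.< d) -> (c I.< d -> a I.< b) -> lt a b ≡ lt c d
   l1 {a} {b} f h with a I.<? b
   ... | yes p = trans (bg p) (sym (bg (f p)))
   ... | no p = trans (bk p) (sym (bk (\ q -> p (h q))))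
  iT : ∀ N {g h : Fn} -> (∀ x y -> g x I.< g y -> h x I.< h y) -> (∀ x y -> h x I.< h y -> g x I.< g y) -> ℓ N g ≡ ℓ N h
  iT N p q = bh N (\ a b -> cong (\ z -> ind (lt a b) I.* ind z) (l1 (p b a) (q b a)))
  lA : ∀ N {g h : Fn} -> (∀ x -> g x ≡ h x) -> ℓ N g ≡ ℓ N h
  lA N e = iT N (\ x y -> E.subst₂ I._<_ (e x) (e y)) (\ x y -> E.subst₂ I._<_ (sym (e x)) (sym (e y)))
  fl : ∀ {D g} -> Adm D g -> ∀ {a b} -> a I.+ + (D M.+ D) I.< b -> ¬ g b I.< g a
  fl {D} {g} w {a} {b} p q = Z.<⇒≱ p (lin 1 (st q & ej w b & ee w a) (L.solve 5 (\ a b ga gb D -> (a L.:+ (D L.:+ D)) L.:- b L.:= ((ga L.:+ ((gb L.:+ D) L.:+ (a L.:+ D))) L.:- ((gb L.:+ L.I) L.:+ (b L.:+ ga))) L.:+ L.I) refl a b (g a) (g b) (+ D)))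
  lc : ∀ {D g} -> Adm D g -> iO (D M.+ D) (inv g)
  lc {D} {g} w = record { i6 = \ a b -> cong₂ (\ y z -> ind y I.* ind z) (ck a b) (trans (cong₂ lt (qp w b) (qp w a)) (ck (g b) (g a))) ; pj = \ a b p -> ind-false _ (bk (\ q -> Z.<-asym q (Z.≤-<-trans (Z.i≤i+j b _) p))) ; kr = \ a b p -> trans (cong (ind (lt a b) I.*_) (cong ind (bk (fl w p)))) (Z.*-zeroʳ (ind (lt a b))) } where
   ck : ∀ a b -> lt (a I.+ + n) (b I.+ + n) ≡ lt a b
   ck a b = l1 (\ p -> aB 0 (st p) (L.solve 3 (\ a b n -> b L.:- a L.:= ((b L.:+ n) L.:- (a L.:+ n L.:+ L.I)) L.:+ L.I) refl a b (+ n))) (Z.+-monoˡ-< (+ n))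
  -- s_i matches the inversions of g with those of g s_i; only the pair (i, i + 1) has no partner.
  h3 : ∀ {N D g} i -> Adm D g -> gq N D -> g (i I.+ 1ℤ) I.< g i -> ℓ N g ≡ ℓ N (\ x -> g (sw aa i x)) I.+ 1ℤ
  h3 {N} {D} {g} i w room dn = trans (bh N f7) (trans (l8 N (\ a b -> inv h (σ a) (σ b)) _) (cong₂ I._+_ (fv i (lc (eI aa i w)) room) (el N i 1ℤ 1ℤ (Z.≤-trans (Z.neg-≤-pos {N} {0}) (I.+≤+ M.z≤n)) (I.+<+ (N.<-trans (N.≤-trans (M.s≤s (M.s≤s M.z≤n)) (N.m≤n+m 2 _)) room))))) where
   σ = sw aa i
   h : Fn
   h x = g (σ x)
   bF : ∀ a b -> g (σ (σ b)) ≡ g b × g (σ (σ a)) ≡ g a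
   bF a b = cong g (aJ i b) , cong g (aJ i a)
   pX : ∀ {y} -> y ∼ i -> g (y I.+ 1ℤ) I.< g y
   pX {y} (mk∼ q e) = E.subst₂ I._<_ (sym (trans (cong g (trans (cong (I._+ 1ℤ) e) (L.solve 2 (\ i q -> i L.:+ q L.:+ L.I L.:= i L.:+ L.I L.:+ q) refl i (q I.* + n)))) (dA w (i I.+ 1ℤ) q))) (sym (trans (cong g e) (dA w i q))) (Z.+-monoˡ-< (q I.* + n) dn)
   i3 : ∀ a -> a I.< a I.+ 1ℤ
   i3 a = aB 0 (Z.≤-refl {a}) (L.solve 1 (\ a -> (a L.:+ L.I) L.:- a L.:= (a L.:- a) L.:+ L.I) refl a)
   fu : ∀ a b -> ¬ (a ∼ i × b ≡ a I.+ 1ℤ) -> inv g a b ≡ inv h (σ a) (σ b)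
   fu a b ne with g b I.<? g a
   ... | no r = trans (iY (bk r) (lt a b)) (sym (iY (trans (cong₂ lt (cong g (aJ i b)) (cong g (aJ i a))) (bk r)) (lt (σ a) (σ b)))) where
    iY : ∀ {y z} -> lt y z ≡ false -> ∀ e -> ind e I.* ind (lt y z) ≡ 0ℤ
    iY q e = trans (cong (\ z -> ind e I.* ind z) q) (Z.*-zeroʳ (ind e))
   ... | yes r = cong₂ (\ y z -> ind y I.* ind z) (l1 (\ q -> dC i q ne) (\ q -> E.subst₂ I._<_ (aJ i a) (aJ i b) (dC i q oN))) (cong₂ lt (cong g (sym (aJ i b))) (cong g (sym (aJ i a)))) where
    oN : ¬ (σ a ∼ i × σ b ≡ σ a I.+ 1ℤ)
    oN (s , e) = Z.<-asym r (E.subst₂ (\ y z -> g y I.< g z) (trans (sym (dy i s)) (aJ i a)) (trans (sym (aJ i (σ a))) (trans (cong σ (trans (dy i s) (sym e))) (aJ i b))) (pX s))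
   f7 : ∀ a b -> inv g a b ≡ inv h (σ a) (σ b) I.+ ind (cg a i) I.* (ind (eq (a I.+ 1ℤ) b) I.* 1ℤ)
   f7 a b with a ∼? i | a I.+ 1ℤ I.≟ b
   ... | yes p | yes refl = trans (cong₂ (\ y z -> ind y I.* ind z) (bg (i3 a)) (bg (pX p))) (sym (cong₂ I._+_ (ind-false _ (bk (\ q -> Z.<-asym q (E.subst₂ I._<_ (sym (trans (cong σ (sym (dy i p))) (aJ i a))) (sym (dy i p)) (i3 a))))) (cong₂ (\ y z -> ind y I.* (ind z I.* 1ℤ)) (d0 p) (cw refl))))
   ... | no p | _ = trans (fu a b (\ (q , _) -> p q)) (sym (trans (cong (I._+_ (inv h (σ a) (σ b))) (ind-false _ (d1 p))) (Z.+-identityʳ _)))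
   ... | yes p | no e = trans (fu a b (\ (_ , q) -> e (sym q))) (sym (trans (cong (I._+_ (inv h (σ a) (σ b))) (trans (cong (\ z -> ind (cg a i) I.* (ind z I.* 1ℤ)) (b7 e)) (Z.*-zeroʳ (ind (cg a i))))) (Z.+-identityʳ _)))
  nN : ∀ {N D g} i -> Adm D g -> gq N (D M.+ 1) -> g i I.< g (i I.+ 1ℤ) -> ℓ N (\ x -> g (sw aa i x)) ≡ ℓ N g I.+ 1ℤ
  nN {N} {D} {g} i w room up = trans (h3 i (eI aa i w) room (E.subst₂ (\ y z -> g y I.< g z) (sym (hE aa i)) (sym (pi aa i)) up)) (cong (I._+ 1ℤ) (lA N (\ x -> cong g (aJ i x))))
  fP : ∀ N {g : Fn} -> (∀ x y -> x I.< y -> g x I.< g y) -> ℓ N g ≡ 0ℤ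
  fP N {g} m = trans (bh N {ψ = \ _ _ -> 0ℤ I.* 0ℤ} hk) (l9 N 0ℤ (\ _ _ -> 0ℤ)) where
   hk : ∀ a b -> inv g a b ≡ 0ℤ I.* 0ℤ
   hk a b with a I.<? b
   ... | yes p = trans (cong (\ z -> ind (lt a b) I.* ind z) (bk (Z.<-asym (m a b p)))) (Z.*-zeroʳ (ind (lt a b)))
   ... | no p = ind-false _ (bk p)
  private
   module _ (p : ℤ -> Bool) where
    f2 : ℤ -> ℕ -> List ℤ
    f2 lo zero = []
    f2 lo (suc m) = (if p lo then (lo ∷_) else (\ l -> l)) (f2 (lo I.+ 1ℤ) m)
    b6 : ∀ lo m -> + length (f2 lo m) ≡ sumR lo m (\ i -> ind (p i))
    b6 lo zero = refl
    b6 lo (suc m) with p lo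
    ... | true = cong (I._+_ 1ℤ) (b6 (lo I.+ 1ℤ) m)
    ... | false = trans (b6 (lo I.+ 1ℤ) m) (sym (Z.+-identityˡ _))
    cr : ∀ lo m {x} -> x ∈ f2 lo m -> lo I.≤ x × p x ≡ true
    cr lo (suc m) q with p lo in e | q
    ... | true | here refl = Z.≤-refl , e
    ... | true | there r = let a , b = cr (lo I.+ 1ℤ) m r in Z.≤-trans (Z.i≤i+j lo 1ℤ) a , b
    ... | false | r = let a , b = cr (lo I.+ 1ℤ) m r in Z.≤-trans (Z.i≤i+j lo 1ℤ) a , b
    a6 : ∀ lo m {x} -> lo I.≤ x -> x I.< lo I.+ + m -> p x ≡ true -> x ∈ f2 lo m
    a6 lo zero a b e = ⊥-elim (Z.<⇒≱ b (subst (I._≤ _) (sym (Z.+-identityʳ lo)) a))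
    a6 lo (suc m) {x} a b e with lo I.≟ x
    ... | yes refl with p lo | e
    ...   | true | _ = here refl
    a6 lo (suc m) {x} a b e | no ne with p lo
    ... | true = there (a6 (lo I.+ 1ℤ) m (st (Z.≤∧≢⇒< a ne)) (subst (x I.<_) (sym (gy lo m)) b) e)
    ... | false = a6 (lo I.+ 1ℤ) m (st (Z.≤∧≢⇒< a ne)) (subst (x I.<_) (sym (gy lo m)) b) e
    b5 : ∀ lo m -> Unique (f2 lo m)
    b5 lo zero = []
    b5 lo (suc m) with p lo
    ... | true = All.tabulate (\ q e -> Z.<⇒≱ (i3 lo) (subst (lo I.+ 1ℤ I.≤_) (sym e) (proj₁ (cr (lo I.+ 1ℤ) m q)))) ∷ b5 (lo I.+ 1ℤ) m where
     i3 : ∀ a -> a I.< a I.+ 1ℤ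
     i3 a = aB 0 (Z.≤-refl {a}) (L.solve 1 (\ a -> (a L.:+ L.I) L.:- a L.:= (a L.:- a) L.:+ L.I) refl a)
    ... | false = b5 (lo I.+ 1ℤ) m
   module _ (N : ℕ) (q : ℤ -> ℤ -> Bool) where
    row : ℤ -> List ℤ
    row a = f2 (q a) (a I.- + N) (N M.+ N)
    f3 : ℤ -> ℕ -> List (ℤ × ℤ)
    f3 lo zero = []
    f3 lo (suc m) = map (lo ,_) (row lo) ++ f3 (lo I.+ 1ℤ) m
    eg : ∀ lo m -> + length (f3 lo m) ≡ sumR lo m (iA N (\ a b -> ind (q a b)))
    eg lo zero = refl
    eg lo (suc m) = trans (cong +_ (trans (LP.length-++ (map (lo ,_) (row lo))) (cong (M._+ length (f3 (lo I.+ 1ℤ) m)) (LP.length-map (lo ,_) (row lo))))) (cong₂ I._+_ (b6 (q lo) (lo I.- + N) (N M.+ N)) (eg (lo I.+ 1ℤ) m))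
    dT : ∀ lo m {a b} -> (a , b) ∈ f3 lo m -> lo I.≤ a × a I.< lo I.+ + m × b ∈ row a
    dT lo (suc m) {a} {b} r with ∈-++⁻ (map (lo ,_) (row lo)) r
    ... | inj₁ s with ∈-map⁻ (lo ,_) s
    ...   | _ , t , refl = Z.≤-refl , aB m (Z.≤-refl {lo}) (L.solve 2 (\ l m -> (l L.:+ (L.I L.:+ m)) L.:- l L.:= (l L.:- l) L.:+ (L.I L.:+ m)) refl lo (+ m)) , t
    dT lo (suc m) {a} r | inj₂ s = let x , y , z = dT (lo I.+ 1ℤ) m s in Z.≤-trans (Z.i≤i+j lo 1ℤ) x , subst (a I.<_) (gy lo m) y , z
    cZ : ∀ lo m {a b} -> lo I.≤ a -> a I.< lo I.+ + m -> b ∈ row a -> (a , b) ∈ f3 lo m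
    cZ lo zero x y z = ⊥-elim (Z.<⇒≱ y (subst (I._≤ _) (sym (Z.+-identityʳ lo)) x))
    cZ lo (suc m) {a} x y z with lo I.≟ a
    ... | yes refl = ∈-++⁺ˡ (∈-map⁺ (lo ,_) z)
    ... | no ne = ∈-++⁺ʳ (map (lo ,_) (row lo)) (cZ (lo I.+ 1ℤ) m (st (Z.≤∧≢⇒< x ne)) (subst (a I.<_) (sym (gy lo m)) y) z)
    ef : ∀ lo m -> Unique (f3 lo m)
    ef lo zero = []
    ef lo (suc m) = UP.++⁺ (UP.map⁺ ,-injectiveʳ (b5 (q lo) (lo I.- + N) (N M.+ N))) (ef (lo I.+ 1ℤ) m) nj where
     nj : ∀ {z} -> ¬ (z ∈ map (lo ,_) (row lo) × z ∈ f3 (lo I.+ 1ℤ) m)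
     nj (s , t) with ∈-map⁻ (lo ,_) s
     ... | _ , _ , refl = Z.<⇒≱ (aB 0 (Z.≤-refl {lo}) (L.solve 1 (\ a -> (a L.:+ L.I) L.:- a L.:= (a L.:- a) L.:+ L.I) refl lo)) (proj₁ (dT (lo I.+ 1ℤ) m t))
  -- No inversion reaches further than 2D (`fl`), so the list cut off at distance N is complete.
  eG : ∀ {N D g} -> Adm D g -> D M.+ D M.< N -> Σ ℕ \ m -> HasLength n g m × + m ≡ ℓ N g
  eG {N} {D} {g} w room = _ , (f3 N q 1ℤ n , ef N q 1ℤ n , (\ i j -> mk⇔ (to i j) (from i j)) , refl) , trans (eg N q 1ℤ n) (bh N bF) where
   q : ℤ -> ℤ -> Bool
   q a b = lt a b ∧ lt (g b) (g a)
   bF : ∀ a b -> ind (q a b) ≡ inv g a b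
   bF a b with lt a b | lt (g b) (g a)
   ... | true | true = refl
   ... | true | false = refl
   ... | false | _ = refl
   md : ∀ {x y} -> x ∧ y ≡ true -> x ≡ true × y ≡ true
   md {true} {true} _ = refl , refl
   mW : ∀ {i} -> i I.< 1ℤ I.+ + n -> i I.≤ + n
   mW {i} p = lin 0 (st p) (L.solve 2 (\ i n -> n L.:- i L.:= ((L.I L.:+ n) L.:- (i L.:+ L.I)) L.:+ L.O) refl i (+ n))
   mV : ∀ {i} -> i I.≤ + n -> i I.< 1ℤ I.+ + n
   mV {i} p = aB 0 p (L.solve 2 (\ i n -> (L.I L.:+ n) L.:- i L.:= (n L.:- i) L.:+ L.I) refl i (+ n))
   to : ∀ i j -> (i , j) ∈ f3 N q 1ℤ n -> (1ℤ I.≤ i × i I.≤ + n) × i I.< j × g j I.< g i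
   to i j r = let x , y , z = dT N q 1ℤ n r ; u , v = md (proj₂ (cr (q i) _ (N M.+ N) z)) in (x , mW y) , aO u , aO v
   from : ∀ i j -> (1ℤ I.≤ i × i I.≤ + n) × i I.< j × g j I.< g i -> (i , j) ∈ f3 N q 1ℤ n
   from i j ((x , y) , u , v) = cZ N q 1ℤ n x (mV y) (a6 (q i) (i I.- + N) (N M.+ N) (Z.≤-trans (Z.i-j≤i i (+ N)) (Z.<⇒≤ u)) (subst (j I.<_) (L.solve 2 (\ i N -> i L.:+ N L.:= i L.:- N L.:+ (N L.:+ N)) refl i (+ N)) (Z.≤-<-trans (Z.≮⇒≥ (\ p -> fl w p v)) (Z.+-monoʳ-< i (I.+<+ room)))) (cong₂ _∧_ (bg u) (bg v)))
  cS : ∀ {g m m'} -> HasLength n g m -> HasLength n g m' -> m ≡ m'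
  cS (L , u , e , l) (L' , u' , e' , l') = trans (sym l) (trans (N.≤-antisym (le u e e') (le u' e' e)) l') where
   le : ∀ {L L' : List (ℤ × ℤ)} {P : ℤ -> ℤ -> Set} -> Unique L -> (∀ i j -> ((i , j) ∈ L) ⇔ P i j) -> (∀ i j -> ((i , j) ∈ L') ⇔ P i j) -> length L M.≤ length L'
   le u e e' = cL sym trans u (All.tabulate (\ {(i , j)} p -> Equivalence.from (e' i j) (Equivalence.to (e i j) p)))
  fN : ∀ {N D g m} -> Adm D g -> D M.+ D M.< N -> HasLength n g m -> + m ≡ ℓ N g
  fN w room h = let m , h' , e = eG w room in trans (cong +_ (cS h h')) e
  b9 : ∀ {N D g m} -> Adm D g -> D M.+ D M.< N -> + m ≡ ℓ N g -> HasLength n g m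
  b9 {g = g} w room e = let m , h , e' = eG w room in subst (HasLength n g) (Z.+-injective (trans e' (sym e))) h

-- Cyclically decreasing permutations and their words

module oX where
 open dK
 open cV
 open cB using (Fn; gy; jB)
 open mj
 open fJ
 open Len
 open ad
 open import Data.List using (map; [_])
 open import Data.List.Reverse using (Reverse; reverseView; _∶_∶ʳ_) renaming ([] to nil)
 open import Data.List.Relation.Unary.All as All using (All; []; _∷_)
 open import Data.List.Relation.Unary.Any as Any using (Any; here; there)
 open import Data.List.Relation.Unary.AllPairs as AllPairs using (AllPairs; []; _∷_)
 open import Data.List.Membership.Propositional using (_∈_)
 open import Data.List.Membership.Propositional.Properties using (∈-++⁺ˡ; ∈-++⁺ʳ; ∈-map⁺)
 open import Data.Product using (_×_)
 open E using (refl; sym; trans; subst)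
 module p4 (n : ℕ) .{{nz : NonZero n}} (aa : 2 M.≤ n) where
  open ay n
  open e6 n aa using (aJ; dy; bA; a7)
  open kJ n aa
  σ[_] : ℤ -> ℤ -> ℤ
  σ[ i ] = sw aa i
  ak : List ℤ -> Fn
  ak [] x = x
  ak (j ∷ w) x = σ[ j ] (ak w x)
  -- act w g = g ∘ (ak w)⁻¹, and vb w g says that every letter, from the right, removes a descent.
  act : List ℤ -> Fn -> Fn
  act [] g = g
  act (j ∷ w) g y = act w g (σ[ j ] y)
  vb : List ℤ -> Fn -> Bool
  vb [] g = true
  vb (j ∷ w) g = vb w g ∧ lt (act w g (j I.+ 1ℤ)) (act w g j)
  fC : ∀ w {g h : Fn} -> (∀ x -> g x ≡ h x) -> ∀ x -> act w g x ≡ act w h x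
  fC [] e = e
  fC (j ∷ w) e x = fC w e _
  iL : ∀ w (h : Fn) x -> act w (\ y -> h (ak w y)) x ≡ h x
  iL [] h x = refl
  iL (j ∷ w) h x = trans (iL w (\ y -> h (σ[ j ] y)) _) (cong h (aJ j x))
  io : ∀ w {g h : Fn} -> (∀ x -> act w g x ≡ h x) -> ∀ x -> g x ≡ h (ak w x)
  io [] e = e
  io (j ∷ w) {g} {h} e = io w (\ x -> trans (cong (act w g) (sym (aJ j x))) (e (σ[ j ] x)))
  jf : ∀ w v g x -> act (w ++ v) g x ≡ act w (act v g) x
  jf [] v g x = refl
  jf (j ∷ w) v g x = jf w v g _
  fL : ∀ {D g} w -> Adm D g -> Adm (D M.+ length w) (act w g)
  fL {D} {g} [] a = subst (\ z -> Adm z g) (sym (N.+-identityʳ D)) a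
  fL {D} {g} (j ∷ w) a = subst (\ z -> Adm z (act (j ∷ w) g)) (trans (N.+-assoc D (length w) 1) (cong (D M.+_) (N.+-comm (length w) 1))) (eI aa j (fL w a))
  qC : Adm 0 (\ x -> x)
  qC = record { qp = \ x -> refl ; inj = \ x y e -> e ; ej = \ x -> Z.≤-reflexive (sym (Z.+-identityʳ x)) ; ee = \ x -> Z.≤-reflexive (sym (Z.+-identityʳ x)) }
  cf : ∀ w j x -> ak (w ++ [ j ]) x ≡ ak w (σ[ j ] x)
  cf [] j x = refl
  cf (i ∷ w) j x = cong σ[ i ] (cf w j x)
  cF : ∀ w -> Adm (length w) (ak w)
  cF w = go (reverseView w) where
   go : ∀ {w} -> Reverse w -> Adm (length w) (ak w)
   go nil = qC
   go (w ∶ r ∶ʳ j) = subst (\ z -> Adm z (ak (w ++ [ j ]))) (sym (LP.length-++ w)) (mC (\ x -> sym (cf w j x)) (eI aa j (go r)))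
  private
   iS : ∀ x -> x ∧ false ≡ false
   iS true = refl
   iS false = refl
  -- A letter at a descent lowers the length by one, any other letter raises it; so one wrong letter
  -- makes the inequality strict for good.
  h4 : ∀ {N D g} w -> Adm D g -> gq N (D M.+ length w) -> (vb w g ≡ true × ℓ N g ≡ ℓ N (act w g) I.+ + length w) ⊎ (vb w g ≡ false × ℓ N g I.< ℓ N (act w g) I.+ + length w)
  h4 {N} {D} {g} [] a room = inj₁ (refl , sym (Z.+-identityʳ _))
  h4 {N} {D} {g} (j ∷ w) a room = bp (Z.<-cmp (h (j I.+ 1ℤ)) (h j)) (h4 w a (cP (N.+-monoʳ-≤ D (N.n≤1+n _)) room)) where
   h : Fn
   h = act w g
   l = length w
   ah : Adm (D M.+ l) h
   ah = fL w a
   nC : Set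
   nC = (vb (j ∷ w) g ≡ true × ℓ N g ≡ ℓ N (act (j ∷ w) g) I.+ + suc l) ⊎ (vb (j ∷ w) g ≡ false × ℓ N g I.< ℓ N (act (j ∷ w) g) I.+ + suc l)
   IH : Set
   IH = (vb w g ≡ true × ℓ N g ≡ ℓ N h I.+ + l) ⊎ (vb w g ≡ false × ℓ N g I.< ℓ N h I.+ + l)
   ph : IH -> ℓ N g I.≤ ℓ N h I.+ + l
   ph (inj₁ (_ , e)) = Z.≤-reflexive e
   ph (inj₂ (_ , p)) = Z.<⇒≤ p
   pF : gq N (D M.+ l M.+ 1)
   pF = subst (gq N) (sym (trans (N.+-assoc D l 1) (cong (D M.+_) (N.+-comm l 1)))) room
   bp : _ -> IH -> nC
   bp (tri≈ _ e _) _ = ⊥-elim (ar aa j (subst (j ∼_) (sym (inj ah _ _ e)) b3))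
   bp (tri> nd _ up) ih = inj₂ (trans (cong (vb w g ∧_) (bk nd)) (iS (vb w g)) , aB 1 (ph ih & Z.≤-reflexive (sym (nN j ah pF up))) (L.solve 4 (\ a b c l -> (c L.:+ (L.I L.:+ l)) L.:- a L.:= ((b L.:+ l) L.:+ c) L.:- (a L.:+ (b L.:+ L.I)) L.:+ L.con (+ 2)) refl (ℓ N g) (ℓ N h) (ℓ N (act (j ∷ w) g)) (+ l)))
   bp (tri< dn _ _) ih = kY ih where
    hI : ℓ N h ≡ ℓ N (act (j ∷ w) g) I.+ 1ℤ
    hI = h3 j ah (cP (N.m≤m+n (D M.+ l) 1) pF) dn
    kY : IH -> nC
    kY (inj₁ (v , e)) = inj₁ (cong₂ _∧_ v (bg dn) , trans e (trans (cong (I._+ + l) hI) (Z.+-assoc (ℓ N (act (j ∷ w) g)) 1ℤ (+ l))))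
    kY (inj₂ (v , p)) = inj₂ (cong (_∧ lt (h (j I.+ 1ℤ)) (h j)) v , subst (ℓ N g I.<_) (trans (cong (I._+ + l) hI) (Z.+-assoc (ℓ N (act (j ∷ w) g)) 1ℤ (+ l))) p)
  -- For x standing before y: the letters are distinct, and y = x + 1 is excluded, so j + 1 always
  -- precedes j.
  eH : List ℤ -> Set
  eH = AllPairs (\ x y -> y ≁ x × y ≁ x I.+ 1ℤ)
  In : List ℤ -> ℤ -> Set
  In w y = Any (y ∼_) w
  In? : ∀ w y -> Dec (In w y)
  In? w y = Any.any? (y ∼?_) w
  hR : ∀ {w y z} -> z ∼ y -> In w y -> In w z
  hR e = Any.map (af e)
  record Up (w : List ℤ) (y z : ℤ) : Set where
   constructor mkUp
   field
    jp : y I.≤ z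
    dW : ∀ t -> y I.≤ t -> t I.< z -> In w t
    stop : ¬ In w z
  open Up
  -- A cyclically decreasing product, described by its set of letters alone.
  record CD (w : List ℤ) (u : Fn) : Set where
   field
    hJ : ∀ y -> In w y -> u (y I.+ 1ℤ) ≡ y
    up : ∀ y -> ¬ In w y -> Up w (y I.+ 1ℤ) (u (y I.+ 1ℤ))
  open CD
  private
   g0 : ∀ {w y z z'} -> Up w y z -> Up w y z' -> z ≡ z'
   g0 {z = z} {z'} p q with Z.<-cmp z z'
   ... | tri< a _ _ = ⊥-elim (stop p (dW q z (jp p) a))
   ... | tri≈ _ e _ = e
   ... | tri> _ _ a = ⊥-elim (stop q (dW p z' (jp q) a))
   i3 : ∀ a -> a I.< a I.+ 1ℤ
   i3 a = aB 0 (Z.≤-refl {a}) (L.solve 1 (\ a -> (a L.:+ L.I) L.:- a L.:= (a L.:- a) L.:+ L.I) refl a)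
   pn : ∀ a -> a I.- 1ℤ I.+ 1ℤ ≡ a
   pn a = L.solve 1 (\ a -> a L.:- L.I L.:+ L.I L.:= a) refl a
   +1-1 : ∀ a -> a I.+ 1ℤ I.- 1ℤ ≡ a
   +1-1 a = L.solve 1 (\ a -> a L.:+ L.I L.:- L.I L.:= a) refl a
   <+1 : ∀ {a b} -> a I.< b I.+ 1ℤ -> a ≢ b -> a I.< b
   <+1 {a} {b} p ne = Z.≤∧≢⇒< (lin 0 (st p) (L.solve 2 (\ a b -> b L.:- a L.:= ((b L.:+ L.I) L.:- (a L.:+ L.I)) L.:+ L.O) refl a b)) ne
   Out : ∀ {w y} (P : ℤ -> Set) -> All P w -> (∀ {t} -> y ∼ t -> ¬ P t) -> ¬ In w y
   Out P (p ∷ ps) h (here e) = h e p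
   Out P (p ∷ ps) h (there q) = Out P ps h q
  -- Induction on the first letter j: neither j nor j + 1 occurs later, so s_j can only prolong a
  -- run that has stopped at j.
  bx : ∀ w -> eH w -> CD w (ak w)
  bx [] [] = record { hJ = \ _ () ; up = \ y _ -> mkUp Z.≤-refl (\ t p q -> ⊥-elim (Z.<⇒≱ q p)) (\ ()) }
  bx (j ∷ w) (a ∷ gs) = record { hJ = dn ; up = \ y out -> rise y out (ak w (y I.+ 1ℤ) ∼? j) } where
   rec = bx w gs
   no-j : ∀ {y} -> y ∼ j -> ¬ In w y
   no-j e = Out _ a (\ s (p , _) -> p (af (ae s) e))
   lW : ∀ {y} -> y ∼ j I.+ 1ℤ -> ¬ In w y
   lW e = Out _ a (\ s (_ , p) -> p (af (ae s) e))
   dn : ∀ y -> In (j ∷ w) y -> σ[ j ] (ak w (y I.+ 1ℤ)) ≡ y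
   dn y (here e) = trans (cong σ[ j ] (g0 (up rec y (no-j e)) (mkUp Z.≤-refl (\ t p q -> ⊥-elim (Z.<⇒≱ q p)) (lW (a7 j e))))) (trans (bA j (a7 j e)) (+1-1 y))
   dn y (there q) = trans (cong σ[ j ] (hJ rec y q)) (aY (\ e -> no-j e q) (\ e -> lW e q))
   rise : ∀ y -> ¬ In (j ∷ w) y -> Dec (ak w (y I.+ 1ℤ) ∼ j) -> Up (j ∷ w) (y I.+ 1ℤ) (σ[ j ] (ak w (y I.+ 1ℤ)))
   rise y out (yes e) = subst (Up (j ∷ w) (y I.+ 1ℤ)) (sym (dy j e)) (mkUp (Z.≤-trans (jp u) (Z.<⇒≤ (i3 z))) ins stp) where
    z = ak w (y I.+ 1ℤ)
    u = up rec y (\ q -> out (there q))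
    ins : ∀ t -> y I.+ 1ℤ I.≤ t -> t I.< z I.+ 1ℤ -> In (j ∷ w) t
    ins t p q with t I.≟ z
    ... | yes refl = here e
    ... | no ne = there (dW u t p (<+1 q ne))
    stp : ¬ In (j ∷ w) (z I.+ 1ℤ)
    stp (here s) = ar aa z (af e (ae s))
    stp (there q) = lW (a7 j e) q
   rise y out (no ne) = subst (Up (j ∷ w) (y I.+ 1ℤ)) (sym (aY ne ne')) (mkUp (jp u) (\ t p q -> there (dW u t p q)) stp) where
    z = ak w (y I.+ 1ℤ)
    u = up rec y (\ q -> out (there q))
    ne' : z ≁ j I.+ 1ℤ
    ne' e with y I.+ 1ℤ I.≟ z
    ... | yes q = out (here (subst (_∼ j) (trans (cong (I._- 1ℤ) (sym q)) (+1-1 y)) (e6.az n aa j e)))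
    ... | no q = no-j (e6.az n aa j e) (dW u (z I.- 1ℤ) (lin 0 (st (Z.≤∧≢⇒< (jp u) q)) (L.solve 2 (\ a z -> (z L.:- L.I) L.:- a L.:= (z L.:- (a L.:+ L.I)) L.:+ L.O) refl (y I.+ 1ℤ) z)) (subst (z I.- 1ℤ I.<_) (pn z) (i3 _)))
    stp : ¬ In (j ∷ w) z
    stp (here e) = ne e
    stp (there q) = stop u q
  -- Makes the set of letters recoverable from the permutation.
  qB : ∀ {w u} y -> CD w u -> u (y I.+ 1ℤ) ≡ y -> In w y
  qB {w} y c e with In? w y
  ... | yes p = p
  ... | no p = ⊥-elim (Z.<⇒≱ (i3 y) (subst (y I.+ 1ℤ I.≤_) e (jp (up c y p))))
  Same : List ℤ -> List ℤ -> Set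
  Same w w' = ∀ y -> (In w y -> In w' y) × (In w' y -> In w y)
  pf : ∀ {w w' u u'} -> Same w w' -> CD w u -> CD w' u' -> ∀ x -> u x ≡ u' x
  pf {w} {w'} {u} {u'} s c c' x = subst (\ z -> u z ≡ u' z) (pn x) (at (x I.- 1ℤ)) where
   at : ∀ y -> u (y I.+ 1ℤ) ≡ u' (y I.+ 1ℤ)
   at y with In? w y
   ... | yes p = trans (hJ c y p) (sym (hJ c' y (proj₁ (s y) p)))
   ... | no p = g0 (up c y p) (let v = up c' y (\ q -> p (proj₂ (s y) q)) in mkUp (jp v) (\ t a b -> proj₂ (s t) (dW v t a b)) (\ q -> stop v (proj₁ (s _) q)))
  -- The successor of the first letter cannot occur.
  fG : ∀ w -> eH w -> Σ ℤ \ y -> ¬ In w y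
  fG [] _ = 0ℤ , \ ()
  fG (j ∷ w) (a ∷ _) = j I.+ 1ℤ , \ { (here e) -> ar aa j (ae e) ; (there q) -> Out _ a (\ s (_ , p) -> p (ae s)) q }
  -- Letters are added on the right. For the new letter j neither j nor j - 1 occurs before, so the
  -- product so far fixes j and sends j + 1 to something at least as large: an ascent.
  gu : ∀ {N} w -> eH w -> gq N (length w) -> ℓ N (ak w) ≡ + length w
  gu {N} w gw room = go (reverseView w) gw room where
   a8 : ∀ w {j} -> eH (w ++ [ j ]) -> eH w × All (\ x -> j ≁ x × j ≁ x I.+ 1ℤ) w
   a8 [] _ = [] , []
   a8 (i ∷ w) (a ∷ gs) = let p , q = a8 w gs in (AP.++⁻ˡ w a ∷ p) , (All.head (AP.++⁻ʳ w a) ∷ q)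
   go : ∀ {w} -> Reverse w -> eH w -> gq N (length w) -> ℓ N (ak w) ≡ + length w
   go nil _ _ = fP N (\ x y p -> p)
   go (w ∶ r ∶ʳ j) gw room = trans (lA N (cf w j)) (trans (nN {D = length w} j (cF w) (subst (gq N) len room) asc) (trans (cong (I._+ 1ℤ) (go r (proj₁ (a8 w gw)) (cP (N.m≤m+n (length w) 1) (subst (gq N) len room)))) (cong +_ (sym len)))) where
    len : length (w ++ [ j ]) ≡ length w M.+ 1
    len = LP.length-++ w
    cd = bx w (proj₁ (a8 w gw))
    a4 = proj₂ (a8 w gw)
    fix : ak w j ≡ j
    fix = subst (\ z -> ak w z ≡ z) (pn j) (g0 (up cd (j I.- 1ℤ) (Out _ a4 (\ {t} s (_ , p) -> p (subst (_∼ t I.+ 1ℤ) (pn j) (fO 1ℤ s))))) (mkUp Z.≤-refl (\ t p q -> ⊥-elim (Z.<⇒≱ q p)) (\ q -> Out _ a4 (\ s (p , _) -> p s) (subst (In w) (pn j) q))))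
    asc : ak w j I.< ak w (j I.+ 1ℤ)
    asc = Z.<-≤-trans (subst (I._< j I.+ 1ℤ) (sym fix) (i3 j)) (jp (up cd j (Out _ a4 (\ s (p , _) -> p s))))
  -- These lists run parallel to `Ch` and `Hgo`: `cK` to the free letters, `hj` to the forced ones,
  -- `my` to the first missing letter.
  cK : ℤ -> ℕ -> List (List ℤ)
  cK i zero = [] ∷ []
  cK i (suc m) = cK i m ++ map ((i I.+ + m) ∷_) (cK i m)
  hj : ℤ -> ℕ -> List ℤ
  hj i zero = []
  hj i (suc m) = i I.+ + m ∷ hj i m
  my : ℤ -> ℕ -> ℕ -> List (List ℤ)
  my b p zero = []
  my b p (suc q) = map (hj (b I.+ + n) p ++_) (cK (b I.+ 1ℤ I.+ + p) q) ++ my b (suc p) q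
  CW : ℤ -> List (List ℤ)
  CW b = my b 0 n
  data dx (lo : ℤ) : ℤ -> List ℤ -> Set where
   [] : ∀ {hi} -> dx lo hi []
   pk : ∀ {hi j w} -> lo I.≤ j -> j I.< hi -> dx lo j w -> dx lo hi (j ∷ w)
  private
   d4 : ∀ {lo hi w} -> dx lo hi w -> All (\ t -> lo I.≤ t × t I.< hi) w
   d4 [] = []
   d4 (pk p q d) = (p , q) ∷ All.map (\ (a , b) -> a , Z.<-trans b q) (d4 d)
   c4 : ∀ {y z} -> y I.< z -> z I.< y I.+ + n -> y ≁ z
   c4 {y} {z} p q e = Z.<-irrefl (bQ e (Z.<-≤-trans p (Z.i≤i+j z (+ n))) q) p
   ev : ∀ {lo hi w} -> dx lo hi w -> hi I.< lo I.+ + n -> eH w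
   ev [] _ = []
   ev {lo} (pk p q d) r = All.map (\ (a , b) -> c4 b (Z.<-trans q (Z.<-≤-trans r (Z.+-monoˡ-≤ (+ n) a))) , c4 (Z.<-trans b (i3 _)) (Z.≤-<-trans (st q) (Z.<-≤-trans r (Z.+-monoˡ-≤ (+ n) a)))) (d4 d) ∷ ev d (Z.<-trans q r)
   e5 : ∀ {lo hi hi' w} -> hi I.≤ hi' -> dx lo hi w -> dx lo hi' w
   e5 p [] = []
   e5 p (pk a b d) = pk a (Z.<-≤-trans b p) d
   nM : ∀ i {m m'} -> m M.≤ m' -> i I.+ + m I.≤ i I.+ + m'
   nM i p = Z.+-monoʳ-≤ i (I.+≤+ p)
   cJ : ∀ i m -> All (dx i (i I.+ + m)) (cK i m)
   cJ i zero = [] ∷ []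
   cJ i (suc m) = AP.++⁺ (All.map (e5 (nM i (N.n≤1+n m))) (cJ i m)) (AP.map⁺ (All.map (\ d -> pk (Z.i≤i+j i (+ m)) (Z.+-monoʳ-< i (I.+<+ (N.n<1+n m))) d) (cJ i m)))
   eW : ∀ {lo} i m {w} -> lo I.≤ i -> dx lo i w -> dx lo (i I.+ + m) (hj i m ++ w)
   eW i zero p d = e5 (Z.≤-reflexive (sym (Z.+-identityʳ i))) d
   eW i (suc m) p d = pk (Z.≤-trans p (Z.i≤i+j i (+ m))) (Z.+-monoʳ-< i (I.+<+ (N.n<1+n m))) (eW i m p d)
   module qh (b : ℤ) (p q : ℕ) (e : suc (q M.+ p) ≡ n) where
    i = b I.+ 1ℤ I.+ + p
    E : + n ≡ 1ℤ I.+ (+ q I.+ + p)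
    E = cong +_ (sym e)
    iq : i I.+ + q ≡ b I.+ + n
    iq = trans (L.solve 3 (\ b p q -> b L.:+ L.I L.:+ p L.:+ q L.:= b L.:+ (L.I L.:+ (q L.:+ p))) refl b (+ p) (+ q)) (cong (I._+_ b) (sym E))
    i≤ : i I.≤ b I.+ + n
    i≤ = subst (i I.≤_) iq (Z.i≤i+j i (+ q))
    i8 : All (dx i (b I.+ + n I.+ + p)) (map (hj (b I.+ + n) p ++_) (cK i q))
    i8 = AP.map⁺ (All.map (\ d -> eW (b I.+ + n) p i≤ (e5 (Z.≤-reflexive iq) d)) (cJ i q))
    oy : b I.+ + n I.+ + p I.< i I.+ + n
    oy = aB 0 (Z.≤-refl {b}) (L.solve 3 (\ b n p -> (b L.:+ L.I L.:+ p L.:+ n) L.:- (b L.:+ n L.:+ p) L.:= (b L.:- b) L.:+ L.I) refl b (+ n) (+ p))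
    lacks : ∀ {w} -> dx i (b I.+ + n I.+ + p) w -> ¬ In w (b I.+ + n I.+ + p)
    lacks d = Out _ (d4 d) (\ s (x , y) -> c4 y (Z.<-≤-trans oy (Z.+-monoˡ-≤ (+ n) x)) (ae s))
  he : ∀ b p q -> q M.+ p ≡ n -> All eH (my b p q)
  he b p zero e = []
  he b p (suc q) e = AP.++⁺ (All.map (\ d -> ev d oy) i8) (he b (suc p) q (trans (N.+-suc q p) e)) where open qh b p q e
  qw : List ℤ -> List ℤ -> Set
  qw w w' = Σ ℤ \ y -> (In w y × ¬ In w' y) ⊎ (¬ In w y × In w' y)
  private
   jS : ∀ i m s -> s M.< m -> ∀ w -> In (hj i m ++ w) (i I.+ + s)
   jS i (suc m) s p w with s M.≟ m
   ... | yes refl = here b3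
   ... | no ne = there (jS i m s (N.≤∧≢⇒< (N.≤-pred p) ne) w)
   hV : ℤ -> ℕ -> List ℤ -> List ℤ -> Set
   hV i m w w' = Σ ℤ \ y -> (i I.≤ y × y I.< i I.+ + m) × ((In w y × ¬ In w' y) ⊎ (¬ In w y × In w' y))
   gL : ∀ i m -> m M.≤ n -> AllPairs (hV i m) (cK i m)
   gL i zero _ = [] ∷ []
   gL i (suc m) le = PP.++⁺ (AllPairs.map ph ih) (PP.map⁺ (AllPairs.map n1 ih)) (All.map (\ d -> AP.map⁺ (All.map (\ _ -> i I.+ + m , (Z.i≤i+j i (+ m) , Z.+-monoʳ-< i (I.+<+ (N.n<1+n m))) , inj₂ (fresh d , here b3)) (cJ i m))) (cJ i m)) where
    ih = gL i m (N.≤-trans (N.n≤1+n m) le)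
    lY : ∀ {t} -> i I.≤ t -> t I.< i I.+ + m -> t ≁ i I.+ + m
    lY a b = c4 b (Z.<-≤-trans (Z.+-monoʳ-< i (I.+<+ le)) (Z.+-monoˡ-≤ (+ n) a))
    fresh : ∀ {w} -> dx i (i I.+ + m) w -> ¬ In w (i I.+ + m)
    fresh d = Out _ (d4 d) (\ s (a , b) -> lY a b (ae s))
    ph : ∀ {w w'} -> hV i m w w' -> hV i (suc m) w w'
    ph (y , (a , b) , r) = y , (a , Z.<-≤-trans b (nM i (N.n≤1+n m))) , r
    n1 : ∀ {w w'} -> hV i m w w' -> hV i (suc m) (i I.+ + m ∷ w) (i I.+ + m ∷ w')
    n1 (y , (a , b) , inj₁ (p , q)) = y , (a , Z.<-≤-trans b (nM i (N.n≤1+n m))) , inj₁ (there p , \ { (here e) -> lY a b e ; (there r) -> q r })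
    n1 (y , (a , b) , inj₂ (p , q)) = y , (a , Z.<-≤-trans b (nM i (N.n≤1+n m))) , inj₂ ((\ { (here e) -> lY a b e ; (there r) -> p r }) , there q)
   iQ : ∀ b p q s -> s M.< p -> All (\ w -> In w (b I.+ + n I.+ + s)) (my b p q)
   iQ b p zero s r = []
   iQ b p (suc q) s r = AP.++⁺ (AP.map⁺ (All.universal (\ w -> jS (b I.+ + n) p s r w) _)) (iQ b (suc p) q s (N.m≤n⇒m≤1+n r))
   -- Words with different first missing letters are told apart by the earlier of these letters,
   -- words with the same one by a free letter (`gL`).
   hf : ∀ b p q -> q M.+ p ≡ n -> AllPairs qw (my b p q)
   hf b p zero e = []
   hf b p (suc q) e = PP.++⁺ (PP.map⁺ (AllPairs.map nV (gL i q (subst (q M.≤_) e (N.≤-trans (N.m≤m+n q p) (N.n≤1+n _)))))) (hf b (suc p) q (trans (N.+-suc q p) e)) (All.map (\ d -> All.map (\ h -> _ , inj₂ (lacks d , h)) (iQ b (suc p) q p N.≤-refl)) i8) where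
    open qh b p q e
    F = hj (b I.+ + n) p
    pc : All (\ t -> b I.+ + n I.≤ t × t I.< b I.+ + n I.+ + p) F
    pc = d4 (subst (dx _ _) (LP.++-identityʳ F) (eW (b I.+ + n) p Z.≤-refl []))
    notF : ∀ {y} -> i I.≤ y -> y I.< i I.+ + q -> ¬ In F y
    notF a c = Out _ pc (\ s (x , z) -> c4 (Z.<-≤-trans (subst (_ I.<_) iq c) x) (Z.<-trans z (Z.<-≤-trans oy (Z.+-monoˡ-≤ (+ n) a))) s)
    l5 : ∀ {w y} -> ¬ In F y -> In (F ++ w) y -> In w y
    l5 no' r with YP.++⁻ F r
    ... | inj₁ s = ⊥-elim (no' s)
    ... | inj₂ s = s
    nV : ∀ {w w'} -> hV i q w w' -> qw (F ++ w) (F ++ w')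
    nV (y , (a , c) , inj₁ (r , s)) = y , inj₁ (YP.++⁺ʳ F r , \ t -> s (l5 (notF a c) t))
    nV (y , (a , c) , inj₂ (r , s)) = y , inj₂ ((\ t -> r (l5 (notF a c) t)) , YP.++⁺ʳ F s)
  j9 : ∀ b -> All eH (CW b)
  j9 b = he b 0 n (N.+-identityʳ n)
  jx : ∀ b -> AllPairs (\ w w' -> ¬ (∀ x -> ak w x ≡ ak w' x)) (CW b)
  jx b = go (j9 b) (hf b 0 n (N.+-identityʳ n)) where
   sep : ∀ {w w'} -> eH w -> eH w' -> qw w w' -> ¬ (∀ x -> ak w x ≡ ak w' x)
   sep gw gw' (y , inj₁ (p , q)) e = q (qB y (bx _ gw') (trans (sym (e _)) (hJ (bx _ gw) y p)))
   sep gw gw' (y , inj₂ (p , q)) e = p (qB y (bx _ gw) (trans (e _) (hJ (bx _ gw') y q)))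
   go : ∀ {ws} -> All eH ws -> AllPairs qw ws -> AllPairs (\ w w' -> ¬ (∀ x -> ak w x ≡ ak w' x)) ws
   go [] [] = []
   go (g ∷ gs) (d ∷ ds) = All.zipWith (\ (g' , r) -> sep g g' r) (gs , d) ∷ go gs ds
  private
   eR : List ℤ -> ℤ -> ℕ -> List ℤ
   eR v i zero = []
   eR v i (suc m) with In? v (i I.+ + m)
   ... | yes _ = i I.+ + m ∷ eR v i m
   ... | no _ = eR v i m
   ip : ∀ v i m -> eR v i m ∈ cK i m
   ip v i zero = here refl
   ip v i (suc m) with In? v (i I.+ + m)
   ... | yes _ = ∈-++⁺ʳ (cK i m) (∈-map⁺ _ (ip v i m))
   ... | no _ = ∈-++⁺ˡ (ip v i m)
   dU : ∀ v i m -> All (In v) (eR v i m)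
   dU v i zero = []
   dU v i (suc m) with In? v (i I.+ + m)
   ... | yes p = p ∷ dU v i m
   ... | no _ = dU v i m
   c1 : ∀ v i m s -> s M.< m -> In v (i I.+ + s) -> In (eR v i m) (i I.+ + s)
   c1 v i (suc m) s p r with s M.≟ m | In? v (i I.+ + m)
   ... | yes refl | yes _ = here b3
   ... | yes refl | no q = ⊥-elim (q r)
   ... | no ne | yes _ = there (c1 v i m s (N.≤∧≢⇒< (N.≤-pred p) ne) r)
   ... | no ne | no _ = c1 v i m s (N.≤∧≢⇒< (N.≤-pred p) ne) r
   lN : ∀ c y -> Σ ℕ \ s -> s M.< n × y ∼ c I.+ + s
   lN c y = (y I.- c) %ℕ n , n%ℕd<d (y I.- c) n , mk∼ ((y I.- c) /ℕ n) (trans (L.solve 2 (\ y c -> y L.:= c L.:+ (y L.:- c)) refl y c) (trans (cong (I._+_ c) (a≡a%ℕn+[a/ℕn]*n (y I.- c) n)) (sym (Z.+-assoc c (+ ((y I.- c) %ℕ n)) _))))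
   mB : ∀ {v w y} -> All (In v) w -> In w y -> In v y
   mB (p ∷ ps) (here e) = hR e p
   mB (p ∷ ps) (there q) = mB ps q
   iB : ∀ {v} i m -> (∀ s -> s M.< m -> In v (i I.+ + s)) -> All (In v) (hj i m)
   iB i zero h = []
   iB i (suc m) h = h m N.≤-refl ∷ iB i m (\ s p -> h s (N.m≤n⇒m≤1+n p))
   -- Search for the first letter missing in v; the free letters after it are then filtered by
   -- membership in v.
   c5 : ∀ b p q -> q M.+ p ≡ n -> ∀ v -> (∀ s -> s M.< p -> In v (b I.+ + n I.+ + s)) -> Σ ℤ (\ y -> ¬ In v y) -> Σ (List ℤ) \ w -> w ∈ my b p q × Same w v
   c5 b p zero refl v h (y , no') = let s , r , e = lN (b I.+ + n) y in ⊥-elim (no' (hR e (h s r)))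
   c5 b p (suc q) e v h miss with In? v (b I.+ + n I.+ + p)
   ... | yes y = let w , m , s = c5 b (suc p) q (trans (N.+-suc q p) e) v h' miss in w , ∈-++⁺ʳ _ m , s where
    h' : ∀ s -> s M.< suc p -> In v (b I.+ + n I.+ + s)
    h' s r with s M.≟ p
    ... | yes refl = y
    ... | no ne = h s (N.≤∧≢⇒< (N.≤-pred r) ne)
   ... | no out = w , ∈-++⁺ˡ (∈-map⁺ _ (ip v i q)) , \ y -> mB (AP.++⁺ (iB (b I.+ + n) p h) (dU v i q)) , je y where
    open qh b p q e
    w = hj (b I.+ + n) p ++ eR v i q
    je : ∀ y -> In v y -> In w y
    je y r with lN (b I.+ + n) y
    ... | s , s<n , ε with N.<-cmp s p
    ... | tri< a _ _ = hR ε (jS (b I.+ + n) p s a _)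
    ... | tri≈ _ refl _ = ⊥-elim (out (hR (ae ε) r))
    ... | tri> _ _ a = hR ε' (YP.++⁺ʳ (hj (b I.+ + n) p) (c1 v i q t t<q (hR (ae ε') r))) where
     t = s M.∸ suc p
     st' : suc p M.+ t ≡ s
     st' = N.m+[n∸m]≡n a
     t<q : t M.< q
     t<q = N.+-cancelˡ-< (suc p) t q (subst (M._< suc p M.+ q) (sym st') (subst (s M.<_) (trans (sym e) (cong suc (N.+-comm q p))) s<n))
     ε' : y ∼ i I.+ + t
     ε' = af ε (subst (_∼ i I.+ + t) (trans (L.solve 4 (\ b p t n -> b L.:+ L.I L.:+ p L.:+ t L.:+ n L.:= b L.:+ n L.:+ (L.I L.:+ p L.:+ t)) refl b (+ p) (+ t) (+ n)) (cong (\ z -> b I.+ + n I.+ + z) st')) bv)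
  jy : ∀ b v -> eH v -> Σ (List ℤ) \ w -> w ∈ CW b × (∀ x -> ak w x ≡ ak v x)
  jy b v gv = let w , m , s = c5 b 0 n (N.+-identityʳ n) v (\ _ ()) (fG v gv) in w , m , pf s (bx w (All.lookup (j9 b) m)) (bx v gv)

-- Coefficients count factorizations

module ql where
 open import Defs
 open dK
 open iM
 open kZ
 open Ideal using (mon; k7)
 open Bad
 open cV
 open cB
 open fJ
 open qA
 open Lop
 open Len
 open oX
 open ad
 open import Data.Nat.DivMod using (_%_)
 open import Data.Fin as Fin using (Fin; toℕ; fromℕ<)
 open import Data.List using (map; concatMap; filter; lookup)
 open import Data.List.Relation.Unary.All as All using (All; []; _∷_)
 open import Data.List.Relation.Unary.Any as Any using (Any; here; there)
 open import Data.List.Relation.Unary.AllPairs as AllPairs using (AllPairs; []; _∷_)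
 open import Data.List.Relation.Unary.Unique.Propositional using (Unique)
 open import Data.List.Membership.Propositional using (_∈_)
 open import Data.List.Membership.Propositional.Properties using (∈-map⁺; ∈-concat⁺′; ∈-filter⁺; ∈-filter⁻)
 open import Data.Vec.Relation.Unary.All as VAll using ([]; _∷_)
 open import Data.Vec.Relation.Unary.All.Properties using (lookup⁺)
 open import Data.Product using (_×_)
 open import Function using (Equivalence; mk⇔)
 open import Relation.Nullary.Decidable using (_×-dec_)
 open E using (refl; sym; trans; subst)
 module jg (n : ℕ) .{{nz : NonZero n}} (aa : 2 M.≤ n) where
  open ay n
  open p4 n aa
  fS : ℤ -> (k : ℕ) -> List (Vec (List ℤ) k)
  fS b zero = [] ∷ []
  fS b (suc k) = concatMap (\ t -> map (_∷ t) (CW b)) (fS (b I.+ 1ℤ) k)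
  cat : ∀ {k} -> Vec (List ℤ) k -> List ℤ
  cat [] = []
  cat (w ∷ t) = w ++ cat t
  b0 : ∀ {k} -> Vec (List ℤ) k -> Vec ℕ k
  b0 = Vec.map length
  ch : ∀ {k} (t : Vec (List ℤ) k) -> length (cat t) ≡ Vec.sum (b0 t)
  ch [] = refl
  ch (w ∷ t) = trans (LP.length-++ w) (cong (length w M.+_) (ch t))
  oq : ∀ w v g -> vb (w ++ v) g ≡ vb v g ∧ vb w (act v g)
  oq [] v g = sym (kc (vb v g)) where
   kc : ∀ x -> x ∧ true ≡ x
   kc true = refl
   kc false = refl
  oq (j ∷ w) v g = trans (cong₂ _∧_ (oq w v g) (cong₂ lt (jf w v g _) (jf w v g _))) (assoc (vb v g) _ _) where
   assoc : ∀ x y z -> (x ∧ y) ∧ z ≡ x ∧ (y ∧ z)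
   assoc true y z = refl
   assoc false y z = refl
  im : ∀ w v x -> ak (w ++ v) x ≡ ak w (ak v x)
  im [] v x = refl
  im (j ∷ w) v x = cong σ[ j ] (im w v x)
  cx : ∀ {k} (t : Vec (List ℤ) k) x -> compose (Vec.map ak t) x ≡ ak (cat t) x
  cx [] x = refl
  cx (w ∷ t) x = trans (cong (ak w) (cx t x)) (sym (im w (cat t) x))
  eL : ∀ b k -> All (VAll.All eH) (fS b k)
  eL b zero = [] ∷ []
  eL b (suc k) = AP.concat⁺ (AP.map⁺ (All.map (\ gs -> AP.map⁺ (All.map (_∷ gs) (j9 b))) (eL (b I.+ 1ℤ) k)))
  cW : ∀ b k -> AllPairs (\ t t' -> ¬ Vec.map ak t ≈T Vec.map ak t') (fS b k)
  cW b zero = [] ∷ []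
  cW b (suc k) = PP.concat⁺ (AP.map⁺ (All.universal (\ t -> PP.map⁺ (AllPairs.map (\ ne e -> ne (e Fin.zero)) (jx b))) _)) (PP.map⁺ (AllPairs.map (\ ne -> AP.map⁺ (All.universal (\ _ -> AP.map⁺ (All.universal (\ _ e -> ne (\ r -> e (Fin.suc r))) _)) _)) (cW (b I.+ 1ℤ) k)))
  cX : ∀ b k (u : Vec Fn k) -> (∀ r -> Σ (List ℤ) \ v -> eH v × (∀ x -> ak v x ≡ Vec.lookup u r x)) -> Σ (Vec (List ℤ) k) \ t -> t ∈ fS b k × (∀ r x -> Vec.lookup u r x ≡ ak (Vec.lookup t r) x)
  cX b zero [] h = [] , here refl , \ ()
  cX b (suc k) (f ∷ u) h = let v , gv , e = h Fin.zero ; w , m , e' = jy b v gv ; t , m' , es = cX (b I.+ 1ℤ) k u (\ r -> h (Fin.suc r)) in w ∷ t , ∈-concat⁺′ (∈-map⁺ (_∷ t) m) (∈-map⁺ _ m') , \ { Fin.zero x -> sym (trans (e' x) (e x)) ; (Fin.suc r) -> es r }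
  module _ (K : ℕ) where
   private
    R = ai K
   open aE R renaming (refl to ≈-refl; sym to ≈-sym; trans to ≈-trans)
   open kI R n aa
   open bz R n aa
   open bt R n aa
   ΣL : ∀ {A : Set} -> (A -> C) -> List A -> C
   ΣL f [] = 0#
   ΣL f (x ∷ l) = f x + ΣL f l
   private
    dR : ∀ {A : Set} {f f' : A -> C} -> (∀ x -> f x ≈ f' x) -> ∀ l -> ΣL f l ≈ ΣL f' l
    dR e [] = ≈-refl
    dR e (x ∷ l) = +-cong (e x) (dR e l)
    ol : ∀ {A : Set} (f f' : A -> C) l -> ΣL (\ x -> f x + f' x) l ≈ ΣL f l + ΣL f' l
    ol f f' [] = ≈-sym (+-identityˡ 0#)
    ol f f' (x ∷ l) = ≈-trans (+-congˡ {f x + f' x} (ol f f' l)) (dh (f x) (f' x) (ΣL f l) (ΣL f' l))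
    iW : ∀ {A : Set} (f : A -> C) l l' -> ΣL f (l ++ l') ≈ ΣL f l + ΣL f l'
    iW f [] l' = ≈-sym (+-identityˡ (ΣL f l'))
    iW f (x ∷ l) l' = ≈-trans (+-congˡ {f x} (iW f l l')) (≈-sym (+-assoc (f x) (ΣL f l) (ΣL f l')))
    gA : ∀ {A B : Set} (f : B -> C) (h : A -> B) l -> ΣL f (map h l) ≡ ΣL (\ x -> f (h x)) l
    gA f h [] = refl
    gA f h (x ∷ l) = cong (\ z -> f (h x) + z) (gA f h l)
    Wd : C -> List ℤ -> (Fn -> C) -> Fn -> C
    Wd x [] Φ = Φ
    Wd x (j ∷ w) Φ = Wd x w (U x j Φ)
    oY : ∀ x w v Φ -> Wd x (v ++ w) Φ ≡ Wd x w (Wd x v Φ)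
    oY x w [] Φ = refl
    oY x w (j ∷ v) Φ = oY x w v (U x j Φ)
    ep : ∀ x w {Φ Φ' : Fn -> C} -> (∀ g -> Φ g ≈ Φ' g) -> ∀ g -> Wd x w Φ g ≈ Wd x w Φ' g
    ep x [] e = e
    ep x (j ∷ w) {Φ} e = ep x w (\ g -> *-congˡ {ind (lt (g (j I.+ 1ℤ)) (g j))} (*-congˡ {x} (e (s[ j ] g))))
    nq : ∀ {A : Set} x w (f : A -> Fn -> C) l g -> Wd x w (\ h -> ΣL (\ a -> f a h) l) g ≈ ΣL (\ a -> Wd x w (f a) g) l
    nq x [] f l g = ≈-refl
    nq x (j ∷ w) f l g = ≈-trans (ep x w (\ h -> push (\ a -> f a (s[ j ] h)) (ind (lt (h (j I.+ 1ℤ)) (h j))) l) g) (nq x w (\ a -> U x j (f a)) l g) where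
     push : ∀ (f : _ -> C) i l -> i * (x * ΣL f l) ≈ ΣL (\ a -> i * (x * f a)) l
     push f i [] = solve 2 (\ i x -> i :* (x :* con 0ℤ) := con 0ℤ) ≈-refl i x
     push f i (a ∷ l) = ≈-trans (solve 4 (\ i x a b -> i :* (x :* (a :+ b)) := i :* (x :* a) :+ i :* (x :* b)) ≈-refl i x (f a) (ΣL f l)) (+-congˡ {i * (x * f a)} (push f i l))
    g9 : ∀ x i m Φ g -> Ch 1# x i m Φ g ≈ ΣL (\ w -> Wd x w Φ g) (cK i m)
    g9 x i zero Φ g = ≈-sym (+-identityʳ (Φ g))
    g9 x i (suc m) Φ g = begin Ch 1# x i (suc m) Φ g ≈⟨ g9 x i m _ g ⟩ ΣL (\ w -> Wd x w (\ g -> 1# * Φ g + U x (i I.+ + m) Φ g) g) (cK i m) ≈⟨ dR two (cK i m) ⟩ ΣL (\ w -> Wd x w Φ g + Wd x (i I.+ + m ∷ w) Φ g) (cK i m) ≈⟨ ol (\ w -> Wd x w Φ g) _ (cK i m) ⟩ ΣL (\ w -> Wd x w Φ g) (cK i m) + ΣL (\ w -> Wd x (i I.+ + m ∷ w) Φ g) (cK i m) ≡⟨ cong (\ z -> ΣL (\ w -> Wd x w Φ g) (cK i m) + z) (sym (gA (\ w -> Wd x w Φ g) _ (cK i m))) ⟩ ΣL (\ w -> Wd x w Φ g) (cK i m) + ΣL (\ w -> Wd x w Φ g) (map (i I.+ + m ∷_) (cK i m)) ≈⟨ ≈-sym (iW _ (cK i m) _) ⟩ ΣL (\ w -> Wd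 x w Φ g) (cK i (suc m)) ∎ where
     two : ∀ w -> Wd x w (\ g -> 1# * Φ g + U x (i I.+ + m) Φ g) g ≈ Wd x w Φ g + Wd x w (U x (i I.+ + m) Φ) g
     two w = ≈-trans (ep x w (\ h -> +-cong {1# * Φ h} {Φ h} (*-identityˡ (Φ h)) (≈-sym (+-identityʳ (U x (i I.+ + m) Φ h)))) g) (≈-trans (nq x w (\ { true -> Φ ; false -> U x (i I.+ + m) Φ }) (true ∷ false ∷ []) g) (+-congˡ {Wd x w Φ g} (+-identityʳ _)))
    ha : ∀ x i m Φ g -> Ch 0# x i m Φ g ≈ Wd x (hj i m) Φ g
    ha x i zero Φ g = ≈-refl
    ha x i (suc m) Φ g = ≈-trans (ha x i m _ g) (ep x (hj i m) (\ h -> ≈-trans (+-congʳ {U x (i I.+ + m) Φ h} (zeroˡ (Φ h))) (+-identityˡ _)) g)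
    g5 : ∀ x b Φ g p q -> Hgo x b Φ g p q ≈ ΣL (\ w -> Wd x w Φ g) (my b p q)
    g5 x b Φ g p zero = ≈-refl
    g5 x b Φ g p (suc q) = ≈-trans (+-cong ek (g5 x b Φ g (suc p) q)) (≈-sym (iW _ (map (hj (b I.+ + n) p ++_) (cK (b I.+ 1ℤ I.+ + p) q)) _)) where
     i = b I.+ 1ℤ I.+ + p
     f = hj (b I.+ + n) p
     ek : Ch 1# x i q (Ch 0# x (b I.+ + n) p Φ) g ≈ ΣL (\ w -> Wd x w Φ g) (map (f ++_) (cK i q))
     ek = ≈-trans (g9 x i q _ g) (≈-trans (dR (\ w -> ≈-trans (ep x w (ha x (b I.+ + n) p Φ) g) (reflexive (cong (\ z -> z g) (sym (oY x w f Φ))))) (cK i q)) (reflexive (sym (gA (\ w -> Wd x w Φ g) (f ++_) (cK i q)))))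
    WT : ∀ {k} -> Vec C k -> Vec (List ℤ) k -> (Fn -> C) -> Fn -> C
    WT [] [] Φ = Φ
    WT (x ∷ xs) (w ∷ t) Φ = WT xs t (Wd x w Φ)
    gZ : ∀ {k} (xs : Vec C k) t {Φ Φ' : Fn -> C} -> (∀ g -> Φ g ≈ Φ' g) -> ∀ g -> WT xs t Φ g ≈ WT xs t Φ' g
    gZ [] [] e = e
    gZ (x ∷ xs) (w ∷ t) e = gZ xs t (ep x w e)
    oZ : ∀ {A : Set} {k} (xs : Vec C k) t (f : A -> Fn -> C) l g -> WT xs t (\ h -> ΣL (\ a -> f a h) l) g ≈ ΣL (\ a -> WT xs t (f a) g) l
    oZ [] [] f l g = ≈-refl
    oZ (x ∷ xs) (w ∷ t) f l g = ≈-trans (gZ xs t (nq x w f l) g) (oZ xs t (\ a -> Wd x w (f a)) l g)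
    g3 : ∀ {k} b (xs : Vec C k) Φ g -> Lop b xs Φ g ≈ ΣL (\ t -> WT xs t Φ g) (fS b k)
    g3 b [] Φ g = ≈-sym (+-identityʳ (Φ g))
    g3 {suc k} b (x ∷ xs) Φ g = ≈-trans (g3 (b I.+ 1ℤ) xs (Hb x b Φ) g) (≈-trans (dR (\ t -> ≈-trans (gZ xs t (\ h -> g5 x b Φ h 0 n) g) (oZ xs t (\ w -> Wd x w Φ) (CW b) g)) (fS (b I.+ 1ℤ) k)) (jU (fS (b I.+ 1ℤ) k))) where
     jU : ∀ ts -> ΣL (\ t -> ΣL (\ w -> WT xs t (Wd x w Φ) g) (CW b)) ts ≈ ΣL (\ t -> WT (x ∷ xs) t Φ g) (concatMap (\ t -> map (_∷ t) (CW b)) ts)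
     jU [] = ≈-refl
     jU (t ∷ ts) = ≈-trans (+-cong (reflexive (sym (gA (\ t -> WT (x ∷ xs) t Φ g) (_∷ t) (CW b)))) (jU ts)) (≈-sym (iW _ (map (_∷ t) (CW b)) _))
    jQ : ∀ a b -> ind (a ∧ b) ≈ ind a * ind b
    jQ true b = ≈-sym (*-identityˡ (ind b))
    jQ false b = ≈-sym (zeroˡ (ind b))
    jW : ∀ x w Φ g -> Wd x w Φ g ≈ pow x (length w) * (ind (vb w g) * Φ (act w g))
    jW x [] Φ g = ≈-sym (≈-trans (*-identityˡ _) (*-identityˡ (Φ g)))
    jW x (j ∷ w) Φ g = ≈-trans (jW x w (U x j Φ) g) (≈-trans (solve 5 (\ p v d x f -> p :* (v :* (d :* (x :* f))) := (x :* p) :* ((v :* d) :* f)) ≈-refl (pow x (length w)) (ind (vb w g)) (ind d) x (Φ (act (j ∷ w) g))) (*-congˡ {pow x (suc (length w))} (*-congʳ {Φ (act (j ∷ w) g)} (≈-sym (jQ (vb w g) d))))) where d = lt (act w g (j I.+ 1ℤ)) (act w g j)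
    jX : ∀ {k} (xs : Vec C k) t {Φ} -> Ext Φ -> ∀ g -> WT xs t Φ g ≈ mon xs (b0 t) * (ind (vb (cat t) g) * Φ (act (cat t) g))
    jX [] [] {Φ} ext g = ≈-sym (≈-trans (*-identityˡ _) (*-identityˡ (Φ g)))
    jX (x ∷ xs) (w ∷ t) {Φ} ext g = begin WT xs t (Wd x w Φ) g ≈⟨ gZ xs t (jW x w Φ) g ⟩ WT xs t Ψ g ≈⟨ jX xs t lg g ⟩ M * (ind (vb (cat t) g) * Ψ (act (cat t) g)) ≈⟨ solve 5 (\ m v p u f -> m :* (v :* (p :* (u :* f))) := (p :* m) :* ((v :* u) :* f)) ≈-refl M (ind (vb (cat t) g)) (pow x (length w)) (ind (vb w (act (cat t) g))) (Φ (act w (act (cat t) g))) ⟩ (pow x (length w) * M) * ((ind (vb (cat t) g) * ind (vb w (act (cat t) g))) * Φ (act w (act (cat t) g))) ≈⟨ *-congˡ {pow x (length w) * M} (*-cong (≈-trans (≈-sym (jQ (vb (cat t) g) _)) (reflexive (cong ind (sym (oq w (cat t) g))))) (ext (\ y -> sym (jf w (cat t) g y)))) ⟩ _ ∎ where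
     M = mon xs (b0 t)
     Ψ : Fn -> C
     Ψ h = pow x (length w) * (ind (vb w h) * Φ (act w h))
     lH : ∀ w {g h : Fn} -> (∀ x -> g x ≡ h x) -> vb w g ≡ vb w h
     lH [] e = refl
     lH (j ∷ w) e = cong₂ _∧_ (lH w e) (cong₂ lt (fC w e _) (fC w e _))
     lg : Ext Ψ
     lg e = *-congˡ {pow x (length w)} (*-cong (reflexive (cong ind (lH w e))) (ext (fC w e)))
   module _ (b : ℤ) (g : Fn) where
    kf : Fn -> C
    kf h = ind (jD n (win b n h))
    -- The second condition says that the lengths add up (`h4`), the third that the product is the
    -- right one (`eJ`).
    Ok : Vec ℕ K -> Vec (List ℤ) K -> Set
    Ok e t = b0 t ≡ e × vb (cat t) g ≡ true × win b n (act (cat t) g) ≡ idw n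
    Ok? : ∀ e t -> Dec (Ok e t)
    Ok? e t = VP.≡-dec M._≟_ (b0 t) e ×-dec (vb (cat t) g Bool.≟ true) ×-dec LP.≡-dec I._≟_ (win b n (act (cat t) g)) (idw n)
    -- Expanding `Lop` gives for each tuple of words one monomial, with coefficient 1 or 0.
    jb : ∀ e -> coeff (Lop b (X K) kf g) e ≡ + length (filter (Ok? e) (fS b K))
    jb e = trans (ac (≈-trans (g3 b (X K) kf g) (dR (\ t -> jX (X K) t (\ {g} {h} q -> reflexive (cong (\ z -> ind (jD n z)) (cp b n {h} {g} (\ s _ -> q _)))) g) (fS b K))) e) (nm (fS b K)) where
     b1 : Vec (List ℤ) K -> C
     b1 t = mon (X K) (b0 t) * (ind (vb (cat t) g) * kf (act (cat t) g))
     i5 : ∀ s -> coeff (mon (X K) s) e ≡ δ[ e ] s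
     i5 s = trans (aj (mon (X K) s) e) (k7 K s δ[ e ])
     mG : ∀ t -> Ok e t -> coeff (b1 t) e ≡ 1ℤ
     mG t (refl , v , u) = trans (ac (≈-trans (*-congˡ {mon (X K) (b0 t)} (≈-trans (*-cong (reflexive (cong ind v)) (reflexive (cong ind (dec-true (LP.≡-dec I._≟_ (win b n (act (cat t) g)) (idw n)) u)))) (*-identityˡ 1#))) (*-identityʳ (mon (X K) (b0 t)))) e) (trans (i5 (b0 t)) (iV (b0 t) (b0 t) refl))
     iX : ∀ t (v u : Bool) -> v ≡ false ⊎ u ≡ false -> coeff (mon (X K) (b0 t) * (ind v * ind u)) e ≡ 0ℤ
     iX t v u h = ac (≈-trans (*-congˡ {mon (X K) (b0 t)} (z v u h)) (zeroʳ (mon (X K) (b0 t)))) e where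
      z : ∀ v u -> v ≡ false ⊎ u ≡ false -> ind v * ind u ≈ 0#
      z v u (inj₁ refl) = zeroˡ (ind u)
      z v u (inj₂ refl) = zeroʳ (ind v)
     oG : ∀ t -> ¬ Ok e t -> coeff (b1 t) e ≡ 0ℤ
     oG t no' with vb (cat t) g in v | LP.≡-dec I._≟_ (win b n (act (cat t) g)) (idw n) in u
     ... | false | d = iX t false (does d) (inj₁ refl)
     ... | true | no w = iX t true false (inj₂ refl)
     ... | true | yes w = trans (ac (≈-trans (*-congˡ {mon (X K) (b0 t)} (*-identityˡ 1#)) (*-identityʳ (mon (X K) (b0 t)))) e) (trans (i5 (b0 t)) (d8 e (b0 t) (\ q -> no' (q , refl , w))))
     nm : ∀ ts -> coeff (ΣL b1 ts) e ≡ + length (filter (Ok? e) ts)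
     nm [] = refl
     nm (t ∷ ts) = trans (a0 (b1 t) (ΣL b1 ts) e) (bp (Ok? e t)) where
      bp : Dec (Ok e t) -> coeff (b1 t) e I.+ coeff (ΣL b1 ts) e ≡ + length (filter (Ok? e) (t ∷ ts))
      bp (yes o) = trans (cong₂ I._+_ (mG t o) (nm ts)) (cong (\ l -> + length l) (sym (LP.filter-accept (Ok? e) o)))
      bp (no o) = trans (cong₂ I._+_ (oG t o) (nm ts)) (trans (Z.+-identityˡ _) (cong (\ l -> + length l) (sym (LP.filter-reject (Ok? e) o))))
    lu : ∀ e -> 1ℤ I.≤ coeff (Lop b (X K) kf g) e -> Σ (Vec (List ℤ) K) (Ok e)
    lu e p = go (filter (Ok? e) (fS b K)) refl (subst (1ℤ I.≤_) (jb e) p) where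
     go : ∀ l -> l ≡ filter (Ok? e) (fS b K) -> 1ℤ I.≤ + length l -> Σ (Vec (List ℤ) K) (Ok e)
     go [] _ (I.+≤+ ())
     go (t ∷ _) q _ = t , proj₂ (∈-filter⁻ (Ok? e) {xs = fS b K} (subst (t ∈_) q (here refl)))
  private
   a2 : ∀ x -> x ∼ + (x %ℕ n)
   a2 x = mk∼ (x /ℕ n) (a≡a%ℕn+[a/ℕn]*n x n)
   eP : ∀ {i j} -> i M.< n -> j M.< n -> + i ∼ + j -> i ≡ j
   eP {i} {j} p q e = Z.+-injective (bQ e (Z.<-≤-trans (I.+<+ p) (Z.i≤j+i (+ n) (+ j))) (Z.<-≤-trans (I.+<+ q) (Z.i≤j+i (+ n) (+ i))))
   lO : ∀ {x y} -> x ∼ y -> x %ℕ n ≡ y %ℕ n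
   lO {x} {y} e = eP (n%ℕd<d x n) (n%ℕd<d y n) (af (ae (a2 x)) (af e (a2 y)))
   jH : ∀ {x} {r : ℕ} -> x %ℕ n ≡ r -> x ∼ + r
   jH {x} refl = a2 x
   po : ∀ (j : ℕ) -> + j I.+ 1ℤ ≡ + suc j
   po j = cong +_ (N.+-comm j 1)
  s-σ : ∀ (j : Fin n) x -> s n j x ≡ σ[ + toℕ j ] x
  s-σ j x with 2 M.≤? n
  ... | no q = ⊥-elim (q aa)
  ... | yes _ with x %ℕ n M.≟ toℕ j
  ...   | yes p = sym (e6.dy n aa (+ toℕ j) (jH p))
  ...   | no p with x %ℕ n M.≟ suc (toℕ j) % n
  ...     | yes q = sym (e6.bA n aa (+ toℕ j) (subst (x ∼_) (sym (po (toℕ j))) (af (jH q) (ae (a2 (+ suc (toℕ j)))))))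
  ...     | no q = sym (aY (\ e -> p (trans (lO e) (eP (n%ℕd<d (+ toℕ j) n) (FN.toℕ<n j) (ae (a2 (+ toℕ j)))))) (\ e -> q (lO (subst (x ∼_) (po (toℕ j)) e))))
  iz : List (Fin n) -> List ℤ
  iz = map (\ j -> + toℕ j)
  dS : ∀ w x -> sWord n w x ≡ ak (iz w) x
  dS [] x = refl
  dS (j ∷ w) x = trans (s-σ j _) (cong σ[ + toℕ j ] (dS w x))
  hr : ∀ {u} -> CycDec n u -> Σ (List ℤ) \ v -> eH v × (∀ x -> ak v x ≡ u x)
  hr (w , uw , cond , e) = iz w , PP.map⁺ (go w uw cond) , \ x -> sym (trans (e x) (dS w x)) where
   go : ∀ w -> Unique w -> (∀ (p q : Fin (length w)) -> toℕ (lookup w q) ≡ suc (toℕ (lookup w p)) % n -> q Fin.< p) -> AllPairs (\ x y -> + toℕ y ≁ + toℕ x × + toℕ y ≁ + toℕ x I.+ 1ℤ) w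
   go [] [] c = []
   go (j ∷ w) (ne ∷ uw) c = All.tabulate (\ {y} m -> (\ r -> All.lookup ne m (FN.toℕ-injective (eP (FN.toℕ<n j) (FN.toℕ<n y) (ae r)))) , \ r -> kY (c Fin.zero (Fin.suc (Any.index m)) (trans (cong toℕ (sym (YP.lookup-index m))) (eP (FN.toℕ<n y) (n%ℕd<d (+ suc (toℕ j)) n) (af (subst (+ toℕ y ∼_) (po (toℕ j)) r) (a2 _)))))) ∷ go w uw (\ p q e -> N.≤-pred (c (Fin.suc p) (Fin.suc q) e)) where
    kY : ∀ {m} {q : Fin m} -> Fin.suc q Fin.< Fin.zero {m} -> ⊥
    kY ()
  hq : ∀ w -> eH w -> CycDec n (ak w)
  hq w gw = map fin w , PP.map⁺ (AllPairs.map (\ (a , _) e -> a (oO (sym e))) gw) , cond , eqn w where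
   fin : ℤ -> Fin n
   fin y = fromℕ< (n%ℕd<d y n)
   i0 : ∀ y -> toℕ (fin y) ≡ y %ℕ n
   i0 y = FN.toℕ-fromℕ< (n%ℕd<d y n)
   oO : ∀ {x y} -> fin x ≡ fin y -> x ∼ y
   oO {x} {y} e = af (a2 x) (subst (\ z -> + z ∼ y) (trans (sym (i0 y)) (trans (cong toℕ (sym e)) (i0 x))) (ae (a2 y)))
   lK : ∀ x y -> toℕ (fin y) ≡ suc (toℕ (fin x)) % n -> y ∼ x I.+ 1ℤ
   lK x y e = af (jH (trans (sym (i0 y)) e)) (af (ae (a2 (+ suc (toℕ (fin x))))) (subst (_∼ x I.+ 1ℤ) (trans (cong (\ z -> + z I.+ 1ℤ) (sym (i0 x))) (po (toℕ (fin x)))) (fO 1ℤ (ae (a2 x)))))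
   cond : ∀ (p q : Fin (length (map fin w))) -> toℕ (lookup (map fin w) q) ≡ suc (toℕ (lookup (map fin w) p)) % n -> q Fin.< p
   cond = go w gw where
    go : ∀ w -> eH w -> ∀ (p q : Fin (length (map fin w))) -> toℕ (lookup (map fin w) q) ≡ suc (toℕ (lookup (map fin w) p)) % n -> q Fin.< p
    go (j ∷ w) (a ∷ gw) Fin.zero Fin.zero e = ⊥-elim (ar aa j (lK j j e))
    go (j ∷ w) (a ∷ gw) Fin.zero (Fin.suc q) e = ⊥-elim (All.lookup (AP.map⁺ {P = \ z -> toℕ z ≢ suc (toℕ (fin j)) % n} (All.map (\ {y} (_ , r) ε -> r (lK j y ε)) a)) (∈-lookup q) e) where open import Data.List.Membership.Propositional.Properties using (∈-lookup)
    go (j ∷ w) (a ∷ gw) (Fin.suc p) Fin.zero e = M.s≤s M.z≤n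
    go (j ∷ w) (a ∷ gw) (Fin.suc p) (Fin.suc q) e = M.s≤s (go w gw p q e)
   eqn : ∀ w x -> ak w x ≡ sWord n (map fin w) x
   eqn [] x = refl
   eqn (j ∷ w) x = trans (cong σ[ j ] (eqn w x)) (trans (e6.fU n aa (ar aa (+ toℕ (fin j))) (subst (\ z -> j ∼ + z) (sym (i0 j)) (a2 j)) (L.solve 2 (\ i j -> (i L.:+ L.I) L.:- i L.:= (j L.:+ L.I) L.:- j) refl j (+ toℕ (fin j))) _) (sym (s-σ (fin j) _)))
  hg : ∀ {D g} a -> Adm D g -> Adm (D M.+ I.∣ a ∣) (\ x -> g x I.+ a)
  hg {D} {g} a w = record { qp = \ x -> trans (cong (I._+ a) (qp w x)) (L.solve 3 (\ g n a -> g L.:+ n L.:+ a L.:= g L.:+ a L.:+ n) refl (g x) (+ n) a) ; inj = \ x y e -> inj w x y (aS a (g x) (g y) e) ; ej = \ x -> lin 0 (ej w x & abs- a) (L.solve 5 (\ x g a D m -> (g L.:+ a L.:+ (D L.:+ m)) L.:- x L.:= ((g L.:+ D) L.:+ (a L.:+ m)) L.:- (x L.:+ L.O) L.:+ L.O) refl x (g x) a (+ D) (+ I.∣ a ∣)) ; ee = \ x -> lin 0 (ee w x & abs+ a) (L.solve 5 (\ x g a D m -> (x L.:+ (D L.:+ m)) L.:- (g L.:+ a) L.:= ((x L.:+ D) L.:+ m) L.:- (g L.:+ a) L.:+ L.O) refl x (g x) a (+ D) (+ I.∣ a ∣)) } where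
   abs+ : ∀ a -> a I.≤ + I.∣ a ∣
   abs+ (+ m) = Z.≤-refl
   abs+ I.-[1+ m ] = I.-≤+
   abs- : ∀ a -> 0ℤ I.≤ a I.+ + I.∣ a ∣
   abs- (+ m) = I.+≤+ M.z≤n
   abs- I.-[1+ m ] = Z.≤-reflexive (sym (Z.+-inverseˡ (+ suc m)))
  private
   kB : ∀ b m {h : Fn} -> win b m h ≡ idw m -> ∀ s -> s M.< m -> h (b I.+ + s) ≡ + suc s
   kB b (suc m) e s p with s M.≟ m
   ... | yes refl = LP.∷-injectiveˡ e
   ... | no ne = kB b m (LP.∷-injectiveʳ e) s (N.≤∧≢⇒< (N.≤-pred p) ne)
   lJ : ∀ b m {h : Fn} -> (∀ s -> h (b I.+ + s) ≡ + suc s) -> win b m h ≡ idw m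
   lJ b zero e = refl
   lJ b (suc m) e = cong₂ _∷_ (e m) (lJ b m e)
  -- The base of the first factor. Each of the k factors moves it by one, so that the last window
  -- begins at 1; the target is the translation by k, whose window at 1 - k is that of the identity.
  aP : ℕ -> ℤ
  aP k = 1ℤ I.- + k
  eJ : ∀ k {D h} -> Adm D h -> win (aP k) n h ≡ idw n -> ∀ x -> h x ≡ x I.+ + k
  eJ k {D} {h} w e x with (x I.- aP k) %ℕ n | (x I.- aP k) /ℕ n | n%ℕd<d (x I.- aP k) n | a≡a%ℕn+[a/ℕn]*n (x I.- aP k) n
  ... | r | q | r<n | ε = trans (cong h x≡) (trans (dA w _ q) (trans (cong (I._+ q I.* + n) (kB (aP k) n e r r<n)) (trans (L.solve 3 (\ k r q -> (L.I L.:+ r) L.:+ q L.:= (L.I L.:- k L.:+ r L.:+ q) L.:+ k) refl (+ k) (+ r) (q I.* + n)) (cong (I._+ + k) (sym x≡))))) where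
   x≡ : x ≡ aP k I.+ + r I.+ q I.* + n
   x≡ = trans (L.solve 2 (\ x b -> x L.:= b L.:+ (x L.:- b)) refl x (aP k)) (trans (cong (I._+_ (aP k)) ε) (sym (Z.+-assoc (aP k) (+ r) (q I.* + n))))
  ld : ∀ k {h : Fn} -> (∀ x -> h x ≡ x I.+ + k) -> win (aP k) n h ≡ idw n
  ld k e = lJ (aP k) n (\ s -> trans (e _) (L.solve 2 (\ k s -> L.I L.:- k L.:+ s L.:+ k L.:= L.I L.:+ s) refl (+ k) (+ s)))
  open kJ n aa
  qi : ∀ {N D k g e t} -> Adm D g -> gq N (D M.+ Vec.sum e) -> Ok k (aP k) g e t -> ℓ N g ≡ + Vec.sum e
  qi {N} {D} {k} {g} {e} {t} w room (refl , v , u) = go (h4 (cat t) w (subst (\ z -> gq N (D M.+ z)) (sym (ch t)) room)) where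
   a1 : ∀ x -> act (cat t) g x ≡ x I.+ + k
   a1 = eJ k (fL (cat t) w) u
   go : _ -> ℓ N g ≡ + Vec.sum (b0 t)
   go (inj₂ (f , _)) with () ← trans (sym v) f
   go (inj₁ (_ , q)) = trans q (trans (cong₂ I._+_ (fP N (\ x y p -> E.subst₂ I._<_ (sym (a1 x)) (sym (a1 y)) (Z.+-monoˡ-< (+ k) p))) (cong +_ (ch t))) (Z.+-identityˡ _))
  private
   big : ℕ -> ℕ
   big M = suc (M M.+ 1 M.+ (M M.+ 1) M.+ 2)
   pT : ∀ {D M} -> D M.≤ M -> D M.+ D M.< big M
   pT p = M.s≤s (N.≤-trans (N.+-mono-≤ (N.≤-trans p (N.m≤m+n _ 1)) (N.≤-trans p (N.m≤m+n _ 1))) (N.m≤m+n _ 2))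
   hp : ∀ {u v : Fn} {m} -> (∀ x -> u x ≡ v x) -> HasLength n u m -> HasLength n v m
   hp e (L , p , q , r) = L , p , (\ i j -> let module Q = Equivalence (q i j) in mk⇔ (\ z -> let a , b , c = Q.to z in a , b , E.subst₂ I._<_ (e j) (e i) c) (\ (a , b , c) -> Q.from (a , b , E.subst₂ I._<_ (sym (e j)) (sym (e i)) c))) , r
   em : ∀ {k} (u v : Vec Fn k) -> u ≈T v -> ∀ x -> compose u x ≡ compose v x
   em [] [] e x = refl
   em (f ∷ u) (h ∷ v) e x = trans (e Fin.zero _) (cong h (em u v (\ r -> e (Fin.suc r)) x))
   jK : ∀ {k} {u v : Vec ℕ k} -> (∀ r -> Vec.lookup u r ≡ Vec.lookup v r) -> u ≡ v
   jK {u = []} {[]} h = refl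
   jK {u = _ ∷ _} {_ ∷ _} h = cong₂ _∷_ (h Fin.zero) (jK (\ r -> h (Fin.suc r)))
  module _ (W : List ℤ) (k : ℕ) (f : Fn) (a : ℤ) (f≡ : ∀ x -> f x ≡ ak W x I.+ a) where
   -- f renormalised to average k, so that boundedness reads i ≤ g(i) ≤ i + n.
   hH : Fn
   hH x = ak W x I.+ + k
   private
    D = length W M.+ (k M.+ I.∣ a ∣)
    qD : Adm D f
    qD = mC (\ x -> sym (f≡ x)) (d6 (N.+-monoʳ-≤ (length W) (N.m≤n+m I.∣ a ∣ k)) (hg a (cF W)))
    pg : Adm D hH
    pg = d6 (N.+-monoʳ-≤ (length W) (N.m≤m+n k I.∣ a ∣)) (hg (+ k) (cF W))
    nO : ∀ N -> ℓ N f ≡ ℓ N hH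
    nO N = iT N (\ x y p -> Z.+-monoˡ-< (+ k) (hN x y (E.subst₂ I._<_ (f≡ x) (f≡ y) p))) (\ x y p -> E.subst₂ I._<_ (sym (f≡ x)) (sym (f≡ y)) (Z.+-monoˡ-< a (hN x y p))) where
     hN : ∀ x y {c} -> ak W x I.+ c I.< ak W y I.+ c -> ak W x I.< ak W y
     hN x y {c} p = aB 0 (st p) (L.solve 3 (\ x y c -> y L.:- x L.:= ((y L.:+ c) L.:- (x L.:+ c L.:+ L.I)) L.:+ L.I) refl (ak W x) (ak W y) c)
    k6 : ∀ {e t} -> VAll.All eH t -> Ok k (aP k) hH e t -> Factorization n k f a e (Vec.map ak t)
    k6 {e} {t} gs o@(refl , v , u) = jF , b9 qD (pT {M = M} (N.m≤m+n D _)) (sym (trans (nO (big M)) (qi {t = t} pg N.≤-refl o))) , \ x -> trans (cx t x) (trans (sym (eh x)) (trans (L.solve 2 (\ p a -> p L.:= (p L.:+ a) L.:- a) refl (ak W x) a) (cong (I._- a) (sym (f≡ x))))) where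
     M = D M.+ Vec.sum e
     eh : ∀ x -> ak W x ≡ ak (cat t) x
     eh x = aS (+ k) _ _ (io (cat t) (eJ k (fL (cat t) pg) u) x)
     one : ∀ w -> eH w -> CycDec n (ak w) × HasLength n (ak w) (length w)
     one w gw = hq w gw , b9 (cF w) (pT {M = length w} N.≤-refl) (sym (gu w gw N.≤-refl))
     jF : ∀ r -> CycDec n (Vec.lookup (Vec.map ak t) r) × HasLength n (Vec.lookup (Vec.map ak t) r) (Vec.lookup (b0 t) r)
     jF r = E.subst₂ (\ u m -> CycDec n u × HasLength n u m) (sym (VP.lookup-map r ak t)) (sym (VP.lookup-map r length t)) (one (Vec.lookup t r) (lookup⁺ gs r))
    -- Each factor is replaced by its listed word (`cX`). That all letters act at descents follows
    -- from the additivity of lengths: otherwise the inequality in `h4` would be strict.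
    lf : ∀ {e u} -> Factorization n k f a e u -> Σ (Vec (List ℤ) k) \ t -> t ∈ filter (Ok? k (aP k) hH e) (fS (aP k) k) × u ≈T Vec.map ak t
    lf {e} {u} (jF , len , p0) = t , ∈-filter⁺ (Ok? k (aP k) hH e) m (sz , os , ld k a1) , bF where
     found = cX (aP k) k u (\ r -> hr (proj₁ (jF r)))
     t = proj₁ found
     m = proj₁ (proj₂ found)
     T = cat t
     eqs = proj₂ (proj₂ found)
     gs = All.lookup (eL (aP k) k) m
     bF : u ≈T Vec.map ak t
     bF r x = trans (eqs r x) (cong (\ z -> z x) (sym (VP.lookup-map r ak t)))
     sz : b0 t ≡ e
     sz = jK (\ r -> trans (VP.lookup-map r length t) (let w = Vec.lookup t r in cS (b9 (cF w) (pT {M = length w} N.≤-refl) (sym (gu w (lookup⁺ gs r) N.≤-refl))) (hp (eqs r) (proj₂ (jF r)))))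
     eh : ∀ x -> ak T x ≡ ak W x
     eh x = trans (sym (trans (em u (Vec.map ak t) bF x) (cx t x))) (trans (p0 x) (trans (cong (I._- a) (f≡ x)) (L.solve 2 (\ p a -> (p L.:+ a) L.:- a L.:= p) refl (ak W x) a)))
     a1 : ∀ x -> act T hH x ≡ x I.+ + k
     a1 x = trans (fC T (\ y -> cong (I._+ + k) (sym (eh y))) x) (iL T (\ y -> y I.+ + k) x)
     M = D M.+ length T
     lenT : Vec.sum e ≡ length T
     lenT = trans (cong Vec.sum (sym sz)) (sym (ch t))
     os : vb T hH ≡ true
     os with h4 {big M} T pg N.≤-refl
     ... | inj₁ (v , _) = v
     ... | inj₂ (_ , p) = ⊥-elim (Z.<-irrefl (trans (sym (nO (big M))) (trans (sym (fN qD (pT {M = M} (N.m≤m+n D _)) len)) (trans (cong +_ lenT) (sym (trans (cong (I._+ + length T) (fP (big M) (\ x y q -> E.subst₂ I._<_ (sym (a1 x)) (sym (a1 y)) (Z.+-monoˡ-< (+ k) q)))) (Z.+-identityˡ _)))))) p)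
   -- The given list of factorizations and the list of good tuples both consist of distinct elements
   -- and exhaust each other, so `cL` applies in both directions.
   ey : ∀ P -> IsStanleyPoly n k f a P -> ∀ e -> coeff P e ≡ coeff (bt.Lop (ai k) n aa (aP k) (X k) (kf k (aP k) hH) hH) e
   ey P st' e with st' e
   ... | c , (L , all , complete , distinct , len) , eqn = trans eqn (trans (cong +_ (trans (sym len) (trans (N.≤-antisym le ge) (LP.length-map _ ts)))) (sym (jb k (aP k) hH e))) where
    ts = filter (Ok? k (aP k) hH e) (fS (aP k) k)
    sy : ∀ {u v : Vec Fn k} -> u ≈T v -> v ≈T u
    sy p r i = sym (p r i)
    tr' : ∀ {u v w : Vec Fn k} -> u ≈T v -> v ≈T w -> u ≈T w
    tr' p q r i = trans (p r i) (q r i)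
    le : length L M.≤ length (map (Vec.map ak) ts)
    le = cL {_≈_ = _≈T_} (\ {u} {v} -> sy {u} {v}) (\ {u} {v} {w} -> tr' {u} {v} {w}) distinct (All.map (\ {u} F -> let t , m , q = lf {u = u} F in Any.map (\ { refl -> q }) (∈-map⁺ (Vec.map ak) m)) all)
    ge : length (map (Vec.map ak) ts) M.≤ length L
    ge = cL {_≈_ = _≈T_} (\ {u} {v} -> sy {u} {v}) (\ {u} {v} {w} -> tr' {u} {v} {w}) (PP.map⁺ (PP.filter⁺ (Ok? k (aP k) hH e) (cW (aP k) k))) (AP.map⁺ (All.tabulate (\ {t} m -> let i , o = ∈-filter⁻ (Ok? k (aP k) hH e) m in complete (Vec.map ak t) (k6 (All.lookup (eL (aP k) k) i) o))))

-- Top windows: minimal exponents and the greedy factorization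

module Top where
 open import Defs using (Poly; coeff; _*P_)
 open dK
 open lq
 open o3
 open iM
 open kZ
 open Bad
 open ad
 open import Data.List using (map)
 open import Data.List.Relation.Unary.All as LAll using ([]; _∷_)
 open import Data.Vec.Relation.Unary.Any using (Any; here; there)
 open import Data.Product using (_×_)
 open import Data.Unit using (⊤; tt)
 open import Relation.Nullary.Decidable using (_×-dec_)
 open E using (refl; sym; trans; subst)
 au : ∀ {us c o c'} -> bu us c o c' -> ℕ
 au eD = 0
 au (b2 p) = au p
 au (f8 p _) = suc (au p)
 -- True at the fixed entries; `aT` counts them, and `ys` lists the slots of the others.
 aA : List ℤ -> List Bool
 aA [] = []
 aA (u ∷ us) = eq u (+ suc (length us)) ∷ aA us
 aT : List Bool -> ℕ
 aT [] = 0
 aT (true ∷ fs) = suc (aT fs)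
 aT (false ∷ fs) = aT fs
 kS : ∀ o -> Dec (bE o)
 kS [] = yes tt
 kS (u ∷ us) = (+ suc (length us) I.≤? u) ×-dec kS us
 -- A fixed entry cannot be picked up, since it would have to be put down further right.
 bU : ∀ {us c o c'} (p : bu us c o c') -> bE o -> + suc (length us) I.≤ c' -> aT (aA us) M.≤ au p × aT (aA us) M.≤ aT (aA o)
 bU eD a q = M.z≤n , M.z≤n
 bU {u ∷ us} (b2 {o = o} {c' = c″} p) (a , as) q = pA (Z.<-irrefl ∘ʳ q) where
  ih = bU p as (subst (\ z -> + suc z I.≤ c″) (aH p) a)
  nR : ∀ b {m} -> m M.≤ aT (aA o) -> m M.≤ aT (b ∷ aA o)
  nR true = N.m≤n⇒m≤1+n
  nR false r = r
  _∘ʳ_ : (∀ {x y} -> x ≡ y -> ¬ x I.< y) -> + suc (suc (length us)) I.≤ u -> u ≢ + suc (length us)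
  (f ∘ʳ q) e = f (sym e) (Z.<-≤-trans (I.+<+ N.≤-refl) q)
  pA : u ≢ + suc (length us) -> aT (aA (u ∷ us)) M.≤ au p × aT (aA (u ∷ us)) M.≤ aT (aA (c″ ∷ o))
  pA ne rewrite b7 ne = proj₁ ih , nR (eq c″ (+ suc (length o))) (proj₂ ih)
 bU {u ∷ us} (f8 {o = o} p _) (a , as) q = subst (\ z -> aT (aA (u ∷ us)) M.≤ suc (au p) × aT (aA (u ∷ us)) M.≤ aT (eq u (+ suc z) ∷ aA o)) (sym (aH p)) (add (eq u (+ suc (length us)))) where
  ih = bU p as (Z.≤-trans (I.+≤+ (N.n≤1+n _)) q)
  add : ∀ b -> aT (b ∷ aA us) M.≤ suc (au p) × aT (b ∷ aA us) M.≤ aT (b ∷ aA o)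
  add true = M.s≤s (proj₁ ih) , M.s≤s (proj₂ ih)
  add false = N.m≤n⇒m≤1+n (proj₁ ih) , proj₂ ih
 ys : List Bool -> List ℤ
 ys [] = []
 ys (true ∷ fs) = ys fs
 ys (false ∷ fs) = + suc (length fs) ∷ ys fs
 data hP (n : ℕ) : List ℤ -> Set where
  [] : hP n []
  m7 : ∀ {us} -> hP n us -> hP n (+ suc (length us) ∷ us)
  nU : ∀ {us} -> hP n us -> hP n (+ suc (length us) I.+ + n ∷ us)
 bT : ∀ us -> length (aA us) ≡ length us
 bT [] = refl
 bT (u ∷ us) = cong suc (bT us)
 private
  nth : List ℤ -> ℕ -> ℤ
  nth [] i = 0ℤ
  nth (x ∷ l) zero = x
  nth (x ∷ l) (suc i) = nth l i
  gQ : ∀ {Q : ℤ -> Set} {A} -> LAll.All Q A -> ∀ B i -> i M.< length A -> Q (nth (A ++ B) i)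
  gQ (q ∷ qs) B zero p = q
  gQ (q ∷ qs) B (suc i) (M.s≤s p) = gQ qs B i p
  i2 : ∀ A B i -> nth (A ++ B) (length A M.+ i) ≡ nth B i
  i2 [] B i = refl
  i2 (x ∷ A) B i = i2 A B i
  ir : ∀ f A B i -> i M.< length A -> nth (map f A ++ B) i ≡ f (nth A i)
  ir f (x ∷ A) B zero p = refl
  ir f (x ∷ A) B (suc i) (M.s≤s p) = ir f A B i p
 -- The window met after r greedy sweeps: the entries that are not fixed rotate.
 module Greedy (n : ℕ) (fs : List Bool) (len : length fs ≡ n) where
  k : ℕ
  k = length (ys fs)
  -- The queue of moving values. At first they stand in the window, increased by n; in the r-th
  -- sweep Z r leaves, and Z (r + k), the same value without n, enters.
  Z : ℕ -> ℤ
  Z = nth (map (I._+ + n) (ys fs) ++ ys fs)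
  aX : List Bool -> ℕ -> List ℤ
  aX [] i = []
  aX (true ∷ fs) i = + suc (length fs) ∷ aX fs i
  aX (false ∷ fs) i = Z i ∷ aX fs (suc i)
  private
   bV : ∀ fs i -> length (aX fs i) ≡ length fs
   bV [] i = refl
   bV (true ∷ fs) i = cong suc (bV fs i)
   bV (false ∷ fs) i = cong suc (bV fs (suc i))
   hz : ∀ fs -> LAll.All (1ℤ I.≤_) (ys fs)
   hz [] = []
   hz (true ∷ fs) = hz fs
   hz (false ∷ fs) = I.+≤+ (M.s≤s M.z≤n) ∷ hz fs
   gC : ∀ fs -> LAll.All (I._≤ + length fs) (ys fs)
   gC [] = []
   gC (true ∷ fs) = LAll.map (\ p -> Z.≤-trans p (I.+≤+ (N.n≤1+n _))) (gC fs)
   gC (false ∷ fs) = Z.≤-refl ∷ LAll.map (\ p -> Z.≤-trans p (I.+≤+ (N.n≤1+n _))) (gC fs)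
   l4 : length (map (I._+ + n) (ys fs)) ≡ k
   l4 = LP.length-map (I._+ + n) (ys fs)
   oV : ∀ i -> Z (k M.+ i) ≡ nth (ys fs) i
   oV i = trans (cong (\ z -> Z (z M.+ i)) (sym l4)) (i2 (map (I._+ + n) (ys fs)) (ys fs) i)
   ng : ∀ fs' pre -> ys fs ≡ pre ++ ys fs' -> aX fs' (k M.+ length pre) ≡ idw (length fs')
   ng [] pre e = refl
   ng (true ∷ fs') pre e = cong (_ ∷_) (ng fs' pre e)
   ng (false ∷ fs') pre e = cong₂ _∷_ (trans (oV (length pre)) (trans (cong (\ z -> nth z (length pre)) e) (trans (cong (nth (pre ++ _)) (sym (N.+-identityʳ _))) (i2 pre _ 0)))) (trans (cong (aX fs') (trans (sym (N.+-suc k (length pre))) (cong (k M.+_) (trans (N.+-comm 1 (length pre)) (sym (LP.length-++ pre)))))) (ng fs' (pre ++ _ ∷ []) (trans e (sym (LP.++-assoc pre _ (ys fs'))))))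
   -- `pre` holds the moving slots to the right of the part that remains; its length plus r is the
   -- place in the queue. A fixed entry can be jumped over because the queued value arriving there
   -- is larger (`big`).
   eS : ∀ r -> r M.< k -> ∀ fs' pre -> ys fs ≡ pre ++ ys fs' -> LAll.All (+ length fs' I.<_) pre -> length fs' M.≤ n -> Σ (bu (aX fs' (r M.+ length pre)) (Z (r M.+ length pre M.+ length (ys fs'))) (aX fs' (suc (r M.+ length pre))) (Z (r M.+ length pre))) \ p -> au p ≡ aT fs'
   eS r r<k [] pre e a l = go (sym (N.+-identityʳ (r M.+ length pre))) where
    go : ∀ {i j} -> i ≡ j -> Σ (bu [] (Z j) [] (Z i)) \ p -> au p ≡ 0
    go refl = eD , refl
   eS r r<k (true ∷ fs') pre e a l = let p , q = eS r r<k fs' pre e (LAll.map (Z.<-trans (I.+<+ N.≤-refl)) a) (N.≤-trans (N.n≤1+n _) l) in f8 p big , cong suc q where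
    i = r M.+ length pre
    big : + suc (length fs') I.< Z i
    big = subst (\ z -> + suc (length fs') I.< nth z i) (trans (LP.++-assoc (map (I._+ + n) (ys fs)) pre (ys fs')) (cong (map (I._+ + n) (ys fs) ++_) (sym e))) (gQ (AP.++⁺ (AP.map⁺ (LAll.map (\ {y} p -> aB 0 (I.+≤+ l & p) (L.solve 3 (\ y n s -> (y L.:+ n) L.:- s L.:= ((n L.:+ y) L.:- (s L.:+ L.I)) L.:+ L.I) refl y (+ n) (+ suc (length fs')))) (hz fs))) a) (ys fs') i (subst (i M.<_) (sym (trans (LP.length-++ (map (I._+ + n) (ys fs))) (cong (M._+ length pre) l4))) (N.+-monoˡ-< (length pre) r<k)))
   eS r r<k (false ∷ fs') pre e a l = oQ (trans (cong (r M.+_) (trans (LP.length-++ pre) (N.+-comm (length pre) 1))) (N.+-suc r (length pre))) (eS r r<k fs' (pre ++ _ ∷ []) (trans e (sym (LP.++-assoc pre _ (ys fs')))) (AP.++⁺ (LAll.map (Z.<-trans (I.+<+ N.≤-refl)) a) (I.+<+ N.≤-refl ∷ [])) (N.≤-trans (N.n≤1+n _) l)) where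
    i = r M.+ length pre
    oQ : ∀ {j} -> j ≡ suc i -> (Σ (bu (aX fs' j) (Z (j M.+ length (ys fs'))) (aX fs' (suc j)) (Z j)) \ p -> au p ≡ aT fs') -> Σ (bu (Z i ∷ aX fs' (suc i)) (Z (i M.+ suc (length (ys fs')))) (Z (suc i) ∷ aX fs' (suc (suc i))) (Z i)) \ p -> au p ≡ aT fs'
    oQ refl (p , q) = go (sym (N.+-suc i (length (ys fs')))) where
     go : ∀ {m} -> suc i M.+ length (ys fs') ≡ m -> Σ (bu (Z i ∷ aX fs' (suc i)) (Z m) (Z (suc i) ∷ aX fs' (suc (suc i))) (Z i)) \ p -> au p ≡ aT fs'
     go refl = b2 p , q
  oW : ∀ r -> r M.< k -> Z r ≡ Z (r M.+ k) I.+ + n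
  oW r p = trans (ir (I._+ + n) (ys fs) (ys fs) r p) (cong (I._+ + n) (sym (trans (cong Z (N.+-comm r k)) (oV r))))
  oU : ∀ r -> r M.< k -> 1ℤ I.≤ Z (r M.+ k) × Z (r M.+ k) I.≤ + n
  oU r p = subst (\ z -> 1ℤ I.≤ z × z I.≤ + n) (sym (trans (cong Z (N.+-comm r k)) (trans (oV r) (cong (\ z -> nth z r) (sym (LP.++-identityʳ (ys fs))))))) (gQ (hz fs) [] r p , subst (\ z -> _ I.≤ + z) len (gQ (gC fs) [] r p))
  pC : ∀ r -> r M.< k -> Σ (bu (aX fs r) (Z (r M.+ k)) (aX fs (suc r)) (Z r)) \ p -> au p ≡ aT fs
  pC r p = subst (\ i -> Σ (bu (aX fs i) (Z (i M.+ k)) (aX fs (suc i)) (Z i)) \ p -> au p ≡ aT fs) (N.+-identityʳ r) (eS r p fs [] refl [] (N.≤-reflexive len))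
  pU : aX fs k ≡ idw n
  pU = trans (cong (aX fs) (sym (N.+-identityʳ k))) (trans (ng fs [] refl) (cong idw len))
  lL : ∀ r -> length (aX fs r) ≡ n
  lL r = trans (bV fs r) len
  jd : 1 M.≤ n -> ∀ {v} pre -> hP n v -> ys fs ≡ pre ++ ys (aA v) -> aX (aA v) (length pre) ≡ v
  jd 1≤n pre [] e = refl
  jd 1≤n pre (m7 {us} t) e with eq (+ suc (length us)) (+ suc (length us)) | cw {+ suc (length us)} refl
  ... | true | _ = cong₂ _∷_ (cong (\ z -> + suc z) (bT us)) (jd 1≤n pre t e)
  jd 1≤n pre (nU {us} t) e with eq (+ suc (length us) I.+ + n) (+ suc (length us)) | b7 {+ suc (length us) I.+ + n} {+ suc (length us)} (\ q -> N.<⇒≢ 1≤n (sym (N.+-cancelˡ-≡ (suc (length us)) n 0 (trans (Z.+-injective q) (sym (N.+-identityʳ _))))))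
  ... | false | _ = cong₂ _∷_ (trans (ir (I._+ + n) (ys fs) (ys fs) (length pre) (subst (length pre M.<_) (sym (trans (cong length e) (LP.length-++ pre))) (N.m<m+n (length pre) (M.s≤s M.z≤n)))) (cong (I._+ + n) (trans (cong (\ z -> nth z (length pre)) e) (trans (cong (nth (pre ++ _)) (sym (N.+-identityʳ _))) (trans (i2 pre _ 0) (cong (\ z -> + suc z) (bT us))))))) (trans (cong (aX (aA us)) (trans (N.+-comm 1 (length pre)) (sym (LP.length-++ pre)))) (jd 1≤n (pre ++ _ ∷ []) t (trans e (sym (LP.++-assoc pre _ (ys (aA us)))))))
 dw : ∀ {k} (A : Poly (suc k)) e -> coeff (al *P A) (0 ∷ e) ≡ 0ℤ
 dw A e = trans (ac (CommutativeRing.*-comm (ai _) al A) (0 ∷ e)) (trans (aj (A *P al) _) (trans (ap A al _) (hl A (\ { (i ∷ a) -> trans (trans (Z.+-identityʳ _) (Z.*-identityˡ _)) (d8 (0 ∷ e) ((i ∷ a) ⊞ (1 ∷ bo)) (\ q -> N.1+n≢0 (trans (N.+-comm 1 i) (cong Vec.head q)))) }))))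
 module gp (n' : ℕ) (lo : ℤ) (m : ℕ) where
  open fD n' lo m
  module _ {k : ℕ} where
   open aE (ai (suc k)) renaming (refl to ≈-refl; sym to ≈-sym; trans to ≈-trans) public using (pow; _≈_; +-cong; +-congˡ; *-congˡ; *-congʳ; *-assoc; *-identityˡ; zeroˡ; zeroʳ; ind; ind-false; ind-true; sumR; distribˡ; reflexive; solve; _:+_; _:*_; _:=_)
   open cA (ai (suc k)) public using (Hs)
  private
   infixl 6 _⊕_
   _⊕_ : ∀ {k} -> Poly k -> Poly k -> Poly k
   _⊕_ = _++_
   cu : ∀ {k} p (G : Poly k) e -> coeff (pow al p *P am G) (p ∷ e) ≡ coeff G e
   cu zero G e = trans (ac (*-identityˡ (am G)) (0 ∷ e)) (cN G e)
   cu (suc p) G e = trans (ac (*-assoc al (pow al p) (am G)) (suc p ∷ e)) (trans (br (pow al p *P am G) p e) (cu p G e))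
   bK : ∀ {k} p (G : Poly k) j e -> j ≢ p -> coeff (pow al p *P am G) (j ∷ e) ≡ 0ℤ
   bK zero G zero e ne = ⊥-elim (ne refl)
   bK zero G (suc j) e ne = trans (ac (*-identityˡ (am G)) (suc j ∷ e)) (bi G j e)
   bK (suc p) G zero e ne = trans (ac (*-assoc al (pow al p) (am G)) (0 ∷ e)) (dw (pow al p *P am G) e)
   bK (suc p) G (suc j) e ne = trans (ac (*-assoc al (pow al p) (am G)) (suc j ∷ e)) (trans (br (pow al p *P am G) j e) (bK p G j e (\ q -> ne (cong suc q))))
   module _ {k : ℕ} (e : Vec ℕ (suc k)) where
    j3 : ∀ us c (Ψ : List ℤ -> ℤ -> Poly (suc k)) -> (∀ {o c'} (p : bu us c o c') -> coeff (pow al (au p) *P Ψ o c') e ≡ 0ℤ) -> coeff (Hs al us c Ψ) e ≡ 0ℤ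
    j3 [] c Ψ h = trans (ac (≈-sym (*-identityˡ (Ψ [] c))) e) (h eD)
    j3 (u ∷ us) c Ψ h = j3 us c _ (\ {o} {c'} p -> trans (ac (distribˡ (pow al (au p)) (Ψ (c' ∷ o) u) _) e) (trans (a0 (pow al (au p) *P Ψ (c' ∷ o) u) _ e) (cong₂ I._+_ (h (b2 p)) (bp p (lt u c') aO)))) where
     bp : ∀ {o c'} (p : bu us c o c') b -> (b ≡ true -> u I.< c') -> coeff (pow al (au p) *P (ind b *P (al *P Ψ (u ∷ o) c'))) e ≡ 0ℤ
     bp {o} {c'} p true r = trans (ac (≈-trans (*-congˡ {x = pow al (au p)} (*-identityˡ (al *P Ψ (u ∷ o) c'))) (solve 3 (\ a x b -> a :* (x :* b) := (x :* a) :* b) ≈-refl (pow al (au p)) al (Ψ (u ∷ o) c'))) e) (h (f8 p (r refl)))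
     bp {o} {c'} p false r = ac (≈-trans (*-congˡ {x = pow al (au p)} (zeroˡ (al *P Ψ (u ∷ o) c'))) (zeroʳ (pow al (au p)))) e
    ie : ∀ lo m (f : ℤ -> Poly (suc k)) -> (∀ c -> coeff (f c) e ≡ 0ℤ) -> coeff (sumR lo m f) e ≡ 0ℤ
    ie lo zero f h = refl
    ie lo (suc m) f h = trans (a0 (f lo) _ e) (cong₂ I._+_ (h lo) (ie _ m f h))
  -- Each sweep jumps over every fixed entry and does not lower their number (`bU`), so every
  -- variable has exponent at least c; windows below the lower bound contribute 0.
  gi : ∀ k c v -> length v ≡ n -> c M.≤ aT (aA v) -> ∀ e -> Any (M._< c) e -> coeff (F k v) e ≡ 0ℤ
  gi (suc k) c v l h (j ∷ e) a = trans (ac (nD k v) (j ∷ e)) (ie (j ∷ e) lo m _ (\ c₀ -> j3 (j ∷ e) v c₀ _ (\ {o} {c'} p -> atp c₀ p (c' I.≟ c₀ I.+ + n) (kS o)))) where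
   atp : ∀ c₀ {o c'} (p : bu v c₀ o c') -> Dec (c' ≡ c₀ I.+ + n) -> Dec (bE o) -> coeff (pow al (au p) *P (ind (eq c' (c₀ I.+ + n)) *P am (F k o))) (j ∷ e) ≡ 0ℤ
   atp c₀ {o} {c'} p (no ne) _ = ac (≈-trans (*-congˡ {x = pow al (au p)} (ind-false (am (F k o)) (b7 ne))) (zeroʳ (pow al (au p)))) (j ∷ e)
   atp c₀ {o} {c'} p (yes q) ab = trans (ac (*-congˡ {x = pow al (au p)} (ind-true (am (F k o)) (cw q))) (j ∷ e)) (go ab a) where
    lo' : length o ≡ n
    lo' = trans (aH p) l
    iI : ∀ {j e} -> coeff (F k o) e ≡ 0ℤ -> coeff (pow al (au p) *P am (F k o)) (j ∷ e) ≡ 0ℤ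
    iI {j} {e} z with j M.≟ au p
    ... | yes refl = trans (cu (au p) (F k o) e) z
    ... | no ne = bK (au p) (F k o) j e ne
    go : Dec (bE o) -> Any (M._< c) (j ∷ e) -> coeff (pow al (au p) *P am (F k o)) (j ∷ e) ≡ 0ℤ
    go (no na) _ = iI (ac (j8 k o lo' na) e)
    go (yes ab) a with bP p ab
    ... | inj₁ r = ⊥-elim (Z.<-irrefl (trans (sym r) q) (aB n' (Z.≤-refl {c₀}) (L.solve 2 (\ c n -> (c L.:+ n) L.:- c L.:= (c L.:- c) L.:+ n) refl c₀ (+ n))))
    ... | inj₂ r with bU p ab (subst (\ z -> + suc z I.≤ c') (sym l) (subst (+ suc n I.≤_) (sym q) (Z.+-monoˡ-≤ (+ n) r)))
    ...   | big , eT = kY a where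
     kY : Any (M._< c) (j ∷ e) -> _
     kY (here s) = bK (au p) (F k o) j e (\ { refl -> N.<⇒≱ s (N.≤-trans h big) })
     kY (there s) = iI (gi k c o lo' (N.≤-trans h eT) e s)
  private
   -- Nonnegative coefficients, so that a single path bounds a coefficient from below.
   record J {k : ℕ} (A : Poly k) : Set where
    constructor mkJ
    field
     nn : ∀ e -> 0ℤ I.≤ coeff A e
   open J
   J-+ : ∀ {k} {A B : Poly k} -> J A -> J B -> J (A ++ B)
   J-+ {A = A} {B} a b = mkJ (\ e -> subst (0ℤ I.≤_) (sym (a0 A B e)) (Z.+-mono-≤ (nn a e) (nn b e)))
   J-x : ∀ {k} {A : Poly (suc k)} -> J A -> J (al *P A)
   J-x {A = A} a = mkJ \ { (zero ∷ e) -> Z.≤-reflexive (sym (dw A e)) ; (suc j ∷ e) -> subst (0ℤ I.≤_) (sym (br A j e)) (nn a (j ∷ e)) }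
   lw : ∀ {k} {A B : Poly k} -> A ≋ B -> J A -> J B
   lw q a = mkJ (\ e -> subst (0ℤ I.≤_) (ac q e) (nn a e))
   jv : ∀ {k} b {A : Poly (suc k)} -> J A -> J (ind b *P A)
   jv true {A} a = lw (≈-sym (*-identityˡ A)) a
   jv false {A} a = lw (≈-sym (zeroˡ A)) (mkJ (\ _ -> Z.≤-refl))
   nx : ∀ {k} p {A : Poly (suc k)} -> J A -> J (pow al p *P A)
   nx zero {A} a = lw (≈-sym (*-identityˡ A)) a
   nx (suc p) {A} a = lw (≈-sym (*-assoc al (pow al p) A)) (J-x (nx p a))
   qr : ∀ {k} us c (Ψ : List ℤ -> ℤ -> Poly (suc k)) -> (∀ o c' -> J (Ψ o c')) -> J (Hs al us c Ψ)
   qr [] c Ψ h = h [] c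
   qr (u ∷ us) c Ψ h = qr us c _ (\ o c' -> J-+ (h (c' ∷ o) u) (jv (lt u c') (J-x (h (u ∷ o) c'))))
   nw : ∀ {k} lo m (f : ℤ -> Poly (suc k)) -> (∀ c -> J (f c)) -> J (sumR lo m f)
   nw lo zero f h = mkJ (\ _ -> Z.≤-refl)
   nw lo (suc m) f h = J-+ (h lo) (nw _ m f h)
   od : ∀ {k} {A : Poly k} -> J A -> J (am A)
   od {A = A} a = mkJ \ { (zero ∷ e) -> subst (0ℤ I.≤_) (sym (cN A e)) (nn a e) ; (suc j ∷ e) -> Z.≤-reflexive (sym (bi A j e)) }
   J-F : ∀ k v -> J (F k v)
   J-F zero v = go (jD n v) where
    go : ∀ b -> J (aE.ind (ai 0) b)
    go true = mkJ \ { [] -> I.+≤+ M.z≤n }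
    go false = mkJ \ _ -> Z.≤-refl
   J-F (suc k) v = lw (≈-sym (nD k v)) (nw lo m _ (\ c -> qr v c _ (\ o c' -> jv (eq c' (c I.+ + n)) (od (J-F k o)))))
   gK : ∀ {k} lo m (f : ℤ -> Poly (suc k)) -> (∀ c -> J (f c)) -> ∀ c e -> lo I.≤ c -> c I.< lo I.+ + m -> coeff (f c) e I.≤ coeff (sumR lo m f) e
   gK lo zero f h c e p q = ⊥-elim (Z.<⇒≱ q (subst (I._≤ c) (sym (Z.+-identityʳ lo)) p))
   gK lo (suc m) f h c e p q with lo I.≟ c
   ... | yes refl = subst (coeff (f c) e I.≤_) (sym (a0 (f c) _ e)) (lin 0 (nn (nw _ m f h) e) (L.solve 2 (\ a b -> (a L.:+ b) L.:- a L.:= (b L.:- L.O) L.:+ L.O) refl (coeff (f c) e) _))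
   ... | no ne = subst (coeff (f c) e I.≤_) (sym (a0 (f lo) _ e)) (Z.≤-trans (gK _ m f h c e (st (Z.≤∧≢⇒< p ne)) (subst (c I.<_) (sym (Z.+-assoc lo 1ℤ (+ m))) q)) (lin 0 (nn (h lo) e) (L.solve 2 (\ a b -> (a L.:+ b) L.:- b L.:= (a L.:- L.O) L.:+ L.O) refl (coeff (f lo) e) _)))
   e1 : ∀ {k us c o c'} (Ψ : List ℤ -> ℤ -> Poly (suc k)) -> (∀ o c' -> J (Ψ o c')) -> (p : bu us c o c') -> ∀ e -> coeff (pow al (au p) *P Ψ o c') e I.≤ coeff (Hs al us c Ψ) e
   e1 {c = c} Ψ h eD e = Z.≤-reflexive (ac (*-identityˡ (Ψ [] c)) e)
   e1 {us = u ∷ us} Ψ h (b2 {o = o} {c' = c'} p) e = Z.≤-trans (pP (nx (au p) (jv (lt u c') (J-x (h (u ∷ o) c')))) (≈-sym (distribˡ (pow al (au p)) (Ψ (c' ∷ o) u) _)) e) (e1 _ (\ o c' -> J-+ (h (c' ∷ o) u) (jv (lt u c') (J-x (h (u ∷ o) c')))) p e) where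
    pP : ∀ {A B C : Poly _} -> J B -> (A ⊕ B) ≋ C -> ∀ e -> coeff A e I.≤ coeff C e
    pP {A} {B} b q e = subst (coeff A e I.≤_) (trans (sym (a0 A B e)) (ac q e)) (lin 0 (nn b e) (L.solve 2 (\ a b -> (a L.:+ b) L.:- a L.:= (b L.:- L.O) L.:+ L.O) refl (coeff A e) (coeff B e)))
   e1 {us = u ∷ us} Ψ h (f8 {o = o} {c' = c'} p r) e = Z.≤-trans (pP (nx (au p) (h (c' ∷ o) u)) (≈-trans (≈-sym (solve 4 (\ q a x b -> q :* (a :+ x :* b) := q :* a :+ (x :* q) :* b) ≈-refl (pow al (au p)) (Ψ (c' ∷ o) u) al (Ψ (u ∷ o) c'))) (*-congˡ {x = pow al (au p)} (+-congˡ {x = Ψ (c' ∷ o) u} (≈-sym (ind-true (al *P Ψ (u ∷ o) c') (bg r)))))) e) (e1 _ (\ o c' -> J-+ (h (c' ∷ o) u) (jv (lt u c') (J-x (h (u ∷ o) c')))) p e) where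
    pP : ∀ {A B C : Poly _} -> J B -> (B ⊕ A) ≋ C -> ∀ e -> coeff A e I.≤ coeff C e
    pP {A} {B} b q e = subst (coeff A e I.≤_) (trans (sym (a0 B A e)) (ac q e)) (lin 0 (nn b e) (L.solve 2 (\ a b -> (b L.:+ a) L.:- a L.:= (b L.:- L.O) L.:+ L.O) refl (coeff A e) (coeff B e)))
  -- The greedy path has c jumps in each of the k sweeps and ends at the identity; other paths
  -- cannot cancel it.
  ib : ∀ v -> length v ≡ n -> hP n v -> lo I.≤ 1ℤ -> + n I.< lo I.+ + m -> let k = length (ys (aA v)) ; c = aT (aA v) in 1ℤ I.≤ coeff (F k v) (Vec.replicate k c)
  ib v l t p q = subst (\ z -> 1ℤ I.≤ coeff (F k z) (Vec.replicate k c)) (jd (M.s≤s M.z≤n) [] t refl) (go k 0 refl) where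
   open Greedy n (aA v) (trans (bT v) l)
   c = aT (aA v)
   go : ∀ j r -> r M.+ j ≡ k -> 1ℤ I.≤ coeff (F j (aX (aA v) r)) (Vec.replicate j c)
   go zero r e = subst (\ z -> 1ℤ I.≤ coeff (F 0 z) []) (sym (trans (cong (aX (aA v)) (trans (sym (N.+-identityʳ r)) e)) pU)) (Z.≤-reflexive (sym (cong (\ b -> coeff (aE.ind (ai 0) b) []) (dec-true (LP.≡-dec I._≟_ (idw n) (idw n)) refl))))
   go (suc j) r e = let eS , cnt = pC r r<k ; lo≤ , ≤n = oU r r<k in subst (1ℤ I.≤_) (sym (ac (nD j (aX (aA v) r)) (c ∷ Vec.replicate j c))) (Z.≤-trans (Z.≤-trans (go j (suc r) (trans (sym (N.+-suc r j)) e)) (Z.≤-reflexive (sym (trans (ac (*-congˡ {x = pow al (au eS)} (ind-true (am (F j (aX (aA v) (suc r)))) (cw (oW r r<k)))) (c ∷ Vec.replicate j c)) (trans (cong (\ z -> coeff (pow al z *P am (F j (aX (aA v) (suc r)))) (c ∷ Vec.replicate j c)) cnt) (cu c (F j (aX (aA v) (suc r))) (Vec.replicate j c))))))) (Z.≤-trans (e1 _ (b1 (Z (r M.+ k))) eS (c ∷ Vec.replicate j c)) (gK lo m _ (\ c₀ -> qr (aX (aA v) r) c₀ _ (b1 c₀)) (Z (r M.+ k)) (c ∷ Vec.replicate j c) (Z.≤-trans p lo≤) (Z.≤-<-trans ≤n q)))) where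
    r<k : r M.< k
    r<k = subst (r M.<_) e (N.m<m+n r (M.s≤s M.z≤n))
    b1 : ∀ c₀ o c' -> J (ind (eq c' (c₀ I.+ + n)) *P am (F j o))
    b1 c₀ o c' = jv (eq c' (c₀ I.+ + n)) (od (J-F j o))

-- Climbing through bounded permutations

module Climb where
 open dK
 open o3
 open cV
 open cB
 open mj
 open fJ
 open Top
 open ad
 open import Data.Product using (_×_)
 open import Data.Unit using (⊤; tt)
 open import Relation.Nullary.Decidable using (_×-dec_)
 open E using (refl; sym; trans; subst)
 module b8 (n : ℕ) .{{nz : NonZero n}} (aa : 2 M.≤ n) where
  open ay n
  open dj n
  open e6 n aa
  open e4 Z.+-*-commutativeRing n aa
  open h2 using (sumR; sumR-cong; bI; ind; ind-true; ind-false)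
  gn : Fn -> Set
  gn g = ∀ i -> i I.≤ g i × g i I.≤ i I.+ + n
  -- `ia` fixes the average k through the sum of the displacements, which transpositions preserve
  -- (`fX`).
  record aC (k : ℕ) (g : Fn) : Set where
   field
    jq : QP g
    bS : ∀ x y -> g x ≡ g y -> x ≡ y
    ce : gn g
    ia : d7 (\ i -> g i I.- i) ≡ + k I.* + n
  open aC public
  ax : ∀ {k g} -> aC k g -> Adm n g
  ax {g = g} w = record { qp = jq w ; inj = bS w ; ej = \ x -> Z.≤-trans (proj₁ (ce w x)) (Z.i≤i+j (g x) (+ n)) ; ee = \ x -> proj₂ (ce w x) }
  private
   one : ∀ x -> x I.+ 1ℤ I.* + n ≡ x I.+ + n
   one x = cong (I._+_ x) (Z.*-identityˡ (+ n))
   c4 : ∀ {y z} -> y I.< z -> z I.< y I.+ + n -> y ≁ z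
   c4 {y} {z} p q e = Z.<-irrefl (bQ e (Z.<-≤-trans p (Z.i≤i+j z (+ n))) q) p
   up-n : ∀ {a b} -> a I.< b -> a I.+ + n I.< b I.+ + n
   up-n = Z.+-monoˡ-< (+ n)
   kG : ∀ {g : Fn} (R : ℤ -> ℤ -> Set) -> QP g -> (∀ x y -> R x y -> ∀ q -> R (x I.+ q I.* + n) (y I.+ q I.* + n)) -> ∀ {x y} -> x ∼ y -> R y (g y) -> R x (g x)
   kG {g} R w ck {x} {y} (mk∼ q e) r = E.subst₂ R (sym e) (sym (trans (cong g e) (d2 {g} w y q))) (ck y (g y) r q)
   hB : ∀ x -> Σ ℕ \ s -> s M.< n × x ∼ 1ℤ I.+ + s
   hB x = (x I.- 1ℤ) %ℕ n , n%ℕd<d (x I.- 1ℤ) n , mk∼ ((x I.- 1ℤ) /ℕ n) (trans (L.solve 1 (\ x -> x L.:= L.I L.:+ (x L.:- L.I)) refl x) (trans (cong (I._+_ 1ℤ) (a≡a%ℕn+[a/ℕn]*n (x I.- 1ℤ) n)) (sym (Z.+-assoc 1ℤ (+ ((x I.- 1ℤ) %ℕ n)) ((x I.- 1ℤ) /ℕ n I.* + n)))))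
   mz : ∀ M o -> Dec (a5 M o)
   mz M [] = yes tt
   mz M (u ∷ us) = (u I.≤? + suc (length us) I.+ M) ×-dec mz M us
   kT : ∀ m {h} -> bE (win 1ℤ m h) -> ∀ s -> s M.< m -> 1ℤ I.+ + s I.≤ h (1ℤ I.+ + s)
   kT (suc m) {h} (a , as) s p with s M.≟ m
   ... | yes refl = subst (\ z -> + suc z I.≤ h (1ℤ I.+ + s)) (aM 1ℤ m h) a
   ... | no ne = kT m as s (N.≤∧≢⇒< (N.≤-pred p) ne)
   kQ : ∀ m {h} -> a5 (+ n) (win 1ℤ m h) -> ∀ s -> s M.< m -> h (1ℤ I.+ + s) I.≤ 1ℤ I.+ + s I.+ + n
   kQ (suc m) {h} (a , as) s p with s M.≟ m
   ... | yes refl = subst (\ z -> h (1ℤ I.+ + s) I.≤ + suc z I.+ + n) (aM 1ℤ m h) a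
   ... | no ne = kQ m as s (N.≤∧≢⇒< (N.≤-pred p) ne)
   gz : ∀ {x y} -> x I.≤ y -> ∀ z -> x I.+ z I.≤ y I.+ z
   gz p z = Z.+-monoˡ-≤ z p
  lF : ∀ {h} -> QP h -> gn h ⊎ (¬ bE (win 1ℤ n h) ⊎ ¬ a5 (+ n) (win 1ℤ n h))
  lF {h} w with kS (win 1ℤ n h) | mz (+ n) (win 1ℤ n h)
  ... | no a | _ = inj₂ (inj₁ a)
  ... | yes _ | no b = inj₂ (inj₂ b)
  ... | yes a | yes b = inj₁ (\ x -> let s , p , e = hB x in kG {h} I._≤_ w (\ x y r q -> gz r (q I.* + n)) e (kT n a s p) , kG {h} (\ x y -> y I.≤ x I.+ + n) w (\ x y r q -> lin 0 r (L.solve 4 (\ x y n q -> (x L.:+ q L.:+ n) L.:- (y L.:+ q) L.:= ((x L.:+ n) L.:- y) L.:+ L.O) refl x y (+ n) (q I.* + n))) e (kQ n b s p))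
  -- For bounded g, the positions that keep it from being a top element; called moving below.
  gr : Fn -> ℤ -> Set
  gr g i = i I.< g i × g i I.< i I.+ + n
  private
   pB : ∀ m {g} -> gn g -> (∀ s -> s M.< m -> ¬ gr g (1ℤ I.+ + s)) -> hP n (win 1ℤ m g)
   pB zero w h = []
   pB (suc m) {g} w h with g (1ℤ I.+ + m) I.≟ 1ℤ I.+ + m
   ... | yes e = subst (\ z -> hP n (z ∷ win 1ℤ m g)) (trans (cong (\ z -> + suc z) (aM 1ℤ m g)) (sym e)) (m7 (pB m w (\ s p -> h s (N.m≤n⇒m≤1+n p))))
   ... | no ne = subst (\ z -> hP n (z ∷ win 1ℤ m g)) (trans (cong (\ z -> + suc z I.+ + n) (aM 1ℤ m g)) (sym top)) (nU (pB m w (\ s p -> h s (N.m≤n⇒m≤1+n p)))) where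
    i = 1ℤ I.+ + m
    top : g i ≡ i I.+ + n
    top = Z.≤-antisym (proj₂ (w i)) (Z.≮⇒≥ (\ q -> h m N.≤-refl (Z.≤∧≢⇒< (proj₁ (w i)) (\ e -> ne (sym e)) , q)))
   eN : ∀ lo m (h : ℤ -> ℤ) -> sumR lo (suc m) h ≡ sumR lo m h I.+ h (lo I.+ + m)
   eN lo zero h = trans (Z.+-comm (h lo) 0ℤ) (cong (I._+_ 0ℤ) (cong h (sym (Z.+-identityʳ lo))))
   eN lo (suc m) h = trans (cong (I._+_ (h lo)) (trans (eN (lo I.+ 1ℤ) m h) (cong (\ z -> sumR (lo I.+ 1ℤ) m h I.+ h z) (gy lo m)))) (sym (Z.+-assoc (h lo) _ _))
   fY : ∀ m g -> hP n (win 1ℤ m g) -> sumR 1ℤ m (\ i -> g i I.- i) ≡ + length (ys (aA (win 1ℤ m g))) I.* + n × aT (aA (win 1ℤ m g)) M.+ length (ys (aA (win 1ℤ m g))) ≡ m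
   fY zero g _ = sym (Z.*-zeroˡ (+ n)) , refl
   fY (suc m) g t = go (inv t) where
    W = win 1ℤ m g
    i = 1ℤ I.+ + m
    slot : + suc (length W) ≡ i
    slot = cong (\ z -> + suc z) (aM 1ℤ m g)
    nC : Bool -> Set
    nC f = sumR 1ℤ (suc m) (\ i -> g i I.- i) ≡ + length (ys (f ∷ aA W)) I.* + n × aT (f ∷ aA W) M.+ length (ys (f ∷ aA W)) ≡ suc m
    inv : ∀ {u us} -> hP n (u ∷ us) -> (u ≡ + suc (length us) ⊎ u ≡ + suc (length us) I.+ + n) × hP n us
    inv (m7 t) = inj₁ refl , t
    inv (nU t) = inj₂ refl , t
    go : (g i ≡ + suc (length W) ⊎ g i ≡ + suc (length W) I.+ + n) × hP n W -> nC (eq (g i) (+ suc (length W)))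
    go (inj₁ q , t') = subst nC (sym (cw q)) (let e , c = fY m g t' in trans (eN 1ℤ m (\ i -> g i I.- i)) (trans (cong₂ I._+_ e (trans (cong (I._- i) (trans q slot)) (Z.+-inverseʳ i))) (Z.+-identityʳ _)) , cong suc c)
    go (inj₂ q , t') = subst nC (sym (b7 (\ r -> N.<⇒≢ (N.<-trans (M.s≤s M.z≤n) aa) (sym (N.+-cancelˡ-≡ (suc (length W)) n 0 (trans (Z.+-injective (trans (sym q) r)) (sym (N.+-identityʳ _)))))))) (let e , c = fY m g t' ; L = length (ys (aA W)) in trans (eN 1ℤ m (\ i -> g i I.- i)) (trans (cong₂ I._+_ e (trans (cong (I._- i) (trans q (cong (I._+ + n) slot))) (L.solve 2 (\ i n -> i L.:+ n L.:- i L.:= n) refl i (+ n)))) (L.solve 2 (\ l n -> l L.:* n L.:+ n L.:= (L.I L.:+ l) L.:* n) refl (+ L) (+ n))) , trans (N.+-suc (aT (aA W)) L) (cong suc c))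
  record ny (k : ℕ) (g : Fn) : Set where
   field
    hm : hP n (win 1ℤ n g)
    raise : length (ys (aA (win 1ℤ n g))) ≡ k
    pS : aT (aA (win 1ℤ n g)) ≡ n M.∸ k
  open ny public
  private
   -- Only the classes of a and b change their summands, and invariance under translation reduces
   -- each class to one term.
   nT : ∀ {D g a b} (φ : ℤ -> ℤ -> ℤ) -> (∀ x y q -> φ (x I.+ q I.* + n) (y I.+ q I.* + n) ≡ φ x y) -> Adm D g -> a ≁ b -> d7 (\ i -> φ (g (tr a b i)) i) ≡ d7 (\ i -> φ (g i) i) I.+ ((φ (g b) a I.- φ (g a) a) I.+ (φ (g a) b I.- φ (g b) b))
   nT {D} {g} {a} {b} φ per w ab = trans (sumR-cong 1ℤ n f7) (trans (bI 1ℤ n _ _) (cong (I._+_ (d7 (\ i -> φ (g i) i))) (trans (bI 1ℤ n _ _) (cong₂ I._+_ (ec a _) (ec b _))))) where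
    A = φ (g b) a I.- φ (g a) a
    B = φ (g a) b I.- φ (g b) b
    add : ∀ {u v} -> u ≡ v -> u ≡ v I.+ (0ℤ I.+ 0ℤ)
    add refl = sym (Z.+-identityʳ _)
    k5 : ∀ c d q -> g (c I.+ q I.* + n I.+ (d I.- c)) ≡ g d I.+ q I.* + n
    k5 c d q = trans (cong g (L.solve 3 (\ c d q -> c L.:+ q L.:+ (d L.:- c) L.:= d L.:+ q) refl c d (q I.* + n))) (dA w d q)
    gF : ∀ c d q x -> x ≡ c I.+ q I.* + n -> φ (g (x I.+ (d I.- c))) x ≡ φ (g x) x I.+ (φ (g d) c I.- φ (g c) c)
    gF c d q x refl = trans (trans (cong (\ z -> φ z x) (k5 c d q)) (per (g d) c q)) (trans (L.solve 2 (\ u v -> u L.:= v L.:+ (u L.:- v)) refl (φ (g d) c) (φ (g c) c)) (cong (I._+ (φ (g d) c I.- φ (g c) c)) (sym (trans (cong (\ z -> φ z x) (dA w c q)) (per (g c) c q)))))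
    f7 : ∀ i -> φ (g (tr a b i)) i ≡ φ (g i) i I.+ (ind (cg i a) I.* A I.+ ind (cg i b) I.* B)
    f7 i with i ∼? a
    ... | yes p@(mk∼ q e) = trans (cong (\ z -> φ (g z) i) (fW p)) (trans (gF a b q i e) (cong (I._+_ (φ (g i) i)) (sym (trans (cong₂ I._+_ (ind-true A (d0 p)) (ind-false B (d1 (\ r -> ab (af (ae p) r))))) (Z.+-identityʳ A)))))
    ... | no p with i ∼? b
    ... | yes r@(mk∼ q e) = trans (cong (\ z -> φ (g z) i) (fV ab r)) (trans (gF b a q i e) (cong (I._+_ (φ (g i) i)) (sym (trans (cong₂ I._+_ (ind-false A (d1 p)) (ind-true B (d0 r))) (Z.+-identityˡ B)))))
    ... | no r = trans (cong (\ z -> φ (g z) i) (aY p r)) (trans (add refl) (cong (I._+_ (φ (g i) i)) (sym (cong₂ I._+_ (ind-false A (d1 p)) (ind-false B (d1 r))))))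
  fX : ∀ {D g a b} -> Adm D g -> a ≁ b -> d7 (\ i -> g (tr a b i) I.- i) ≡ d7 (\ i -> g i I.- i)
  fX {g = g} {a} {b} w ab = trans (nT (\ x y -> x I.- y) (\ x y q -> L.solve 3 (\ x y q -> (x L.:+ q) L.:- (y L.:+ q) L.:= x L.:- y) refl x y (q I.* + n)) w ab) (trans (cong (I._+_ (d7 (\ i -> g i I.- i))) (L.solve 4 (\ x y a b -> ((y L.:- a) L.:- (x L.:- a)) L.:+ ((x L.:- b) L.:- (y L.:- b)) L.:= L.O) refl (g a) (g b) a b)) (Z.+-identityʳ _))
  -- A potential that strictly grows along covers and is bounded on bounded permutations.
  gk : Fn -> ℤ
  gk g = d7 (\ i -> (g i I.- i) I.* (g i I.- i))
  -- The increase is 2(b - a)(g(b) - g(a)).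
  iC : ∀ {D g a b} -> Adm D g -> Cov g a b -> gk g I.< gk (\ x -> g (tr a b x))
  iC {g = g} {a} {b} w c = subst (gk g I.<_) (sym (nT (\ x y -> (x I.- y) I.* (x I.- y)) (\ x y q -> L.solve 3 (\ x y q -> ((x L.:+ q) L.:- (y L.:+ q)) L.:* ((x L.:+ q) L.:- (y L.:+ q)) L.:= (x L.:- y) L.:* (x L.:- y)) refl x y (q I.* + n)) w (a4 c))) (aB 1 (pos-* (bL (ord c)) (bL (asc c)) & pos-* (bL (ord c)) (bL (asc c))) (L.solve 5 (\ E x y a b -> (E L.:+ (((y L.:- a) L.:* (y L.:- a) L.:- (x L.:- a) L.:* (x L.:- a)) L.:+ ((x L.:- b) L.:* (x L.:- b) L.:- (y L.:- b) L.:* (y L.:- b)))) L.:- E L.:= (((b L.:- a) L.:* (y L.:- x) L.:+ (b L.:- a) L.:* (y L.:- x)) L.:- (L.I L.:+ L.I)) L.:+ L.con (+ 2)) refl (gk g) (g a) (g b) a b)) where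
   bL : ∀ {x y} -> x I.< y -> 1ℤ I.≤ y I.- x
   bL {x} {y} p = lin 0 (st p) (L.solve 2 (\ x y -> (y L.:- x) L.:- L.I L.:= (y L.:- (x L.:+ L.I)) L.:+ L.O) refl x y)
   pos-* : ∀ {x y} -> 1ℤ I.≤ x -> 1ℤ I.≤ y -> 1ℤ I.≤ x I.* y
   pos-* {+ suc p} {+ suc q} (I.+≤+ _) (I.+≤+ _) = I.+≤+ (M.s≤s M.z≤n)
  iD : ∀ {g} -> gn g -> gk g I.≤ + (n M.* (n M.* n))
  iD {g} w = go 1ℤ n where
   pD : ∀ {x} -> 0ℤ I.≤ x -> x I.≤ + n -> x I.* x I.≤ + (n M.* n)
   pD {+ d} _ (I.+≤+ p) = subst (I._≤ + (n M.* n)) (Z.pos-* d d) (I.+≤+ (N.*-mono-≤ p p))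
   b1 : ∀ i -> (g i I.- i) I.* (g i I.- i) I.≤ + (n M.* n)
   b1 i = pD (Z.i≤j⇒0≤j-i (proj₁ (w i))) (lin 0 (proj₂ (w i)) (L.solve 3 (\ g i n -> n L.:- (g L.:- i) L.:= ((i L.:+ n) L.:- g) L.:+ L.O) refl (g i) i (+ n)))
   go : ∀ lo m -> sumR lo m (\ i -> (g i I.- i) I.* (g i I.- i)) I.≤ + (m M.* (n M.* n))
   go lo zero = Z.≤-refl
   go lo (suc m) = Z.+-mono-≤ (b1 lo) (go (lo I.+ 1ℤ) m)
  private
   module Pair {k g} (w : aC k g) where
    -- Here and in `gg`: g(a) and g(b) - n are moving again, and they serve as new end points in
    -- `gV`.
    de : ∀ a -> gr g a -> gr g (g a)
    de a (p , q) = Z.≤∧≢⇒< (proj₁ (ce w (g a))) (\ e -> Z.<-irrefl (sym (bS w _ _ (sym e))) p) , Z.≤∧≢⇒< (proj₂ (ce w (g a))) (\ e -> Z.<-irrefl (bS w _ _ (trans e (sym (jq w a)))) q)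
    gg : ∀ b e -> e I.+ + n ≡ g b -> gr g b -> gr g e
    gg b e q (r , s) = Z.≤∧≢⇒< (proj₁ (ce w e)) (\ z -> Z.<-irrefl (trans (sym (bS w _ _ (trans (jq w e) (trans (cong (I._+ + n) (sym z)) q)))) q) r) , Z.≤∧≢⇒< (proj₂ (ce w e)) (\ z -> Z.<-irrefl (trans (sym q) (cong (I._+ + n) (bS w _ _ (trans z q)))) s)
    Found : Set
    Found = Σ ℤ \ a -> Σ ℤ \ b -> Cov g a b × aC k (\ x -> g (tr a b x))
    -- g t_ab sends a to g(b) and b to g(a); with g(a) < g(b) only g(b) ≤ a + n and b ≤ g(a) are not
    -- automatic.
    gF : ∀ {a b} -> a I.< b -> a ≁ b -> g a I.< g b -> g b I.≤ a I.+ + n -> b I.≤ g a -> aC k (\ x -> g (tr a b x))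
    gF {a} {b} a<b ab up hb lb = record { jq = \ x -> trans (cong g (kh ab x)) (jq w _) ; bS = \ x y e -> nS ab (bS w _ _ e) ; ce = dW ; ia = trans (fX (ax w) ab) (ia w) } where
     Rel : ℤ -> ℤ -> Set
     Rel x y = x I.≤ y × y I.≤ x I.+ + n
     ck : ∀ x y -> Rel x y -> ∀ q -> Rel (x I.+ q I.* + n) (y I.+ q I.* + n)
     ck x y (r , s) q = gz r (q I.* + n) , lin 0 s (L.solve 4 (\ x y n q -> (x L.:+ q L.:+ n) L.:- (y L.:+ q) L.:= ((x L.:+ n) L.:- y) L.:+ L.O) refl x y (+ n) (q I.* + n))
     h : Fn
     h x = g (tr a b x)
     h-qp : QP h
     h-qp x = trans (cong g (kh ab x)) (jq w _)
     dW : gn h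
     dW x with x ∼? a
     ... | yes p = kG {h} Rel h-qp ck p (subst (Rel a) (cong g (sym (dF a b))) (Z.≤-trans (proj₁ (ce w a)) (Z.<⇒≤ up) , hb))
     ... | no p with x ∼? b
     ... | yes r = kG {h} Rel h-qp ck r (subst (Rel b) (cong g (sym (dE ab))) (lb , Z.≤-trans (Z.<⇒≤ up) (proj₂ (ce w b))))
     ... | no r = subst (Rel x) (cong g (sym (aY p r))) (ce w x)
    ku : ∀ {a b c d : ℤ} {m} -> b I.< a I.+ + suc m -> a I.≤ c -> d I.≤ b -> (a I.< c ⊎ d I.< b) -> d I.< c I.+ + m
    ku {a} {b} {c} {d} {m} p q r (inj₁ s) = aB 0 (st p & st s & r) (L.solve 5 (\ a b c d m -> (c L.:+ m) L.:- d L.:= ((a L.:+ (L.I L.:+ m)) L.:+ (c L.:+ b)) L.:- ((b L.:+ L.I) L.:+ ((a L.:+ L.I) L.:+ d)) L.:+ L.I) refl a b c d (+ m))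
    ku {a} {b} {c} {d} {m} p q r (inj₂ s) = aB 0 (st p & st s & q) (L.solve 5 (\ a b c d m -> (c L.:+ m) L.:- d L.:= ((a L.:+ (L.I L.:+ m)) L.:+ (b L.:+ c)) L.:- ((b L.:+ L.I) L.:+ ((d L.:+ L.I) L.:+ a)) L.:+ L.I) refl a b c d (+ m))
    -- A closest pair of moving positions in increasing order is a cover with bounded result.
    gV : ∀ m a b -> a I.< b -> b I.< a I.+ + m -> b I.< a I.+ + n -> gr g a -> gr g b -> g a I.< g b -> Found
    gV zero a b p q _ _ _ _ = ⊥-elim (Z.<-asym p (subst (b I.<_) (Z.+-identityʳ a) q))
    gV (suc m) a b p q r ma mb up with g b I.≤? a I.+ + n | b I.≤? g a
    -- g(b) is too large for position a: replace a by g(b) - n, which lies strictly between a and b.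
    ... | no hb | _ = gV m e b e<b (ku {a} {m = m} q (Z.<⇒≤ a<e) Z.≤-refl (inj₁ a<e)) (Z.<-trans r (up-n a<e)) (gg b e e≡ mb) mb (subst (g e I.<_) e≡ (proj₂ (gg b e e≡ mb))) where
     e = g b I.- + n
     e≡ : e I.+ + n ≡ g b
     e≡ = L.solve 2 (\ x n -> x L.:- n L.:+ n L.:= x) refl (g b) (+ n)
     a<e : a I.< e
     a<e = aB 0 (st (Z.≰⇒> hb)) (L.solve 3 (\ a x n -> (x L.:- n) L.:- a L.:= (x L.:- (a L.:+ n L.:+ L.I)) L.:+ L.I) refl a (g b) (+ n))
     e<b : e I.< b
     e<b = aB 0 (st (proj₂ mb)) (L.solve 3 (\ b x n -> b L.:- (x L.:- n) L.:= ((b L.:+ n) L.:- (x L.:+ L.I)) L.:+ L.I) refl b (g b) (+ n))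
    -- g(a) is too small for position b: replace b by g(a), which lies strictly between a and b.
    ... | yes _ | no lb = gV m a (g a) (proj₁ ma) (ku {a} {m = m} q Z.≤-refl (Z.<⇒≤ (Z.≰⇒> lb)) (inj₂ (Z.≰⇒> lb))) (proj₂ ma) ma (de a ma) (proj₁ (de a ma))
    ... | yes hb | yes lb with N.anyUpTo? (\ s -> (a I.+ + s I.<? b) ×-dec (g a I.<? g (a I.+ + s)) ×-dec (g (a I.+ + s) I.<? g b) ×-dec (a I.<? a I.+ + s)) (suc m)
    -- A value in the gap: its position c is moving, because c < b ≤ g(a) < g(c) < g(b) ≤ a + n < c
    -- + n.
    ... | yes (s , _ , c<b , lo , hi , a<c) = gV m a (a I.+ + s) a<c (ku {a} {m = m} q Z.≤-refl (Z.<⇒≤ c<b) (inj₂ c<b)) (Z.<-trans c<b r) ma (Z.<-trans c<b (Z.≤-<-trans lb lo) , Z.<-≤-trans hi (Z.≤-trans hb (gz (Z.<⇒≤ a<c) (+ n)))) lo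
    ... | no gf = a , b , mkCov p (c4 p r) up pQ , gF p (c4 p r) up hb lb where
     pQ : ∀ c -> a I.< c -> c I.< b -> ¬ (g a I.< g c × g c I.< g b)
     pQ c x y (u , v) with c I.- a in e | Z.i≤j⇒0≤j-i (Z.<⇒≤ x)
     ... | + s | _ = gf (s , s<m , subst (\ z -> z I.< b × g a I.< g z × g z I.< g b × a I.< z) c≡ (y , u , v , x)) where
      c≡ : c ≡ a I.+ + s
      c≡ = trans (L.solve 2 (\ a c -> c L.:= a L.:+ (c L.:- a)) refl a c) (cong (I._+_ a) e)
      s<m : s M.< suc m
      s<m = Z.drop‿+<+ (aB 0 (st (Z.<-trans (subst (I._< b) c≡ y) q)) (L.solve 3 (\ a s m -> m L.:- s L.:= ((a L.:+ m) L.:- (a L.:+ s L.:+ L.I)) L.:+ L.I) refl a (+ s) (+ suc m)))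
  -- Any moving position a starts the search with the pair a, g(a).
  oR : ∀ {k g} -> aC k g -> ny k g ⊎ Σ ℤ \ a -> Σ ℤ \ b -> Cov g a b × aC k (\ x -> g (tr a b x))
  oR {k} {g} w with N.anyUpTo? (\ s -> (1ℤ I.+ + s I.<? g (1ℤ I.+ + s)) ×-dec (g (1ℤ I.+ + s) I.<? 1ℤ I.+ + s I.+ + n)) n
  ... | no gf = inj₁ (let t = pB n (ce w) (\ s p r -> gf (s , p , r)) ; e , c = fY n g t ; len = Z.+-injective (Z.*-cancelʳ-≡ _ _ (+ n) (trans (sym e) (ia w))) in record { hm = t ; raise = len ; pS = trans (sym (N.m+n∸n≡m _ k)) (cong (M._∸ k) (trans (cong (aT (aA (win 1ℤ n g)) M.+_) (sym len)) c)) })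
  ... | yes (s , _ , mv) = inj₂ (gV n a (g a) (proj₁ mv) (proj₂ mv) (proj₂ mv) mv (de a mv) (proj₁ (de a mv))) where
   open Pair w
   a = 1ℤ I.+ + s

-- Counting reduced words

module Degree where
 open dK
 open cV
 open cB
 open mj
 open fJ
 open Bad using (jD; idw)
 open qA
 open Len
 open oX
 open ql
 open ad
 open import Data.Product using (_×_)
 open E using (refl; sym; trans; subst)
 private
  ℤR = Z.+-*-commutativeRing
 open h2 using (ι; nat; ind; sumR; sumR-cong; bI; bJ; ind-true; ind-false; aU)
 k2 : ∀ z -> ι z ≡ z
 k2 (+ m) = go m where
  go : ∀ m -> nat m ≡ + m
  go zero = refl
  go (suc m) = cong (I._+_ 1ℤ) (go m)
 k2 -[1+ m ] = cong I.-_ (k2 (+ suc m))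
 cI : ∀ lo m (f : ℤ -> ℤ) -> (∀ i -> 0ℤ I.≤ f i) -> 0ℤ I.≤ sumR lo m f
 cI lo zero f h = Z.≤-refl
 cI lo (suc m) f h = Z.+-mono-≤ (h lo) (cI _ m f h)
 gI : ∀ lo m (f : ℤ -> ℤ) -> (∀ i -> 0ℤ I.≤ f i) -> ∀ i -> lo I.≤ i -> i I.< lo I.+ + m -> 0ℤ I.< f i -> 0ℤ I.< sumR lo m f
 gI lo zero f h i p q r = ⊥-elim (Z.<⇒≱ q (subst (I._≤ i) (sym (Z.+-identityʳ lo)) p))
 gI lo (suc m) f h i p q r with lo I.≟ i
 ... | yes refl = Z.+-mono-<-≤ r (cI _ m f h)
 ... | no ne = Z.+-mono-≤-< (h lo) (gI _ m f h i (st (Z.≤∧≢⇒< p ne)) (subst (i I.<_) (sym (gy lo m)) q) r)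
 gG : ∀ lo m (f : ℤ -> ℤ) -> sumR lo m f ≢ 0ℤ -> Σ ℤ \ i -> f i ≢ 0ℤ
 gG lo zero f h = ⊥-elim (h refl)
 gG lo (suc m) f h with f lo I.≟ 0ℤ
 ... | no p = lo , p
 ... | yes p = gG _ m f (\ q -> h (cong₂ I._+_ p q))
 gh : ∀ b {z} -> 0ℤ I.≤ z -> 0ℤ I.≤ ind b I.* z
 gh true p = subst (0ℤ I.≤_) (sym (Z.*-identityˡ _)) p
 gh false p = Z.≤-refl
 oh : ∀ {x y} -> 0ℤ I.≤ x -> 0ℤ I.≤ y -> 0ℤ I.≤ x I.* y
 oh {+ x} {+ y} _ _ = subst (0ℤ I.≤_) (Z.pos-* x y) (I.+≤+ M.z≤n)
 *->0 : ∀ {x y} -> 0ℤ I.< x -> 0ℤ I.< y -> 0ℤ I.< x I.* y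
 *->0 {+ suc x} {+ suc y} _ _ = I.+<+ (M.s≤s M.z≤n)
 *->0 {+ zero} (I.+<+ ())
 *->0 {+ suc x} {+ zero} _ (I.+<+ ())
 module mu (n : ℕ) .{{nz : NonZero n}} (aa : 2 M.≤ n) where
  open ay n
  open dj n
  open kI ℤR n aa
  open e4 ℤR n aa
  open e6 n aa
  open bz ℤR n aa
  open kJ n aa
  open p4 n aa
  open jg n aa using (eJ; aP)
  -- All weights are positive, so one positive term suffices once no cover contributes negatively.
  -- The given cover is first translated so that its position a lies in the period of summation.
  pv : ∀ {N D g} (Ψ : Fn -> ℤ) -> Adm D g -> D M.+ D M.+ n M.< N -> Ext Ψ -> (∀ {a b} -> Cov g a b -> 0ℤ I.≤ Ψ (\ x -> g (tr a b x))) -> ∀ {a b} -> Cov g a b -> 0ℤ I.< Ψ (\ x -> g (tr a b x)) -> 0ℤ I.< Δ N Ψ g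
  pv {N} {D} {g} Ψ w room ext lV {a} {b} c pos with rep a
  ... | a' , e@(mk∼ q ε) , lo , hi = gI 1ℤ n _ (\ x -> cI _ (N M.+ N) _ (b1 x)) a' lo hi (gI (a' I.- + N) (N M.+ N) _ (b1 a') b' (Z.≤-trans (Z.i-j≤i a' (+ N)) (Z.<⇒≤ (ord c'))) (subst (b' I.<_) (L.solve 2 (\ i N -> i L.:+ N L.:= i L.:- N L.:+ (N L.:+ N)) refl a' (+ N)) (Z.≤-<-trans (dP w c') (Z.+-monoʳ-< a' (I.+<+ room)))) (subst (0ℤ I.<_) (sym (ind-true _ (fx c'))) (*->0 (hC c') (subst (0ℤ I.<_) (ext (\ x -> cong g (sym (fU (a4 c) e (trans (cong (\ z -> b' I.- z) ε) (L.solve 3 (\ a b q -> (b L.:+ q) L.:- (a L.:+ q) L.:= b L.:- a) refl a b (q I.* + n))) x)))) pos)))) where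
   b' = b I.+ q I.* + n
   c' : Cov g a' b'
   c' = subst (\ z -> Cov g z b') (sym ε) (g8 (qp w) q c)
   hC : ∀ {a b} -> Cov g a b -> 0ℤ I.< ι (g b I.- g a)
   hC {a} {b} c = subst (0ℤ I.<_) (sym (k2 (g b I.- g a))) (aB 0 (st (asc c)) (L.solve 2 (\ x y -> (y L.:- x) L.:- L.O L.:= (y L.:- (x L.:+ L.I)) L.:+ L.I) refl (g a) (g b)))
   b1 : ∀ a b -> 0ℤ I.≤ eY Ψ g a b
   b1 a b with nH g a b
   ... | yes c = subst (0ℤ I.≤_) (sym (ind-true _ (fx c))) (oh (Z.<⇒≤ (hC c)) (lV c))
   ... | no nc = Z.≤-reflexive (sym (ind-false _ (hn nc)))
  kU : (Fn -> ℤ) -> Fn -> ℤ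
  kU Φ g = d7 (\ i -> U 1ℤ i Φ g)
  -- For the indicator Φ of a target this counts the words of m letters modulo n, each acting at a
  -- descent, that lead from g to the target.
  eC : ℕ -> (Fn -> ℤ) -> Fn -> ℤ
  eC zero Φ = Φ
  eC (suc m) Φ = kU (eC m Φ)
  eU : ∀ m {Φ} -> Ext Φ -> Ext (eC m Φ)
  eU zero ext = ext
  eU (suc m) ext e = sumR-cong 1ℤ n (\ i -> lp 1ℤ i (eU m ext) e)
  dN : ∀ m {Φ} -> (∀ g -> 0ℤ I.≤ Φ g) -> ∀ g -> 0ℤ I.≤ eC m Φ g
  dN zero h = h
  dN (suc m) h g = cI 1ℤ n _ (\ i -> gh (lt (g (i I.+ 1ℤ)) (g i)) (subst (0ℤ I.≤_) (sym (Z.*-identityˡ _)) (dN m h _)))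
  private
   lC : ∀ N lo m (f : ℤ -> Fn -> ℤ) g -> Δ N (\ h -> sumR lo m (\ i -> f i h)) g ≡ sumR lo m (\ i -> Δ N (f i) g)
   lC N lo zero f g = nQ N 0ℤ (\ _ -> 0ℤ) g
   lC N lo (suc m) f g = trans (pw N (f lo) (\ h -> sumR (lo I.+ 1ℤ) m (\ i -> f i h)) g) (cong (I._+_ (Δ N (f lo) g)) (lC N (lo I.+ 1ℤ) m f g))
   -- `pu` for all letters at once; the differences g(i + 1) - g(i) add up to n over a period.
   oo : ∀ {N D g Φ} -> Adm D g -> Bud N D -> Ext Φ -> Δ N (kU Φ) g ≡ kU (Δ N Φ) g I.+ + n I.* Φ g
   oo {N} {D} {g} {Φ} w bud ext = trans (lC N 1ℤ n (\ i -> U 1ℤ i Φ) g) (trans (sumR-cong 1ℤ n (\ i -> pu 1ℤ i w bud ext)) (trans (bI 1ℤ n _ _) (cong (I._+_ (kU (Δ N Φ) g)) (trans (sumR-cong 1ℤ n {g = \ i -> Φ g I.* (e i I.- e (i I.- 1ℤ))} (\ i -> trans (Z.*-identityˡ _) (trans (Z.*-comm _ (Φ g)) (cong (Φ g I.*_) (trans (k2 _) (cong (\ z -> g (i I.+ 1ℤ) I.- g z) (L.solve 1 (\ i -> i L.:= i L.:- L.I L.:+ L.I) refl i))))))) (trans (bJ 1ℤ n (Φ g) (\ i -> e i I.- e (i I.- 1ℤ))) (trans (cong (Φ g I.*_) (trans (eM 1ℤ n e) (trans (cong (\ z -> g z I.- g 1ℤ) (L.solve 1 (\ n -> L.I L.:+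 n L.:- L.I L.:+ L.I L.:= L.I L.:+ n) refl (+ n))) (trans (cong (I._- g 1ℤ) (qp w 1ℤ)) (L.solve 2 (\ a n -> a L.:+ n L.:- a L.:= n) refl (g 1ℤ) (+ n)))))) (Z.*-comm (Φ g) (+ n)))))))) where
    e : ℤ -> ℤ
    e i = g (i I.+ 1ℤ)
   -- `Δ` acts like a derivative: each of the m steps contributes n by `oo`, and `Δ` of the
   -- indicator itself vanishes.
   jJ : ∀ {N Φ} -> Ext Φ -> (∀ {D h} -> Adm D h -> Δ N Φ h ≡ 0ℤ) -> ∀ m {D g} -> Adm D g -> Bud N (D M.+ m) -> Δ N (eC m Φ) g ≡ + m I.* (+ n I.* eC (m M.∸ 1) Φ g)
   jJ {Φ = Φ} ext z zero {g = g} w bud = trans (z w) (sym (Z.*-zeroˡ (+ n I.* Φ g)))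
   jJ {N} {Φ} ext z (suc m) {D} {g} w bud = trans (oo w (cE (N.m≤m+n D (suc m)) bud) (eU m ext)) (trans (cong (I._+ + n I.* eC m Φ g) (aQ m bud)) (L.solve 3 (\ m n p -> m L.:* (n L.:* p) L.:+ n L.:* p L.:= (L.I L.:+ m) L.:* (n L.:* p)) refl (+ m) (+ n) (eC m Φ g))) where
    aQ : ∀ m -> Bud N (D M.+ suc m) -> kU (Δ N (eC m Φ)) g ≡ + m I.* (+ n I.* eC m Φ g)
    aQ m bud = trans (sumR-cong 1ℤ n (\ i -> cong (\ z -> ind (lt (g (i I.+ 1ℤ)) (g i)) I.* (1ℤ I.* z)) (jJ ext z m (eI aa i w) (subst (Bud N) (sym (N.+-assoc D 1 m)) bud)))) (pull m) where
     pull : ∀ m -> sumR 1ℤ n (\ i -> ind (lt (g (i I.+ 1ℤ)) (g i)) I.* (1ℤ I.* (+ m I.* (+ n I.* eC (m M.∸ 1) Φ (s[ i ] g))))) ≡ + m I.* (+ n I.* eC m Φ g)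
     pull zero = trans (sumR-cong 1ℤ n (\ i -> trans (cong (\ z -> ind (lt (g (i I.+ 1ℤ)) (g i)) I.* (1ℤ I.* z)) (Z.*-zeroˡ (+ n I.* Φ (s[ i ] g)))) (Z.*-zeroʳ (ind (lt (g (i I.+ 1ℤ)) (g i)))))) (trans (bJ 1ℤ n 0ℤ (\ _ -> 0ℤ)) (sym (Z.*-zeroˡ (+ n I.* Φ g))))
     pull (suc m) = trans (sumR-cong 1ℤ n (\ i -> L.solve 4 (\ d m n p -> d L.:* (L.I L.:* (m L.:* (n L.:* p))) L.:= (m L.:* n) L.:* (d L.:* (L.I L.:* p))) refl (ind (lt (g (i I.+ 1ℤ)) (g i))) (+ suc m) (+ n) (eC m Φ (s[ i ] g)))) (trans (bJ 1ℤ n (+ suc m I.* + n) _) (Z.*-assoc (+ suc m) (+ n) _))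
  module _ (k : ℕ) where
   cH : Fn -> Bool
   cH h = jD n (win (aP k) n h)
   hD : ∀ {g h : Fn} -> (∀ x -> g x ≡ h x) -> cH g ≡ cH h
   hD {g} {h} e = cong (jD n) (cp (aP k) n {h} {g} (\ s _ -> e _))
   c9 : ∀ {D h} -> Adm D h -> cH h ≡ true -> ∀ x -> h x ≡ x I.+ + k
   c9 {h = h} w t with LP.≡-dec I._≟_ (win (aP k) n h) (idw n) | t
   ... | yes e | _ = eJ k w e
   ... | no _ | ()
   ki : ∀ {h} -> win (aP k) n h ≡ idw n -> cH h ≡ true
   ki {h} = dec-true (LP.≡-dec I._≟_ (win (aP k) n h) (idw n))
   -- The target has no inversion, hence is not above anything.
   fd : ∀ {D g a b} -> Adm D g -> Cov g a b -> cH (\ x -> g (tr a b x)) ≢ true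
   fd {D} {g} {a} {b} w c t = Z.<-asym (ord c) (aB 0 (st (E.subst₂ I._<_ ga gb (asc c))) (L.solve 3 (\ a b k -> a L.:- b L.:= ((a L.:+ k) L.:- (b L.:+ k L.:+ L.I)) L.:+ L.I) refl a b (+ k))) where
    bnd : b I.≤ a I.+ + (D M.+ D M.+ n)
    bnd = dP w c
    wt = kR (D M.+ D M.+ n) (a4 c) bnd (Z.≤-trans (Z.<⇒≤ (ord c)) (Z.i≤i+j b _)) w
    ga : g a ≡ b I.+ + k
    ga = trans (cong g (sym (dE (a4 c)))) (c9 wt t b)
    gb : g b ≡ a I.+ + k
    gb = trans (cong g (sym (dF a b))) (c9 wt t a)
   private
    Φ : Fn -> ℤ
    Φ h = ind (cH h)
    hy : Ext Φ
    hy {g} {h} e = cong ind (hD {g} {h} e)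
    jI : ∀ g -> 0ℤ I.≤ Φ g
    jI g = subst (0ℤ I.≤_) (Z.*-identityʳ (Φ g)) (gh (cH g) {1ℤ} (I.+≤+ M.z≤n))
    pt : ∀ {N D h} -> Adm D h -> Δ N Φ h ≡ 0ℤ
    pt {N} {D} {h} w = trans (d9 N {Φ} {\ _ -> 0ℤ I.* 0ℤ} h (\ a b c -> fa (cH (\ x -> h (tr a b x))) (fd w c))) (nQ N 0ℤ (\ _ -> 0ℤ) h) where
     fa : ∀ t -> t ≢ true -> ind t ≡ 0ℤ
     fa true ne = ⊥-elim (ne refl)
     fa false ne = refl
   -- A reduced word of length m leads from g down to the translation by k. Positivity of the count
   -- is kept instead of the bare length because it passes from g t_ab to g by `ly`.
   Deg : ℕ -> Fn -> Set
   Deg m g = 0ℤ I.< eC m Φ g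
   mw : ∀ {N} m {D g} -> Adm D g -> gq N (D M.+ m) -> Deg m g -> ℓ N g ≡ + m
   mw {N} m w room d = go m w room (\ e -> Z.<-irrefl (sym e) d) where
    go : ∀ m {D g} -> Adm D g -> gq N (D M.+ m) -> eC m Φ g ≢ 0ℤ -> ℓ N g ≡ + m
    go zero {g = g} w room ne with cH g in t
    ... | false = ⊥-elim (ne refl)
    ... | true = fP N (\ x y p -> E.subst₂ I._<_ (sym (c9 w t x)) (sym (c9 w t y)) (Z.+-monoˡ-< (+ k) p))
    go (suc m) {D} {g} w room ne with gG 1ℤ n _ ne
    ... | i , nz with g (i I.+ 1ℤ) I.<? g i
    ... | no nd = ⊥-elim (nz (ind-false _ (bk nd)))
    ... | yes dn = trans (h3 i w (cP (N.m≤m+n D (suc m)) room) dn) (trans (cong (I._+ 1ℤ) (go m (eI aa i w) (subst (gq N) (sym (N.+-assoc D 1 m)) room) (\ e -> nz (trans (ind-true _ (bg dn)) (trans (Z.*-identityˡ _) e))))) (cong +_ (N.+-comm m 1)))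
   -- A reduced word of g t_ab makes `Δ` of the count positive at g (`pv`), and `jJ` evaluates it as
   -- m n times the count for g with one letter less.
   ly : ∀ {N D g a b} m -> Adm D g -> Bud N (D M.+ m) -> D M.+ D M.+ n M.< N -> Cov g a b -> Deg m (\ x -> g (tr a b x)) -> Σ ℕ \ m' -> m ≡ suc m' × Deg m' g
   ly {N} {D} {g} m w bud room c d = go m (subst (0ℤ I.<_) (jJ hy (\ v -> pt {N} v) m w bud) (pv (eC m Φ) w room (eU m hy) (\ _ -> dN m jI _) c d)) where
    go : ∀ m -> 0ℤ I.< + m I.* (+ n I.* eC (m M.∸ 1) Φ g) -> Σ ℕ \ m' -> m ≡ suc m' × Deg m' g
    go zero p = ⊥-elim (Z.<-irrefl (sym (Z.*-zeroˡ (+ n I.* Φ g))) p)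
    go (suc m) p = m , refl , Z.≤∧≢⇒< (dN m jI g) (\ e -> Z.<-irrefl (sym (trans (cong (\ z -> + suc m I.* (+ n I.* z)) (sym e)) (trans (cong (+ suc m I.*_) (Z.*-zeroʳ (+ n))) (Z.*-zeroʳ (+ suc m))))) p)
   nG : ∀ {D g} w -> Adm D g -> vb w g ≡ true -> cH (act w g) ≡ true -> Deg (length w) g
   nG {D} {g} w a v t = go w jI hy v (subst (\ z -> 0ℤ I.< ind z) (sym t) (I.+<+ (M.s≤s M.z≤n))) where
    comm : ∀ m Φ -> eC m (kU Φ) ≡ kU (eC m Φ)
    comm zero Φ = refl
    comm (suc m) Φ = cong kU (comm m Φ)
    md : ∀ {x y} -> x ∧ y ≡ true -> x ≡ true × y ≡ true
    md {true} {true} _ = refl , refl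
    go : ∀ w {Φ} -> (∀ g -> 0ℤ I.≤ Φ g) -> Ext Φ -> vb w g ≡ true -> 0ℤ I.< Φ (act w g) -> 0ℤ I.< eC (length w) Φ g
    go [] nn ext v p = p
    go (j ∷ w) {Φ} nn ext v p = subst (\ z -> 0ℤ I.< z g) (comm (length w) Φ) (go w (dN 1 nn) (eU 1 ext) (proj₁ (md v)) pos) where
     h : Fn
     h = act w g
     w' = fL w a
     pos : 0ℤ I.< kU Φ h
     pos with rep j
     ... | i , e@(mk∼ q ε) , lo , hi = gI 1ℤ n _ (\ i -> gh (lt (h (i I.+ 1ℤ)) (h i)) (subst (0ℤ I.≤_) (sym (Z.*-identityˡ _)) (nn _))) i lo hi (subst (0ℤ I.<_) (sym (trans (ind-true _ (bg dn)) (trans (Z.*-identityˡ _) (ext (\ y -> cong h (fU (ar aa j) e (L.solve 2 (\ i j -> (i L.:+ L.I) L.:- i L.:= (j L.:+ L.I) L.:- j) refl i j) y)))))) p) where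
      dn : h (i I.+ 1ℤ) I.< h i
      dn = E.subst₂ I._<_ (sym (trans (cong h (trans (cong (I._+ 1ℤ) ε) (L.solve 2 (\ j q -> j L.:+ q L.:+ L.I L.:= j L.:+ L.I L.:+ q) refl j (q I.* + n)))) (dA w' (j I.+ 1ℤ) q))) (sym (trans (cong h ε) (dA w' j q))) (Z.+-monoˡ-< (q I.* + n) (aO (proj₂ (md v))))

-- Positivity of the top coefficient

module qg where
 open import Defs using (Poly; coeff; _*P_)
 open dK
 open o3
 open iM
 open kZ
 open Alt using (vand; T; sg; dL; fz)
 open mk
 open Bad
 open cV
 open cB
 open mj
 open fJ
 open qA
 open Lop
 open Len
 open oX
 open ql
 open Top
 open Climb
 open Degree
 open ad
 open import Data.Vec.Relation.Unary.All as VAll using ([]; _∷_)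
 open import Data.Product using (_×_)
 open E using (refl; sym; trans; subst)
 module qd (n' : ℕ) (aa : 2 M.≤ suc n') (k : ℕ) (k≤n : k M.≤ suc n') (D : ℕ) where
  n = suc n'
  open ay n
  open b8 n aa
  open jg n aa
  -- `oa` is the width that `j7` needs with d = k + 1, and `np` the one that `dr` needs for up to n
  -- inverse sweeps starting from displacement D.
  oa np B : ℕ
  oa = D M.+ k M.* n M.+ n M.+ suc k
  np = suc (D M.+ n M.+ n M.* n)
  B = oa M.+ np
  lo : ℤ
  lo = I.- + B
  m = B M.+ B
  open fD n' lo m using (F; j8; dr; Rng; δw)
  hi≡ : lo I.+ + m ≡ + B
  hi≡ = L.solve 1 (\ b -> (L.:- b) L.:+ (b L.:+ b) L.:= b) refl (+ B)
  private
   l3 : ∀ {x} -> x M.≤ B -> lo I.+ + x I.≤ 0ℤ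
   l3 {x} p = lin 0 (I.+≤+ p) (L.solve 2 (\ b x -> L.O L.:- ((L.:- b) L.:+ x) L.:= (b L.:- x) L.:+ L.O) refl (+ B) (+ x))
   jR : ∀ {x} -> x M.≤ B -> + x I.≤ lo I.+ + m
   jR p = Z.≤-trans (I.+≤+ p) (Z.≤-reflexive (sym hi≡))
  nW : lo I.≤ 1ℤ × + n I.< lo I.+ + m
  nW = Z.≤-trans Z.neg-≤-pos (I.+≤+ {0} M.z≤n) , Z.<-≤-trans (I.+<+ (N.n<1+n n)) (jR (N.≤-trans (M.s≤s (N.≤-trans (N.m≤n+m n D) (N.m≤m+n (D M.+ n) (n M.* n)))) (N.m≤n+m np oa)))
  n9 : aP k I.+ + k ≡ 1ℤ
  n9 = L.solve 1 (\ k -> L.I L.:- k L.:+ k L.:= L.I) refl (+ k)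
  module _ (R : CommutativeRing 0ℓ 0ℓ) where
   open CommutativeRing R using (_≈_) renaming (trans to ≈-trans; reflexive to ≈-reflexive)
   open bt R n aa
   hA : ∀ {g} (xs : Vec (CommutativeRing.Carrier R) k) φ -> Adm D g -> fH.Fop R n lo m xs φ (win 1ℤ n g) ≈ Lop (aP k) xs (\ h -> φ (win (aP k) n h)) g
   hA {g} xs φ w = ≈-trans (≈-reflexive (cong (\ z -> fH.Fop R n lo m xs φ (win z n g)) (sym n9))) (j7 lo m {D} {suc k} (aP k) xs φ g w (l3 (N.m≤m+n oa np)) (jR (N.m≤m+n oa np)) (lin 2 (Z.≤-refl {+ k}) (L.solve 1 (\ k -> (L.I L.:- k) L.:- (L.:- (L.I L.:+ k)) L.:= (k L.:- k) L.:+ L.con (+ 2)) refl (+ k))) (Z.≤-trans (Z.≤-reflexive n9) (I.+≤+ (M.s≤s M.z≤n))))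
  G : Fn -> Poly k
  G g = F k (win 1ℤ n g)
  g7 : ∀ {g} -> Adm D g -> ∀ e -> coeff (G g) e ≡ coeff (bt.Lop (ai k) n aa (aP k) (X k) (kf k (aP k) g) g) e
  g7 w = ac (hA (ai k) (X k) (δw (ai k)) w)
  lv : ∀ {g} -> ¬ bE (win 1ℤ n g) -> G g ≋ []
  lv {g} = j8 k (win 1ℤ n g) (aM 1ℤ n g)
  dl : ∀ {g} -> Adm D g -> ¬ bE (win 1ℤ n g) ⊎ ¬ a5 (+ n) (win 1ℤ n g) -> Low n (vand (X k) *P G g)
  dl w (inj₁ a) = dJ n (Q.sym (Q.trans (Q.*-congˡ {x = vand (X k)} (lv a)) (Q.zeroʳ (vand (X k))))) (mkLow (\ _ _ -> refl)) where module Q = CommutativeRing (ai k)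
  dl {g} w (inj₂ b) = dr (n ∸ k) k (N.m+[n∸m]≡n k≤n) (win 1ℤ n g) (aM 1ℤ n g) (gD 1ℤ n f4) b where
   f4 : ∀ s -> s M.< n -> Rng (n ∸ k) (g (1ℤ I.+ + s))
   f4 s p = lin 1 (ej w i & l3 {D} D≤ & I.+≤+ {0} {s} M.z≤n) (L.solve 4 (\ g lo d s -> g L.:- lo L.:= ((g L.:+ d) L.:+ (L.O L.:+ s)) L.:- ((L.I L.:+ s) L.:+ ((lo L.:+ d) L.:+ L.O)) L.:+ L.I) refl (g i) lo (+ D) (+ s)) , aB 0 (ee w i & I.+≤+ p & I.+≤+ (N.*-monoˡ-≤ n (N.m∸n≤m n k)) & jR {np} (N.m≤n+m np oa)) (L.solve 7 (\ g s d n r q h -> h L.:- (g L.:+ r) L.:= ((L.I L.:+ s L.:+ d) L.:+ (n L.:+ (q L.:+ h))) L.:- (g L.:+ ((L.I L.:+ s) L.:+ (r L.:+ (L.I L.:+ (d L.:+ n L.:+ q))))) L.:+ L.I) refl (g i) (+ s) (+ D) (+ n) (+ ((n ∸ k) M.* n)) (+ (n M.* n)) (lo I.+ + m)) where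
    i = 1ℤ I.+ + s
    D≤ : D M.≤ B
    D≤ = N.≤-trans (N.≤-trans (N.m≤m+n D (k M.* n)) (N.≤-trans (N.m≤m+n _ n) (N.m≤m+n _ (suc k)))) (N.m≤m+n oa np)
 spend : ∀ {x e e' : ℤ} {f : ℕ} -> x I.< e I.+ + suc f -> e I.< e' -> x I.< e' I.+ + f
 spend {x} {e} {e'} {f} p q = Z.<-≤-trans p (lin 0 (st q) (L.solve 3 (\ a b f -> (b L.:+ f) L.:- (a L.:+ (L.I L.:+ f)) L.:= (b L.:- (a L.:+ L.I)) L.:+ L.O) refl e e' (+ f)))
 pW : ∀ {e : ℤ} m -> 0ℤ I.≤ e -> + m I.< e I.+ + suc m
 pW {e} m p = aB 0 p (L.solve 2 (\ e m -> (e L.:+ (L.I L.:+ m)) L.:- m L.:= (e L.:- L.O) L.:+ L.I) refl e (+ m))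
 -- `T M g` stands for the signed coefficient of the full rectangle in (x_1 + ... + x_k)^M times the
 -- polynomial of g. The climb is an argument about its properties alone, which are the parameters.
 module Ladder (n : ℕ) .{{nz : NonZero n}} (aa : 2 M.≤ n) (k c : ℕ) (cQ : ℕ) (roomy : n M.+ n M.+ n M.< cQ) (T : ℕ -> Fn -> ℤ) (o2 : ∀ M -> bz.Ext Z.+-*-commutativeRing n aa (T M)) (mg : ∀ M {g} -> b8.aC n aa k g -> bz.Δ Z.+-*-commutativeRing n aa cQ (T M) g ≡ + n I.* T (suc M) g) (g1 : ∀ M {h} -> ay.Adm n (n M.+ (n M.+ n M.+ n)) h -> ¬ bE (win 1ℤ n h) ⊎ ¬ a5 (+ n) (win 1ℤ n h) -> T M h ≡ 0ℤ) (T-top : ∀ {g} -> b8.aC n aa k g -> b8.ny n aa k g -> 0ℤ I.< T 0 g) (top-degree : ∀ {g} -> b8.aC n aa k g -> b8.ny n aa k g -> mu.Deg n aa k (k M.* c) g) where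
  open ay n
  open e6 n aa
  open b8 n aa
  open kJ n aa
  open mu n aa
  f1 : ∀ e -> n M.+ n M.+ n M.< suc ((n M.+ e) M.+ 1 M.+ ((n M.+ e) M.+ 1) M.+ n M.+ 2)
  f1 e = M.s≤s (N.≤-trans (N.+-monoˡ-≤ n (N.+-mono-≤ nX nX)) (N.m≤m+n _ 2)) where
   nX : n M.≤ (n M.+ e) M.+ 1
   nX = N.≤-trans (N.m≤m+n n e) (N.m≤m+n _ 1)
  ex : ∀ {g a b} -> aC k g -> Cov g a b -> Adm (n M.+ (n M.+ n M.+ n)) (\ x -> g (tr a b x))
  ex w cv = kR (n M.+ n M.+ n) (a4 cv) (dP (ax w) cv) (Z.≤-trans (Z.<⇒≤ (ord cv)) (Z.i≤i+j _ _)) (ax w)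
  hW : ∀ {g p q} -> aC k g -> Deg k p g -> Deg k q g -> p ≡ q
  hW {g} {p} {q} w dp dq = Z.+-injective (trans (sym (mw k p a (cP (N.+-monoʳ-≤ n (N.m≤m+n p q)) N.≤-refl) dp)) (mw k q a (cP (N.+-monoʳ-≤ n (N.m≤n+m q p)) N.≤-refl) dq)) where a = ax w
  hJ : ∀ {g a b} p -> aC k g -> Cov g a b -> Deg k p (\ x -> g (tr a b x)) -> Σ ℕ \ q -> p ≡ suc q × Deg k q g
  hJ p w cv = ly k p (ax w) N.≤-refl (f1 p) cv
  -- p is the degree of g, and M the number of steps left to the top degree k c.
  hT : Fn -> Set
  hT g = Σ ℕ \ p -> Σ ℕ \ M -> p M.+ M ≡ k M.* c × Deg k p g
  -- The climb ends because the potential `gk` grows and is bounded; the degree is known at the top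
  -- and is carried back down by `ly`.
  l6 : ∀ fuel {g} -> aC k g -> + (n M.* (n M.* n)) I.< gk g I.+ + fuel -> hT g
  l6 zero {g} w r = ⊥-elim (Z.<⇒≱ r (Z.≤-trans (Z.≤-reflexive (Z.+-identityʳ (gk g))) (iD (ce w))))
  l6 (suc fuel) {g} w r = go (oR w) where
   lift' : ∀ {a b} -> Cov g a b -> hT (\ x -> g (tr a b x)) -> hT g
   lift' cv (p , M , e , d) = let q , p≡ , d' = hJ p w cv d in q , suc M , trans (N.+-suc q M) (trans (cong (M._+ M) (sym p≡)) e) , d'
   go : _ -> hT g
   go (inj₁ t) = k M.* c , 0 , N.+-identityʳ _ , top-degree w t
   go (inj₂ (a , b , cv , w')) = lift' cv (l6 fuel w' (spend r (iC (ax w) cv)))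
  oM : ∀ {g} -> aC k g -> hT g
  oM {g} w = l6 (suc (n M.* (n M.* n))) w (pW (n M.* (n M.* n)) (cI 1ℤ n _ (\ i -> let p = Z.i≤j⇒0≤j-i (proj₁ (ce w i)) in oh p p)))
  -- Degrees are unique (`hW`), so the cover has degree exactly p + 1.
  gm : ∀ {g a b p} -> aC k g -> Deg k p g -> Cov g a b -> hT (\ x -> g (tr a b x)) -> Σ ℕ \ M -> suc p M.+ M ≡ k M.* c × Deg k (suc p) (\ x -> g (tr a b x))
  gm {g} {a} {b} {p} w d cv (r , M , e , d') = let q , r≡ , d″ = hJ r w cv d' ; eq' = trans r≡ (cong suc (hW {g} {q} {p} w d″ d)) in M , trans (cong (M._+ M) (sym eq')) e , subst (\ z -> Deg k z (\ x -> g (tr a b x))) eq' d'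
  -- Induction on M. A cover is either bounded, with positive T by induction, or contributes 0, so
  -- the Chevalley sum is positive; comparison of degrees shows that M = 0 exactly at the top.
  bL : ∀ M p {g} -> aC k g -> p M.+ M ≡ k M.* c -> Deg k p g -> 0ℤ I.< T M g
  bL zero p {g} w e d = go (oR w) where
   go : _ -> 0ℤ I.< T 0 g
   go (inj₁ t) = T-top w t
   go (inj₂ (a , b , cv , w')) = let M , q , _ = gm {p = p} w d cv (oM w') in ⊥-elim (N.<-irrefl (trans (sym (N.+-identityʳ p)) e) (N.≤-trans (N.m≤m+n (suc p) M) (N.≤-reflexive q)))
  bL (suc M) p {g} w e d = go (oR w) where
   fB : ∀ {a b} -> Cov g a b -> aC k (\ x -> g (tr a b x)) -> 0ℤ I.< T M (\ x -> g (tr a b x))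
   fB cv w' = bL M (suc p) w' (trans (sym (N.+-suc p M)) e) (proj₂ (proj₂ (gm {p = p} w d cv (oM w'))))
   lV : ∀ {a b} -> Cov g a b -> 0ℤ I.≤ T M (\ x -> g (tr a b x))
   lV {a} {b} cv = pE (lF {\ x -> g (tr a b x)} (qp (ex w cv))) where
    pE : _ -> 0ℤ I.≤ T M (\ x -> g (tr a b x))
    pE (inj₂ o) = Z.≤-reflexive (sym (g1 M (ex w cv) o))
    pE (inj₁ dW) = Z.<⇒≤ (fB cv (record { jq = qp (ex w cv) ; bS = inj (ex w cv) ; ce = dW ; ia = trans (fX (ax w) (a4 cv)) (ia w) }))
   go : _ -> 0ℤ I.< T (suc M) g
   go (inj₁ t) = ⊥-elim (N.<-irrefl (hW {g} {p} {k M.* c} w d (top-degree w t)) (subst (p M.<_) e (N.m<m+n p (M.s≤s M.z≤n))))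
   go (inj₂ (a , b , cv , w')) = Z.≰⇒> (\ le -> Z.<⇒≱ (subst (0ℤ I.<_) (mg M w) (pv (T M) (ax w) roomy (\ {g} {h} -> o2 M {g} {h}) lV cv (fB cv w'))) (Z.≤-trans (Z.*-monoˡ-≤-nonNeg (+ n) le) (Z.≤-reflexive (Z.*-zeroʳ (+ n)))))
  oz : ∀ {g} -> aC k g -> Σ ℕ \ M -> 0ℤ I.< T M g
  oz w = let p , M , e , d = oM w in M , bL M p w e d
 module oc (n' : ℕ) (aa : 2 M.≤ suc n') (k : ℕ) (k≤n : k M.≤ suc n') where
  -- A bounded permutation moves points by at most n, and a cover of it reaches at most 3n by `dP`.
  D = suc n' M.+ (suc n' M.+ suc n' M.+ suc n')
  open qd n' aa k k≤n D
  open fD n' lo m using (F; δw)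
  open ay n
  open e6 n aa
  open b8 n aa
  open jg n aa
  open p4 n aa using (act; vb)
  open kJ n aa
  open mu n aa
  private
   module W = j0 k n
   module WR = aE W.quotient
   module ΔW = bz W.quotient n aa
   module LW = bt W.quotient n aa
   module mE = bz Z.+-*-commutativeRing n aa
   module FW = fH W.quotient n lo m
   module qa = h2
   module Q = CommutativeRing (ai k)
   c = n ∸ k
   E : Vec ℕ k
   E = T c k
   Sm : Poly k
   Sm = LW.mM (X k)
   -- The least value that `Bud` allows for the displacement n + kn, reached after all k factors.
   cQ : ℕ
   cQ = suc ((n M.+ k M.* n) M.+ 1 M.+ ((n M.+ k M.* n) M.+ 1) M.+ n M.+ 2)
   mt : VAll.All (M._< n) E
   mt = go c k (N.≤-reflexive (N.m∸n+n≡m k≤n)) where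
    go : ∀ c k -> c M.+ k M.≤ n -> VAll.All (M._< n) (T c k)
    go c zero p = []
    go c (suc k) p = N.<-≤-trans (N.m<m+n c (M.s≤s M.z≤n)) p ∷ go (suc c) k (subst (M._≤ n) (N.+-suc c k) p)
   ex : ∀ {g a b} -> aC k g -> Cov g a b -> Adm D (\ x -> g (tr a b x))
   ex w cv = kR (n M.+ n M.+ n) (a4 cv) (dP (ax w) cv) (Z.≤-trans (Z.<⇒≤ (ord cv)) (Z.i≤i+j _ _)) (ax w)
   wide : ∀ {g} -> aC k g -> Adm D g
   wide w = d6 (N.m≤m+n n _) (ax w)
   module ci (V : Poly k) where
    -- The exponents in `E` are below n, so the functional is well defined modulo n-th powers (`o5`)
    -- and can be applied to identities in the quotient ring.
    L : Poly k -> ℤ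
    L A = coeff (V *P A) E
    qq : ∀ A A' -> L (A ++ A') ≡ L A I.+ L A'
    qq A A' = trans (ac (Q.distribˡ V A A') E) (a0 (V *P A) (V *P A') E)
    ju : ∀ {A A'} -> A ≋ A' -> L A ≡ L A'
    ju e = ac (Q.*-congˡ {x = V} e) E
    qo : L [] ≡ 0ℤ
    qo = ac (Q.zeroʳ V) E
    L-low : ∀ {A} -> Low n A -> L A ≡ 0ℤ
    L-low l = low (nt n V l) E mt
    o5 : ∀ {A A'} -> A WR.≈ A' -> L A ≡ L A'
    o5 {A} {A'} l = trans (ju (P.solve 2 (\ a b -> a P.:= b P.:+ (a P.:- b)) Q.refl A A')) (trans (qq A' (A Q.- A')) (trans (cong (I._+_ (L A')) (L-low l)) (Z.+-identityʳ _)))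
    L-neg : ∀ A -> L (Q.- A) ≡ I.- L A
    L-neg A = trans (L.solve 2 (\ a b -> a L.:= (b L.:+ a) L.:- b) refl (L (Q.- A)) (L A)) (trans (cong (I._- L A) (trans (sym (qq A (Q.- A))) (trans (ju (Q.-‿inverseʳ A)) qo))) (Z.+-identityˡ _))
    nv : ∀ m A -> L (WR.nat m *P A) ≡ + m I.* L A
    nv zero A = trans (ju (Q.zeroˡ A)) (trans qo (sym (Z.*-zeroˡ (L A))))
    nv (suc m) A = trans (ju (Q.trans (Q.distribʳ A Q.1# (WR.nat m)) (Q.+-congʳ (Q.*-identityˡ A)))) (trans (qq A _) (trans (cong (I._+_ (L A)) (nv m A)) (L.solve 2 (\ m l -> l L.:+ m L.:* l L.:= (L.I L.:+ m) L.:* l) refl (+ m) (L A))))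
    L-ι : ∀ z A -> L (WR.ι z *P A) ≡ z I.* L A
    L-ι (+ m) A = nv m A
    L-ι -[1+ m ] A = trans (ju (Q.sym (P.-‿distribˡ-* (WR.nat (suc m)) A))) (trans (L-neg (WR.nat (suc m) *P A)) (trans (cong I.-_ (nv (suc m) A)) (Z.neg-distribˡ-* (+ suc m) (L A))))
    qn : ∀ b A -> L (WR.ind b *P A) ≡ qa.ind b I.* L A
    qn true A = trans (ju (Q.*-identityˡ A)) (sym (Z.*-identityˡ (L A)))
    qn false A = trans (ju (Q.zeroˡ A)) qo
    nu : ∀ lo m (f : ℤ -> Poly k) -> L (WR.sumR lo m f) ≡ qa.sumR lo m (\ i -> L (f i))
    nu lo zero f = qo
    nu lo (suc m) f = trans (qq (f lo) _) (cong (I._+_ (L (f lo))) (nu _ m f))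
    L-Δ : ∀ N Ψ g -> L (ΔW.Δ N Ψ g) ≡ mE.Δ N (\ h -> L (Ψ h)) g
    L-Δ N Ψ g = trans (nu 1ℤ n _) (qa.sumR-cong 1ℤ n (\ a -> trans (nu (a I.- + N) (N M.+ N) _) (qa.sumR-cong _ (N M.+ N) (\ b -> trans (qn (cv g a b) _) (cong (qa.ind (cv g a b) I.*_) (trans (L-ι (g b I.- g a) _) (cong (I._* L (Ψ (\ x -> g (tr a b x)))) (sym (k2 (g b I.- g a))))))))))
   Fq : Fn -> Poly k
   Fq h = FW.Fop (X k) (δw W.quotient) (win 1ℤ n h)
   oe : ∀ g -> G g WR.≈ Fq g
   oe g = WR.trans {G g} (W.Id.hw n lo m (X k) (δw (ai k)) v) (WR.trans {FW.Fop (Vec.map (\ P -> P) (X k)) (δw (ai k)) v} (WR.reflexive (cong (\ z -> FW.Fop z (δw (ai k)) v) (VP.map-id (X k)))) (FW.Fop-cong (X k) (\ w -> W.Id.fQ (jD n w)) v)) where v = win 1ℤ n g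
   Φ : Fn -> Poly k
   Φ h = δw W.quotient (win (aP k) n h)
   hy : ΔW.Ext Φ
   hy {g} {h} e = WR.reflexive (cong WR.ind (hD k {g} {h} e))
   pt : ∀ {D h} -> Adm D h -> ΔW.Δ cQ Φ h WR.≈ []
   pt {h = h} w = WR.begin ΔW.Δ cQ Φ h WR.≈⟨ ΔW.d9 cQ {Φ} {\ _ -> WR.0# WR.* WR.0#} h (\ a b cv -> fa (cH k (\ x -> h (tr a b x))) (fd k w cv)) ⟩ ΔW.Δ cQ (\ _ -> WR.0# WR.* WR.0#) h WR.≈⟨ ΔW.nQ cQ WR.0# (\ _ -> WR.0#) h ⟩ WR.0# WR.* ΔW.Δ cQ (\ _ -> WR.0#) h WR.≈⟨ WR.zeroˡ (ΔW.Δ cQ (\ _ -> WR.0#) h) ⟩ [] WR.∎ where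
    fa : ∀ t -> t ≢ true -> WR.ind t WR.≈ (WR.0# WR.* WR.0#)
    fa true ne = ⊥-elim (ne refl)
    fa false ne = WR.sym {WR.0# WR.* WR.0#} {WR.0#} (WR.zeroˡ WR.0#)
   -- `Δ` passes through all k factors by `lD`; on the indicator of the target it vanishes by `pt`.
   lj : ∀ {g} -> aC k g -> ΔW.Δ cQ Fq g WR.≈ Sm *P (WR.ι (+ n) *P Fq g)
   lj {g} w = WR.begin ΔW.Δ cQ Fq g WR.≈⟨ ΔW.d9 cQ {Fq} {L} g (\ a b cv -> link (ex w cv)) ⟩ ΔW.Δ cQ L g WR.≈⟨ LW.lD (aP k) (X k) (ax w) N.≤-refl (\ {g} {h} -> hy {g} {h}) nil ⟩ LW.Lop (aP k) (X k) (ΔW.Δ cQ Φ) g WR.+ Sm WR.* (WR.ι (+ n) WR.* L g) WR.≈⟨ WR.+-congʳ {Sm WR.* (WR.ι (+ n) WR.* L g)} {LW.Lop (aP k) (X k) (ΔW.Δ cQ Φ) g} {WR.0#} gf ⟩ WR.0# WR.+ Sm WR.* (WR.ι (+ n) WR.* L g) WR.≈⟨ WR.+-identityˡ (Sm WR.* (WR.ι (+ n) WR.* L g)) ⟩ Sm WR.* (WR.ι (+ n) WR.* L g) WR.≈⟨ WR.*-congˡ {Sm} {WR.ι (+ n) WR.* L g} {WR.ι (+ n) WR.* Fq g} (WR.*-congˡ {WR.ι (+ n)} {L g} {Fq g} (WR.sym {Fq g} {L g} (link (wide w)))) ⟩ Sm WR.* (WR.ι (+ n) WR.* Fq g) WR.∎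 where
    L : Fn -> Poly k
    L = LW.Lop (aP k) (X k) Φ
    link : ∀ {h} -> Adm D h -> Fq h WR.≈ L h
    link = hA W.quotient (X k) (δw W.quotient)
    nil : VAll.All (\ x -> WR.pow x n WR.≈ WR.0#) (X k)
    nil = VAll.map (\ {x} l -> WR.trans {WR.pow x n} {P.pow x n} (WR.sym {P.pow x n} {WR.pow x n} (W.Id.hv x n)) (W.e0 l)) (fk n)
    -- Linearity is available in the form Φ + a Φ', so the zero function is written as Φ - Φ.
    gf : LW.Lop (aP k) (X k) (ΔW.Δ cQ Φ) g WR.≈ WR.0#
    gf = WR.begin LW.Lop (aP k) (X k) (ΔW.Δ cQ Φ) g WR.≈⟨ LW.cR (aP k) (X k) {ΔW.Δ cQ Φ} {\ h -> Φ h WR.+ (WR.- WR.1#) WR.* Φ h} (\ h w' -> WR.trans {ΔW.Δ cQ Φ h} {WR.0#} (pt w') (WR.sym {Φ h WR.+ (WR.- WR.1#) WR.* Φ h} {WR.0#} (hN (Φ h)))) g (ax w) ⟩ LW.Lop (aP k) (X k) (\ h -> Φ h WR.+ (WR.- WR.1#) WR.* Φ h) g WR.≈⟨ LW.iN (aP k) (X k) (WR.- WR.1#) Φ Φ g (ax w) ⟩ L g WR.+ (WR.- WR.1#) WR.* L g WR.≈⟨ hN (L g) ⟩ WR.0# WR.∎ where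
     hN : ∀ a -> (a WR.+ (WR.- WR.1#) WR.* a) WR.≈ WR.0#
     hN a = W.ht {a Q.+ (Q.- Q.1#) Q.* a} {Q.0#} (Q.trans (Q.+-congˡ {x = a} (Q.trans (Q.sym (P.-‿distribˡ-* Q.1# a)) (Q.-‿cong (Q.*-identityˡ a)))) (Q.-‿inverseʳ a))
   V : ℕ -> Poly k
   V M = vand (X k) *P P.pow Sm M
  -- The sign `sg k` makes the value at a top element with M = 0 equal to the coefficient at (c,
  -- ..., c), see `AtTop`.
  T' : ℕ -> Fn -> ℤ
  T' M g = sg k I.* ci.L (V M) (G g)
  private
   o2 : ∀ M -> mE.Ext (T' M)
   o2 M {g} {h} e = cong (\ v -> sg k I.* ci.L (V M) (F k v)) (cp 1ℤ n {h} {g} (\ s _ -> e _))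
   mg : ∀ M {g} -> aC k g -> mE.Δ cQ (T' M) g ≡ + n I.* T' (suc M) g
   mg M {g} w = trans (mE.nQ cQ (sg k) (\ h -> L (G h)) g) (trans (cong (sg k I.*_) (trans (mE.d9 cQ {\ h -> L (G h)} {\ h -> L (Fq h)} g (\ a b _ -> o5 {G (\ x -> g (tr a b x))} {Fq (\ x -> g (tr a b x))} (oe (\ x -> g (tr a b x))))) (trans (sym (L-Δ cQ Fq g)) (trans (o5 {ΔW.Δ cQ Fq g} {Sm *P (WR.ι (+ n) *P Fq g)} (lj w)) (trans (ij (Fq g)) (cong (+ n I.*_) (sym (ci.o5 (V (suc M)) {G g} {Fq g} (oe g))))))))) (L.solve 3 (\ s n l -> s L.:* (n L.:* l) L.:= n L.:* (s L.:* l)) refl (sg k) (+ n) (ci.L (V (suc M)) (G g)))) where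
    open ci (V M)
    ij : ∀ A -> L (Sm *P (WR.ι (+ n) *P A)) ≡ + n I.* ci.L (V (suc M)) A
    ij A = trans (ac (P.solve 5 (\ v p s i a -> (v P.:* p) P.:* (s P.:* (i P.:* a)) P.:= (v P.:* (s P.:* p)) P.:* (i P.:* a)) Q.refl (vand (X k)) (P.pow Sm M) Sm (WR.ι (+ n)) A) E) (ci.L-ι (V (suc M)) (+ n) A)
   p6 : ∀ M h -> Low n (vand (X k) *P G h) -> T' M h ≡ 0ℤ
   p6 M h l = trans (cong (sg k I.*_) (trans (ac (P.solve 3 (\ v p g -> (v P.:* p) P.:* g P.:= p P.:* (v P.:* g)) Q.refl (vand (X k)) (P.pow Sm M) (G h)) E) (low (nt n (P.pow Sm M) l) E mt))) (Z.*-zeroʳ (sg k))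
   g1 : ∀ M {h} -> Adm D h -> ¬ bE (win 1ℤ n h) ⊎ ¬ a5 (+ n) (win 1ℤ n h) -> T' M h ≡ 0ℤ
   g1 M {h} w o = p6 M h (dl w o)
   module AtTop {g} (w : aC k g) (t : ny k g) where
    v = win 1ℤ n g
    ja : 1ℤ I.≤ coeff (G g) (Vec.replicate k c)
    ja = subst (\ j -> 1ℤ I.≤ coeff (F j v) (Vec.replicate j c)) (raise t) (subst (\ d -> let j = length (ys (aA v)) in 1ℤ I.≤ coeff (F j v) (Vec.replicate j d)) (pS t) (gp.ib n' lo m v (aM 1ℤ n g) (hm t) (proj₁ nW) (proj₂ nW)))
    T-pos : 0ℤ I.< T' 0 g
    T-pos = subst (0ℤ I.<_) (sym (trans (cong (sg k I.*_) (trans (ac (Q.*-congʳ {x = G g} (Q.*-identityʳ (vand (X k)))) E) (fz k c (G g) (gp.gi n' lo m k c v (aM 1ℤ n g) (N.≤-reflexive (sym (pS t))))))) (trans (sym (Z.*-assoc (sg k) (sg k) _)) (trans (cong (I._* coeff (G g) (Vec.replicate k c)) (dL k)) (Z.*-identityˡ _))))) (Z.<-≤-trans (I.+<+ (M.s≤s M.z≤n)) ja)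
    kD : Deg k (k M.* c) g
    kD = let t' , sz , os , ng = lu k (aP k) g (Vec.replicate k c) (subst (1ℤ I.≤_) (g7 (wide w) (Vec.replicate k c)) ja) in subst (\ z -> Deg k z g) (trans (ch t') (trans (cong Vec.sum sz) (jO k))) (nG k (cat t') (wide w) os (ki k ng)) where
     jO : ∀ k -> Vec.sum (Vec.replicate k c) ≡ k M.* c
     jO zero = refl
     jO (suc k) = cong (c M.+_) (jO k)
  -- If aF had no coefficient at exponents below n, every `T' M g` would be 0 by `p6`, against the
  -- positive one that the climb provides.
  lU : ∀ {g} -> aC k g -> ¬ Low n (vand (X k) *P G g)
  lU {g} w l = let M , p = Ladder.oz n aa k c cQ (f1 n) T' (\ M {g} {h} -> o2 M {g} {h}) mg g1 AtTop.T-pos AtTop.kD w in Z.<-irrefl (sym (p6 M g l)) p where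
   f1 : ∀ n -> n M.+ n M.+ n M.< suc ((n M.+ k M.* n) M.+ 1 M.+ ((n M.+ k M.* n) M.+ 1) M.+ n M.+ 2)
   f1 n = M.s≤s (N.≤-trans (N.+-monoˡ-≤ n (N.+-mono-≤ (nX n) (nX n))) (N.m≤m+n _ 2)) where
    nX : ∀ n -> n M.≤ (n M.+ k M.* n) M.+ 1
    nX n = N.≤-trans (N.m≤m+n n (k M.* n)) (N.m≤m+n _ 1)
open import Defs
open dK
open iM
open kZ
open Alt using (vand)
open mk
open Ideal using (eE)
open Bad
open cV
open cB
open mj
open oX
open ql
open Climb
open qg
open ad
open import Data.Nat using (_≤_)
open import Data.List using (map; filter; applyUpTo; [_])
open import Data.List.Reverse using (Reverse; reverseView; _∶_∶ʳ_) renaming ([] to nil)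
open import Data.List.Relation.Unary.AllPairs using ([])
open import Data.List.Relation.Unary.Any using (here; there)
open import Data.Vec.Relation.Unary.All using (All; []; _∷_)
open import Data.Fin as Fin using ()
open import Data.Product using (_×_)
open import Function using (_⇔_; mk⇔)
open E using (refl; sym; trans; subst)
open h2 using (sumR; sumR-cong; aV; bI; bJ; ind)

-- The average as a count of values beyond n, and the conclusion

gt : ∀ {n k} (P Q : Poly k) -> P ≈P Q -> InIdeal n k P -> InIdeal n k Q
gt P Q e (L , ok , q) = L , ok , \ a -> trans (sym (e a)) (q a)
module qz (n : ℕ) .{{nz : NonZero n}} (aa : 2 M.≤ n) where
 open ay n
 open e4 Z.+-*-commutativeRing n aa
 open p4 n aa
 open b8 n aa using (fX)
 private
  -- The number of the period that contains y: 0 on 1, ..., n and 1 on n + 1, ..., 2n.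
  ct : ℤ -> ℤ
  ct y = (y I.- 1ℤ) /ℕ n
  f5 : ∀ y q r -> r M.< n -> y I.- 1ℤ ≡ + r I.+ q I.* + n -> ct y ≡ q
  f5 y q r r<n e = Z.*-cancelʳ-≡ _ _ (+ n) (aS (+ r) _ _ (trans (Z.+-comm (ct y I.* + n) (+ r)) (trans (cong (\ z -> z I.+ ct y I.* + n) r≡) (trans (sym (a≡a%ℕn+[a/ℕn]*n (y I.- 1ℤ) n)) (trans e (Z.+-comm (+ r) (q I.* + n))))))) where
   r' = (y I.- 1ℤ) %ℕ n
   r≡ : + r ≡ + r'
   r≡ = bQ (af (ae (mk∼ q e)) (mk∼ (ct y) (a≡a%ℕn+[a/ℕn]*n (y I.- 1ℤ) n))) (Z.<-≤-trans (I.+<+ r<n) (Z.i≤j+i (+ n) (+ r'))) (Z.<-≤-trans (I.+<+ (n%ℕd<d (y I.- 1ℤ) n)) (Z.i≤j+i (+ n) (+ r)))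
  fj : ∀ y -> ct (y I.+ + n) ≡ ct y I.+ 1ℤ
  fj y = f5 (y I.+ + n) (ct y I.+ 1ℤ) ((y I.- 1ℤ) %ℕ n) (n%ℕd<d (y I.- 1ℤ) n) (trans (L.solve 2 (\ y n -> y L.:+ n L.:- L.I L.:= (y L.:- L.I) L.:+ n) refl y (+ n)) (trans (cong (I._+ + n) (a≡a%ℕn+[a/ℕn]*n (y I.- 1ℤ) n)) (L.solve 3 (\ r q n -> r L.:+ q L.:* n L.:+ n L.:= r L.:+ (q L.:+ L.I) L.:* n) refl (+ ((y I.- 1ℤ) %ℕ n)) (ct y) (+ n))))
  eQ : ∀ y -> 1ℤ I.≤ y -> y I.≤ + n -> ct y ≡ 0ℤ
  eQ (+ suc r) _ (I.+≤+ p) = f5 (+ suc r) 0ℤ r p (sym (trans (cong (I._+_ (+ r)) (Z.*-zeroˡ (+ n))) (Z.+-identityʳ _)))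
  eQ (+ zero) (I.+≤+ ()) _
  fq : ∀ lo m (h : ℤ -> ℤ) -> sumR lo m (\ i -> h (i I.+ 1ℤ)) ≡ sumR lo m h I.+ (h (lo I.+ + m) I.- h lo)
  fq lo zero h = sym (trans (Z.+-identityˡ _) (trans (cong (\ z -> h z I.- h lo) (Z.+-identityʳ lo)) (Z.+-inverseʳ (h lo))))
  fq lo (suc m) h = trans (cong (I._+_ (h (lo I.+ 1ℤ))) (trans (fq (lo I.+ 1ℤ) m h) (cong (\ z -> sumR (lo I.+ 1ℤ) m h I.+ (h z I.- h (lo I.+ 1ℤ))) (gy lo m)))) (L.solve 4 (\ a b c d -> b L.:+ (c L.:+ (d L.:- b)) L.:= (a L.:+ c) L.:+ (d L.:- a)) refl (h lo) (h (lo I.+ 1ℤ)) (sumR (lo I.+ 1ℤ) m h) (h (lo I.+ + suc m)))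
  a1 : ∀ z -> d7 (\ i -> ct (i I.+ (z I.+ 1ℤ))) ≡ d7 (\ i -> ct (i I.+ z)) I.+ 1ℤ
  a1 z = trans (sumR-cong 1ℤ n (\ i -> cong ct (L.solve 2 (\ i z -> i L.:+ (z L.:+ L.I) L.:= i L.:+ L.I L.:+ z) refl i z))) (trans (fq 1ℤ n (\ i -> ct (i I.+ z))) (cong (I._+_ (d7 (\ i -> ct (i I.+ z)))) (trans (cong (I._- ct (1ℤ I.+ z)) (trans (cong ct (L.solve 2 (\ n z -> L.I L.:+ n L.:+ z L.:= L.I L.:+ z L.:+ n) refl (+ n) z)) (fj (1ℤ I.+ z)))) (L.solve 1 (\ a -> a L.:+ L.I L.:- a L.:= L.I) refl (ct (1ℤ I.+ z))))))
  dc : ∀ z -> d7 (\ i -> ct (i I.+ z)) ≡ z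
  dc (+ zero) = trans (aV 1ℤ n (\ i p q -> trans (cong ct (Z.+-identityʳ i)) (eQ i p (lin 0 (st q) (L.solve 2 (\ i n -> n L.:- i L.:= ((L.I L.:+ n) L.:- (i L.:+ L.I)) L.:+ L.O) refl i (+ n)))))) (bJ 1ℤ n 0ℤ (\ _ -> 0ℤ))
  dc (+ suc m) = trans (cong (\ z -> d7 (\ i -> ct (i I.+ z))) (sym (cong +_ (N.+-comm m 1)))) (trans (a1 (+ m)) (trans (cong (I._+ 1ℤ) (dc (+ m))) (cong +_ (N.+-comm m 1))))
  dc -[1+ zero ] = aS 1ℤ _ _ (trans (sym (a1 -[1+ 0 ])) (dc 0ℤ))
  dc -[1+ suc m ] = aS 1ℤ _ _ (trans (sym (a1 -[1+ suc m ])) (dc -[1+ m ]))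
  -- A letter added on the right only permutes the summands up to translation by periods (`fb`), so
  -- the sum depends on z alone.
  gO : ∀ z {w} -> Reverse w -> d7 (\ i -> ct (ak w i I.+ z)) ≡ z
  gO z nil = dc z
  gO z (w ∶ r ∶ʳ j) = trans (sumR-cong 1ℤ n (\ i -> cong (\ y -> ct (y I.+ z)) (cf w j i))) (trans (fb j H (\ a -> trans (bp a) (sym (bp 1ℤ)))) (gO z r)) where
   H : ℤ -> ℤ
   H a = ct (ak w a I.+ z)
   bp : ∀ a -> H (a I.+ + n) I.- H a ≡ 1ℤ
   bp a = trans (cong (I._- H a) (trans (cong ct (trans (cong (I._+ z) (qp (cF w) a)) (L.solve 3 (\ p n z -> p L.:+ n L.:+ z L.:= p L.:+ z L.:+ n) refl (ak w a) (+ n) z))) (fj (ak w a I.+ z)))) (L.solve 1 (\ a -> a L.:+ L.I L.:- a L.:= L.I) refl (H a))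
 lh : (ℤ -> ℤ) -> ℕ
 lh g = length (filter (\ i -> + n I.<? g i) (oneToN n))
 -- For bounded g the values at 1, ..., n lie in the periods 0 and 1, so the sum of `ct` counts
 -- those beyond n; by `gO` it is z.
 dv : ∀ w z {g} -> (∀ x -> g x ≡ ak w x I.+ z) -> (∀ i -> i I.≤ g i × g i I.≤ i I.+ + n) -> + lh g ≡ z
 dv w z {g} e b = trans (go 0 n (\ s -> s) (\ s -> refl)) (trans (aV 1ℤ n k5) (gO z (reverseView w))) where
  go : ∀ d m (u : ℕ -> ℕ) -> (∀ s -> u s ≡ d M.+ s) -> + length (filter (\ i -> + n I.<? g i) (map (\ m -> + suc m) (applyUpTo u m))) ≡ sumR (+ suc d) m (\ i -> ind (lt (+ n) (g i)))
  go d zero u h = refl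
  go d (suc m) u h = bp (+ n I.<? g (+ suc (u 0))) where
   u0 : + suc (u 0) ≡ + suc d
   u0 = cong (\ z -> + suc z) (trans (h 0) (N.+-identityʳ d))
   ih = trans (go (suc d) m (\ s -> u (suc s)) (\ s -> trans (h (suc s)) (N.+-suc d s))) (cong (\ z -> sumR z m (\ i -> ind (lt (+ n) (g i)))) (cong +_ (N.+-comm 1 (suc d))))
   bp : _ -> _
   bp (yes p) = trans (cong (\ l -> + length l) (LP.filter-accept (\ i -> + n I.<? g i) p)) (cong₂ I._+_ (cong ind (sym (trans (cong (\ z -> lt (+ n) (g z)) (sym u0)) (bg p)))) ih)
   bp (no p) = trans (cong (\ l -> + length l) (LP.filter-reject (\ i -> + n I.<? g i) p)) (trans (sym (Z.+-identityˡ _)) (cong₂ I._+_ (cong ind (sym (trans (cong (\ z -> lt (+ n) (g z)) (sym u0)) (bk p)))) ih))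
  k5 : ∀ i -> 1ℤ I.≤ i -> i I.< 1ℤ I.+ + n -> ind (lt (+ n) (g i)) ≡ ct (ak w i I.+ z)
  k5 i p q = trans (a8 (+ n I.<? g i)) (cong ct (e i)) where
   i≤n : i I.≤ + n
   i≤n = lin 0 (st q) (L.solve 2 (\ i n -> n L.:- i L.:= ((L.I L.:+ n) L.:- (i L.:+ L.I)) L.:+ L.O) refl i (+ n))
   a8 : _ -> ind (lt (+ n) (g i)) ≡ ct (g i)
   a8 (no r) = trans (cong ind (bk r)) (sym (eQ (g i) (Z.≤-trans p (proj₁ (b i))) (Z.≮⇒≥ r)))
   a8 (yes r) = trans (cong ind (bg r)) (sym (trans (cong ct (L.solve 2 (\ g n -> g L.:= g L.:- n L.:+ n) refl (g i) (+ n))) (trans (fj (g i I.- + n)) (cong (I._+ 1ℤ) (eQ (g i I.- + n) (lin 0 (st r) (L.solve 2 (\ g n -> (g L.:- n) L.:- L.I L.:= (g L.:- (n L.:+ L.I)) L.:+ L.O) refl (g i) (+ n))) (lin 0 (proj₂ (b i) & i≤n) (L.solve 3 (\ g i n -> n L.:- (g L.:- n) L.:= ((i L.:+ n) L.:+ n) L.:- (g L.:+ i) L.:+ L.O) refl (g i) i (+ n))))))))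
 jo : ∀ w z -> d7 (\ i -> ak w i I.+ z I.- i) ≡ z I.* + n
 jo w z = trans (sumR-cong 1ℤ n (\ i -> L.solve 3 (\ p z i -> p L.:+ z L.:- i L.:= (p L.:- i) L.:+ z) refl (ak w i) z i)) (trans (bI 1ℤ n (\ i -> ak w i I.- i) (\ _ -> z)) (trans (cong₂ I._+_ (iJ (reverseView w)) (gl 1ℤ n)) (Z.+-identityˡ _))) where
  gl : ∀ lo m -> sumR lo m (\ _ -> z) ≡ z I.* + m
  gl lo zero = sym (Z.*-zeroʳ z)
  gl lo (suc m) = trans (cong (I._+_ z) (gl _ m)) (L.solve 2 (\ z m -> z L.:+ z L.:* m L.:= z L.:* (L.I L.:+ m)) refl z (+ m))
  iJ : ∀ {w} -> Reverse w -> d7 (\ i -> ak w i I.- i) ≡ 0ℤ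
  iJ nil = trans (sumR-cong 1ℤ n (\ i -> Z.+-inverseʳ i)) (bJ 1ℤ n 0ℤ (\ _ -> 0ℤ))
  iJ (w ∶ r ∶ʳ j) = trans (sumR-cong 1ℤ n (\ i -> cong (I._- i) (cf w j i))) (trans (fX (cF w) (ar aa j)) (iJ r))
module Large (n' : ℕ) (aa : 2 M.≤ suc n') (k : ℕ) (k≤n : k M.≤ suc n') where
 private n = suc n'
 open ay n
 open p4 n aa
 open b8 n aa
 open jg n aa
 open qz n aa
 module _ (f : ℤ -> ℤ) (perm : IsAffPerm n f) (a : ℤ) (W : List ℤ) (f≡ : ∀ x -> f x ≡ ak W x I.+ a) (P : Poly k) (st' : IsStanleyPoly n k f a P) where
  private
   g : Fn
   g = hH W k f a f≡
   D₀ = length W M.+ k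
   adm : Adm D₀ g
   adm = hg (+ k) (cF W)
   fA : gn g -> aC k g
   fA b = record { jq = qp adm ; bS = inj adm ; ce = b ; ia = jo W (+ k) }
   f-g : ∀ x -> f x ≡ g x I.+ (a I.- + k)
   f-g x = trans (f≡ x) (L.solve 3 (\ p a k -> p L.:+ a L.:= p L.:+ k L.:+ (a L.:- k)) refl (ak W x) a (+ k))
   to : ¬ InIdeal n k P -> InTBound k n f
   to h with lF (qp adm)
   ... | inj₁ b = a I.- + k , g , ((inj adm , onto , qp adm) , b , Z.+-injective (dv W (+ k) (\ _ -> refl) b)) , f-g where
    onto : ∀ y -> Σ ℤ \ x -> g x ≡ y
    onto y = let x , e = proj₁ (proj₂ perm) (y I.+ (a I.- + k)) in x , aS (a I.- + k) _ _ (trans (sym (f-g x)) e)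
   -- If the renormalised g violates a bound, aF vanishes at exponents below n, and P lies in the
   -- ideal after all.
   ... | inj₂ o = ⊥-elim (h (gt (G g) P (\ e -> trans (g7 adm e) (sym (ey W k f a f≡ P st' e))) (eE n k k≤n (G g) (fD.qv n' lo m k (win 1ℤ n g)) (dl adm o)))) where open qd n' aa k k≤n D₀ using (G; g7; dl; lo; m)
   from : InTBound k n f -> ¬ InIdeal n k P
   -- The count of values of g' beyond n is its average, so this average is k and g' agrees with the
   -- renormalised g.
   from (j , g' , (_ , b , cnt) , e) I = lU (fA b₀) (eF n k (G g) k≤n (gt P (G g) (\ e -> trans (ey W k f a f≡ P st' e) (sym (g7 (d6 (N.m≤m+n n _) (ax (fA b₀))) e))) I)) where
    open qd n' aa k k≤n (suc n' M.+ (suc n' M.+ suc n' M.+ suc n')) using (G; g7)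
    open oc n' aa k k≤n using (lU)
    pR : ∀ x -> g' x ≡ ak W x I.+ (a I.- j)
    pR x = trans (L.solve 2 (\ g j -> g L.:= g L.:+ j L.:- j) refl (g' x) j) (trans (cong (I._- j) (trans (sym (e x)) (f≡ x))) (Z.+-assoc (ak W x) a (I.- j)))
    k≡ : a I.- j ≡ + k
    k≡ = trans (sym (dv W (a I.- j) pR b)) (cong +_ cnt)
    b₀ : gn g
    b₀ i = subst (\ z -> i I.≤ z × z I.≤ i I.+ + n) (trans (pR i) (cong (I._+_ (ak W i)) k≡)) (b i)
  ei : (¬ InIdeal n k P) ⇔ InTBound k n f
  ei = mk⇔ to from
-- For n = 1 every permutation is a translation and the Stanley polynomial has constant term 1.
module o1 (k : ℕ) (k≤1 : k M.≤ 1) (f : ℤ -> ℤ) (a : ℤ) (f≡ : ∀ x -> f x ≡ x I.+ a) (P : Poly k) (st' : IsStanleyPoly 1 k f a P) where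
 private
  ez : ∀ {g : ℤ -> ℤ} -> (∀ x y -> x I.< y -> g x I.< g y) -> HasLength 1 g 0
  ez h = [] , [] , (\ i j -> mk⇔ (\ ()) (\ (_ , p , q) -> ⊥-elim (Z.<-asym q (h i j p)))) , refl
  pV : HasLength 1 f 0
  pV = ez (\ x y p -> E.subst₂ I._<_ (sym (f≡ x)) (sym (f≡ y)) (Z.+-monoˡ-< a p))
  pO : CycDec 1 (\ x -> x)
  pO = [] , [] , (\ ()) , \ _ -> refl
  p0 : ∀ x -> x ≡ f x I.- a
  p0 x = trans (L.solve 2 (\ x a -> x L.:= x L.:+ a L.:- a) refl x a) (cong (I._- a) (sym (f≡ x)))
  -- The coefficient counts factorizations, so an existing one keeps it from being 0.
  kt : ∀ e u -> Factorization 1 k f a e u -> coeff P e ≢ 0ℤ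
  kt e u F z with st' e
  ... | c , (L , _ , complete , _ , len) , q with complete u F | len
  ... | here _ | refl with () ← trans (sym q) z
  ... | there _ | refl with () ← trans (sym q) z
  fR : vand (X k) ≋ du -> InIdeal 1 k P -> ∀ e -> All (M._< 1) e -> coeff P e ≡ 0ℤ
  fR v I e mO = trans (ac (P.trans (P.sym (P.*-identityˡ P)) (P.*-congʳ {x = P} (P.sym v))) e) (low (eF 1 k P k≤1 I) e mO)
 oF : ¬ InIdeal 1 k P
 oF I = go k≤1 refl where
  go : ∀ {j} -> j M.≤ 1 -> k ≡ j -> ⊥
  go M.z≤n refl = kt [] [] ((\ ()) , pV , p0) (fR P.refl I [] [])
  go (M.s≤s M.z≤n) refl = kt (0 ∷ []) ((\ x -> x) ∷ []) ((\ { Fin.zero -> pO , ez (\ _ _ p -> p) }) , pV , p0) (fR (P.*-identityˡ du) I (0 ∷ []) (M.s≤s M.z≤n ∷ []))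
 fT : InTBound k 1 f
 fT = go k≤1 where
  go : ∀ {k} -> k M.≤ 1 -> InTBound k 1 f
  go M.z≤n = a , (\ x -> x) , (((\ _ _ e -> e) , (\ y -> y , refl) , \ _ -> refl) , (\ i -> Z.≤-refl , Z.i≤i+j i 1ℤ) , refl) , f≡
  go (M.s≤s M.z≤n) = a I.- 1ℤ , (\ x -> x I.+ 1ℤ) , (((\ x y e -> aS 1ℤ x y e) , (\ y -> y I.- 1ℤ , L.solve 1 (\ y -> y L.:- L.I L.:+ L.I L.:= y) refl y) , \ _ -> refl) , (\ i -> Z.i≤i+j i 1ℤ , Z.≤-refl) , refl) , \ x -> trans (f≡ x) (L.solve 2 (\ x a -> x L.:+ a L.:= x L.:+ L.I L.:+ (a L.:- L.I)) refl x a)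

theorem2p23 : (n k : ℕ) .{{_ : NonZero n}} → k ≤ n →
    (f : ℤ → ℤ) → IsAffPerm n f →
    (a : ℤ) → IsAv n f a →
    (P : Poly k) → IsStanleyPoly n k f a P →
    ((¬ InIdeal n k P) ⇔ InTBound k n f)
theorem2p23 zero k k≤n f perm a av P st' = ⊥-elim (N.<-irrefl refl (M.>-nonZero⁻¹ 0))
theorem2p23 (suc zero) k k≤1 f perm a (g , (w , g≡) , f≡) P st' = mk⇔ (\ _ -> o1.fT k k≤1 f a ck P st') (\ _ -> o1.oF k k≤1 f a ck P st') where
 word : ∀ w x -> sWord 1 w x ≡ x
 word [] x = refl
 word (j ∷ w) x = word w x
 ck : ∀ x -> f x ≡ x I.+ a
 ck x = trans (f≡ x) (cong (I._+ a) (trans (g≡ x) (word w x)))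
theorem2p23 (suc (suc n)) k k≤n f perm a (g , (w , g≡) , f≡) P st' = Large.ei (suc n) aa k k≤n f perm a (jg.iz (suc (suc n)) aa w) (\ x -> trans (f≡ x) (cong (I._+ a) (trans (g≡ x) (jg.dS (suc (suc n)) aa w x)))) P st' where
 aa : 2 M.≤ suc (suc n)
 aa = M.s≤s (M.s≤s M.z≤n)
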